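{- Fix a positive integer $n$, and let $\gamma$ be a strong composition with $\lambda=\mathrm{sort}(\gamma)$, $\ell(\gamma)\le n$ and $n>\ell(\lambda)$. Then \[ G_{\gamma}(X;q,0)=\sum_{\tau}K_{\gamma,\tau}(q)\,\mathrm{QS}_{\tau}(X), \] where the sum runs over strong compositions $\tau$ with $\mathrm{sort}(\tau)\le\mathrm{sort}(\gamma)$ in dominance order, and \[ K_{\gamma,\tau}(q)=\sum_{\substack{Q\in\mathrm{SSYT}(\mathrm{sort}(\tau)',\mathrm{sort}(\gamma)')\\ \mathrm{strtype}(\rho^{ -1}(M_\tau,Q))=\gamma}}q^{\mathrm{charge}(Q)} . \]
   Context: Compositions: a (weak) composition is a finite sequence of nonnegative integers; a strong composition has only positive parts; $\alpha^+$ is $\alpha$ with zero entries deleted; $\mathrm{sort}(\alpha)$ is the partition obtained by sorting the positive parts in weakly decreasing order; $\lambda'$ is the conjugate partition; $\le$ on partitions is dominance order. $\mathrm{SSYT}(\mu,\nu)$: semistandard Young tableaux of shape $\mu$ and content $\nu$ (French convention). $\mathrm{charge}$ is the Lascoux–Schützenberger charge statistic. Multiline queues (MLQs): fix $n$. For a partition $\lambda$ with $L=\lambda_1$, $n>\ell(\lambda)$, an MLQ of shape $\lambda$ is a tuple $M=(B_1,\dots,B_L)$ of subsets of $[n]$ with $|B_r|=\lambda'_r$, pictured as an $L\times n$ array, rows $1..L$ bottom to top, columns $1..n$ left to right cyclically, ball at $(r,j)$ iff $j\in B_r$. $\mathrm{MLQ}_\lambda$ is the set of these; $x^M=\prod_r\prod_{b\in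 B_r}x_b$, $X=(x_1,\dots,x_n)$. FM labelling: for $r=L,\dots,2$: unlabelled balls in row $r$ get label $r$; then balls of row $r$, in order of decreasing label (left to right among equals), are each paired with the first not-yet-paired ball of row $r-1$ weakly to the right, cyclically; it receives the same label. Unlabelled balls of row 1 get label 1. $\mathrm{type}(M)$ is the sequence of labels in row 1 (0 at empty sites), $\mathrm{strtype}(M)=\mathrm{type}(M)^+$. A pairing wraps if the lower ball lies in a strictly smaller column; $\mathrm{maj}(M)=\sum(\ell-r+1)$ over wrapping pairings from row $r$ to $r-1$ of balls with label $\ell$. Nonwrapping means $\mathrm{maj}=0$; $\mathrm{NMLQ}_\mu$ denotes nonwrapping MLQs of shape $\mu$. $\mathrm{SMLQ}[\gamma]=\{M:\mathrm{strtype}(M)=\gamma\}$, $\mathrm{SNMLQ}[\gamma]$ its nonwrapping elements. For a strong composition $\tau$ with at most $n$ parts, $M_\tau$ is the MLQ with $B_r=\{i:\tilde\tau_i\ge r\}$ where $\tilde\tau=(\tau,0,\dots,0)$ is $\tau$ padded with zeros to length $n$. Polynomials: $G_\gamma(X;q,0)=\sum_{M\in\mathrm{SMLQ}[\gamma]}q^{\mathrm{maj}(M)}x^M$ (quasisymmetric Macdonald polynomial at $t=0$), $\mathrm{QS}_\tau(X)=\sum_{M\in\mathrm{SNMLQ}[\tau]}x^M$ (quasisymmetric Schur function). Collapsing map: for a tuple $N$ of subsets of $[n]$, $cw(N)$ lists row indices of balls, columns left to right, each column top to bottom. Bracketing w.r.t. $j$: $j\mapsto$ ")", $j+1\mapsto$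 "(", iteratively match "(" with a ")" to its right with no unmatched parenthesis between. $e^{\downarrow}_j$ moves the ball of the leftmost unmatched $j+1$ of $cw(N)$ from row $j+1$ to row $j$ (same column; identity if none); $e^{\downarrow\star}_j$ iterates it until trivial. For $M=(B_1,\dots,B_L)$: $M_1=M$, $Q_1$ a row of $|B_1|$ ones; for $i=1,\dots,L-1$, $M_{i+1}=e^{\downarrow\star}_1\cdots e^{\downarrow\star}_i(M_i)$ ($e^{\downarrow\star}_i$ first), and $Q_{i+1}$ is $Q_i$ with $|B^{(i+1)}_j|-|B^{(i)}_j|$ boxes added to row $j$ ($j\le i$) and $|B^{(i+1)}_{i+1}|$ boxes in row $i+1$, filled with $i+1$ (where $M_i=(B^{(i)}_1,\dots)$). $\rho_N(M)=M_L$, $\rho_Q(M)=Q_L$. It is known that $M\mapsto(\rho_N(M),\rho_Q(M))$ is a bijection $\mathrm{MLQ}_\lambda\to\bigcup_{\mu\le\lambda}\mathrm{NMLQ}_\mu\times\mathrm{SSYT}(\mu',\lambda')$; $\rho^{ -1}(M_\tau,Q)$ denotes the preimage of $(M_\tau,Q)$. -}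

module Defs where

open import Data.Nat using (ℕ; zero; suc; _+_; _∸_; _≤ᵇ_; _<ᵇ_; _≡ᵇ_; _⊔_)
open import Data.Bool using (Bool; true; false; if_then_else_; _∧_; _∨_; not)
open import Data.List using (List; []; _∷_; length; map; filterᵇ; concatMap; foldr; reverse; replicate; _++_; upTo; applyUpTo; take; zip; last; concat)
open import Data.Nat.ListAction using (sum)
open import Data.Bool.ListAction using (all; any)
open import Data.Product using (_×_; _,_; proj₁; proj₂)
open import Data.Maybe using (Maybe; just; nothing)
open import Data.Vec using (Vec; tabulate; toList; []; _∷_)
open import Data.Fin using (Fin; toℕ)
open import Data.Fin.Subset using (Subset; ∣_∣)

count : {A : Set} → (A → Bool) → List A → ℕ
count p xs = length (filterᵇ p xs)

maxL : List ℕ → ℕ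
maxL = foldr _⊔_ 0

nth : {A : Set} → A → List A → ℕ → A
nth d []       _       = d
nth d (x ∷ xs) zero    = x
nth d (x ∷ xs) (suc i) = nth d xs i

modifyAt : {A : Set} → ℕ → (A → A) → List A → List A
modifyAt _       f []       = []
modifyAt zero    f (x ∷ xs) = f x ∷ xs
modifyAt (suc i) f (x ∷ xs) = x ∷ modifyAt i f xs

eqNat : List ℕ → List ℕ → Bool
eqNat []       []       = true
eqNat (x ∷ xs) (y ∷ ys) = (x ≡ᵇ y) ∧ eqNat xs ys
eqNat _        _        = false

eqBool : List Bool → List Bool → Bool
eqBool []       []       = true
eqBool (x ∷ xs) (y ∷ ys) = (if x then y else not y) ∧ eqBool xs ys
eqBool _        _        = false

eqBools : List (List Bool) → List (List Bool) → Bool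
eqBools []       []       = true
eqBools (x ∷ xs) (y ∷ ys) = eqBool x y ∧ eqBools xs ys
eqBools _        _        = false

eqNats : List (List ℕ) → List (List ℕ) → Bool
eqNats []       []       = true
eqNats (x ∷ xs) (y ∷ ys) = eqNat x y ∧ eqNats xs ys
eqNats _        _        = false

elemᵇ : ℕ → List ℕ → Bool
elemᵇ c = any (λ x → c ≡ᵇ x)

strip : List ℕ → List ℕ
strip = filterᵇ (λ x → not (x ≡ᵇ 0))

insertDesc : ℕ → List ℕ → List ℕ
insertDesc x []       = x ∷ []
insertDesc x (y ∷ ys) = if y <ᵇ x then x ∷ y ∷ ys else y ∷ insertDesc x ys

sortP : List ℕ → List ℕ
sortP α = foldr insertDesc [] (strip α)

conj : List ℕ → List ℕ
conj la = applyUpTo (λ r → count (λ x → suc r ≤ᵇ x) la) (maxL la)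

dominatesᵇ : List ℕ → List ℕ → Bool
dominatesᵇ mu la =
  (sum mu ≡ᵇ sum la) ∧
  all (λ k → sum (take k mu) ≤ᵇ sum (take k la)) (upTo (suc (length mu + length la)))

comps : ℕ → List (List ℕ)
comps zero          = [] ∷ []
comps (suc zero)    = (1 ∷ []) ∷ []
comps (suc (suc N)) =
  concatMap (λ c → (1 ∷ c) ∷ incHead c ∷ []) (comps (suc N))
  where
  incHead : List ℕ → List ℕ
  incHead []       = []
  incHead (x ∷ xs) = suc x ∷ xs

-- Multiline queues: M = (B_1 , … , B_L), rows bottom (B_1) to top (B_L),
-- each B_r a subset of [n]; columns are 0-based naturals 0 .. n-1.

MLQ : ℕ → Set
MLQ n = List (Subset n)

cols : {n : ℕ} → Subset n → List ℕ
cols {n} B = map proj₁ (filterᵇ proj₂ (zip (upTo n) (toList B)))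

allSubsets : (n : ℕ) → List (Subset n)
allSubsets zero    = [] ∷ []
allSubsets (suc n) = concatMap (λ B → (true ∷ B) ∷ (false ∷ B) ∷ []) (allSubsets n)

mlqs : (n : ℕ) → List ℕ → List (MLQ n)
mlqs n la =
  foldr (λ k acc → concatMap (λ B → map (B ∷_) acc)
                             (filterᵇ (λ B → ∣ B ∣ ≡ᵇ k) (allSubsets n)))
        ([] ∷ []) (conj la)

-- FM labelling.  A labelled ball is (column , label).

insertBall : ℕ × ℕ → List (ℕ × ℕ) → List (ℕ × ℕ)
insertBall b [] = b ∷ []
insertBall (c , l) ((c' , l') ∷ bs) =
  if (l' <ᵇ l) ∨ ((l ≡ᵇ l') ∧ (c ≤ᵇ c'))
  then (c , l) ∷ (c' , l') ∷ bs
  else (c' , l') ∷ insertBall (c , l) bs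

sortBalls : List (ℕ × ℕ) → List (ℕ × ℕ)
sortBalls = foldr insertBall []

firstGE : ℕ → List ℕ → Maybe ℕ
firstGE j []       = nothing
firstGE j (k ∷ ks) = if j ≤ᵇ k then just k else firstGE j ks

removeN : ℕ → List ℕ → List ℕ
removeN k = filterᵇ (λ x → not (x ≡ᵇ k))

-- pair the (sorted) balls of row r with the available (ascending) balls
-- of row r-1; returns (assigned balls of row r-1, unpaired columns, maj)
pairRow : ℕ → List (ℕ × ℕ) → List ℕ → List (ℕ × ℕ) → ℕ →
          List (ℕ × ℕ) × List ℕ × ℕ
pairRow r []             avail asg m = asg , avail , m
pairRow r ((j , l) ∷ bs) avail asg m with firstGE j avail
... | just k  = pairRow r bs (removeN k avail) ((k , l) ∷ asg) m
... | nothing with avail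
...   | []      = pairRow r bs avail asg m
...   | (k ∷ _) = pairRow r bs (removeN k avail) ((k , l) ∷ asg) (m + suc (l ∸ r))

-- r : index of the currently labelled row; rows : the rows below it, top down
fmGo : {n : ℕ} → ℕ → List (ℕ × ℕ) → List (Subset n) → ℕ → List (ℕ × ℕ) × ℕ
fmGo r lab []         m = lab , m
fmGo r lab (B ∷ rest) m with pairRow r (sortBalls lab) (cols B) [] m
... | asg , left , m' = fmGo (r ∸ 1) (asg ++ map (λ c → c , r ∸ 1) left) rest m'

-- (labels of row 1, maj)
fm : {n : ℕ} → MLQ n → List (ℕ × ℕ) × ℕ
fm M with reverse M
... | []         = [] , 0
... | top ∷ rest = fmGo (length M) (map (λ c → c , length M) (cols top)) rest 0

labelAt : ℕ → List (ℕ × ℕ) → ℕ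
labelAt c = foldr (λ b acc → if c ≡ᵇ proj₁ b then proj₂ b else acc) 0

typeM : {n : ℕ} → MLQ n → List ℕ
typeM {n} M = map (λ c → labelAt c (proj₁ (fm M))) (upTo n)

strtype : {n : ℕ} → MLQ n → List ℕ
strtype M = strip (typeM M)

maj : {n : ℕ} → MLQ n → ℕ
maj M = proj₂ (fm M)

nonwrappingᵇ : {n : ℕ} → MLQ n → Bool
nonwrappingᵇ M = maj M ≡ᵇ 0

xexp : {n : ℕ} → MLQ n → Vec ℕ n
xexp {n} M = tabulate (λ i → count (λ B → elemᵇ (toℕ i) (cols B)) M)

SMLQ : (n : ℕ) → List ℕ → List (MLQ n)
SMLQ n γ = filterᵇ (λ M → eqNat (strtype M) γ) (mlqs n (sortP γ))

SNMLQ : (n : ℕ) → List ℕ → List (MLQ n)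
SNMLQ n γ = filterᵇ nonwrappingᵇ (SMLQ n γ)

Mtau : (n : ℕ) → List ℕ → MLQ n
Mtau n τ = applyUpTo (λ r → tabulate (λ i → suc r ≤ᵇ nth 0 τ (toℕ i))) (maxL τ)

-- Tableaux: a tableau is a list of rows, row 1 (longest, bottom in
-- French convention) first.

Tableau : Set
Tableau = List (List ℕ)

chop : List ℕ → List ℕ → Tableau
chop []       w = []
chop (k ∷ ks) w = take k w ∷ chop ks (Data.List.drop k w)

words : ℕ → ℕ → List (List ℕ)
words m zero    = [] ∷ []
words m (suc k) = concatMap (λ w → map (_∷ w) (applyUpTo suc m)) (words m k)

weakIncr : List ℕ → Bool
weakIncr []           = true
weakIncr (x ∷ [])     = true
weakIncr (x ∷ y ∷ ys) = (x ≤ᵇ y) ∧ weakIncr (y ∷ ys)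

strictAbove : List ℕ → List ℕ → Bool
strictAbove (x ∷ xs) (y ∷ ys) = (x <ᵇ y) ∧ strictAbove xs ys
strictAbove _        _        = true

columnsStrict : Tableau → Bool
columnsStrict []             = true
columnsStrict (r ∷ [])       = true
columnsStrict (r ∷ r' ∷ rs)  = strictAbove r r' ∧ columnsStrict (r' ∷ rs)

hasContent : List ℕ → Tableau → Bool
hasContent nu T =
  all (λ i → count (λ x → x ≡ᵇ suc i) (concat T) ≡ᵇ nth 0 nu i) (upTo (length nu))

ssyts : List ℕ → List ℕ → List Tableau
ssyts mu nu =
  filterᵇ (λ T → all weakIncr T ∧ columnsStrict T ∧ hasContent nu T)
          (map (chop mu) (words (length nu) (sum mu)))

-- Lascoux–Schützenberger charge.  Reading word: rows from top to bottom
-- (French), each left to right.  Letters carry positions.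

readingWord : Tableau → List ℕ
readingWord T = concat (reverse T)

maxPosWith : (ℕ → ℕ → Bool) → List (ℕ × ℕ) → Maybe ℕ
maxPosWith p = foldr step nothing
  where
  step : ℕ × ℕ → Maybe ℕ → Maybe ℕ
  step (pos , x) acc with p pos x
  ... | false = acc
  ... | true with acc
  ...   | nothing = just pos
  ...   | just q  = just (pos ⊔ q)

removePos : ℕ → List (ℕ × ℕ) → List (ℕ × ℕ)
removePos p = filterᵇ (λ b → not (proj₁ b ≡ᵇ p))

-- extract one standard subword: having taken letter k at position p with
-- index idx, look for k+1 cyclically to the left; returns (sum of indices
-- of the letters k+1, …, remaining word)
extractRest : ℕ → ℕ → ℕ → ℕ → List (ℕ × ℕ) → ℕ × List (ℕ × ℕ)
extractRest zero       k p idx w = 0 , w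
extractRest (suc fuel) k p idx w
  with maxPosWith (λ pos x → (x ≡ᵇ suc k) ∧ (pos <ᵇ p)) w
... | just q = let r = extractRest fuel (suc k) q idx (removePos q w)
               in idx + proj₁ r , proj₂ r
... | nothing with maxPosWith (λ pos x → x ≡ᵇ suc k) w
...   | just q = let r = extractRest fuel (suc k) q (suc idx) (removePos q w)
                 in suc idx + proj₁ r , proj₂ r
...   | nothing = 0 , w

chargeGo : ℕ → List (ℕ × ℕ) → ℕ
chargeGo zero       w = 0
chargeGo (suc fuel) w with maxPosWith (λ pos x → x ≡ᵇ 1) w
... | nothing = 0
... | just p  = let r = extractRest (length w) 1 p 0 (removePos p w)
                in proj₁ r + chargeGo fuel (proj₂ r)

chargeWord : List ℕ → ℕ
chargeWord w = chargeGo (length w) (zip (upTo (length w)) w)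

charge : Tableau → ℕ
charge T = chargeWord (readingWord T)

-- Collapsing map.  Rows of N are 1-based (row r is list index r-1).

rowAt : {n : ℕ} → List (Subset n) → ℕ → List ℕ
rowAt N r = nth [] (map cols N) (r ∸ 1)

rowSize : {n : ℕ} → List (Subset n) → ℕ → ℕ
rowSize N r = length (rowAt N r)

-- column reading word: columns left to right, each top to bottom;
-- entries (column , row)
cw : {n : ℕ} → List (Subset n) → List (ℕ × ℕ)
cw {n} N =
  concatMap (λ c → concatMap (λ r → if elemᵇ c (rowAt N r) then (c , r) ∷ [] else [])
                             (reverse (applyUpTo suc (length N))))
            (upTo n)

-- stack of columns of unmatched j+1 ("(") entries, most recent first
unmatched : ℕ → List (ℕ × ℕ) → List ℕ → List ℕ
unmatched j []             st = st
unmatched j ((c , r) ∷ ws) st =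
  if r ≡ᵇ suc j then unmatched j ws (c ∷ st)
  else if r ≡ᵇ j then unmatched j ws (pop st)
  else unmatched j ws st
  where
  pop : List ℕ → List ℕ
  pop []       = []
  pop (_ ∷ xs) = xs

setCol : {n : ℕ} → ℕ → Bool → Subset n → Subset n
setCol _       b []      = []
setCol zero    b (x ∷ v) = b ∷ v
setCol (suc c) b (x ∷ v) = x ∷ setCol c b v

eDown : {n : ℕ} → ℕ → List (Subset n) → List (Subset n)
eDown j N with last (unmatched j (cw N) [])
... | nothing = N
... | just c  = modifyAt (j ∸ 1) (setCol c true) (modifyAt j (setCol c false) N)

iter : {A : Set} → ℕ → (A → A) → A → A
iter zero    f x = x
iter (suc k) f x = iter k f (f x)

ballCount : {n : ℕ} → List (Subset n) → ℕ
ballCount N = sum (map ∣_∣ N)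

-- e↓⋆_j : iterate e↓_j until it acts trivially (it can act
-- non-trivially at most ballCount N times, after which it is the identity)
eDownStar : {n : ℕ} → ℕ → List (Subset n) → List (Subset n)
eDownStar j N = iter (ballCount N) (eDown j) N

applyDown : {n : ℕ} → ℕ → List (Subset n) → List (Subset n)
applyDown zero    N = N
applyDown (suc k) N = applyDown k (eDownStar (suc k) N)

updQ : {n : ℕ} → ℕ → List (Subset n) → List (Subset n) → Tableau → Tableau
updQ i N N' Q =
  map (λ j → nth [] Q (j ∸ 1) ++ replicate (rowSize N' j ∸ rowSize N j) (suc i))
      (applyUpTo suc i)
  ++ (replicate (rowSize N' (suc i)) (suc i) ∷ [])

rhoLoop : {n : ℕ} → ℕ → ℕ → List (Subset n) → Tableau → List (Subset n) × Tableau
rhoLoop i zero    N Q = N , Q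
rhoLoop i (suc k) N Q = let N' = applyDown i N in rhoLoop (suc i) k N' (updQ i N N' Q)

rho : {n : ℕ} → MLQ n → MLQ n × Tableau
rho M = rhoLoop 1 (length M ∸ 1) M (replicate (rowSize M 1) 1 ∷ [])

trimN : {n : ℕ} → MLQ n → MLQ n
trimN M = reverse (dropE (reverse M))
  where
  dropE : {n : ℕ} → List (Subset n) → List (Subset n)
  dropE []       = []
  dropE (B ∷ Bs) = if ∣ B ∣ ≡ᵇ 0 then dropE Bs else B ∷ Bs

trimQ : Tableau → Tableau
trimQ = filterᵇ (λ r → not (length r ≡ᵇ 0))

rhoIsᵇ : {n : ℕ} → MLQ n → List ℕ → Tableau → Bool
rhoIsᵇ {n} M τ Q =
  eqBools (map toList (trimN (proj₁ (rho M)))) (map toList (Mtau n τ))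
  ∧ eqNats (trimQ (proj₂ (rho M))) Q

-- Polynomials in q and X = (x_1 … x_n) with ℕ coefficients, as multisets
-- of monomials q^d x^a (a list, compared up to permutation).

Monomial : ℕ → Set
Monomial n = ℕ × Vec ℕ n

Gpoly : (n : ℕ) → List ℕ → List (Monomial n)
Gpoly n γ = map (λ M → maj M , xexp M) (SMLQ n γ)

QSpoly : (n : ℕ) → List ℕ → List (Vec ℕ n)
QSpoly n τ = map xexp (SNMLQ n τ)

Kset : (n : ℕ) → List ℕ → List ℕ → List Tableau
Kset n γ τ =
  filterᵇ (λ Q → any (λ M → rhoIsᵇ M τ Q ∧ eqNat (strtype M) γ) (mlqs n (sortP γ)))
          (ssyts (conj (sortP τ)) (conj (sortP γ)))

-- K_{γ,τ}(q) as a multiset of q-exponents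
Kpoly : (n : ℕ) → List ℕ → List ℕ → List ℕ
Kpoly n γ τ = map charge (Kset n γ τ)

taus : List ℕ → List (List ℕ)
taus γ = filterᵇ (λ τ → dominatesᵇ (sortP τ) (sortP γ)) (comps (sum γ))

RHSpoly : (n : ℕ) → List ℕ → List (Monomial n)
RHSpoly n γ =
  concatMap (λ τ → concatMap (λ d → map (λ a → d , a) (QSpoly n τ)) (Kpoly n γ τ))
            (taus γ)

{-# OPTIONS --safe #-}
module Submission where

-- A multiline queue is a 0/1 matrix, and 0/1 matrices carry two commuting
-- crystal structures: vertical operators move balls between adjacent rows,
-- horizontal ones between adjacent columns. The collapse applies vertical
-- raising operators until none acts, that is, until nothing wraps; a vertical
-- component contains only one such element, and the horizontal operators act
-- transitively on those of a given shape. Hence they change the collapse of M at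
-- will while fixing its recording tableau Q. The FM pairing of adjacent rows is
-- a vertical reflection, so maj depends on Q only, and the strong type of M only
-- on Q and on the strong type of its collapse. Evaluating maj on the reading
-- word of Q, with one ball per column, identifies it with the charge: FM pairs
-- greedily downwards to the right, the charge upwards to the left, and both
-- minimise the number of wraps. The expansion then follows from the bijection
-- M ↦ (strong type of the collapse, Q, collapse).

open import Defs
open import Data.Nat using (ℕ; zero; suc; pred; _+_; _∸_; _<_; _≤_; _⊓_; _≤ᵇ_; _<ᵇ_; _≡ᵇ_; z≤n; s≤s; z<s; s<s; s≤s⁻¹)
open import Data.Nat.Properties hiding (_≟_)
open import Data.Nat.Induction using (<-wellFounded)
open import Data.Nat.ListAction using (sum)
open import Data.Nat.ListAction.Properties using (sum-↭)
open import Data.Nat.Solver using (module +-*-Solver)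
open import Data.Bool using (Bool; true; false; if_then_else_; _∧_; _∨_; not; T)
open import Data.Bool.Properties using (∧-comm; ∧-zeroʳ; ∧-identityʳ; T-≡; T-∧)
open import Data.Bool.ListAction using (all; any)
open import Data.List using (List; _∷_; length; map; filterᵇ; concatMap; foldr; reverse; replicate; _++_; upTo; applyUpTo; take; drop; zip; last; concat; _∷ʳ_; initLast; []; _∷ʳ′_)
open import Data.List.Properties
open import Data.List.Relation.Unary.All using (All; []; _∷_)
import Data.List.Relation.Unary.All as All
import Data.List.Relation.Unary.All.Properties as All
open import Data.List.Relation.Unary.Any using (here; there)
open import Data.List.Relation.Unary.AllPairs using (AllPairs; []; _∷_)
import Data.List.Relation.Unary.AllPairs as AllPairs
open import Data.List.Relation.Unary.Unique.Propositional using (Unique)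
open import Data.List.Membership.Propositional using (_∈_; _∉_)
open import Data.List.Membership.Propositional.Properties using (∈-map⁺; ∈-map⁻; ∈-++⁺ˡ; ∈-++⁺ʳ; ∈-++⁻; ∈-applyUpTo⁺)
open import Data.List.Relation.Binary.Permutation.Propositional using (_↭_; ↭-refl; ↭-sym; ↭-trans; ↭-reflexive; prep; swap)
import Data.List.Relation.Binary.Permutation.Propositional.Properties as Perm
open import Data.Maybe using (Maybe; just; nothing)
import Data.Maybe
open import Data.Product using (Σ; ∃; _×_; _,_; proj₁; proj₂; uncurry)
open import Data.Sum using (_⊎_; inj₁; inj₂)
open import Data.Empty using (⊥; ⊥-elim)
open import Data.Unit using (⊤; tt)
open import Data.Vec using (Vec; []; _∷_; toList)
import Data.Vec as Vec
import Data.Vec.Properties as Vec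
open import Data.Fin using (Fin; toℕ)
import Data.Fin as Fin
open import Data.Fin.Subset using (∣_∣)
open import Relation.Nullary using (contradiction)
open import Relation.Binary.PropositionalEquality using (_≡_; _≢_; refl; sym; trans; cong; cong₂; subst; module ≡-Reasoning)
open import Relation.Binary using (tri<; tri≈; tri>)
open import Induction.WellFounded using (Acc; acc)
open import Function using (_∘_; id; case_of_; Equivalence; mk⇔)
import Data.List.Relation.Unary.AllPairs.Properties as APP
open import Data.List.Relation.Binary.Pointwise using (Pointwise; []; _∷_)
import Data.List.Relation.Binary.Pointwise as PW
open import Data.List.Membership.Propositional.Properties.WithK using (unique∧set⇒bag)
open import Data.List.Relation.Binary.BagAndSetEquality using (∼bag⇒↭)

-- Horizontal operators preserve neither types nor strong types, so the dependence of the strong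
-- type on the collapse needs a finer tool. Labels are encoded by layers: layer `k` is the set of
-- bottom balls with label exceeding `k`. Each layer is the bottom row of some vertical image of
-- `M`. Collapsing the rows above it and then inserting it from below must give the collapse of `M`,
-- by uniqueness of the highest weight element. Undoing that insertion uses lowering operators in
-- numbers that horizontal moves do not change, and every lowering deletes the last bottom ball left
-- unserved from above. Carried over to the labelled bottom row of the collapse, these deletions
-- depend on the order of the labels and not on the columns that carry them, that is, on the strong
-- type alone. Two technical obstacles remain. A queue and the reading word of its tableau have
-- different numbers of columns, which is settled by adding empty columns. The collapse keeps the
-- number of rows and may end with empty ones, which M_τ does not have, so both the collapse and its
-- tableau are trimmed.

interchange : ∀ a b c d → (a + b) + (c + d) ≡ (a + c) + (b + d)
interchange = +-*-Solver.solve 4 (λ a b c d → (a :+ b) :+ (c :+ d) := (a :+ c) :+ (b :+ d)) refl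
  where open +-*-Solver

applyUpTo-cong : ∀ {A : Set} {f g : ℕ → A} → (∀ j → f j ≡ g j) → ∀ k → applyUpTo f k ≡ applyUpTo g k
applyUpTo-cong e zero    = refl
applyUpTo-cong e (suc k) = cong₂ _∷_ (e 0) (applyUpTo-cong (e ∘ suc) k)

filterᵇ-none : ∀ {A : Set} (p : A → Bool) q → All (λ x → p x ≡ false) q → filterᵇ p q ≡ []
filterᵇ-none p []      []       = refl
filterᵇ-none p (x ∷ q) (h ∷ hs) rewrite h = filterᵇ-none p q hs

filterᵇ-all : ∀ {A : Set} (p : A → Bool) q → All (λ x → p x ≡ true) q → filterᵇ p q ≡ q
filterᵇ-all p []      []       = refl
filterᵇ-all p (x ∷ q) (h ∷ hs) rewrite h = cong (x ∷_) (filterᵇ-all p q hs)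

length≡0⇒[] : ∀ {A : Set} (l : List A) → length l ≡ 0 → l ≡ []
length≡0⇒[] [] _ = refl

-- Bracket words and the two crystals

Row : ℕ → Set
Row n = Vec Bool n

Config : ℕ → Set
Config n = List (Row n)

data Bracket : Set where
  op cl nu : Bracket

bracket : Bool → Bool → Bracket
bracket true  false = op
bracket false true  = cl
bracket _     _     = nu

flip : Bracket → Bracket
flip op = cl
flip cl = op
flip nu = nu

-- Prepending a bracket to a word with x unmatched ")" and y unmatched "(".
stepX : Bracket → ℕ → ℕ
stepX op = pred
stepX cl = suc
stepX nu = id

stepY : Bracket → ℕ → ℕ → ℕ
stepY op zero    y = suc y
stepY op (suc _) y = y
stepY cl _       y = y
stepY nu _       y = y

module _ {A : Set} where

  -- `a` is the outcome of acting at the head of the word and `r` that of acting further on. The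
  -- leftmost unmatched "(" is the first one with no unmatched ")" behind it, so one count of the
  -- remaining word decides.
  pickE : Bracket → ℕ → A → A → A
  pickE op zero    a r = a
  pickE op (suc _) a r = r
  pickE cl _       a r = r
  pickE nu _       a r = r

  -- The lowering operator acts at the rightmost unmatched ")". A "(" in front cancels the leftmost
  -- unmatched ")": if there is at most one, nothing is left to lower and the outcome is `s`; if
  -- there are two or more, the rightmost one survives.
  pickF : Bracket → ℕ → A → A → A → A
  pickF op zero          a s r = s
  pickF op (suc zero)    a s r = s
  pickF op (suc (suc _)) a s r = r
  pickF cl zero          a s r = a
  pickF cl (suc _)       a s r = r
  pickF nu _             a s r = r

  pickE-op-suc : ∀ {m k a r} → m ≡ suc k → pickE op m a r ≡ r
  pickE-op-suc refl = refl

  pickE-op-zero : ∀ {m a r} → m ≡ 0 → pickE op m a r ≡ a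
  pickE-op-zero refl = refl

  pickF-cl-zero : ∀ {m a s r} → m ≡ 0 → pickF cl m a s r ≡ a
  pickF-cl-zero refl = refl

  pickF-cl-suc : ∀ {m k a s r} → m ≡ suc k → pickF cl m a s r ≡ r
  pickF-cl-suc refl = refl

  pickF-op-suc : ∀ {m k a s r} → m ≡ suc (suc k) → pickF op m a s r ≡ r
  pickF-op-suc refl = refl

stepY-op-zero : ∀ {m y} → m ≡ 0 → stepY op m y ≡ suc y
stepY-op-zero refl = refl

stepY-op-suc : ∀ {m k y} → m ≡ suc k → stepY op m y ≡ y
stepY-op-suc refl = refl

cons2 : ∀ {n} → Bool → Bool → Row n × Row n → Row (suc n) × Row (suc n)
cons2 p q w = p ∷ proj₁ w , q ∷ proj₂ w

-- The vertical crystal on two adjacent rows, the lower one listed first.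

ux : ∀ {n} → Row n → Row n → ℕ
ux []      []      = 0
ux (p ∷ b) (q ∷ t) = stepX (bracket q p) (ux b t)

uy : ∀ {n} → Row n → Row n → ℕ
uy []      []      = 0
uy (p ∷ b) (q ∷ t) = stepY (bracket q p) (ux b t) (uy b t)

E2 : ∀ {n} → Row n → Row n → Row n × Row n
E2 []      []      = [] , []
E2 (p ∷ b) (q ∷ t) = pickE (bracket q p) (ux b t) (cons2 q p (b , t)) (cons2 p q (E2 b t))

F2 : ∀ {n} → Row n → Row n → Row n × Row n
F2 []      []      = [] , []
F2 (p ∷ b) (q ∷ t) =
  pickF (bracket q p) (ux b t) (cons2 q p (b , t)) (cons2 p q (b , t)) (cons2 p q (F2 b t))

ux² uy² : ∀ {n} → Row n × Row n → ℕ
ux² w = ux (proj₁ w) (proj₂ w)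
uy² w = uy (proj₁ w) (proj₂ w)

E2² F2² : ∀ {n} → Row n × Row n → Row n × Row n
E2² w = E2 (proj₁ w) (proj₂ w)
F2² w = F2 (proj₁ w) (proj₂ w)

E2-idle : ∀ {n} (b t : Row n) → uy b t ≡ 0 → E2 b t ≡ (b , t)
E2-idle []          []          _ = refl
E2-idle (true ∷ b)  (true ∷ t)  h = cong (cons2 true true) (E2-idle b t h)
E2-idle (true ∷ b)  (false ∷ t) h = cong (cons2 true false) (E2-idle b t h)
E2-idle (false ∷ b) (false ∷ t) h = cong (cons2 false false) (E2-idle b t h)
E2-idle (false ∷ b) (true ∷ t)  h with ux b t
... | suc _ = cong (cons2 false true) (E2-idle b t h)

F2-idle : ∀ {n} (b t : Row n) → ux b t ≡ 0 → F2 b t ≡ (b , t)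
F2-idle []          []          _ = refl
F2-idle (true ∷ b)  (true ∷ t)  h = cong (cons2 true true) (F2-idle b t h)
F2-idle (false ∷ b) (false ∷ t) h = cong (cons2 false false) (F2-idle b t h)
F2-idle (false ∷ b) (true ∷ t)  h with ux b t
... | zero     = refl
... | suc zero = refl

record Acts (n : ℕ) (b t : Row n) (w : Row n × Row n) : Set where
  constructor acts
  field
    xUp   : ux² w ≡ suc (ux b t)
    yDown : suc (uy² w) ≡ uy b t
    back  : F2² w ≡ (b , t)

E2-acts : ∀ {n} (b t : Row n) → 0 < uy b t → Acts n b t (E2 b t)
E2-acts []          []          ()
E2-acts (true ∷ b)  (true ∷ t)  h with E2-acts b t h
... | acts x y e = acts x y (cong (cons2 true true) e)
E2-acts (false ∷ b) (false ∷ t) h with E2-acts b t h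
... | acts x y e = acts x y (cong (cons2 false false) e)
E2-acts (true ∷ b)  (false ∷ t) h with E2-acts b t h
... | acts x y e =
  acts (cong suc x) y (trans (pickF-cl-suc x) (cong (cons2 true false) e))
E2-acts (false ∷ b) (true ∷ t)  h with ux b t in eq
... | zero  = acts (trans (cong suc eq) (cong (suc ∘ pred) (sym eq)))
                   (sym (stepY-op-zero eq)) (pickF-cl-zero eq)
... | suc m with E2-acts b t h
...   | acts x y e =
  acts (trans (cong pred x) (trans eq (cong suc (cong pred (sym eq)))))
       (trans (cong suc (stepY-op-suc x)) (trans y (sym (stepY-op-suc eq))))
       (trans (pickF-op-suc (trans x (cong suc eq))) (cong (cons2 false true) e))

record ActsF (n : ℕ) (b t : Row n) (w : Row n × Row n) : Set where
  constructor actsF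
  field
    xDown : suc (ux² w) ≡ ux b t
    yUp   : uy² w ≡ suc (uy b t)
    back  : E2² w ≡ (b , t)

F2-acts : ∀ {n} (b t : Row n) → 0 < ux b t → ActsF n b t (F2 b t)
F2-acts []          []          ()
F2-acts (true ∷ b)  (true ∷ t)  h with F2-acts b t h
... | actsF x y e = actsF x y (cong (cons2 true true) e)
F2-acts (false ∷ b) (false ∷ t) h with F2-acts b t h
... | actsF x y e = actsF x y (cong (cons2 false false) e)
F2-acts (true ∷ b)  (false ∷ t) h with ux b t in eq
... | zero  = actsF (trans (cong (suc ∘ pred) eq) (cong suc (sym eq)))
                    (stepY-op-zero eq) (pickE-op-zero eq)
... | suc m with F2-acts b t (subst (0 <_) (sym eq) z<s)
...   | actsF x y e = actsF (cong suc x) y (cong (cons2 true false) e)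
F2-acts (false ∷ b) (true ∷ t)  h with ux b t in eq
... | suc (suc m) with F2-acts b t (subst (0 <_) (sym eq) z<s)
...   | actsF x y e =
  actsF (trans (cong (suc ∘ pred) x′) (sym (cong pred eq)))
        (trans (stepY-op-suc x′) (trans y (cong suc (sym (stepY-op-suc eq)))))
        (trans (pickE-op-suc x′) (cong (cons2 false true) e))
  where
  x′ : ux² (F2 b t) ≡ suc m
  x′ = suc-injective (trans x eq)

-- The horizontal crystal at the columns c and c + 1, read along the rows
-- from the bottom row (the head of the list) upwards.

letter : ∀ {n} → ℕ → Row n → Bracket
letter c       []          = nu
letter zero    (p ∷ [])    = nu
letter zero    (p ∷ q ∷ r) = bracket p q
letter (suc c) (p ∷ r)     = letter c r

exch : ∀ {n} → ℕ → Row n → Row n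
exch c       []          = []
exch zero    (p ∷ [])    = p ∷ []
exch zero    (p ∷ q ∷ r) = q ∷ p ∷ r
exch (suc c) (p ∷ r)     = p ∷ exch c r

letter-exch : ∀ {n} c (r : Row n) → letter c (exch c r) ≡ flip (letter c r)
letter-exch c       []                  = refl
letter-exch zero    (p ∷ [])            = refl
letter-exch zero    (true ∷ true ∷ r)   = refl
letter-exch zero    (true ∷ false ∷ r)  = refl
letter-exch zero    (false ∷ true ∷ r)  = refl
letter-exch zero    (false ∷ false ∷ r) = refl
letter-exch (suc c) (p ∷ r)             = letter-exch c r

exch-exch : ∀ {n} c (r : Row n) → exch c (exch c r) ≡ r
exch-exch c       []          = refl
exch-exch zero    (p ∷ [])    = refl
exch-exch zero    (p ∷ q ∷ r) = refl
exch-exch (suc c) (p ∷ r)     = cong (p ∷_) (exch-exch c r)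

module _ {n : ℕ} where

  hx hy : ℕ → Config n → ℕ
  hx c []      = 0
  hx c (r ∷ M) = stepX (letter c r) (hx c M)
  hy c []      = 0
  hy c (r ∷ M) = stepY (letter c r) (hx c M) (hy c M)

  -- An `op` is a ball in column `c` without a neighbour in column `c + 1`, so `Eh` pushes balls to
  -- the right and `Fh` to the left. The second direction is the one along which inductions run.
  Eh Fh : ℕ → Config n → Config n
  Eh c []      = []
  Eh c (r ∷ M) = pickE (letter c r) (hx c M) (exch c r ∷ M) (r ∷ Eh c M)
  Fh c []      = []
  Fh c (r ∷ M) = pickF (letter c r) (hx c M) (exch c r ∷ M) (r ∷ M) (r ∷ Fh c M)

  Fh-idle : ∀ c (M : Config n) → hx c M ≡ 0 → Fh c M ≡ M
  Fh-idle c []      h = refl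
  Fh-idle c (r ∷ M) h with letter c r | hx c M in eq
  ... | nu | _        = cong (r ∷_) (Fh-idle c M (trans eq h))
  ... | op | zero     = refl
  ... | op | suc zero = refl

  record ActsH (c : ℕ) (M M′ : Config n) : Set where
    constructor actsH
    field
      xUp   : hx c M′ ≡ suc (hx c M)
      yDown : suc (hy c M′) ≡ hy c M
      back  : Fh c M′ ≡ M

  private
    pickF-cong : ∀ {A : Set} {l l′ m m′} {a s r : A} → l ≡ l′ → m ≡ m′ →
                 pickF l m a s r ≡ pickF l′ m′ a s r
    pickF-cong refl refl = refl

    pickE-cong : ∀ {A : Set} {l l′ m m′} {a r : A} → l ≡ l′ → m ≡ m′ →
                 pickE l m a r ≡ pickE l′ m′ a r
    pickE-cong refl refl = refl

    stepY-cong : ∀ {l l′ m m′ y} → l ≡ l′ → m ≡ m′ → stepY l m y ≡ stepY l′ m′ y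
    stepY-cong refl refl = refl

  Eh-acts : ∀ c (M : Config n) → 0 < hy c M → ActsH c M (Eh c M)
  Eh-acts c (r ∷ M) h with letter c r in le | hx c M in eq
  ... | op | zero = actsH
      (trans (cong₂ stepX le′ eq) (cong suc (sym (cong₂ stepX le eq))))
      (trans (cong suc (stepY-cong le′ eq)) (sym (stepY-cong le eq)))
      (trans (pickF-cong le′ eq) (cong (_∷ M) (exch-exch c r)))
    where
    le′ : letter c (exch c r) ≡ cl
    le′ = trans (letter-exch c r) (cong flip le)
  ... | op | suc m with Eh-acts c M h
  ...   | actsH x y e = actsH
      (trans (cong₂ stepX le (trans x (cong suc eq))) (cong suc (sym (cong₂ stepX le eq))))
      (trans (cong suc (stepY-cong le x)) (trans y (sym (stepY-cong le eq))))
      (trans (pickF-cong le (trans x (cong suc eq))) (cong (r ∷_) e))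
  Eh-acts c (r ∷ M) h | nu | m with Eh-acts c M h
  ...   | actsH x y e = actsH
      (trans (cong₂ stepX le x) (cong suc (sym (cong₂ stepX le refl))))
      (trans (cong suc (stepY-cong le x)) (trans y (sym (stepY-cong le eq))))
      (trans (pickF-cong le x) (cong (r ∷_) e))
  Eh-acts c (r ∷ M) h | cl | m with Eh-acts c M h
  ...   | actsH x y e = actsH
      (trans (cong₂ stepX le x) (cong suc (sym (cong₂ stepX le refl))))
      (trans (cong suc (stepY-cong le x)) (trans y (sym (stepY-cong le eq))))
      (trans (pickF-cong le x) (cong (r ∷_) e))

  record ActsHF (c : ℕ) (M M′ : Config n) : Set where
    constructor actsHF
    field
      xDown : suc (hx c M′) ≡ hx c M
      yUp   : hy c M′ ≡ suc (hy c M)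
      back  : Eh c M′ ≡ M

  Fh-acts : ∀ c (M : Config n) → 0 < hx c M → ActsHF c M (Fh c M)
  Fh-acts c (r ∷ M) h with letter c r in le | hx c M in eq
  ... | cl | zero = actsHF
      (trans (cong suc (cong₂ stepX le′ eq)) (sym (cong₂ stepX le eq)))
      (trans (stepY-cong le′ eq) (cong suc (sym (stepY-cong le eq))))
      (trans (pickE-cong le′ eq) (cong (_∷ M) (exch-exch c r)))
    where
    le′ : letter c (exch c r) ≡ op
    le′ = trans (letter-exch c r) (cong flip le)
  ... | cl | suc m with Fh-acts c M (subst (0 <_) (sym eq) z<s)
  ...   | actsHF x y e = actsHF
      (trans (cong suc (trans (cong₂ stepX le refl) (trans x eq))) (sym (cong₂ stepX le eq)))
      (trans (stepY-cong le refl) (trans y (cong suc (sym (stepY-cong le refl)))))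
      (trans (pickE-cong le refl) (cong (r ∷_) e))
  Fh-acts c (r ∷ M) h | nu | m with Fh-acts c M (subst (0 <_) (sym eq) h)
  ...   | actsHF x y e = actsHF
      (trans (cong suc (cong₂ stepX le refl)) (trans x (sym (cong₂ stepX le refl))))
      (trans (stepY-cong le refl) (trans y (cong suc (sym (stepY-cong le refl)))))
      (trans (pickE-cong le refl) (cong (r ∷_) e))
  Fh-acts c (r ∷ M) h | op | suc (suc m) with Fh-acts c M (subst (0 <_) (sym eq) z<s)
  ...   | actsHF x y e = actsHF
      (trans (cong suc (cong₂ stepX le x′)) (sym (cong₂ stepX le eq)))
      (trans (stepY-cong le x′) (trans y (cong suc (sym (stepY-cong le eq)))))
      (trans (pickE-cong le x′) (cong (r ∷_) e))
    where
    x′ : hx c (Fh c M) ≡ suc m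
    x′ = suc-injective (trans x eq)

-- Commutation of the two crystals

-- One horizontal step seen on two adjacent rows, m being the number of
-- unmatched ")" in the rows above them.

H2 : ∀ {n} → ℕ → ℕ → Row n → Row n → Row n × Row n
H2 c m b t = pickE (letter c b) (stepX (letter c t) m) (exch c b , t)
               (pickE (letter c t) m (b , exch c t) (b , t))

H2² : ∀ {n} → ℕ → ℕ → Row n × Row n → Row n × Row n
H2² c m w = H2 c m (proj₁ w) (proj₂ w)

hx² : ∀ {n} → ℕ → ℕ → Row n × Row n → ℕ
hx² c m w = stepX (letter c (proj₁ w)) (stepX (letter c (proj₂ w)) m)

hy² : ∀ {n} → ℕ → ℕ → ℕ → Row n × Row n → ℕ
hy² c m y w = stepY (letter c (proj₁ w)) (stepX (letter c (proj₂ w)) m)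
                    (stepY (letter c (proj₂ w)) m y)

-- Whether the step passes by both rows and is left to the rows above. A vertical move inside the
-- pair must not change this answer.
goes : ∀ {n} → ℕ → ℕ → Row n × Row n → Bool
goes c m w = pickE (letter c (proj₁ w)) (stepX (letter c (proj₂ w)) m) false
               (pickE (letter c (proj₂ w)) m false true)

-- The interaction of the two crystals happens inside a 2 × 2 block, whose
-- surroundings enter only through the two counts of unmatched ")".

E2-H2₀ : ∀ {n} m p p′ q q′ (b t : Row n) →
  E2² (H2 0 m (p ∷ p′ ∷ b) (q ∷ q′ ∷ t)) ≡ H2² 0 m (E2 (p ∷ p′ ∷ b) (q ∷ q′ ∷ t))
E2-H2₀ m true true true true b t = refl
E2-H2₀ zero true true true false b t = refl
E2-H2₀ (suc m) true true true false b t = refl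
E2-H2₀ m true true false true b t = refl
E2-H2₀ m true true false false b t = refl
E2-H2₀ zero true false true true b t with ux b t
... | zero = refl
... | (suc k) = refl
E2-H2₀ (suc m) true false true true b t with ux b t
... | zero = refl
... | (suc k) = refl
E2-H2₀ zero true false true false b t = refl
E2-H2₀ (suc zero) true false true false b t = refl
E2-H2₀ (suc (suc m)) true false true false b t = refl
E2-H2₀ m true false false true b t with ux b t
... | zero = refl
... | (suc k) = refl
E2-H2₀ zero true false false false b t = refl
E2-H2₀ (suc m) true false false false b t = refl
E2-H2₀ m false true true true b t with ux b t
... | zero = refl
... | (suc k) = refl
E2-H2₀ zero false true true false b t = refl
E2-H2₀ (suc m) false true true false b t = refl
E2-H2₀ m false true false true b t = refl
E2-H2₀ m false true false false b t = refl
E2-H2₀ m false false true true b t with ux b t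
... | zero = refl
... | (suc zero) = refl
... | (suc (suc k)) = refl
E2-H2₀ zero false false true false b t with ux b t
... | zero = refl
... | (suc k) = refl
E2-H2₀ (suc m) false false true false b t with ux b t
... | zero = refl
... | (suc k) = refl
E2-H2₀ m false false false true b t with ux b t
... | zero = refl
... | (suc k) = refl
E2-H2₀ m false false false false b t = refl

ux-H2₀ : ∀ {n} m p p′ q q′ (b t : Row n) →
  ux² (H2 0 m (p ∷ p′ ∷ b) (q ∷ q′ ∷ t)) ≡ ux (p ∷ p′ ∷ b) (q ∷ q′ ∷ t)
ux-H2₀ m true true true true b t = refl
ux-H2₀ zero true true true false b t = refl
ux-H2₀ (suc m) true true true false b t = refl
ux-H2₀ m true true false true b t = refl
ux-H2₀ m true true false false b t = refl
ux-H2₀ zero true false true true b t = refl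
ux-H2₀ (suc m) true false true true b t = refl
ux-H2₀ zero true false true false b t = refl
ux-H2₀ (suc zero) true false true false b t = refl
ux-H2₀ (suc (suc m)) true false true false b t = refl
ux-H2₀ m true false false true b t = refl
ux-H2₀ zero true false false false b t = refl
ux-H2₀ (suc m) true false false false b t = refl
ux-H2₀ m false true true true b t = refl
ux-H2₀ zero false true true false b t = refl
ux-H2₀ (suc m) false true true false b t = refl
ux-H2₀ m false true false true b t = refl
ux-H2₀ m false true false false b t = refl
ux-H2₀ m false false true true b t = refl
ux-H2₀ zero false false true false b t = refl
ux-H2₀ (suc m) false false true false b t = refl
ux-H2₀ m false false false true b t = refl
ux-H2₀ m false false false false b t = refl

uy-H2₀ : ∀ {n} m p p′ q q′ (b t : Row n) →
  uy² (H2 0 m (p ∷ p′ ∷ b) (q ∷ q′ ∷ t)) ≡ uy (p ∷ p′ ∷ b) (q ∷ q′ ∷ t)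
uy-H2₀ m true true true true b t = refl
uy-H2₀ zero true true true false b t = refl
uy-H2₀ (suc m) true true true false b t = refl
uy-H2₀ m true true false true b t = refl
uy-H2₀ m true true false false b t = refl
uy-H2₀ zero true false true true b t with ux b t
... | zero = refl
... | (suc k) = refl
uy-H2₀ (suc m) true false true true b t with ux b t
... | zero = refl
... | (suc k) = refl
uy-H2₀ zero true false true false b t = refl
uy-H2₀ (suc zero) true false true false b t = refl
uy-H2₀ (suc (suc m)) true false true false b t = refl
uy-H2₀ m true false false true b t with ux b t
... | zero = refl
... | (suc k) = refl
uy-H2₀ zero true false false false b t = refl
uy-H2₀ (suc m) true false false false b t = refl
uy-H2₀ m false true true true b t with ux b t
... | zero = refl
... | (suc k) = refl
uy-H2₀ zero false true true false b t = refl
uy-H2₀ (suc m) false true true false b t = refl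
uy-H2₀ m false true false true b t = refl
uy-H2₀ m false true false false b t = refl
uy-H2₀ m false false true true b t with ux b t
... | zero = refl
... | (suc zero) = refl
... | (suc (suc k)) = refl
uy-H2₀ zero false false true false b t with ux b t
... | zero = refl
... | (suc k) = refl
uy-H2₀ (suc m) false false true false b t with ux b t
... | zero = refl
... | (suc k) = refl
uy-H2₀ m false false false true b t with ux b t
... | zero = refl
... | (suc k) = refl
uy-H2₀ m false false false false b t = refl

hx-E2₀ : ∀ {n} m p p′ q q′ (b t : Row n) →
  hx² 0 m (E2 (p ∷ p′ ∷ b) (q ∷ q′ ∷ t)) ≡ hx² 0 m (p ∷ p′ ∷ b , q ∷ q′ ∷ t)
hx-E2₀ m true true true true b t = refl
hx-E2₀ m true true true false b t = refl
hx-E2₀ m true true false true b t = refl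
hx-E2₀ m true true false false b t = refl
hx-E2₀ m true false true true b t with ux b t
... | zero = refl
... | (suc k) = refl
hx-E2₀ m true false true false b t = refl
hx-E2₀ m true false false true b t with ux b t
... | zero = refl
... | (suc k) = refl
hx-E2₀ m true false false false b t = refl
hx-E2₀ m false true true true b t with ux b t
... | zero = refl
... | (suc k) = refl
hx-E2₀ m false true true false b t = refl
hx-E2₀ m false true false true b t = refl
hx-E2₀ m false true false false b t = refl
hx-E2₀ m false false true true b t with ux b t
... | zero = refl
... | (suc zero) = refl
... | (suc (suc k)) = refl
hx-E2₀ m false false true false b t with ux b t
... | zero = refl
... | (suc k) = refl
hx-E2₀ m false false false true b t with ux b t
... | zero = refl
... | (suc k) = refl
hx-E2₀ m false false false false b t = refl

hy-E2₀ : ∀ {n} m y p p′ q q′ (b t : Row n) →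
  hy² 0 m y (E2 (p ∷ p′ ∷ b) (q ∷ q′ ∷ t)) ≡ hy² 0 m y (p ∷ p′ ∷ b , q ∷ q′ ∷ t)
hy-E2₀ m y true true true true b t = refl
hy-E2₀ zero y true true true false b t = refl
hy-E2₀ (suc m) y true true true false b t = refl
hy-E2₀ m y true true false true b t = refl
hy-E2₀ m y true true false false b t = refl
hy-E2₀ zero y true false true true b t with ux b t
... | zero = refl
... | (suc k) = refl
hy-E2₀ (suc m) y true false true true b t with ux b t
... | zero = refl
... | (suc k) = refl
hy-E2₀ zero y true false true false b t = refl
hy-E2₀ (suc zero) y true false true false b t = refl
hy-E2₀ (suc (suc m)) y true false true false b t = refl
hy-E2₀ m y true false false true b t with ux b t
... | zero = refl
... | (suc k) = refl
hy-E2₀ zero y true false false false b t = refl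
hy-E2₀ (suc m) y true false false false b t = refl
hy-E2₀ m y false true true true b t with ux b t
... | zero = refl
... | (suc k) = refl
hy-E2₀ zero y false true true false b t = refl
hy-E2₀ (suc m) y false true true false b t = refl
hy-E2₀ m y false true false true b t = refl
hy-E2₀ m y false true false false b t = refl
hy-E2₀ m y false false true true b t with ux b t
... | zero = refl
... | (suc zero) = refl
... | (suc (suc k)) = refl
hy-E2₀ zero y false false true false b t with ux b t
... | zero = refl
... | (suc k) = refl
hy-E2₀ (suc m) y false false true false b t with ux b t
... | zero = refl
... | (suc k) = refl
hy-E2₀ m y false false false true b t with ux b t
... | zero = refl
... | (suc k) = refl
hy-E2₀ m y false false false false b t = refl

goes-E2₀ : ∀ {n} m p p′ q q′ (b t : Row n) →
  goes 0 m (E2 (p ∷ p′ ∷ b) (q ∷ q′ ∷ t)) ≡ goes 0 m (p ∷ p′ ∷ b , q ∷ q′ ∷ t)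
goes-E2₀ m true true true true b t = refl
goes-E2₀ zero true true true false b t = refl
goes-E2₀ (suc m) true true true false b t = refl
goes-E2₀ m true true false true b t = refl
goes-E2₀ m true true false false b t = refl
goes-E2₀ zero true false true true b t with ux b t
... | zero = refl
... | (suc k) = refl
goes-E2₀ (suc m) true false true true b t with ux b t
... | zero = refl
... | (suc k) = refl
goes-E2₀ zero true false true false b t = refl
goes-E2₀ (suc zero) true false true false b t = refl
goes-E2₀ (suc (suc m)) true false true false b t = refl
goes-E2₀ m true false false true b t with ux b t
... | zero = refl
... | (suc k) = refl
goes-E2₀ zero true false false false b t = refl
goes-E2₀ (suc m) true false false false b t = refl
goes-E2₀ m false true true true b t with ux b t
... | zero = refl
... | (suc k) = refl
goes-E2₀ zero false true true false b t = refl
goes-E2₀ (suc m) false true true false b t = refl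
goes-E2₀ m false true false true b t = refl
goes-E2₀ m false true false false b t = refl
goes-E2₀ m false false true true b t with ux b t
... | zero = refl
... | (suc zero) = refl
... | (suc (suc k)) = refl
goes-E2₀ zero false false true false b t with ux b t
... | zero = refl
... | (suc k) = refl
goes-E2₀ (suc m) false false true false b t with ux b t
... | zero = refl
... | (suc k) = refl
goes-E2₀ m false false false true b t with ux b t
... | zero = refl
... | (suc k) = refl
goes-E2₀ m false false false false b t = refl

pickE-map : ∀ {A B : Set} (f : A → B) l m {a r} → f (pickE l m a r) ≡ pickE l m (f a) (f r)
pickE-map f op zero    = refl
pickE-map f op (suc m) = refl
pickE-map f cl m       = refl
pickE-map f nu m       = refl

pickE-const : ∀ {A : Set} l m {a r v : A} → a ≡ v → r ≡ v → pickE l m a r ≡ v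
pickE-const op zero    p q = p
pickE-const op (suc m) p q = q
pickE-const cl m       p q = q
pickE-const nu m       p q = q

H2-cons : ∀ {n} c m p q (b t : Row n) → H2 (suc c) m (p ∷ b) (q ∷ t) ≡ cons2 p q (H2 c m b t)
H2-cons c m p q b t =
  sym (trans (pickE-map (cons2 p q) (letter c b) (stepX (letter c t) m))
             (cong (pickE (letter c b) (stepX (letter c t) m) _) (pickE-map (cons2 p q) (letter c t) m)))

ux-H2 : ∀ {n} c m (b t : Row n) → ux² (H2 c m b t) ≡ ux b t
ux-H2 c       m []           []           = refl
ux-H2 zero    m (p ∷ [])     (q ∷ [])     = refl
ux-H2 zero    m (p ∷ p′ ∷ b) (q ∷ q′ ∷ t) = ux-H2₀ m p p′ q q′ b t
ux-H2 (suc c) m (p ∷ b)      (q ∷ t)      =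
  trans (cong ux² (H2-cons c m p q b t)) (cong (stepX (bracket q p)) (ux-H2 c m b t))

uy-H2 : ∀ {n} c m (b t : Row n) → uy² (H2 c m b t) ≡ uy b t
uy-H2 c       m []           []           = refl
uy-H2 zero    m (p ∷ [])     (q ∷ [])     = refl
uy-H2 zero    m (p ∷ p′ ∷ b) (q ∷ q′ ∷ t) = uy-H2₀ m p p′ q q′ b t
uy-H2 (suc c) m (p ∷ b)      (q ∷ t)      =
  trans (cong uy² (H2-cons c m p q b t)) (cong₂ (stepY (bracket q p)) (ux-H2 c m b t) (uy-H2 c m b t))

hx-E2 : ∀ {n} c m (b t : Row n) → hx² c m (E2 b t) ≡ hx² c m (b , t)
hx-E2 c       m []           []           = refl
hx-E2 zero    m (p ∷ [])     (q ∷ [])     = trans (pickE-map (hx² 0 m) (bracket q p) 0) (pickE-const (bracket q p) 0 refl refl)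
hx-E2 zero    m (p ∷ p′ ∷ b) (q ∷ q′ ∷ t) = hx-E2₀ m p p′ q q′ b t
hx-E2 (suc c) m (p ∷ b)      (q ∷ t)      =
  trans (pickE-map (hx² (suc c) m) (bracket q p) (ux b t)) (pickE-const (bracket q p) (ux b t) refl (hx-E2 c m b t))

hy-E2 : ∀ {n} c m y (b t : Row n) → hy² c m y (E2 b t) ≡ hy² c m y (b , t)
hy-E2 c       m y []           []           = refl
hy-E2 zero    m y (p ∷ [])     (q ∷ [])     = trans (pickE-map (hy² 0 m y) (bracket q p) 0) (pickE-const (bracket q p) 0 refl refl)
hy-E2 zero    m y (p ∷ p′ ∷ b) (q ∷ q′ ∷ t) = hy-E2₀ m y p p′ q q′ b t
hy-E2 (suc c) m y (p ∷ b)      (q ∷ t)      =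
  trans (pickE-map (hy² (suc c) m y) (bracket q p) (ux b t)) (pickE-const (bracket q p) (ux b t) refl (hy-E2 c m y b t))

goes-E2 : ∀ {n} c m (b t : Row n) → goes c m (E2 b t) ≡ goes c m (b , t)
goes-E2 c       m []           []           = refl
goes-E2 zero    m (p ∷ [])     (q ∷ [])     = trans (pickE-map (goes 0 m) (bracket q p) 0) (pickE-const (bracket q p) 0 refl refl)
goes-E2 zero    m (p ∷ p′ ∷ b) (q ∷ q′ ∷ t) = goes-E2₀ m p p′ q q′ b t
goes-E2 (suc c) m (p ∷ b)      (q ∷ t)      =
  trans (pickE-map (goes (suc c) m) (bracket q p) (ux b t)) (pickE-const (bracket q p) (ux b t) refl (goes-E2 c m b t))

-- At a column to the left of `c` the vertical operator looks at the columns behind it only through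
-- `ux`, which the horizontal step preserves. This reduces the claim to the block at `c`.
E2-H2 : ∀ {n} c m (b t : Row n) → E2² (H2 c m b t) ≡ H2² c m (E2 b t)
E2-H2 c       m []           []           = refl
E2-H2 zero    m (p ∷ [])     (q ∷ [])     =
  sym (trans (pickE-map (H2² 0 m) (bracket q p) 0) refl)
E2-H2 zero    m (p ∷ p′ ∷ b) (q ∷ q′ ∷ t) = E2-H2₀ m p p′ q q′ b t
E2-H2 (suc c) m (p ∷ b)      (q ∷ t)      = begin
  E2² (H2 (suc c) m (p ∷ b) (q ∷ t))
    ≡⟨ cong E2² (H2-cons c m p q b t) ⟩
  pickE (bracket q p) (ux² (H2 c m b t)) (cons2 q p (H2 c m b t)) (cons2 p q (E2² (H2 c m b t)))
    ≡⟨ cong₂ (λ x r → pickE (bracket q p) x (cons2 q p (H2 c m b t)) (cons2 p q r)) (ux-H2 c m b t) (E2-H2 c m b t) ⟩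
  pickE (bracket q p) (ux b t) (cons2 q p (H2 c m b t)) (cons2 p q (H2² c m (E2 b t)))
    ≡⟨ cong₂ (pickE (bracket q p) (ux b t)) (H2-cons c m q p b t) (H2-cons c m p q (proj₁ (E2 b t)) (proj₂ (E2 b t))) ⟨
  pickE (bracket q p) (ux b t) (H2 (suc c) m (q ∷ b) (p ∷ t)) (H2² (suc c) m (cons2 p q (E2 b t)))
    ≡⟨ pickE-map (H2² (suc c) m) (bracket q p) (ux b t) ⟨
  H2² (suc c) m (E2 (p ∷ b) (q ∷ t)) ∎
  where open ≡-Reasoning

consC : ∀ {n} → Row n × Row n → Config n → Config n
consC w M = proj₁ w ∷ proj₂ w ∷ M

-- Separates the two rows touched by a vertical operator from the rest: the step is taken inside the
-- pair or handed over to the rows above.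
Eh-H2 : ∀ {n} c (b t : Row n) M →
        Eh c (b ∷ t ∷ M) ≡ consC (H2 c (hx c M) b t) (if goes c (hx c M) (b , t) then Eh c M else M)
Eh-H2 c b t M with letter c b | letter c t | hx c M
... | op | op | zero        = refl
... | op | op | suc zero    = refl
... | op | op | suc (suc m) = refl
... | op | cl | m           = refl
... | op | nu | zero        = refl
... | op | nu | suc m       = refl
... | cl | op | zero        = refl
... | cl | op | suc m       = refl
... | cl | cl | m           = refl
... | cl | nu | m           = refl
... | nu | op | zero        = refl
... | nu | op | suc m       = refl
... | nu | cl | m           = refl
... | nu | nu | m           = refl

zero⊎pos : ∀ m → m ≡ 0 ⊎ 0 < m
zero⊎pos zero    = inj₁ refl
zero⊎pos (suc m) = inj₂ z<s

-- The vertical operators with index j act on the rows j and j + 1.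

module _ {n : ℕ} where

  vx vy : ℕ → Config n → ℕ
  vx zero    (b ∷ t ∷ M) = ux b t
  vx (suc j) (b ∷ M)     = vx j M
  vx _       _           = 0
  vy zero    (b ∷ t ∷ M) = uy b t
  vy (suc j) (b ∷ M)     = vy j M
  vy _       _           = 0

  Ev Fv : ℕ → Config n → Config n
  Ev zero    (b ∷ t ∷ M) = consC (E2 b t) M
  Ev (suc j) (b ∷ M)     = b ∷ Ev j M
  Ev _       M           = M
  Fv zero    (b ∷ t ∷ M) = consC (F2 b t) M
  Fv (suc j) (b ∷ M)     = b ∷ Fv j M
  Fv _       M           = M

  hx-Ev : ∀ c j M → hx c (Ev j M) ≡ hx c M
  hx-Ev c zero    []          = refl
  hx-Ev c zero    (b ∷ [])    = refl
  hx-Ev c zero    (b ∷ t ∷ M) = hx-E2 c (hx c M) b t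
  hx-Ev c (suc j) []          = refl
  hx-Ev c (suc j) (b ∷ M)     = cong (stepX (letter c b)) (hx-Ev c j M)

  hy-Ev : ∀ c j M → hy c (Ev j M) ≡ hy c M
  hy-Ev c zero    []          = refl
  hy-Ev c zero    (b ∷ [])    = refl
  hy-Ev c zero    (b ∷ t ∷ M) = hy-E2 c (hx c M) (hy c M) b t
  hy-Ev c (suc j) []          = refl
  hy-Ev c (suc j) (b ∷ M)     = cong₂ (stepY (letter c b)) (hx-Ev c j M) (hy-Ev c j M)

  vx-Eh : ∀ c j M → vx j (Eh c M) ≡ vx j M
  vx-Eh c zero    []          = refl
  vx-Eh c zero    (b ∷ [])    = trans (pickE-map (vx 0) (letter c b) 0) (pickE-const (letter c b) 0 refl refl)
  vx-Eh c zero    (b ∷ t ∷ M) = trans (cong (vx 0) (Eh-H2 c b t M)) (ux-H2 c (hx c M) b t)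
  vx-Eh c (suc j) []          = refl
  vx-Eh c (suc j) (b ∷ M)     =
    trans (pickE-map (vx (suc j)) (letter c b) (hx c M)) (pickE-const (letter c b) (hx c M) refl (vx-Eh c j M))

  vy-Eh : ∀ c j M → vy j (Eh c M) ≡ vy j M
  vy-Eh c zero    []          = refl
  vy-Eh c zero    (b ∷ [])    = trans (pickE-map (vy 0) (letter c b) 0) (pickE-const (letter c b) 0 refl refl)
  vy-Eh c zero    (b ∷ t ∷ M) = trans (cong (vy 0) (Eh-H2 c b t M)) (uy-H2 c (hx c M) b t)
  vy-Eh c (suc j) []          = refl
  vy-Eh c (suc j) (b ∷ M)     =
    trans (pickE-map (vy (suc j)) (letter c b) (hx c M)) (pickE-const (letter c b) (hx c M) refl (vy-Eh c j M))

  Ev-Eh : ∀ c j M → Ev j (Eh c M) ≡ Eh c (Ev j M)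
  Ev-Eh c zero    []          = refl
  Ev-Eh c zero    (b ∷ [])    =
    trans (pickE-map (Ev 0) (letter c b) 0) refl
  Ev-Eh c zero    (b ∷ t ∷ M) = begin
    Ev 0 (Eh c (b ∷ t ∷ M))
      ≡⟨ cong (Ev 0) (Eh-H2 c b t M) ⟩
    consC (E2² (H2 c m b t)) (if goes c m (b , t) then Eh c M else M)
      ≡⟨ cong₂ (λ w f → consC w (if f then Eh c M else M)) (E2-H2 c m b t) (sym (goes-E2 c m b t)) ⟩
    consC (H2² c m (E2 b t)) (if goes c m (E2 b t) then Eh c M else M)
      ≡⟨ Eh-H2 c (proj₁ (E2 b t)) (proj₂ (E2 b t)) M ⟨
    Eh c (consC (E2 b t) M) ∎
    where
    open ≡-Reasoning
    m = hx c M
  Ev-Eh c (suc j) []          = refl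
  Ev-Eh c (suc j) (b ∷ M)     =
    trans (pickE-map (Ev (suc j)) (letter c b) (hx c M))
          (trans (cong (λ r → pickE (letter c b) (hx c M) (exch c b ∷ Ev j M) (b ∷ r)) (Ev-Eh c j M))
                 (cong (λ m → pickE (letter c b) m (exch c b ∷ Ev j M) (b ∷ Eh c (Ev j M))) (sym (hx-Ev c j M))))

  Ev-idle : ∀ j M → vy j M ≡ 0 → Ev j M ≡ M
  Ev-idle zero    []          h = refl
  Ev-idle zero    (b ∷ [])    h = refl
  Ev-idle zero    (b ∷ t ∷ M) h = cong (λ w → consC w M) (E2-idle b t h)
  Ev-idle (suc j) []          h = refl
  Ev-idle (suc j) (b ∷ M)     h = cong (b ∷_) (Ev-idle j M h)

  Fv-idle : ∀ j M → vx j M ≡ 0 → Fv j M ≡ M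
  Fv-idle zero    []          h = refl
  Fv-idle zero    (b ∷ [])    h = refl
  Fv-idle zero    (b ∷ t ∷ M) h = cong (λ w → consC w M) (F2-idle b t h)
  Fv-idle (suc j) []          h = refl
  Fv-idle (suc j) (b ∷ M)     h = cong (b ∷_) (Fv-idle j M h)

  Fv∘Ev : ∀ j M → 0 < vy j M → Fv j (Ev j M) ≡ M
  Fv∘Ev zero    (b ∷ t ∷ M) h = cong (λ w → consC w M) (Acts.back (E2-acts b t h))
  Fv∘Ev (suc j) (b ∷ M)     h = cong (b ∷_) (Fv∘Ev j M h)

  vy-Ev : ∀ j M → 0 < vy j M → suc (vy j (Ev j M)) ≡ vy j M
  vy-Ev zero    (b ∷ t ∷ M) h = Acts.yDown (E2-acts b t h)
  vy-Ev (suc j) (b ∷ M)     h = vy-Ev j M h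

  Ev∘Fv : ∀ j M → 0 < vx j M → Ev j (Fv j M) ≡ M
  Ev∘Fv zero    (b ∷ t ∷ M) h = cong (λ w → consC w M) (ActsF.back (F2-acts b t h))
  Ev∘Fv (suc j) (b ∷ M)     h = cong (b ∷_) (Ev∘Fv j M h)

  vy-Fv : ∀ j M → 0 < vx j M → vy j (Fv j M) ≡ suc (vy j M)
  vy-Fv zero    (b ∷ t ∷ M) h = ActsF.yUp (F2-acts b t h)
  vy-Fv (suc j) (b ∷ M)     h = vy-Fv j M h

  -- Commutation with the inverse operators is formal.

  hx-Fv : ∀ c j M → hx c (Fv j M) ≡ hx c M
  hx-Fv c j M with zero⊎pos (vx j M)
  ... | inj₁ h = cong (hx c) (Fv-idle j M h)
  ... | inj₂ h = trans (sym (hx-Ev c j (Fv j M))) (cong (hx c) (Ev∘Fv j M h))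

  vx-Fh : ∀ c j M → vx j (Fh c M) ≡ vx j M
  vx-Fh c j M with zero⊎pos (hx c M)
  ... | inj₁ h = cong (vx j) (Fh-idle c M h)
  ... | inj₂ h = trans (sym (vx-Eh c j (Fh c M))) (cong (vx j) (ActsHF.back (Fh-acts c M h)))

  vy-Fh : ∀ c j M → vy j (Fh c M) ≡ vy j M
  vy-Fh c j M with zero⊎pos (hx c M)
  ... | inj₁ h = cong (vy j) (Fh-idle c M h)
  ... | inj₂ h = trans (sym (vy-Eh c j (Fh c M))) (cong (vy j) (ActsHF.back (Fh-acts c M h)))

  Ev-Fh : ∀ c j M → Ev j (Fh c M) ≡ Fh c (Ev j M)
  Ev-Fh c j M with zero⊎pos (hx c M)
  ... | inj₁ h = trans (cong (Ev j) (Fh-idle c M h)) (sym (Fh-idle c (Ev j M) (trans (hx-Ev c j M) h)))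
  ... | inj₂ h = sym (begin
    Fh c (Ev j M)
      ≡⟨ cong (Fh c ∘ Ev j) (ActsHF.back a) ⟨
    Fh c (Ev j (Eh c (Fh c M)))
      ≡⟨ cong (Fh c) (Ev-Eh c j (Fh c M)) ⟩
    Fh c (Eh c (Ev j (Fh c M)))
      ≡⟨ ActsH.back (Eh-acts c (Ev j (Fh c M)) (subst (0 <_) (sym (trans (hy-Ev c j (Fh c M)) (ActsHF.yUp a))) z<s)) ⟩
    Ev j (Fh c M) ∎)
    where
    open ≡-Reasoning
    a = Fh-acts c M h

  -- Where `Fv` acts it is inverse to `Ev`, and `X` preserves the counts that tell whether it acts.
  -- Hence commutation passes from the raising to the lowering operators.
  Fv-comm : (X : Config n → Config n) → (∀ j M → Ev j (X M) ≡ X (Ev j M)) →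
            (∀ j M → vx j (X M) ≡ vx j M) → (∀ j M → vy j (X M) ≡ vy j M) →
            ∀ j M → Fv j (X M) ≡ X (Fv j M)
  Fv-comm X comm px py j M with zero⊎pos (vx j M)
  ... | inj₁ h = trans (Fv-idle j (X M) (trans (px j M) h)) (cong X (sym (Fv-idle j M h)))
  ... | inj₂ h = begin
    Fv j (X M)                ≡⟨ cong (Fv j ∘ X) (Ev∘Fv j M h) ⟨
    Fv j (X (Ev j (Fv j M)))  ≡⟨ cong (Fv j) (comm j (Fv j M)) ⟨
    Fv j (Ev j (X (Fv j M)))  ≡⟨ Fv∘Ev j (X (Fv j M)) (subst (0 <_) (sym (trans (py j (Fv j M)) (vy-Fv j M h))) z<s) ⟩
    X (Fv j M)                ∎
    where open ≡-Reasoning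

-- Ball counts and dominance between rows

bit : Bool → ℕ
bit true  = 1
bit false = 0

cnt : ∀ {n} → Row n → ℕ
cnt []      = 0
cnt (p ∷ r) = bit p + cnt r

-- Suffix dominance: every suffix of b contains at least as many balls as
-- the corresponding suffix of t.

infix 4 _≼_ _⊑_

_≼_ : ∀ {n} → Row n → Row n → Set
[]      ≼ []      = ⊤
(q ∷ t) ≼ (p ∷ b) = t ≼ b × cnt (q ∷ t) ≤ cnt (p ∷ b)

≼-cnt : ∀ {n} (t b : Row n) → t ≼ b → cnt t ≤ cnt b
≼-cnt []      []      _       = z≤n
≼-cnt (q ∷ t) (p ∷ b) (_ , h) = h

≼-trans : ∀ {n} (s t u : Row n) → s ≼ t → t ≼ u → s ≼ u
≼-trans []      []      []      _       _         = tt
≼-trans (_ ∷ s) (_ ∷ t) (_ ∷ u) (h , i) (h′ , i′) = ≼-trans s t u h h′ , ≤-trans i i′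

-- Matched brackets and full columns take equally many balls from both rows, so the sizes differ
-- exactly by the unmatched brackets.
balance : ∀ {n} (b t : Row n) → uy b t + cnt b ≡ ux b t + cnt t
balance []          []          = refl
balance (true ∷ b)  (true ∷ t)  rewrite +-suc (uy b t) (cnt b) | +-suc (ux b t) (cnt t) = cong suc (balance b t)
balance (false ∷ b) (false ∷ t) = balance b t
balance (true ∷ b)  (false ∷ t) rewrite +-suc (uy b t) (cnt b) = cong suc (balance b t)
balance (false ∷ b) (true ∷ t)  with ux b t | balance b t
... | zero  | e = cong suc e
... | suc m | e rewrite +-suc m (cnt t) = e

uy≡0⇒≼ : ∀ {n} (b t : Row n) → uy b t ≡ 0 → t ≼ b
uy≡0⇒≼ []      []      _ = tt
uy≡0⇒≼ (p ∷ b) (q ∷ t) h = uy≡0⇒≼ b t (tail₀ (bracket q p) (ux b t) h) , le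
  where
  tail₀ : ∀ l m → stepY l m (uy b t) ≡ 0 → uy b t ≡ 0
  tail₀ op (suc m) e = e
  tail₀ cl m       e = e
  tail₀ nu m       e = e
  le : cnt (q ∷ t) ≤ cnt (p ∷ b)
  le = subst (cnt (q ∷ t) ≤_)
         (trans (sym (balance (p ∷ b) (q ∷ t))) (cong (_+ cnt (p ∷ b)) h))
         (m≤n+m (cnt (q ∷ t)) (ux (p ∷ b) (q ∷ t)))

-- By `balance`, the suffix that starts at the last unmatched "(" would hold more balls above than
-- below.
≼⇒uy≡0 : ∀ {n} (b t : Row n) → t ≼ b → uy b t ≡ 0
≼⇒uy≡0 []          []          _       = refl
≼⇒uy≡0 (true ∷ b)  (true ∷ t)  (h , _) = ≼⇒uy≡0 b t h
≼⇒uy≡0 (true ∷ b)  (false ∷ t) (h , _) = ≼⇒uy≡0 b t h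
≼⇒uy≡0 (false ∷ b) (false ∷ t) (h , _) = ≼⇒uy≡0 b t h
≼⇒uy≡0 (false ∷ b) (true ∷ t)  (h , i) with ux b t | balance b t | ≼⇒uy≡0 b t h
... | suc _ | _ | e  = e
... | zero  | e | e′ = ⊥-elim (<-irrefl (trans (sym e) (cong (_+ cnt b) e′)) i)

_⊑_ : ∀ {n} → Row n → Row n → Set
[]      ⊑ []      = ⊤
(q ∷ t) ⊑ (p ∷ b) = (p ≡ false → q ≡ false) × t ⊑ b

⊑-refl : ∀ {n} (r : Row n) → r ⊑ r
⊑-refl []      = tt
⊑-refl (p ∷ r) = id , ⊑-refl r

⊑-trans : ∀ {n} (s t u : Row n) → s ⊑ t → t ⊑ u → s ⊑ u
⊑-trans []      []      []      _       _         = tt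
⊑-trans (_ ∷ s) (_ ∷ t) (_ ∷ u) (h , i) (h′ , i′) = h ∘ h′ , ⊑-trans s t u i i′

bit-mono : ∀ p q → (p ≡ false → q ≡ false) → bit q ≤ bit p
bit-mono true  true  _ = ≤-refl
bit-mono true  false _ = z≤n
bit-mono false q     h rewrite h refl = z≤n

⊑⇒≼ : ∀ {n} (t b : Row n) → t ⊑ b → t ≼ b
⊑⇒≼ []      []      _       = tt
⊑⇒≼ (q ∷ t) (p ∷ b) (h , i) = ⊑⇒≼ t b i , +-mono-≤ (bit-mono p q h) (≼-cnt t b (⊑⇒≼ t b i))

-- What each direction preserves

cs : ∀ {n} → Config n → Vec ℕ n
cs []      = Vec.replicate _ 0
cs (r ∷ M) = Vec.zipWith (λ p k → bit p + k) r (cs M)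

cnt-exch : ∀ {n} c (r : Row n) → cnt (exch c r) ≡ cnt r
cnt-exch c       []          = refl
cnt-exch zero    (p ∷ [])    = refl
cnt-exch zero    (p ∷ q ∷ r) = begin
  bit q + (bit p + cnt r) ≡⟨ +-assoc (bit q) (bit p) (cnt r) ⟨
  bit q + bit p + cnt r   ≡⟨ cong (_+ cnt r) (+-comm (bit q) (bit p)) ⟩
  bit p + bit q + cnt r   ≡⟨ +-assoc (bit p) (bit q) (cnt r) ⟩
  bit p + (bit q + cnt r) ∎
  where open ≡-Reasoning
cnt-exch (suc c) (p ∷ r)     = cong (bit p +_) (cnt-exch c r)

pickF-map : ∀ {A B : Set} (f : A → B) l m {a s r} → f (pickF l m a s r) ≡ pickF l m (f a) (f s) (f r)
pickF-map f op zero          = refl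
pickF-map f op (suc zero)    = refl
pickF-map f op (suc (suc m)) = refl
pickF-map f cl zero          = refl
pickF-map f cl (suc m)       = refl
pickF-map f nu m             = refl

pickF-const : ∀ {A : Set} l m {a s r v : A} → a ≡ v → s ≡ v → r ≡ v → pickF l m a s r ≡ v
pickF-const op zero          p q r = q
pickF-const op (suc zero)    p q r = q
pickF-const op (suc (suc m)) p q r = r
pickF-const cl zero          p q r = p
pickF-const cl (suc m)       p q r = r
pickF-const nu m             p q r = r

cs²-E2 : ∀ {m} (b t : Row m) v →
         Vec.zipWith (λ p k → bit p + k) (proj₁ (E2 b t)) (Vec.zipWith (λ p k → bit p + k) (proj₂ (E2 b t)) v)
         ≡ Vec.zipWith (λ p k → bit p + k) b (Vec.zipWith (λ p k → bit p + k) t v)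
cs²-E2 []      []      []      = refl
cs²-E2 (p ∷ b) (q ∷ t) (k ∷ v) =
  trans (pickE-map col² (bracket q p) (ux b t)) (pickE-const (bracket q p) (ux b t)
    (cong (_∷ Vec.zipWith (λ p k → bit p + k) b (Vec.zipWith (λ p k → bit p + k) t v)) (trans (sym (+-assoc (bit q) (bit p) k)) (trans (cong (_+ k) (+-comm (bit q) (bit p))) (+-assoc (bit p) (bit q) k))))
    (cong (_ ∷_) (cs²-E2 b t v)))
  where
  col² : Row (suc _) × Row (suc _) → Vec ℕ (suc _)
  col² w = Vec.zipWith (λ p k → bit p + k) (proj₁ w) (Vec.zipWith (λ p k → bit p + k) (proj₂ w) (k ∷ v))

iter-comm : ∀ {A : Set} (f g : A → A) → (∀ x → f (g x) ≡ g (f x)) → ∀ k x → iter k f (g x) ≡ g (iter k f x)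
iter-comm f g c zero    x = refl
iter-comm f g c (suc k) x = trans (cong (iter k f) (c x)) (iter-comm f g c k (f x))

iter-inv : ∀ {A B : Set} (f : A → A) (p : A → B) → (∀ x → p (f x) ≡ p x) → ∀ k x → p (iter k f x) ≡ p x
iter-inv f p c zero    x = refl
iter-inv f p c (suc k) x = trans (iter-inv f p c k (f x)) (c x)

module _ {n : ℕ} where

  sizes : Config n → List ℕ
  sizes = map cnt

  sizes-Eh : ∀ c (M : Config n) → sizes (Eh c M) ≡ sizes M
  sizes-Eh c []      = refl
  sizes-Eh c (r ∷ M) =
    trans (pickE-map sizes (letter c r) (hx c M))
          (pickE-const (letter c r) (hx c M) (cong (_∷ sizes M) (cnt-exch c r)) (cong (cnt r ∷_) (sizes-Eh c M)))

  sizes-Fh : ∀ c (M : Config n) → sizes (Fh c M) ≡ sizes M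
  sizes-Fh c []      = refl
  sizes-Fh c (r ∷ M) =
    trans (pickF-map sizes (letter c r) (hx c M))
          (pickF-const (letter c r) (hx c M) (cong (_∷ sizes M) (cnt-exch c r)) refl (cong (cnt r ∷_) (sizes-Fh c M)))

  cs-Ev : ∀ j (M : Config n) → cs (Ev j M) ≡ cs M
  cs-Ev zero    []          = refl
  cs-Ev zero    (b ∷ [])    = refl
  cs-Ev zero    (b ∷ t ∷ M) = cs²-E2 b t (cs M)
  cs-Ev (suc j) []          = refl
  cs-Ev (suc j) (b ∷ M)     = cong (Vec.zipWith (λ p k → bit p + k) b) (cs-Ev j M)

  cs-Fv : ∀ j (M : Config n) → cs (Fv j M) ≡ cs M
  cs-Fv j M with zero⊎pos (vx j M)
  ... | inj₁ h = cong cs (Fv-idle j M h)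
  ... | inj₂ h = trans (sym (cs-Ev j (Fv j M))) (cong cs (Ev∘Fv j M h))

  length-Ev : ∀ j (M : Config n) → length (Ev j M) ≡ length M
  length-Ev zero    []          = refl
  length-Ev zero    (b ∷ [])    = refl
  length-Ev zero    (b ∷ t ∷ M) = refl
  length-Ev (suc j) []          = refl
  length-Ev (suc j) (b ∷ M)     = cong suc (length-Ev j M)

  length-Fv : ∀ j (M : Config n) → length (Fv j M) ≡ length M
  length-Fv zero    []          = refl
  length-Fv zero    (b ∷ [])    = refl
  length-Fv zero    (b ∷ t ∷ M) = refl
  length-Fv (suc j) []          = refl
  length-Fv (suc j) (b ∷ M)     = cong suc (length-Fv j M)

  -- All that later arguments use of a composite of horizontal operators. By `py`, equally many
  -- raising steps are needed before and after `g`, so that complete collapses commute with `g` as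
  -- well.
  record Hor (g : Config n → Config n) : Set where
    field
      ev : ∀ j M → Ev j (g M) ≡ g (Ev j M)
      px : ∀ j M → vx j (g M) ≡ vx j M
      py : ∀ j M → vy j (g M) ≡ vy j M
      sz : ∀ M → sizes (g M) ≡ sizes M
    fv : ∀ j M → Fv j (g M) ≡ g (Fv j M)
    fv = Fv-comm g ev px py

  Hor-id : Hor id
  Hor-id = record { ev = λ _ _ → refl ; px = λ _ _ → refl ; py = λ _ _ → refl ; sz = λ _ → refl }

  Hor-Eh : ∀ c → Hor (Eh c)
  Hor-Eh c = record { ev = Ev-Eh c ; px = vx-Eh c ; py = vy-Eh c ; sz = sizes-Eh c }

  Hor-Fh : ∀ c → Hor (Fh c)
  Hor-Fh c = record { ev = Ev-Fh c ; px = vx-Fh c ; py = vy-Fh c ; sz = sizes-Fh c }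

  Hor-∘ : ∀ {g h} → Hor g → Hor h → Hor (g ∘ h)
  Hor-∘ {g} {h} G H = record
    { ev = λ j M → trans (G.ev j (h M)) (cong g (H.ev j M))
    ; px = λ j M → trans (G.px j (h M)) (H.px j M)
    ; py = λ j M → trans (G.py j (h M)) (H.py j M)
    ; sz = λ M → trans (G.sz (h M)) (H.sz M) }
    where
    module G = Hor G
    module H = Hor H

  -- `fh` and `px` allow an induction along `Fh` down to the configurations that no `Fh` moves;
  -- there `col` and `len` determine a highest weight image.
  record Ver (v : Config n → Config n) : Set where
    field
      fh  : ∀ c M → Fh c (v M) ≡ v (Fh c M)
      px  : ∀ c M → hx c (v M) ≡ hx c M
      col : ∀ M → cs (v M) ≡ cs M
      len : ∀ M → length (v M) ≡ length M

  Ver-id : Ver id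
  Ver-id = record { fh = λ _ _ → refl ; px = λ _ _ → refl ; col = λ _ → refl ; len = λ _ → refl }

  Ver-Ev : ∀ j → Ver (Ev j)
  Ver-Ev j = record { fh = λ c M → sym (Ev-Fh c j M) ; px = λ c → hx-Ev c j ; col = cs-Ev j ; len = length-Ev j }

  Ver-Fv : ∀ j → Ver (Fv j)
  Ver-Fv j = record { fh = λ c M → sym (Hor.fv (Hor-Fh c) j M) ; px = λ c → hx-Fv c j ; col = cs-Fv j ; len = length-Fv j }

  Ver-∘ : ∀ {u v} → Ver u → Ver v → Ver (u ∘ v)
  Ver-∘ {u} {v} U V = record
    { fh  = λ c M → trans (U.fh c (v M)) (cong u (V.fh c M))
    ; px  = λ c M → trans (U.px c (v M)) (V.px c M)
    ; col = λ M → trans (U.col (v M)) (V.col M)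
    ; len = λ M → trans (U.len (v M)) (V.len M) }
    where
    module U = Ver U
    module V = Ver V

  -- The number of repetitions may depend on the configuration, as it does for collapses and
  -- reflections, provided that moves to the left do not change it.
  Ver-iter : ∀ {v} (k : Config n → ℕ) → (∀ c M → k (Fh c M) ≡ k M) → Ver v → Ver (λ M → iter (k M) v M)
  Ver-iter {v} k kh V = record
    { fh  = λ c M → sym (trans (cong (λ m → iter m v (Fh c M)) (kh c M)) (iter-comm v (Fh c) (λ x → sym (V.fh c x)) (k M) M))
    ; px  = λ c M → iter-inv v (hx c) (V.px c) (k M) M
    ; col = λ M → iter-inv v cs V.col (k M) M
    ; len = λ M → iter-inv v length V.len (k M) M }
    where module V = Ver V

  -- `HW` is the nonwrapping condition (`majM≡0⇒HW`, `HW⇒majM≡0`). `HH` says that no ball can be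
  -- moved to the left by the horizontal crystal.
  HW HH : Config n → Set
  HW M = ∀ j → vy j M ≡ 0
  HH M = ∀ c → hx c M ≡ 0

-- Highest weight elements: uniqueness and connectedness

-- This is the sum of the columns of the balls, counted from 0: each ball contributes 1 at every
-- position to its left.
wt : ∀ {n} → Row n → ℕ
wt []      = 0
wt (p ∷ r) = cnt r + wt r

wt-exch : ∀ {n} c (r : Row n) → letter c r ≡ cl → suc (wt (exch c r)) ≡ wt r
wt-exch zero    (false ∷ true ∷ r) _ = refl
wt-exch zero    (false ∷ false ∷ r) ()
wt-exch zero    (true ∷ true ∷ r)   ()
wt-exch zero    (true ∷ false ∷ r)  ()
wt-exch (suc c) (p ∷ r)            h rewrite cnt-exch c r =
  trans (sym (+-suc (cnt r) (wt (exch c r)))) (cong (cnt r +_) (wt-exch c r h))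

letter-≥ : ∀ {n} c (r : Row n) → n ≤ c → letter c r ≡ nu
letter-≥ c       []      _       = refl
letter-≥ (suc c) (p ∷ r) (s≤s h) = letter-≥ c r h

module _ {n : ℕ} where

  wts : Config n → ℕ
  wts []      = 0
  wts (r ∷ M) = wt r + wts M

  wts-Fh : ∀ c (M : Config n) → 0 < hx c M → suc (wts (Fh c M)) ≡ wts M
  wts-Fh c (r ∷ M) h with letter c r in le | hx c M in eq
  ... | cl | zero  = cong (_+ wts M) (wt-exch c r le)
  ... | cl | suc m = trans (sym (+-suc (wt r) _)) (cong (wt r +_) (wts-Fh c M (subst (0 <_) (sym eq) z<s)))
  ... | nu | m     = trans (sym (+-suc (wt r) _)) (cong (wt r +_) (wts-Fh c M (subst (0 <_) (sym eq) h)))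
  ... | op | suc (suc m) = trans (sym (+-suc (wt r) _)) (cong (wt r +_) (wts-Fh c M (subst (0 <_) (sym eq) z<s)))

  hx-≥ : ∀ c (M : Config n) → n ≤ c → hx c M ≡ 0
  hx-≥ c []      h = refl
  hx-≥ c (r ∷ M) h rewrite letter-≥ c r h = hx-≥ c M h

  hh-search : ∀ k (M : Config n) → (∃ λ c → 0 < hx c M) ⊎ (∀ c → c < k → hx c M ≡ 0)
  hh-search zero    M = inj₂ (λ _ ())
  hh-search (suc k) M with hh-search k M | zero⊎pos (hx k M)
  ... | inj₁ f | _      = inj₁ f
  ... | inj₂ _ | inj₂ p = inj₁ (k , p)
  ... | inj₂ g | inj₁ z = inj₂ λ c h → case m≤n⇒m<n∨m≡n (s≤s⁻¹ h) of λ where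
        (inj₁ l)    → g c l
        (inj₂ refl) → z

  -- Each move to the left lowers `wts`, the total of all column indices, by one. Columns from `n`
  -- on give only neutral letters, so finitely many `c` have to be searched.
  hor-ind : (P : Config n → Set) → (∀ M → HH M → P M) →
            (∀ M c → 0 < hx c M → P (Fh c M) → P M) → ∀ M → P M
  hor-ind P base step M = go M (<-wellFounded (wts M))
    where
    go : ∀ M → Acc _<_ (wts M) → P M
    go M (acc rs) with hh-search n M
    ... | inj₁ (c , p) = step M c p (go (Fh c M) (rs (≤-reflexive (wts-Fh c M p))))
    ... | inj₂ g       = base M λ c → case <-≤-connex c n of λ where
          (inj₁ l) → g c l
          (inj₂ l) → hx-≥ c M l

lj : ∀ n → ℕ → Row n
lj zero    k       = []
lj (suc n) zero    = false ∷ lj n 0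
lj (suc n) (suc k) = true ∷ lj n k

cnt-lj₀ : ∀ n → cnt (lj n 0) ≡ 0
cnt-lj₀ zero    = refl
cnt-lj₀ (suc n) = cnt-lj₀ n

no-cl⇒lj : ∀ {n} (r : Row n) → (∀ c → letter c r ≢ cl) → r ≡ lj n (cnt r)
no-cl⇒lj []                  h = refl
no-cl⇒lj (true ∷ r)          h = cong (true ∷_) (no-cl⇒lj r (h ∘ suc))
no-cl⇒lj (false ∷ [])        h = refl
no-cl⇒lj (false ∷ true ∷ r)  h = ⊥-elim (h 0 refl)
no-cl⇒lj (false ∷ false ∷ r) h with cnt r | no-cl⇒lj (false ∷ r) (h ∘ suc)
... | zero  | e = cong (false ∷_) e
... | suc k | e = contradiction (cong Vec.head e) λ ()

-- An `op` at `c` means that the justified block ends in column `c`. A ball at `c + 1` would then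
-- lie in a suffix where the dominating row is empty.
≼-lj-no-cl : ∀ {n} c k (t : Row n) → letter c (lj n k) ≡ op → t ≼ lj n k → letter c t ≢ cl
≼-lj-no-cl {suc (suc n)} zero (suc zero) (false ∷ true ∷ t) _ ((_ , h) , _) _ =
  case subst (suc (cnt t) ≤_) (cnt-lj₀ n) h of λ ()
≼-lj-no-cl zero (suc zero) (false ∷ false ∷ t) _ _ ()
≼-lj-no-cl zero (suc zero) (true ∷ false ∷ t)  _ _ ()
≼-lj-no-cl zero (suc zero) (true ∷ true ∷ t)   _ _ ()
≼-lj-no-cl {suc (suc _)} zero zero t () _
≼-lj-no-cl {suc (suc _)} zero (suc (suc k)) t () _
≼-lj-no-cl (suc c) zero    (p ∷ t) e (h , _) = ≼-lj-no-cl c 0 t e h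
≼-lj-no-cl (suc c) (suc k) (p ∷ t) e (h , _) = ≼-lj-no-cl c k t e h

≼-lj⇒⊑ : ∀ {n} k (t : Row n) → t ≼ lj n k → t ⊑ lj n k
≼-lj⇒⊑ k       []          _       = tt
≼-lj⇒⊑ {suc n} zero (true ∷ t) (_ , i) = case subst (suc (cnt t) ≤_) (cnt-lj₀ n) i of λ ()
≼-lj⇒⊑ zero    (false ∷ t) (h , _) = id , ≼-lj⇒⊑ 0 t h
≼-lj⇒⊑ (suc k) (q ∷ t)     (h , _) = (λ ()) , ≼-lj⇒⊑ k t h

ZeroOff : ∀ {m} → Row m → Vec ℕ m → Set
ZeroOff []      []      = ⊤
ZeroOff (p ∷ r) (k ∷ v) = (p ≡ false → k ≡ 0) × ZeroOff r v

ZeroOff-zeros : ∀ {m} (r : Row m) → ZeroOff r (Vec.replicate m 0)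
ZeroOff-zeros []      = tt
ZeroOff-zeros (p ∷ r) = (λ _ → refl) , ZeroOff-zeros r

ZeroOff-add : ∀ {m} (r t : Row m) v → t ⊑ r → ZeroOff r v → ZeroOff r (Vec.zipWith (λ p k → bit p + k) t v)
ZeroOff-add []      []      []      _       _         = tt
ZeroOff-add (p ∷ r) (q ∷ t) (k ∷ v) (h , i) (h′ , i′) =
  (λ e → cong₂ (λ a b → bit a + b) (h e) (h′ e)) , ZeroOff-add r t v i i′

-- The set `r` is recovered as the support of the sum, because the other summand vanishes off `r`.
zipWith-bit-cancel : ∀ {m} (r s : Row m) u v → ZeroOff r u → ZeroOff s v →
  Vec.zipWith (λ p k → bit p + k) r u ≡ Vec.zipWith (λ p k → bit p + k) s v → r ≡ s × u ≡ v
zipWith-bit-cancel []      []      []      []      _       _         _ = refl , refl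
zipWith-bit-cancel (p ∷ r) (q ∷ s) (k ∷ u) (l ∷ v) (h , i) (h′ , i′) e
  with zipWith-bit-cancel r s u v i i′ (Vec.∷-injectiveʳ e) | p | q | Vec.∷-injectiveˡ e
... | refl , refl | true  | true  | e′ = refl , cong (_∷ u) (suc-injective e′)
... | refl , refl | false | false | e′ = refl , cong (_∷ u) e′
... | refl , refl | true  | false | e′ = ⊥-elim (1+n≢0 (trans e′ (h′ refl)))
... | refl , refl | false | true  | e′ = ⊥-elim (1+n≢0 (trans (sym e′) (h refl)))

module _ {n : ℕ} where

  HW-tail : ∀ {r} {M : Config n} → HW (r ∷ M) → HW M
  HW-tail h j = h (suc j)

  HW-below : ∀ r (M : Config n) → HW (r ∷ M) → All (_≼ r) M
  HW-below r []      h = []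
  HW-below r (t ∷ M) h = t≼r ∷ All.map (λ {u} k → ≼-trans u t r k t≼r) (HW-below t M (HW-tail h))
    where
    t≼r : t ≼ r
    t≼r = uy≡0⇒≼ r t (h 0)

  no-cl⇒hx≡0 : ∀ c (M : Config n) → All (λ t → letter c t ≢ cl) M → hx c M ≡ 0
  no-cl⇒hx≡0 c []      []       = refl
  no-cl⇒hx≡0 c (r ∷ M) (h ∷ hs) with letter c r | hx c M | no-cl⇒hx≡0 c M hs
  ... | op | .0 | refl = refl
  ... | nu | .0 | refl = refl
  ... | cl | _  | _    = ⊥-elim (h refl)

  -- The bottom row gives the first letter of each word, and a ")" in first position is never
  -- matched.
  extremal-head : ∀ r (M : Config n) → HH (r ∷ M) → r ≡ lj n (cnt r)
  extremal-head r M hh = no-cl⇒lj r λ c e → 1+n≢0 (trans (cong (λ l → stepX l (hx c M)) (sym e)) (hh c))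

  -- Only an `op` in the bottom row could cancel an unmatched ")" from above. But then `c` is the
  -- end of its justified block, and the rows above, being dominated by it, have no ")" at `c`.
  extremal-tail : ∀ r (M : Config n) → HW (r ∷ M) → HH (r ∷ M) → HH M
  extremal-tail r M hw hh c with letter c r in le | hh c
  ... | nu | e = e
  ... | op | _ = no-cl⇒hx≡0 c M (All.map (λ {t} h → ≼-lj-no-cl c (cnt r) t
                   (trans (cong (letter c) (sym r≡)) le) (subst (t ≼_) r≡ h)) (HW-below r M hw))
    where r≡ = extremal-head r M hh

  extremal⇒lj : ∀ (M : Config n) → HW M → HH M → M ≡ map (lj n) (sizes M)
  extremal⇒lj []      _  _  = refl
  extremal⇒lj (r ∷ M) hw hh =
    cong₂ _∷_ (extremal-head r M hh) (extremal⇒lj M (HW-tail hw) (extremal-tail r M hw hh))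

  ZeroOff-cs : ∀ (r : Row n) M → All (_⊑ r) M → ZeroOff r (cs M)
  ZeroOff-cs r []      []       = ZeroOff-zeros r
  ZeroOff-cs r (t ∷ M) (h ∷ hs) = ZeroOff-add r t (cs M) h (ZeroOff-cs r M hs)

  -- In an extremal configuration the upper rows are subsets of the bottom row, so the bottom row is
  -- the support of the column sums and can be split off.
  extremal-unique : ∀ (M M′ : Config n) → HW M → HH M → HW M′ → HH M′ →
                    length M ≡ length M′ → cs M ≡ cs M′ → M ≡ M′
  extremal-unique []      []       _  _  _   _   _ _ = refl
  extremal-unique (r ∷ M) (s ∷ M′) hw hh hw′ hh′ l e
    with zipWith-bit-cancel r s (cs M) (cs M′) (off r M hw hh) (off s M′ hw′ hh′) e
    where
    off : ∀ r M → HW (r ∷ M) → HH (r ∷ M) → ZeroOff r (cs M)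
    off r M hw hh = ZeroOff-cs r M (All.map (λ {t} h → subst (t ⊑_) (sym r≡)
                      (≼-lj⇒⊑ (cnt r) t (subst (t ≼_) r≡ h))) (HW-below r M hw))
      where r≡ = extremal-head r M hh
  ... | refl , e′ = cong (r ∷_) (extremal-unique M M′ (HW-tail hw) (extremal-tail r M hw hh)
                                   (HW-tail hw′) (extremal-tail r M′ hw′ hh′) (suc-injective l) e′)

  -- A vertical component contains one highest weight element: after moving
  -- everything to the left by horizontal operators, which commute with the
  -- vertical ones, the element is determined by its column sums.
  hw-unique : ∀ {u v} → Ver u → Ver v → ∀ (M : Config n) → HW (u M) → HW (v M) → u M ≡ v M
  hw-unique {u} {v} U V = hor-ind (λ M → HW (u M) → HW (v M) → u M ≡ v M) base step
    where
    module U = Ver U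
    module V = Ver V
    base : ∀ M → HH M → HW (u M) → HW (v M) → u M ≡ v M
    base M hh hu hv = extremal-unique (u M) (v M) hu (λ c → trans (U.px c M) (hh c)) hv (λ c → trans (V.px c M) (hh c))
                        (trans (U.len M) (sym (V.len M))) (trans (U.col M) (sym (V.col M)))
    step : ∀ M c → 0 < hx c M → (HW (u (Fh c M)) → HW (v (Fh c M)) → u (Fh c M) ≡ v (Fh c M)) →
           HW (u M) → HW (v M) → u M ≡ v M
    step M c p ih hu hv = begin
      u M                ≡⟨ ActsHF.back (Fh-acts c (u M) (subst (0 <_) (sym (U.px c M)) p)) ⟨
      Eh c (Fh c (u M))  ≡⟨ cong (Eh c) (U.fh c M) ⟩
      Eh c (u (Fh c M))  ≡⟨ cong (Eh c) (ih (λ j → trans (cong (vy j) (sym (U.fh c M))) (trans (vy-Fh c j (u M)) (hu j)))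
                                            (λ j → trans (cong (vy j) (sym (V.fh c M))) (trans (vy-Fh c j (v M)) (hv j)))) ⟩
      Eh c (v (Fh c M))  ≡⟨ cong (Eh c) (V.fh c M) ⟨
      Eh c (Fh c (v M))  ≡⟨ ActsHF.back (Fh-acts c (v M) (subst (0 <_) (sym (V.px c M)) p)) ⟩
      v M ∎
      where open ≡-Reasoning

  -- Maps in both directions are recorded because `Eh` inverts `Fh` only at configurations where
  -- `Fh` acts, not as a function.
  record ToLJ (N : Config n) : Set where
    field
      {fwd bwd} : Config n → Config n
      fwdHor    : Hor fwd
      bwdHor    : Hor bwd
      fwd≡      : fwd N ≡ map (lj n) (sizes N)
      bwd≡      : bwd (map (lj n) (sizes N)) ≡ N

  toLJ : ∀ (N : Config n) → HW N → ToLJ N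
  toLJ = hor-ind (λ N → HW N → ToLJ N)
    (λ N hh hw → record { fwdHor = Hor-id ; bwdHor = Hor-id ; fwd≡ = extremal⇒lj N hw hh ; bwd≡ = sym (extremal⇒lj N hw hh) })
    (λ N c p ih hw → let open ToLJ (ih (λ j → trans (vy-Fh c j N) (hw j)))
                         e = cong (map (lj n)) (sizes-Fh c N) in record
       { fwdHor = Hor-∘ fwdHor (Hor-Fh c)
       ; bwdHor = Hor-∘ (Hor-Eh c) bwdHor
       ; fwd≡   = trans fwd≡ e
       ; bwd≡   = trans (cong (Eh c) (trans (cong bwd (sym e)) bwd≡)) (ActsHF.back (Fh-acts c N p)) })

  hw-connected : ∀ (N N′ : Config n) → HW N → HW N′ → sizes N ≡ sizes N′ → ∃ λ g → Hor g × g N ≡ N′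
  hw-connected N N′ h h′ e =
    bwd B ∘ fwd A , Hor-∘ (bwdHor B) (fwdHor A) ,
    trans (cong (bwd B) (trans (fwd≡ A) (cong (map (lj n)) e))) (bwd≡ B)
    where
    open ToLJ
    A = toLJ N h
    B = toLJ N′ h′

-- Complete collapses and the insertion of a row

-- Turns over all unmatched "(" at once. A single raising step does not change this outcome
-- (`S2-E2`), so it is the end of the iteration of `E2`.
S2 : ∀ {n} → Row n → Row n → Row n × Row n
S2 []      []      = [] , []
S2 (p ∷ b) (q ∷ t) =
  cons2 (pickE (bracket q p) (ux b t) q p) (pickE (bracket q p) (ux b t) p q) (S2 b t)

lower upper : ∀ {n} → Row n → Row n → Row n
lower b t = proj₁ (S2 b t)
upper b t = proj₂ (S2 b t)

S2-idle : ∀ {n} (b t : Row n) → uy b t ≡ 0 → S2 b t ≡ (b , t)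
S2-idle []          []          _ = refl
S2-idle (true ∷ b)  (true ∷ t)  h = cong (cons2 true true) (S2-idle b t h)
S2-idle (true ∷ b)  (false ∷ t) h = cong (cons2 true false) (S2-idle b t h)
S2-idle (false ∷ b) (false ∷ t) h = cong (cons2 false false) (S2-idle b t h)
S2-idle (false ∷ b) (true ∷ t)  h with ux b t
... | suc _ = cong (cons2 false true) (S2-idle b t h)

S2² : ∀ {n} → Row n × Row n → Row n × Row n
S2² w = S2 (proj₁ w) (proj₂ w)

S2-E2 : ∀ {n} (b t : Row n) → S2² (E2 b t) ≡ S2 b t
S2-E2 []          []          = refl
S2-E2 (true ∷ b)  (true ∷ t)  = cong (cons2 true true) (S2-E2 b t)
S2-E2 (true ∷ b)  (false ∷ t) = cong (cons2 true false) (S2-E2 b t)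
S2-E2 (false ∷ b) (false ∷ t) = cong (cons2 false false) (S2-E2 b t)
S2-E2 (false ∷ b) (true ∷ t)  with ux b t in eq
... | zero  = refl
... | suc m = begin
  S2 (false ∷ proj₁ (E2 b t)) (true ∷ proj₂ (E2 b t))
    ≡⟨ cong (λ z → cons2 (pickE op z true false) (pickE op z false true) (S2² (E2 b t))) (proj₂ x′) ⟩
  cons2 false true (S2² (E2 b t))
    ≡⟨ cong (cons2 false true) (S2-E2 b t) ⟩
  cons2 false true (S2 b t) ∎
  where
  open ≡-Reasoning
  x′ : ∃ λ k → ux² (E2 b t) ≡ suc k
  x′ with zero⊎pos (uy b t)
  ... | inj₁ h = m , trans (cong ux² (E2-idle b t h)) eq
  ... | inj₂ h = _ , Acts.xUp (E2-acts b t h)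

cnt-lower : ∀ {n} (b t : Row n) → cnt (lower b t) ≡ uy b t + cnt b
cnt-lower []          []          = refl
cnt-lower (true ∷ b)  (true ∷ t)  = trans (cong suc (cnt-lower b t)) (sym (+-suc (uy b t) (cnt b)))
cnt-lower (true ∷ b)  (false ∷ t) = trans (cong suc (cnt-lower b t)) (sym (+-suc (uy b t) (cnt b)))
cnt-lower (false ∷ b) (false ∷ t) = cnt-lower b t
cnt-lower (false ∷ b) (true ∷ t)  with ux b t
... | zero  = cong suc (cnt-lower b t)
... | suc _ = cnt-lower b t

cnt-upper : ∀ {n} (b t : Row n) → uy b t + cnt (upper b t) ≡ cnt t
cnt-upper []          []          = refl
cnt-upper (true ∷ b)  (true ∷ t)  = trans (+-suc (uy b t) _) (cong suc (cnt-upper b t))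
cnt-upper (true ∷ b)  (false ∷ t) = cnt-upper b t
cnt-upper (false ∷ b) (false ∷ t) = cnt-upper b t
cnt-upper (false ∷ b) (true ∷ t)  with ux b t
... | zero  = cong suc (cnt-upper b t)
... | suc _ = trans (+-suc (uy b t) _) (cong suc (cnt-upper b t))

ux+upper : ∀ {n} (b t : Row n) → ux b t + cnt (upper b t) ≡ cnt b
ux+upper b t = +-cancelˡ-≡ (uy b t) _ _ (begin
  uy b t + (ux b t + cnt (upper b t)) ≡⟨ +-assoc (uy b t) (ux b t) _ ⟨
  uy b t + ux b t + cnt (upper b t)   ≡⟨ cong (_+ cnt (upper b t)) (+-comm (uy b t) (ux b t)) ⟩
  ux b t + uy b t + cnt (upper b t)   ≡⟨ +-assoc (ux b t) (uy b t) _ ⟩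
  ux b t + (uy b t + cnt (upper b t)) ≡⟨ cong (ux b t +_) (cnt-upper b t) ⟩
  ux b t + cnt t                      ≡⟨ balance b t ⟨
  uy b t + cnt b                      ∎)
  where open ≡-Reasoning

upper≼ : ∀ {n} (b t : Row n) → upper b t ≼ b
upper≼ []      []      = tt
upper≼ (p ∷ b) (q ∷ t) = upper≼ b t ,
  subst (cnt (upper (p ∷ b) (q ∷ t)) ≤_) (ux+upper (p ∷ b) (q ∷ t)) (m≤n+m _ (ux (p ∷ b) (q ∷ t)))

≼lower : ∀ {n} (b t : Row n) → t ≼ lower b t
≼lower []      []      = tt
≼lower (p ∷ b) (q ∷ t) = ≼lower b t ,
  subst (cnt (q ∷ t) ≤_) (trans (sym (balance (p ∷ b) (q ∷ t))) (sym (cnt-lower (p ∷ b) (q ∷ t))))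
        (m≤n+m _ (ux (p ∷ b) (q ∷ t)))

⊑lower : ∀ {n} (b t : Row n) → b ⊑ lower b t
⊑lower []          []          = tt
⊑lower (true ∷ b)  (true ∷ t)  = id , ⊑lower b t
⊑lower (true ∷ b)  (false ∷ t) = id , ⊑lower b t
⊑lower (false ∷ b) (q ∷ t)     = (λ _ → refl) , ⊑lower b t

upper⊑ : ∀ {n} (b t : Row n) → upper b t ⊑ t
upper⊑ []          []          = tt
upper⊑ (true ∷ b)  (true ∷ t)  = id , upper⊑ b t
upper⊑ (true ∷ b)  (false ∷ t) = id , upper⊑ b t
upper⊑ (false ∷ b) (false ∷ t) = id , upper⊑ b t
upper⊑ (false ∷ b) (true ∷ t)  = (λ ()) , upper⊑ b t

stepY-elim : ∀ (P : ℕ → Set) l x {y} → (l ≡ op → x ≡ 0 → P (suc y)) → P y → P (stepY l x y)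
stepY-elim P op zero    f g = f refl refl
stepY-elim P op (suc x) f g = g
stepY-elim P cl x       f g = g
stepY-elim P nu x       f g = g

bracket-op : ∀ q p → bracket q p ≡ op → q ≡ true × p ≡ false
bracket-op true  false _ = refl , refl
bracket-op true  true  ()
bracket-op false true  ()
bracket-op false false ()

-- Nothing of `b` is unmatched above `a`, and each ball added to the upper row creates at most one
-- more unmatched "(". At an unmatched head the estimate comes from `balance` rather than from the
-- induction.
uy-bound : ∀ {n} (a b b⁺ : Row n) → b ≼ a → b ⊑ b⁺ → uy a b⁺ + cnt b ≤ cnt b⁺
uy-bound []      []      []        _       _         = z≤n
uy-bound (p ∷ a) (q ∷ b) (q⁺ ∷ b⁺) (h , i) (h′ , i′) =
  stepY-elim (λ y → y + (bit q + cnt b) ≤ bit q⁺ + cnt b⁺) (bracket q⁺ p) (ux a b⁺) opens rest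
  where
  open ≤-Reasoning
  rest : uy a b⁺ + (bit q + cnt b) ≤ bit q⁺ + cnt b⁺
  rest = begin
    uy a b⁺ + (bit q + cnt b) ≡⟨ +-assoc (uy a b⁺) (bit q) (cnt b) ⟨
    uy a b⁺ + bit q + cnt b   ≡⟨ cong (_+ cnt b) (+-comm (uy a b⁺) (bit q)) ⟩
    bit q + uy a b⁺ + cnt b   ≡⟨ +-assoc (bit q) (uy a b⁺) (cnt b) ⟩
    bit q + (uy a b⁺ + cnt b) ≤⟨ +-mono-≤ (bit-mono q⁺ q h′) (uy-bound a b b⁺ h i′) ⟩
    bit q⁺ + cnt b⁺           ∎
  opens : bracket q⁺ p ≡ op → ux a b⁺ ≡ 0 → suc (uy a b⁺) + (bit q + cnt b) ≤ bit q⁺ + cnt b⁺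
  opens e z with bracket-op q⁺ p e
  ... | refl , refl = s≤s (begin
    uy a b⁺ + (bit q + cnt b) ≤⟨ +-monoʳ-≤ (uy a b⁺) i ⟩
    uy a b⁺ + cnt a           ≡⟨ balance a b⁺ ⟩
    ux a b⁺ + cnt b⁺          ≡⟨ cong (_+ cnt b⁺) z ⟩
    cnt b⁺                    ∎)

-- The counterpart for removing balls from the lower row instead of adding them to the upper one.
uy-bound′ : ∀ {n} (b b⁻ c : Row n) → c ≼ b → b⁻ ⊑ b → uy b⁻ c + cnt b⁻ ≤ cnt b
uy-bound′ []      []        []      _       _         = z≤n
uy-bound′ (p ∷ b) (p⁻ ∷ b⁻) (q ∷ c) (h , i) (h′ , i′) =
  stepY-elim (λ y → y + (bit p⁻ + cnt b⁻) ≤ bit p + cnt b) (bracket q p⁻) (ux b⁻ c) opens rest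
  where
  open ≤-Reasoning
  rest : uy b⁻ c + (bit p⁻ + cnt b⁻) ≤ bit p + cnt b
  rest = begin
    uy b⁻ c + (bit p⁻ + cnt b⁻) ≡⟨ +-assoc (uy b⁻ c) (bit p⁻) (cnt b⁻) ⟨
    uy b⁻ c + bit p⁻ + cnt b⁻   ≡⟨ cong (_+ cnt b⁻) (+-comm (uy b⁻ c) (bit p⁻)) ⟩
    bit p⁻ + uy b⁻ c + cnt b⁻   ≡⟨ +-assoc (bit p⁻) (uy b⁻ c) (cnt b⁻) ⟩
    bit p⁻ + (uy b⁻ c + cnt b⁻) ≤⟨ +-mono-≤ (bit-mono p p⁻ h′) (uy-bound′ b b⁻ c h i′) ⟩
    bit p + cnt b               ∎
  opens : bracket q p⁻ ≡ op → ux b⁻ c ≡ 0 → suc (uy b⁻ c) + (bit p⁻ + cnt b⁻) ≤ bit p + cnt b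
  opens e z with bracket-op q p⁻ e
  ... | refl , refl = begin
    suc (uy b⁻ c + cnt b⁻) ≡⟨ cong suc (trans (balance b⁻ c) (cong (_+ cnt c) z)) ⟩
    suc (cnt c)            ≤⟨ i ⟩
    bit p + cnt b          ∎

-- Applied to every suffix, `uy-bound` says that the collapse takes away no more balls than `b⁺` has
-- in excess of `b`.
≼upper : ∀ {n} (a b b⁺ : Row n) → b ≼ a → b ⊑ b⁺ → b ≼ upper a b⁺
≼upper []      []      []        _ _ = tt
≼upper (p ∷ a) (q ∷ b) (q⁺ ∷ b⁺) h i =
  ≼upper a b b⁺ (proj₁ h) (proj₂ i) ,
  +-cancelˡ-≤ (uy (p ∷ a) (q⁺ ∷ b⁺)) _ _
    (≤-trans (uy-bound (p ∷ a) (q ∷ b) (q⁺ ∷ b⁺) h i) (≤-reflexive (sym (cnt-upper (p ∷ a) (q⁺ ∷ b⁺)))))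

lower≼ : ∀ {n} (b b⁻ c : Row n) → c ≼ b → b⁻ ⊑ b → lower b⁻ c ≼ b
lower≼ []      []        []      _ _ = tt
lower≼ (p ∷ b) (p⁻ ∷ b⁻) (q ∷ c) h i =
  lower≼ b b⁻ c (proj₁ h) (proj₂ i) ,
  ≤-trans (≤-reflexive (cnt-lower (p⁻ ∷ b⁻) (q ∷ c))) (uy-bound′ (p ∷ b) (p⁻ ∷ b⁻) (q ∷ c) h i)

module _ {n : ℕ} where

  vy-[] : ∀ j → vy {n} j [] ≡ 0
  vy-[] zero    = refl
  vy-[] (suc j) = refl

  HW-one : ∀ (r : Row n) → HW (r ∷ [])
  HW-one r zero    = refl
  HW-one r (suc j) = vy-[] j

  Sv : ℕ → Config n → Config n
  Sv zero    (b ∷ t ∷ M) = consC (S2 b t) M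
  Sv (suc j) (b ∷ M)     = b ∷ Sv j M
  Sv _       M           = M

  Sv-idle : ∀ j M → vy j M ≡ 0 → Sv j M ≡ M
  Sv-idle zero    []          h = refl
  Sv-idle zero    (b ∷ [])    h = refl
  Sv-idle zero    (b ∷ t ∷ M) h = cong (λ w → consC w M) (S2-idle b t h)
  Sv-idle (suc j) []          h = refl
  Sv-idle (suc j) (b ∷ M)     h = cong (b ∷_) (Sv-idle j M h)

  Sv-Ev : ∀ j M → Sv j (Ev j M) ≡ Sv j M
  Sv-Ev zero    []          = refl
  Sv-Ev zero    (b ∷ [])    = refl
  Sv-Ev zero    (b ∷ t ∷ M) = cong (λ w → consC w M) (S2-E2 b t)
  Sv-Ev (suc j) []          = refl
  Sv-Ev (suc j) (b ∷ M)     = cong (b ∷_) (Sv-Ev j M)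

  iter-Ev≡Sv : ∀ j k M → vy j M ≤ k → iter k (Ev j) M ≡ Sv j M
  iter-Ev≡Sv j zero    M h = sym (Sv-idle j M (n≤0⇒n≡0 h))
  iter-Ev≡Sv j (suc k) M h with zero⊎pos (vy j M)
  ... | inj₁ z = trans (cong (iter k (Ev j)) (Ev-idle j M z)) (iter-Ev≡Sv j k M (≤-trans (≤-reflexive z) z≤n))
  ... | inj₂ p = trans (iter-Ev≡Sv j k (Ev j M) (s≤s⁻¹ (≤-trans (≤-reflexive (vy-Ev j M p)) h))) (Sv-Ev j M)

  iter-Fv-Sv : ∀ j k M → vy j M ≡ k → iter k (Fv j) (Sv j M) ≡ M
  iter-Fv-Sv j zero    M h = Sv-idle j M h
  iter-Fv-Sv j (suc k) M h = begin
    iter k (Fv j) (Fv j (Sv j M))        ≡⟨ iter-comm (Fv j) (Fv j) (λ _ → refl) k (Sv j M) ⟩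
    Fv j (iter k (Fv j) (Sv j M))        ≡⟨ cong (Fv j ∘ iter k (Fv j)) (Sv-Ev j M) ⟨
    Fv j (iter k (Fv j) (Sv j (Ev j M))) ≡⟨ cong (Fv j) (iter-Fv-Sv j k (Ev j M) (suc-injective (trans (vy-Ev j M p) h))) ⟩
    Fv j (Ev j M)                        ≡⟨ Fv∘Ev j M p ⟩
    M                                    ∎
    where
    open ≡-Reasoning
    p : 0 < vy j M
    p = subst (0 <_) (sym h) z<s

  Sv-hor : ∀ {g} → Hor g → ∀ j M → Sv j (g M) ≡ g (Sv j M)
  Sv-hor {g} G j M = begin
    Sv j (g M)                  ≡⟨ iter-Ev≡Sv j (vy j M) (g M) (≤-reflexive (Hor.py G j M)) ⟨
    iter (vy j M) (Ev j) (g M)  ≡⟨ iter-comm (Ev j) g (Hor.ev G j) (vy j M) M ⟩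
    g (iter (vy j M) (Ev j) M)  ≡⟨ cong g (iter-Ev≡Sv j (vy j M) M ≤-refl) ⟩
    g (Sv j M)                  ∎
    where open ≡-Reasoning

  Ver-≗ : ∀ {u v : Config n → Config n} → (∀ M → u M ≡ v M) → Ver u → Ver v
  Ver-≗ {u} {v} e U = record
    { fh  = λ c M → trans (cong (Fh c) (sym (e M))) (trans (U.fh c M) (e (Fh c M)))
    ; px  = λ c M → trans (cong (hx c) (sym (e M))) (U.px c M)
    ; col = λ M → trans (cong cs (sym (e M))) (U.col M)
    ; len = λ M → trans (cong length (sym (e M))) (U.len M) }
    where module U = Ver U

  Ver-Sv : ∀ j → Ver (Sv j)
  Ver-Sv j = Ver-≗ (λ M → iter-Ev≡Sv j (vy j M) M ≤-refl) (Ver-iter (vy j) (λ c → vy-Fh c j) (Ver-Ev j))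

  -- appD k performs the collapses at k - 1, …, 0, in this order.
  appD : ℕ → Config n → Config n
  appD zero    M       = M
  appD (suc k) []      = []
  appD (suc k) (r ∷ M) = Sv 0 (r ∷ appD k M)

  headLe : Config n → Row n → Set
  headLe []      r = ⊤
  headLe (t ∷ M) r = t ≼ r

  -- The row sizes before and after inserting the row k into the rows
  -- 0, …, k - 1 differ by a horizontal strip.
  Strip : ℕ → Config n → Config n → Set
  Strip k       []       []       = ⊤
  Strip zero    (o ∷ os) (m ∷ ms) = os ≡ ms
  Strip (suc k) (o ∷ os) (m ∷ ms) = cnt o ≤ cnt m × headLe ms o × Strip k os ms
  Strip k       _        _        = ⊥

  HW< : ℕ → Config n → Set
  HW< k M = ∀ j → j < k → vy j M ≡ 0

  record Inserted (k : ℕ) (r : Row n) (M : Config n) : Set where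
    constructor inserted
    field
      {r′}  : Row n
      {M′}  : Config n
      eq    : appD k (r ∷ M) ≡ r′ ∷ M′
      grow  : r ⊑ r′
      hw    : HW< k (r′ ∷ M′)
      strp  : Strip k (r ∷ M) (r′ ∷ M′)

  -- Induction on the height of the new row. The collapses higher up enlarge the row `s` above `r`
  -- to `s′`. The old `s` then interlaces: the row left in its place after the collapse with `r`
  -- dominates `s`, and `s` dominates the new row above that. This gives both the highest weight
  -- property and the horizontal strip.
  insert-hw : ∀ k r M → HW< (pred k) (r ∷ M) → Inserted k r M
  insert-hw zero    r M       h = inserted refl (⊑-refl r) (λ _ ()) refl
  insert-hw (suc k) r []      h = inserted (cong (λ N → Sv 0 (r ∷ N)) (appD-[] k)) (⊑-refl r) (λ j _ → HW-one r j) (≤-refl , tt , strip[] k)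
    where
    appD-[] : ∀ k → appD k [] ≡ []
    appD-[] zero    = refl
    appD-[] (suc k) = refl
    strip[] : ∀ k → Strip k [] []
    strip[] zero    = tt
    strip[] (suc k) = tt
  insert-hw (suc zero) r (s ∷ M) h = inserted refl (⊑lower r s)
    (λ { zero _ → ≼⇒uy≡0 (lower r s) (upper r s) (≼-trans (upper r s) r (lower r s) (upper≼ r s) (⊑⇒≼ r (lower r s) (⊑lower r s)))
       ; (suc _) (s≤s ()) })
    (≼-cnt r (lower r s) (⊑⇒≼ r (lower r s) (⊑lower r s)) , upper≼ r s , refl)
  insert-hw (suc (suc k)) r (s ∷ M) h with insert-hw (suc k) s M (λ j l → h (suc j) (s<s l))
  ... | inserted {s′} {M′} eq grow hw (_ , le , st) =
    inserted (cong (λ N → Sv 0 (r ∷ N)) eq) (⊑lower r s′) hw′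
      (≼-cnt r (lower r s′) r≼ , upper≼ r s′ , ≼-cnt s (upper r s′) s≼ , le , st)
    where
    r≼ : r ≼ lower r s′
    r≼ = ⊑⇒≼ r (lower r s′) (⊑lower r s′)
    s≼ : s ≼ upper r s′
    s≼ = ≼upper r s s′ (uy≡0⇒≼ r s (h 0 z<s)) grow
    next : ∀ (N : Config n) → headLe N s → vy 0 (upper r s′ ∷ N) ≡ 0
    next []      _ = refl
    next (t ∷ N) l = ≼⇒uy≡0 (upper r s′) t (≼-trans t s (upper r s′) l s≼)
    hw′ : HW< (suc (suc k)) (lower r s′ ∷ upper r s′ ∷ M′)
    hw′ zero          _       = ≼⇒uy≡0 (lower r s′) (upper r s′) (≼-trans (upper r s′) r (lower r s′) (upper≼ r s′) r≼)
    hw′ (suc zero)    _       = next M′ le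
    hw′ (suc (suc j)) (s≤s l) = hw (suc j) l

  -- collapseUp k performs the collapses at 0, 1, …, k - 1, in this order.
  collapseUp : ℕ → Config n → Config n
  collapseUp zero    M = M
  collapseUp (suc k) M = Sv k (collapseUp k M)

  collapseUp-cons : ∀ k r b M → collapseUp (suc k) (r ∷ b ∷ M) ≡ lower r b ∷ collapseUp k (upper r b ∷ M)
  collapseUp-cons zero    r b M = refl
  collapseUp-cons (suc k) r b M = cong (Sv (suc k)) (collapseUp-cons k r b M)

  collapseUp-one : ∀ k r → collapseUp k (r ∷ []) ≡ r ∷ []
  collapseUp-one zero    r = refl
  collapseUp-one (suc k) r = trans (cong (Sv k) (collapseUp-one k r)) (Sv-one k)
    where
    Sv-one : ∀ k → Sv k (r ∷ []) ≡ r ∷ []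
    Sv-one zero          = refl
    Sv-one (suc zero)    = refl
    Sv-one (suc (suc k)) = refl

  -- `b⁻` is what the row below has left of `b`. The bottom row of the result stays dominated by the
  -- old `b`, and this is what the row below needs in order to dominate it; the old rows again
  -- interlace with the new ones.
  collapseUp-hw′ : ∀ k b b⁻ M → HW (b ∷ M) → b⁻ ⊑ b → length M ≤ k →
                   HW (collapseUp k (b⁻ ∷ M)) × headLe (collapseUp k (b⁻ ∷ M)) b
  collapseUp-hw′ k b b⁻ [] hw i l =
    subst (λ N → HW N × headLe N b) (sym (collapseUp-one k b⁻)) (HW-one b⁻ , ⊑⇒≼ b⁻ b i)
  collapseUp-hw′ (suc k) b b⁻ (c ∷ M) hw i (s≤s l) with collapseUp-hw′ k c (upper b⁻ c) M (HW-tail hw) (upper⊑ b⁻ c) l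
  ... | hw′ , le = subst (λ N → HW N × headLe N b) (sym (collapseUp-cons k b⁻ c M))
                     (all₀ (collapseUp k (upper b⁻ c ∷ M)) hw′ le , lower≼ b b⁻ c (uy≡0⇒≼ b c (hw 0)) i)
    where
    all₀ : ∀ N → HW N → headLe N c → HW (lower b⁻ c ∷ N)
    all₀ []      h _ zero    = refl
    all₀ (t ∷ N) h l zero    = ≼⇒uy≡0 (lower b⁻ c) t (≼-trans t c (lower b⁻ c) l (≼lower b⁻ c))
    all₀ N       h _ (suc j) = h j

  collapseUp-hw : ∀ k r M → HW M → length M ≤ k → HW (collapseUp k (r ∷ M))
  collapseUp-hw k r [] hw l = subst HW (sym (collapseUp-one k r)) (HW-one r)
  collapseUp-hw (suc k) r (b ∷ M) hw (s≤s l) with collapseUp-hw′ k b (upper r b) M hw (upper⊑ r b) l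
  ... | hw′ , le = subst HW (sym (collapseUp-cons k r b M)) (all₀ (collapseUp k (upper r b ∷ M)) hw′ le)
    where
    all₀ : ∀ N → HW N → headLe N b → HW (lower r b ∷ N)
    all₀ []      h _ zero    = refl
    all₀ (t ∷ N) h l zero    = ≼⇒uy≡0 (lower r b) t (≼-trans t b (lower r b) l (≼lower r b))
    all₀ N       h _ (suc j) = h j

  Ver-collapseUp : ∀ k → Ver (collapseUp k)
  Ver-collapseUp zero    = Ver-id
  Ver-collapseUp (suc k) = Ver-∘ (Ver-Sv k) (Ver-collapseUp k)

  collapseUp-hor : ∀ {g} → Hor g → ∀ k M → collapseUp k (g M) ≡ g (collapseUp k M)
  collapseUp-hor G zero    M = refl
  collapseUp-hor G (suc k) M = trans (cong (Sv k) (collapseUp-hor G k M)) (Sv-hor G k (collapseUp k M))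

-- Lowering operators as queues, and the labels of a nonwrapping queue

-- serve q b t : the balls of b matched from the left by q waiting balls and
-- the balls of t (a queue with arrivals t and services b).

hit : Bool → ℕ → Bool
hit true  (suc _) = true
hit true  zero    = false
hit false _       = false

left : Bool → ℕ → ℕ
left true  q = pred q
left false q = q

serve : ∀ {n} → ℕ → Row n → Row n → Row n
serve q []      []      = []
serve q (p ∷ b) (s ∷ t) = hit p (bit s + q) ∷ serve (left p (bit s + q)) b t

diff : ∀ {n} → Row n → Row n → ℕ
diff []      []      = 0
diff (a ∷ A) (s ∷ S) = bit (s ∧ not a) + diff A S

-- removeLast A S removes from S its last element outside A.
removeLast : ∀ {n} → Row n → Row n → Row n
removeLast []      []      = []
removeLast (a ∷ A) (s ∷ S) = pickE op (diff A S) ((s ∧ a) ∷ S) (s ∷ removeLast A S)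

-- With an empty start a service is idle exactly at an unmatched ")"; `q` waiting balls act as `q`
-- further "(" in front of the word.
diff-serve : ∀ {n} q (b t : Row n) → diff (serve q b t) b ≡ ux b t ∸ q
diff-serve q       []          []          = sym (0∸n≡0 q)
diff-serve q       (true ∷ b)  (true ∷ t)  = diff-serve q b t
diff-serve zero    (true ∷ b)  (false ∷ t) = cong suc (diff-serve 0 b t)
diff-serve (suc q) (true ∷ b)  (false ∷ t) = diff-serve q b t
diff-serve q       (false ∷ b) (false ∷ t) = diff-serve q b t
diff-serve q       (false ∷ b) (true ∷ t)  = trans (diff-serve (suc q) b t) (lem (ux b t))
  where
  lem : ∀ m → m ∸ suc q ≡ pred m ∸ q
  lem zero    = sym (0∸n≡0 q)
  lem (suc m) = refl

hit-⊑ : ∀ p q → p ≡ false → hit p q ≡ false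
hit-⊑ false q _ = refl

serve-⊑ : ∀ {n} q (b t : Row n) → serve q b t ⊑ b
serve-⊑ q []      []      = tt
serve-⊑ q (p ∷ b) (s ∷ t) = hit-⊑ p (bit s + q) , serve-⊑ (left p (bit s + q)) b t

diff≡0⇒≡ : ∀ {n} (A S : Row n) → A ⊑ S → diff A S ≡ 0 → A ≡ S
diff≡0⇒≡ []          []          _       _ = refl
diff≡0⇒≡ (true ∷ A)  (true ∷ S)  (_ , i) e = cong (true ∷_) (diff≡0⇒≡ A S i e)
diff≡0⇒≡ (false ∷ A) (false ∷ S) (_ , i) e = cong (false ∷_) (diff≡0⇒≡ A S i e)
diff≡0⇒≡ (true ∷ A)  (false ∷ S) (h , _) e = contradiction (h refl) λ ()

diff-self : ∀ {n} (A : Row n) → diff A A ≡ 0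
diff-self []          = refl
diff-self (true ∷ A)  = diff-self A
diff-self (false ∷ A) = diff-self A

removeLast-idle : ∀ {n} (A S : Row n) → diff A S ≡ 0 → removeLast A S ≡ S
removeLast-idle []      []      _ = refl
removeLast-idle (a ∷ A) (s ∷ S) e with diff A S | m+n≡0⇒n≡0 (bit (s ∧ not a)) e
... | .0 | refl = cong (_∷ S) (lem s a (m+n≡0⇒m≡0 (bit (s ∧ not a)) e))
  where
  lem : ∀ s a → bit (s ∧ not a) ≡ 0 → s ∧ a ≡ s
  lem true  true  _ = refl
  lem false a     _ = refl

removeLast-⊑ : ∀ {n} (A S : Row n) → removeLast A S ⊑ S
removeLast-⊑ []      []      = tt
removeLast-⊑ (a ∷ A) (s ∷ S) with diff A S
... | zero  = (λ { refl → refl }) , ⊑-refl S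
... | suc _ = id , removeLast-⊑ A S

⊑-removeLast : ∀ {n} (A S : Row n) → A ⊑ S → A ⊑ removeLast A S
⊑-removeLast []      []      _       = tt
⊑-removeLast (a ∷ A) (s ∷ S) (h , i) with diff A S
... | suc _ = h , ⊑-removeLast A S i
... | zero  = lem s a h , i
  where
  lem : ∀ s a → (s ≡ false → a ≡ false) → s ∧ a ≡ false → a ≡ false
  lem true  a h e = e
  lem false a h e = h refl

serve-full : ∀ {n} q (b t : Row n) → ux b t ≤ q → serve q b t ≡ b
serve-full q b t h = diff≡0⇒≡ (serve q b t) b (serve-⊑ q b t) (trans (diff-serve q b t) (m≤n⇒m∸n≡0 h))

pos⇒suc : ∀ {m} → 0 < m → ∃ λ k → m ≡ suc k
pos⇒suc {suc m} _ = m , refl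

-- The ball that moves is the last idle service. Every service behind it is busy, so the additional
-- arrival that it becomes changes nothing.
F2-serve : ∀ {n} q (b t : Row n) → q < ux b t →
           proj₁ (F2 b t) ≡ removeLast (serve q b t) b × serve q (proj₁ (F2 b t)) (proj₂ (F2 b t)) ≡ serve q b t
F2-serve q []          []          ()
F2-serve q (true ∷ b)  (true ∷ t)  h with F2-serve q b t h | pos⇒suc (m<n⇒0<n∸m h)
... | e , e′ | k , eq = trans (cong (true ∷_) e) (sym (pickE-op-suc (trans (diff-serve q b t) eq))) , cong (true ∷_) e′
F2-serve q (false ∷ b) (false ∷ t) h with F2-serve q b t h | pos⇒suc (m<n⇒0<n∸m h)
... | e , e′ | k , eq = trans (cong (false ∷_) e) (sym (pickE-op-suc (trans (diff-serve q b t) eq))) , cong (false ∷_) e′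
F2-serve zero (true ∷ b) (false ∷ t) h with ux b t in eq
... | zero  = sym (pickE-op-zero (trans (diff-serve 0 b t) eq)) ,
              cong (false ∷_) (trans (serve-full 1 b t (≤-trans (≤-reflexive eq) z≤n)) (sym (serve-full 0 b t (≤-reflexive eq))))
... | suc m with F2-serve 0 b t (subst (0 <_) (sym eq) z<s)
...   | e , e′ = trans (cong (true ∷_) e) (sym (pickE-op-suc (trans (diff-serve 0 b t) eq))) , cong (false ∷_) e′
F2-serve (suc q) (true ∷ b) (false ∷ t) (s≤s h) with ux b t in eq
... | suc m with F2-serve q b t (subst (q <_) (sym eq) h) | pos⇒suc (m<n⇒0<n∸m (subst (q <_) (sym eq) h))
...   | e , e′ | k , eq′ = trans (cong (true ∷_) e) (sym (pickE-op-suc (trans (diff-serve q b t) eq′))) , cong (true ∷_) e′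
F2-serve q (false ∷ b) (true ∷ t) h with ux b t in eq
... | suc (suc m) with F2-serve (suc q) b t (subst (suc q <_) (sym eq) (s<s h)) | pos⇒suc (m<n⇒0<n∸m (subst (suc q <_) (sym eq) (s<s h)))
...   | e , e′ | k , eq′ = trans (cong (false ∷_) e) (sym (pickE-op-suc (trans (diff-serve (suc q) b t) eq′))) , cong (false ∷_) e′

iter-F2 : ∀ {n} a (b t : Row n) →
          proj₁ (iter a F2² (b , t)) ≡ iter a (removeLast (serve 0 b t)) b
iter-F2 zero    b t = refl
iter-F2 (suc a) b t with zero⊎pos (ux b t)
... | inj₁ z rewrite F2-idle b t z | removeLast-idle (serve 0 b t) b (trans (diff-serve 0 b t) z) = iter-F2 a b t
... | inj₂ p with F2-serve 0 b t p
...   | e , e′ = trans (iter-F2 a (proj₁ (F2 b t)) (proj₂ (F2 b t)))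
                       (cong₂ (λ A S → iter a (removeLast A) S) e′ e)

-- All of q + t is eventually served.
Fit : ∀ {n} → ℕ → Row n → Row n → Set
Fit q b t = uy b t ≡ 0 × q ≤ ux b t

Fit-tail : ∀ {n} q p s (b t : Row n) → Fit q (p ∷ b) (s ∷ t) → Fit (left p (bit s + q)) b t
Fit-tail q true  true  b t (y , x) = y , x
Fit-tail q true  false b t (y , x) = y , ≤-trans (pred-mono-≤ x) ≤-refl
Fit-tail q false false b t (y , x) = y , x
Fit-tail q false true  b t (y , x) with ux b t
... | suc m = y , s≤s x

hit+left : ∀ p m → bit (hit p m) + left p m ≡ m
hit+left true  zero    = refl
hit+left true  (suc m) = refl
hit+left false m       = refl

left-mono : ∀ p {m m′} → m ≤ m′ → left p m ≤ left p m′
left-mono true  l = pred-mono-≤ l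
left-mono false l = l

cnt-serve : ∀ {n} q (b t : Row n) → Fit q b t → cnt (serve q b t) ≡ q + cnt t
cnt-serve q []      []      (_ , z≤n) = refl
cnt-serve q (p ∷ b) (s ∷ t) f         =
  trans (cong (bit (hit p (bit s + q)) +_) (cnt-serve (left p (bit s + q)) b t (Fit-tail q p s b t f)))
        (trans (sym (+-assoc (bit (hit p (bit s + q))) _ (cnt t)))
               (trans (cong (_+ cnt t) (hit+left p (bit s + q))) (trans (cong (_+ cnt t) (+-comm (bit s) q)) (+-assoc q (bit s) (cnt t)))))

serve-mono : ∀ {n} q q′ (b A S : Row n) → q ≤ q′ → A ⊑ S → serve q b A ⊑ serve q′ b S
serve-mono q q′ []      []      []      _ _       = tt
serve-mono q q′ (p ∷ b) (a ∷ A) (s ∷ S) l (h , i) = lem p l′ , serve-mono _ _ b A S (left-mono p l′) i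
  where
  l′ : bit a + q ≤ bit s + q′
  l′ = +-mono-≤ (bit-mono s a h) l
  lem : ∀ p {m m′} → m ≤ m′ → hit p m′ ≡ false → hit p m ≡ false
  lem true  z≤n _ = refl
  lem false _   _ = refl

diff+cnt : ∀ {n} (A S : Row n) → A ⊑ S → diff A S + cnt A ≡ cnt S
diff+cnt []          []          _       = refl
diff+cnt (true ∷ A)  (true ∷ S)  (_ , i) = trans (+-suc (diff A S) (cnt A)) (cong suc (diff+cnt A S i))
diff+cnt (false ∷ A) (true ∷ S)  (_ , i) = cong suc (diff+cnt A S i)
diff+cnt (false ∷ A) (false ∷ S) (_ , i) = diff+cnt A S i
diff+cnt (true ∷ A)  (false ∷ S) (h , _) = contradiction (h refl) λ ()

Fit-mono : ∀ {n} q q′ (b A S : Row n) → q ≤ q′ → A ⊑ S → Fit q′ b S → Fit q b A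
Fit-mono q q′ b A S l i (y , x) = y′ , ≤-trans l (≤-trans x (+-cancelʳ-≤ (cnt A) _ _ (begin
    ux b S + cnt A ≤⟨ +-monoʳ-≤ (ux b S) (≼-cnt A S (⊑⇒≼ A S i)) ⟩
    ux b S + cnt S ≡⟨ balance b S ⟨
    uy b S + cnt b ≡⟨ cong (_+ cnt b) (trans y (sym y′)) ⟩
    uy b A + cnt b ≡⟨ balance b A ⟩
    ux b A + cnt A ∎)))
  where
  open ≤-Reasoning
  y′ : uy b A ≡ 0
  y′ = ≼⇒uy≡0 b A (≼-trans A S b (⊑⇒≼ A S i) (uy≡0⇒≼ b S y))

diff-serves : ∀ {n} q q′ (b A S : Row n) → q ≤ q′ → A ⊑ S → Fit q′ b S → q + cnt A < q′ + cnt S →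
              ∃ λ k → diff (serve q b A) (serve q′ b S) ≡ suc k
diff-serves q q′ b A S l i f h = pos⇒suc (+-cancelʳ-< (q + cnt A) 0 _ (subst (q + cnt A <_) (sym (begin
    diff (serve q b A) (serve q′ b S) + (q + cnt A)
      ≡⟨ cong (diff (serve q b A) (serve q′ b S) +_) (cnt-serve q b A (Fit-mono q q′ b A S l i f)) ⟨
    diff (serve q b A) (serve q′ b S) + cnt (serve q b A)
      ≡⟨ diff+cnt (serve q b A) (serve q′ b S) (serve-mono q q′ b A S l i) ⟩
    cnt (serve q′ b S)
      ≡⟨ cnt-serve q′ b S f ⟩
    q′ + cnt S ∎)) h))
  where open ≡-Reasoning

-- The queues started with `q′` and `suc q′` differ until a service finds the first of them empty.
-- The queue started with `q` is empty there too and all three agree afterwards, so this service is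
-- the last one outside `serve q b S`.
serve-pred : ∀ {n} q q′ (b S : Row n) → q < suc q′ → Fit (suc q′) b S →
             removeLast (serve q b S) (serve (suc q′) b S) ≡ serve q′ b S
serve-pred q q′ []          []      l       (_ , ())
serve-pred q q′ (false ∷ b) (s ∷ S) l       f
  with diff-serves (bit s + q) (bit s + suc q′) b S S (+-monoʳ-≤ (bit s) (<⇒≤ l)) (⊑-refl S) (Fit-tail _ false s b S f)
         (+-monoˡ-< (cnt S) (+-monoʳ-< (bit s) l))
... | k , e = trans (pickE-op-suc e) (cong (false ∷_) (trans (cong (λ m → removeLast (serve (bit s + q) b S) (serve m b S)) (+-suc (bit s) q′))
                (serve-pred (bit s + q) (bit s + q′) b S (subst (bit s + q <_) (+-suc (bit s) q′) (+-monoʳ-< (bit s) l))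
                  (subst (λ m → Fit m b S) (+-suc (bit s) q′) (Fit-tail _ false s b S f)))))
serve-pred q       q′      (true ∷ b) (true ∷ S)  l       f
  with diff-serves q (suc q′) b S S (<⇒≤ l) (⊑-refl S) (Fit-tail _ true true b S f) (+-monoˡ-< (cnt S) l)
... | k , e = trans (pickE-op-suc e) (cong (true ∷_) (serve-pred q q′ b S l (Fit-tail _ true true b S f)))
serve-pred zero    zero    (true ∷ b) (false ∷ S) l       f = pickE-op-zero (diff-self (serve 0 b S))
serve-pred zero    (suc q′) (true ∷ b) (false ∷ S) l      f
  with diff-serves 0 (suc q′) b S S z≤n (⊑-refl S) (Fit-tail _ true false b S f) (+-monoˡ-< (cnt S) z<s)
... | k , e = trans (pickE-op-suc e) (cong (true ∷_) (serve-pred 0 q′ b S z<s (Fit-tail _ true false b S f)))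
serve-pred (suc q) (suc q′) (true ∷ b) (false ∷ S) (s≤s l) f
  with diff-serves q (suc q′) b S S (<⇒≤ l) (⊑-refl S) (Fit-tail _ true false b S f) (+-monoˡ-< (cnt S) l)
... | k , e = trans (pickE-op-suc e) (cong (true ∷_) (serve-pred q q′ b S l (Fit-tail _ true false b S f)))
serve-pred (suc q) zero     (true ∷ b) (false ∷ S) (s≤s ()) f

-- Both sides run in parallel up to the last element of `S` outside `A`. Behind it the arrivals
-- coincide, the removed one only shortens the queue by one ball, and `serve-pred` applies.
serve-removeLast⁺ : ∀ {n} q q′ (b A S : Row n) → q ≤ q′ → A ⊑ S → Fit q′ b S → 0 < diff A S →
                    removeLast (serve q b A) (serve q′ b S) ≡ serve q′ b (removeLast A S)
serve-removeLast⁺ q q′ []      []      []      _ _       _ ()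
serve-removeLast⁺ q q′ (p ∷ b) (a ∷ A) (s ∷ S) l (h , i) f d with diff A S in eq
... | suc m = trans (pickE-op-suc (proj₂ (diff-serves (left p (bit a + q)) (left p (bit s + q′)) b A S l′ i f′ lt)))
                    (cong (hit p (bit s + q′) ∷_)
                      (serve-removeLast⁺ (left p (bit a + q)) (left p (bit s + q′)) b A S l′ i f′ (subst (0 <_) (sym eq) z<s)))
  where
  l′ = left-mono p (+-mono-≤ (bit-mono s a h) l)
  f′ = Fit-tail q′ p s b S f
  lt : left p (bit a + q) + cnt A < left p (bit s + q′) + cnt S
  lt = +-mono-≤-< l′ (subst (cnt A <_) (diff+cnt A S i) (subst (λ z → cnt A < z + cnt A) (sym eq) (s≤s (m≤n+m (cnt A) m))))
... | zero with diff≡0⇒≡ A S i eq | s | a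
...   | refl | true | false = case-p p q q′ l f
  where
  case-p : ∀ p q q′ → q ≤ q′ → Fit q′ (p ∷ b) (true ∷ A) →
           pickE op (diff (serve (left p q) b A) (serve (left p (suc q′)) b A))
             ((hit p (suc q′) ∧ hit p q) ∷ serve (left p (suc q′)) b A)
             (hit p (suc q′) ∷ removeLast (serve (left p q) b A) (serve (left p (suc q′)) b A))
           ≡ hit p q′ ∷ serve (left p q′) b A
  case-p false q q′ l f =
    trans (pickE-op-suc (proj₂ (diff-serves q (suc q′) b A A (m≤n⇒m≤1+n l) (⊑-refl A) (Fit-tail q′ false true b A f) (+-monoˡ-< (cnt A) (s≤s l)))))
          (cong (false ∷_) (serve-pred q q′ b A (s≤s l) (Fit-tail q′ false true b A f)))
  case-p true zero zero l f = pickE-op-zero (diff-self (serve 0 b A))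
  case-p true zero (suc q′) l f =
    trans (pickE-op-suc (proj₂ (diff-serves 0 (suc q′) b A A z≤n (⊑-refl A) (Fit-tail (suc q′) true true b A f) (+-monoˡ-< (cnt A) z<s))))
          (cong (true ∷_) (serve-pred 0 q′ b A z<s (Fit-tail (suc q′) true true b A f)))
  case-p true (suc q) (suc q′) (s≤s l) f =
    trans (pickE-op-suc (proj₂ (diff-serves q (suc q′) b A A (m≤n⇒m≤1+n l) (⊑-refl A) (Fit-tail (suc q′) true true b A f) (+-monoˡ-< (cnt A) (s≤s l)))))
          (cong (true ∷_) (serve-pred q q′ b A (s≤s l) (Fit-tail (suc q′) true true b A f)))

serve-removeLast : ∀ {n} (b A S : Row n) → A ⊑ S → S ≼ b →
                   removeLast (serve 0 b A) (serve 0 b S) ≡ serve 0 b (removeLast A S)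
serve-removeLast b A S i l with zero⊎pos (diff A S)
... | inj₂ d = serve-removeLast⁺ 0 0 b A S z≤n i (≼⇒uy≡0 b S l , z≤n) d
... | inj₁ z with diff≡0⇒≡ A S i z
...   | refl = trans (removeLast-idle (serve 0 b A) (serve 0 b A) (diff-self (serve 0 b A))) (cong (serve 0 b) (sym (removeLast-idle A A z)))

iter-removeLast-⊑ : ∀ {n} a (A S : Row n) → iter a (removeLast A) S ⊑ S
iter-removeLast-⊑ zero    A S = ⊑-refl S
iter-removeLast-⊑ (suc a) A S = ⊑-trans _ _ S (iter-removeLast-⊑ a A (removeLast A S)) (removeLast-⊑ A S)

serve-iter : ∀ {n} a (b A S : Row n) → A ⊑ S → S ≼ b →
             iter a (removeLast (serve 0 b A)) (serve 0 b S) ≡ serve 0 b (iter a (removeLast A) S)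
serve-iter zero    b A S i l = refl
serve-iter (suc a) b A S i l =
  trans (cong (iter a (removeLast (serve 0 b A))) (serve-removeLast b A S i l))
        (serve-iter a b A (removeLast A S) (⊑-removeLast A S i)
          (≼-trans _ S b (⊑⇒≼ _ S (removeLast-⊑ A S)) l))

-- The FM labelling of a nonwrapping configuration: the k-th row of layN N
-- is the set of balls in the bottom row whose label exceeds k.

layN : ∀ {n} → Config n → List (Row n)
layN []      = []
layN (z ∷ Z) = z ∷ map (serve 0 z) (layN Z)

-- Repeated deletions among nested rows, in which a ball is chosen only by its place in the
-- left-to-right order (`keep-comp`). This is why the strong type of the collapse contains enough
-- information.
keep : ∀ {n} → List ℕ → List (Row n) → Row n
keep as       []       = Vec.replicate _ false
keep []       (f ∷ fs) = f
keep (a ∷ as) (f ∷ fs) = iter a (removeLast (keep as fs)) f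

-- Retraces `collapseUp` and retains the bottom row; the entries of the list are the numbers of
-- raising steps to be undone.
uncollapse : ∀ {n} → List ℕ → Config n → Row n
uncollapse as       []      = Vec.replicate _ false
uncollapse []       (z ∷ Z) = z
uncollapse (a ∷ as) (z ∷ Z) = proj₁ (iter a F2² (z , uncollapse as Z))

Nested : ∀ {n} → List (Row n) → Set
Nested = AllPairs (λ f g → g ⊑ f)

serve-zeros : ∀ {n} (b : Row n) → serve 0 b (Vec.replicate n false) ≡ Vec.replicate n false
serve-zeros []          = refl
serve-zeros (true ∷ b)  = cong (false ∷_) (serve-zeros b)
serve-zeros (false ∷ b) = cong (false ∷_) (serve-zeros b)

zeros-⊑ : ∀ {n} (r : Row n) → Vec.replicate n false ⊑ r
zeros-⊑ []      = tt
zeros-⊑ (p ∷ r) = (λ _ → refl) , zeros-⊑ r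

keep-⊑ : ∀ {n} as f (fs : List (Row n)) → All (_⊑ f) fs → keep as fs ⊑ f
keep-⊑ as       f []       _       = zeros-⊑ f
keep-⊑ []       f (g ∷ fs) (h ∷ _) = h
keep-⊑ (a ∷ as) f (g ∷ fs) (h ∷ _) = ⊑-trans _ g f (iter-removeLast-⊑ a (keep as fs) g) h

keep-serve : ∀ {n} as (b : Row n) fs → Nested fs → All (_≼ b) fs →
             keep as (map (serve 0 b) fs) ≡ serve 0 b (keep as fs)
keep-serve as       b []       _        _        = sym (serve-zeros b)
keep-serve []       b (f ∷ fs) _        _        = refl
keep-serve (a ∷ as) b (f ∷ fs) (n ∷ ns) (h ∷ hs) =
  trans (cong (λ A → iter a (removeLast A) (serve 0 b f)) (keep-serve as b fs ns hs))
        (serve-iter a b (keep as fs) f (keep-⊑ as f fs n) h)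

Nested-map-serve : ∀ {n} (b : Row n) fs → Nested fs → Nested (map (serve 0 b) fs)
Nested-map-serve b []       []       = []
Nested-map-serve b (f ∷ fs) (n ∷ ns) =
  All.map⁺ (All.map (λ {g} h → serve-mono 0 0 b g f z≤n h) n) ∷ Nested-map-serve b fs ns

layN-⊑ : ∀ {n} (Z : List (Row n)) (b : Row n) → All (_⊑ b) (map (serve 0 b) Z)
layN-⊑ Z b = All.map⁺ (All.universal (λ f → serve-⊑ 0 b f) Z)

layN-nested : ∀ {n} (Z : Config n) → Nested (layN Z)
layN-nested []      = []
layN-nested (z ∷ Z) = layN-⊑ (layN Z) z ∷ Nested-map-serve z (layN Z) (layN-nested Z)

layN-≼ : ∀ {n} (z : Row n) Z → HW (z ∷ Z) → All (_≼ z) (layN Z)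
layN-≼ z []      _  = []
layN-≼ z (y ∷ Z) hw = y≼z ∷ All.map (λ {f} h → ≼-trans f y z (⊑⇒≼ f y h) y≼z) (layN-⊑ (layN Z) y)
  where
  y≼z : y ≼ z
  y≼z = uy≡0⇒≼ z y (hw 0)

-- A lowering step deletes from the lower row the last ball not served from above (`iter-F2`).
-- Serving commutes with such deletions (`serve-iter`), so the deletions made in all rows can be
-- transported to the labelled bottom row.
uncollapse≡keep : ∀ {n} as (Z : Config n) → HW Z → uncollapse as Z ≡ keep as (layN Z)
uncollapse≡keep as       []      hw = refl
uncollapse≡keep []       (z ∷ Z) hw = refl
uncollapse≡keep (a ∷ as) (z ∷ Z) hw = begin
  proj₁ (iter a F2² (z , uncollapse as Z))
    ≡⟨ cong (λ r → proj₁ (iter a F2² (z , r))) (uncollapse≡keep as Z (HW-tail hw)) ⟩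
  proj₁ (iter a F2² (z , keep as (layN Z)))
    ≡⟨ iter-F2 a z (keep as (layN Z)) ⟩
  iter a (removeLast (serve 0 z (keep as (layN Z)))) z
    ≡⟨ cong (λ A → iter a (removeLast A) z) (keep-serve as z (layN Z) (layN-nested Z) (layN-≼ z Z hw)) ⟨
  iter a (removeLast (keep as (map (serve 0 z) (layN Z)))) z ∎
  where open ≡-Reasoning

consC-injective : ∀ {n} {w w′ : Row n × Row n} {M} → consC w M ≡ consC w′ M → w ≡ w′
consC-injective refl = refl

iter-F2-S2 : ∀ {n} (b t : Row n) → iter (uy b t) F2² (S2 b t) ≡ (b , t)
iter-F2-S2 b t = consC-injective (trans (sym (push (uy b t) (S2 b t))) (iter-Fv-Sv 0 (uy b t) (b ∷ t ∷ []) refl))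
  where
  push : ∀ k w → iter k (Fv 0) (consC w []) ≡ consC (iter k F2² w) []
  push zero    w = refl
  push (suc k) w = push k (F2² w)

upCounts : ∀ {n} → ℕ → Config n → List ℕ
upCounts k M = applyUpTo (λ j → vy j (collapseUp j M)) k

upCounts-cons : ∀ {n} k (r b : Row n) M → upCounts (suc k) (r ∷ b ∷ M) ≡ uy r b ∷ upCounts k (upper r b ∷ M)
upCounts-cons k r b M = cong (uy r b ∷_) (applyUpTo-cong (λ j → cong (vy (suc j)) (collapseUp-cons j r b M)) k)

uncollapse-collapseUp : ∀ {n} (r : Row n) M →
                        uncollapse (upCounts (length M) (r ∷ M)) (collapseUp (length M) (r ∷ M)) ≡ r
uncollapse-collapseUp r []      = refl
uncollapse-collapseUp r (b ∷ M) = begin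
  uncollapse (upCounts (suc (length M)) (r ∷ b ∷ M)) (collapseUp (suc (length M)) (r ∷ b ∷ M))
    ≡⟨ cong₂ uncollapse (upCounts-cons (length M) r b M) (collapseUp-cons (length M) r b M) ⟩
  proj₁ (iter (uy r b) F2² (lower r b , uncollapse (upCounts (length M) (upper r b ∷ M)) (collapseUp (length M) (upper r b ∷ M))))
    ≡⟨ cong (λ z → proj₁ (iter (uy r b) F2² (lower r b , z))) (uncollapse-collapseUp (upper r b) M) ⟩
  proj₁ (iter (uy r b) F2² (S2 r b))
    ≡⟨ cong proj₁ (iter-F2-S2 r b) ⟩
  r ∎
  where open ≡-Reasoning

bottom-row : ∀ {n} (r : Row n) M → HW M →
             r ≡ keep (upCounts (length M) (r ∷ M)) (layN (collapseUp (length M) (r ∷ M)))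
bottom-row r M hw =
  trans (sym (uncollapse-collapseUp r M))
        (uncollapse≡keep _ (collapseUp (length M) (r ∷ M)) (collapseUp-hw (length M) r M hw ≤-refl))

upCounts-hor : ∀ {n} {g : Config n → Config n} → Hor g → ∀ k M → upCounts k (g M) ≡ upCounts k M
upCounts-hor {g = g} G k M = go k id
  where
  go : ∀ k (f : ℕ → ℕ) → applyUpTo (λ j → vy (f j) (collapseUp (f j) (g M))) k ≡ applyUpTo (λ j → vy (f j) (collapseUp (f j) M)) k
  go zero    f = refl
  go (suc k) f = cong₂ _∷_ (trans (cong (vy (f 0)) (collapseUp-hor G (f 0) M)) (Hor.py G (f 0) (collapseUp (f 0) M))) (go k (f ∘ suc))

-- Layers, wraps and their behaviour under horizontal operators

-- The FM pairing of two rows is the Lascoux–Schützenberger reflection: it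
-- sends up the last unmatched balls of the lower row until the sizes of the
-- two rows are exchanged.

Tc : ∀ {n} → Row n → Row n → Row n
Tc b t = proj₁ (iter (cnt b ∸ cnt t) F2² (b , t))

-- Row `k` of the list is the set of bottom balls with FM label exceeding `k`, wrapping pairings
-- included; `layN` is the nonwrapping case.
layM : ∀ {n} → Config n → List (Row n)
layM []      = []
layM (r ∷ M) = r ∷ map (Tc r) (layM M)

-- A wrapping pairing from row `r` of a ball labelled `l` has weight `l - r + 1`, which is the
-- number of thresholds from `r` to `l`. Counting it once in each corresponding layer turns the
-- weighted sum into plain numbers of wraps.
majM : ∀ {n} → Config n → ℕ
majM []      = 0
majM (r ∷ M) = majM M + sum (map (uy r) (layM M))

headR : ∀ {n} → Config n → Row n
headR []      = Vec.replicate _ false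
headR (r ∷ M) = r

gap : ℕ → List ℕ → ℕ
gap zero    (a ∷ b ∷ l) = a ∸ b
gap (suc j) (a ∷ l)     = gap j l
gap _       _           = 0

down : ℕ → List ℕ
down zero    = []
down (suc k) = k ∷ down k

rhoOps : ℕ → ℕ → List ℕ
rhoOps i zero    = []
rhoOps i (suc k) = down i ++ rhoOps (suc i) k

module _ {n : ℕ} where

  sig : ℕ → Config n → Config n
  sig j M = iter (gap j (sizes M)) (Fv j) M

  sig-hor : ∀ {g} → Hor g → ∀ j M → sig j (g M) ≡ g (sig j M)
  sig-hor {g} G j M = trans (cong (λ s → iter (gap j s) (Fv j) (g M)) (Hor.sz G M)) (iter-comm (Fv j) g (Hor.fv G j) (gap j (sizes M)) M)

  Ver-sig : ∀ j → Ver (sig j)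
  Ver-sig j = Ver-iter (λ M → gap j (sizes M)) (λ c M → cong (gap j) (sizes-Fh c M)) (Ver-Fv j)

  sig-cons : ∀ j r M → sig (suc j) (r ∷ M) ≡ r ∷ sig j M
  sig-cons j r M = go (gap j (sizes M)) M
    where
    go : ∀ k M → iter k (Fv (suc j)) (r ∷ M) ≡ r ∷ iter k (Fv j) M
    go zero    M = refl
    go (suc k) M = go k (Fv j M)

  -- layC k performs the reflections at k - 1, …, 0, in this order.
  layC : ℕ → Config n → Config n
  layC zero    M = M
  layC (suc k) M = layC k (sig k M)

  wC : ℕ → Config n → ℕ
  wC zero    M = 0
  wC (suc k) M = vy k M + wC k (sig k M)

  layC-cons : ∀ k r M → layC (suc k) (r ∷ M) ≡ sig 0 (r ∷ layC k M)
  layC-cons zero    r M = refl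
  layC-cons (suc k) r M = trans (cong (layC (suc k)) (sig-cons k r M)) (layC-cons k r (sig k M))

  wC-cons : ∀ k r M → wC (suc k) (r ∷ M) ≡ wC k M + vy 0 (r ∷ layC k M)
  wC-cons zero    r M = +-identityʳ (vy 0 (r ∷ M))
  wC-cons (suc k) r M = begin
    vy k M + wC (suc k) (sig (suc k) (r ∷ M))                   ≡⟨ cong (λ N → vy k M + wC (suc k) N) (sig-cons k r M) ⟩
    vy k M + wC (suc k) (r ∷ sig k M)                           ≡⟨ cong (vy k M +_) (wC-cons k r (sig k M)) ⟩
    vy k M + (wC k (sig k M) + vy 0 (r ∷ layC k (sig k M)))     ≡⟨ +-assoc (vy k M) _ _ ⟨
    vy k M + wC k (sig k M) + vy 0 (r ∷ layC k (sig k M))       ∎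
    where open ≡-Reasoning

  layC-hor : ∀ {g} → Hor g → ∀ k M → layC k (g M) ≡ g (layC k M)
  layC-hor G zero    M = refl
  layC-hor G (suc k) M = trans (cong (layC k) (sig-hor G k M)) (layC-hor G k (sig k M))

  wC-hor : ∀ {g} → Hor g → ∀ k M → wC k (g M) ≡ wC k M
  wC-hor G zero    M = refl
  wC-hor G (suc k) M = cong₂ _+_ (Hor.py G k M) (trans (cong (wC k) (sig-hor G k M)) (wC-hor G k (sig k M)))

  Ver-layC : ∀ k → Ver (layC k)
  Ver-layC zero    = Ver-id
  Ver-layC (suc k) = Ver-∘ (Ver-layC k) (Ver-sig k)

  headR-sig₀ : ∀ r t M → headR (sig 0 (r ∷ t ∷ M)) ≡ Tc r t
  headR-sig₀ r t M = go (cnt r ∸ cnt t) (r , t)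
    where
    go : ∀ k w → headR (iter k (Fv 0) (consC w M)) ≡ proj₁ (iter k F2² w)
    go zero    w = refl
    go (suc k) w = go k (F2² w)

  nonempty : ∀ (M : Config n) {k} → k < length M → ∃ λ r → ∃ λ M′ → M ≡ r ∷ M′
  nonempty (r ∷ M) _ = r , M , refl

  -- Row `k`, counted from 0, consists of balls whose labels all exceed `k`. The reflections at
  -- `k - 1`, ..., 0 transport it to the bottom along the FM pairings.
  layM-layC : ∀ M → layM M ≡ applyUpTo (λ k → headR (layC k M)) (length M)
  layM-layC []      = refl
  layM-layC (r ∷ M) = cong (r ∷_) (trans (cong (map (Tc r)) (layM-layC M)) (trans (map-applyUpTo (λ k → headR (layC k M)) (Tc r) (length M)) (go (length M) id (λ k l → l))))
    where
    go : ∀ m (f : ℕ → ℕ) → (∀ k → k < m → f k < length M) →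
         applyUpTo (λ k → Tc r (headR (layC (f k) M))) m ≡ applyUpTo (λ k → headR (layC (suc (f k)) (r ∷ M))) m
    go zero    f h = refl
    go (suc m) f h = cong₂ _∷_ here′ (go m (f ∘ suc) (λ k l → h (suc k) (s<s l)))
      where
      here′ : Tc r (headR (layC (f 0) M)) ≡ headR (layC (suc (f 0)) (r ∷ M))
      here′ with nonempty (layC (f 0) M) (subst (f 0 <_) (sym (Ver.len (Ver-layC (f 0)) M)) (h 0 z<s))
      ... | t , M′ , e = sym (trans (cong headR (layC-cons (f 0) r M)) (trans (cong (λ N → headR (sig 0 (r ∷ N))) e)
                           (trans (headR-sig₀ r t M′) (cong (Tc r ∘ headR) (sym e)))))

  majM-wC : ∀ M → majM M ≡ sum (applyUpTo (λ k → wC k M) (length M))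
  majM-wC []      = refl
  majM-wC (r ∷ M) = trans (cong₂ _+_ (majM-wC M) (cong sum (trans (cong (map (uy r)) (layM-layC M)) (map-applyUpTo (λ k → headR (layC k M)) (uy r) (length M)))))
                          (go (length M) id (λ k l → l))
    where
    go : ∀ m (f : ℕ → ℕ) → (∀ k → k < m → f k < length M) →
         sum (applyUpTo (λ k → wC (f k) M) m) + sum (applyUpTo (λ k → uy r (headR (layC (f k) M))) m)
         ≡ sum (applyUpTo (λ k → wC (suc (f k)) (r ∷ M)) m)
    go zero    f h = refl
    go (suc m) f h = begin
      (a + A) + (b + B)   ≡⟨ interchange a A b B ⟩
      (a + b) + (A + B)   ≡⟨ cong₂ _+_ here′ (go m (f ∘ suc) (λ k l → h (suc k) (s<s l))) ⟩
      wC (suc (f 0)) (r ∷ M) + sum (applyUpTo (λ k → wC (suc (f (suc k))) (r ∷ M)) m) ∎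
      where
      open ≡-Reasoning
      a = wC (f 0) M
      A = sum (applyUpTo (λ k → wC (f (suc k)) M) m)
      b = uy r (headR (layC (f 0) M))
      B = sum (applyUpTo (λ k → uy r (headR (layC (f (suc k)) M))) m)
      here′ : a + b ≡ wC (suc (f 0)) (r ∷ M)
      here′ with nonempty (layC (f 0) M) (subst (f 0 <_) (sym (Ver.len (Ver-layC (f 0)) M)) (h 0 z<s))
      ... | t , M′ , e = sym (trans (wC-cons (f 0) r M) (cong (a +_) (trans (cong (λ N → vy 0 (r ∷ N)) e) (cong (uy r ∘ headR) (sym e)))))

  Hor-len : ∀ {g : Config n → Config n} → Hor g → ∀ M → length (g M) ≡ length M
  Hor-len {g} G M = trans (sym (length-map cnt (g M))) (trans (cong length (Hor.sz G M)) (length-map cnt M))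

  majM-hor : ∀ {g} → Hor g → ∀ M → majM (g M) ≡ majM M
  majM-hor {g} G M = begin
    majM (g M)                                                ≡⟨ majM-wC (g M) ⟩
    sum (applyUpTo (λ k → wC k (g M)) (length (g M)))         ≡⟨ cong (λ l → sum (applyUpTo (λ k → wC k (g M)) l)) (Hor-len G M) ⟩
    sum (applyUpTo (λ k → wC k (g M)) (length M))             ≡⟨ cong sum (go (length M) id) ⟩
    sum (applyUpTo (λ k → wC k M) (length M))                 ≡⟨ majM-wC M ⟨
    majM M                                                    ∎
    where
    open ≡-Reasoning
    go : ∀ m (f : ℕ → ℕ) → applyUpTo (λ k → wC (f k) (g M)) m ≡ applyUpTo (λ k → wC (f k) M) m
    go zero    f = refl
    go (suc m) f = cong₂ _∷_ (wC-hor G (f 0) M) (go m (f ∘ suc))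

  runS : List ℕ → Config n → Config n
  runS []       M = M
  runS (j ∷ js) M = runS js (Sv j M)

  runS-++ : ∀ is js M → runS (is ++ js) M ≡ runS js (runS is M)
  runS-++ []       js M = refl
  runS-++ (i ∷ is) js M = runS-++ is js (Sv i M)

  runS-cons : ∀ js r M → runS (map suc js) (r ∷ M) ≡ r ∷ runS js M
  runS-cons []       r M = refl
  runS-cons (j ∷ js) r M = runS-cons js r (Sv j M)

  runS-hor : ∀ {g} → Hor g → ∀ js M → runS js (g M) ≡ g (runS js M)
  runS-hor G []       M = refl
  runS-hor G (j ∷ js) M = trans (cong (runS js) (Sv-hor G j M)) (runS-hor G js (Sv j M))

  Ver-runS : ∀ js → Ver (runS js)
  Ver-runS []       = Ver-id
  Ver-runS (j ∷ js) = Ver-∘ (Ver-runS js) (Ver-Sv j)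

  runS-down : ∀ k M → runS (down k) M ≡ appD k M
  runS-down zero    M       = refl
  runS-down (suc k) []      = trans (cong (runS (down k)) (Sv-[] k)) (trans (runS-down k []) (appD-[] k))
    where
    Sv-[] : ∀ k → Sv {n} k [] ≡ []
    Sv-[] zero    = refl
    Sv-[] (suc k) = refl
    appD-[] : ∀ k → appD {n} k [] ≡ []
    appD-[] zero    = refl
    appD-[] (suc k) = refl
  runS-down (suc zero)    (r ∷ M) = refl
  runS-down (suc (suc k)) (r ∷ M) = trans (runS-down (suc k) (r ∷ Sv k M)) (cong (λ N → Sv 0 (r ∷ N)) (trans (sym (runS-down k (Sv k M))) (runS-down (suc k) M)))

  rhoM : Config n → Config n
  rhoM M = runS (rhoOps 1 (length M ∸ 1)) M

  down-hw : ∀ i M → HW< (pred i) M → HW< i (runS (down i) M)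
  down-hw i M h rewrite runS-down i M = go i M h
    where
    go : ∀ i M → HW< (pred i) M → HW< i (appD i M)
    go zero    []      h j ()
    go (suc i) []      h j _ = vy-[] j
    go i       (r ∷ M) h j l = let open Inserted (insert-hw i r M h) in trans (cong (vy j) eq) (hw j l)

  rhoOps-hw : ∀ k i M → HW< (pred i) M → HW< (pred (i + k)) (runS (rhoOps i k) M)
  rhoOps-hw zero    i M h rewrite +-identityʳ i = h
  rhoOps-hw (suc k) i M h rewrite runS-++ (down i) (rhoOps (suc i) k) M | +-suc i k =
    rhoOps-hw k (suc i) (runS (down i) M) (down-hw i M h)

  vy-≥ : ∀ j (M : Config n) → length M ≤ suc j → vy j M ≡ 0
  vy-≥ zero    []          _       = refl
  vy-≥ zero    (r ∷ [])    _       = refl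
  vy-≥ zero    (r ∷ t ∷ M) (s≤s ())
  vy-≥ (suc j) []          _       = refl
  vy-≥ (suc j) (r ∷ M)     (s≤s l) = vy-≥ j M l

  rhoM-hw : ∀ M → HW (rhoM M)
  rhoM-hw M j with <-≤-connex j (length M ∸ 1)
  ... | inj₁ l = rhoOps-hw (length M ∸ 1) 1 M (λ _ ()) j l
  ... | inj₂ l = vy-≥ j (rhoM M) (≤-trans (≤-reflexive (Ver.len (Ver-runS (rhoOps 1 (length M ∸ 1))) M)) (≤-trans (m≤n+m∸n (length M) 1) (s≤s l)))

  rhoM-hor : ∀ {g} → Hor g → ∀ M → rhoM (g M) ≡ g (rhoM M)
  rhoM-hor {g} G M = trans (cong (λ l → runS (rhoOps 1 (l ∸ 1)) (g M)) (Hor-len G M)) (runS-hor G (rhoOps 1 (length M ∸ 1)) M)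

  collapsed : ℕ → Config n → Config n
  collapsed k M = runS (map suc (rhoOps 1 (length M ∸ 1 ∸ 1))) (layC k M)

  exps : ℕ → Config n → List ℕ
  exps k M = upCounts (length M ∸ 1) (collapsed k M)

  exps-hor : ∀ {g} → Hor g → ∀ k M → exps k (g M) ≡ exps k M
  exps-hor {g} G k M =
    trans (cong (λ m → upCounts (m ∸ 1) (runS (map suc (rhoOps 1 (m ∸ 1 ∸ 1))) (layC k (g M)))) (Hor-len G M))
          (trans (cong (upCounts (length M ∸ 1)) (trans (cong (runS (map suc (rhoOps 1 (length M ∸ 1 ∸ 1)))) (layC-hor G k M)) (runS-hor G (map suc (rhoOps 1 (length M ∸ 1 ∸ 1))) (layC k M))))
                 (upCounts-hor G (length M ∸ 1) (collapsed k M)))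

  -- Two vertical routes lead from `M` to a highest weight configuration: the collapse itself, and
  -- the route that brings the layer to the bottom, collapses the rows above it and inserts it
  -- again. By `hw-unique` they end at the same place, and `bottom-row` reads the layer off the
  -- second one.
  layer-from-hw : ∀ k M → 0 < length M → headR (layC k M) ≡ keep (exps k M) (layN (rhoM M))
  layer-from-hw k M l with nonempty (layC k M) (subst (0 <_) (sym (Ver.len (Ver-layC k) M)) l)
  ... | r , X , eq = begin
    headR (layC k M)
      ≡⟨ cong headR eq ⟩
    r
      ≡⟨ bottom-row r X′ hwX′ ⟩
    keep (upCounts (length X′) (r ∷ X′)) (layN (collapseUp (length X′) (r ∷ X′)))
      ≡⟨ cong₂ (λ m Y → keep (upCounts m Y) (layN (collapseUp m Y))) len′ (sym col≡) ⟩
    keep (upCounts (length M ∸ 1) (collapsed k M)) (layN (collapseUp (length M ∸ 1) (collapsed k M)))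
      ≡⟨ cong (keep (exps k M) ∘ layN) same ⟩
    keep (exps k M) (layN (rhoM M)) ∎
    where
    open ≡-Reasoning
    X′ = rhoM X
    hwX′ : HW X′
    hwX′ = rhoM-hw X
    lenX : length X ≡ length M ∸ 1
    lenX = cong (_∸ 1) (trans (cong length (sym eq)) (Ver.len (Ver-layC k) M))
    len′ : length X′ ≡ length M ∸ 1
    len′ = trans (Ver.len (Ver-runS (rhoOps 1 (length X ∸ 1))) X) lenX
    col≡ : collapsed k M ≡ r ∷ X′
    col≡ = trans (cong (runS (map suc (rhoOps 1 (length M ∸ 1 ∸ 1)))) eq)
                 (trans (runS-cons (rhoOps 1 (length M ∸ 1 ∸ 1)) r X) (cong (λ m → r ∷ runS (rhoOps 1 (m ∸ 1)) X) (sym lenX)))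
    same : collapseUp (length M ∸ 1) (collapsed k M) ≡ rhoM M
    same = hw-unique
      (Ver-∘ (Ver-collapseUp (length M ∸ 1)) (Ver-∘ (Ver-runS (map suc (rhoOps 1 (length M ∸ 1 ∸ 1)))) (Ver-layC k)))
      (Ver-runS (rhoOps 1 (length M ∸ 1))) M
      (subst (λ Y → HW (collapseUp (length M ∸ 1) Y)) (sym col≡)
        (collapseUp-hw (length M ∸ 1) r X′ hwX′ (≤-reflexive len′)))
      (rhoM-hw M)

-- The strong type as a function of the collapse

compV : ∀ {A : Set} {n} (r : Row n) → Vec A n → Vec A (cnt r)
compV []          []      = []
compV (true ∷ r)  (x ∷ v) = x ∷ compV r v
compV (false ∷ r) (x ∷ v) = compV r v

diff-comp : ∀ {n} (r A S : Row n) → S ⊑ r → diff (compV r A) (compV r S) ≡ diff A S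
diff-comp []          []      []      _       = refl
diff-comp (true ∷ r)  (a ∷ A) (s ∷ S) (_ , i) = cong (bit (s ∧ not a) +_) (diff-comp r A S i)
diff-comp (false ∷ r) (a ∷ A) (s ∷ S) (h , i) rewrite h refl = diff-comp r A S i

removeLast-comp : ∀ {n} (r A S : Row n) → S ⊑ r → removeLast (compV r A) (compV r S) ≡ compV r (removeLast A S)
removeLast-comp []          []      []      _       = refl
removeLast-comp (true ∷ r)  (a ∷ A) (s ∷ S) (_ , i) rewrite diff-comp r A S i =
  trans (cong (λ z → pickE op (diff A S) _ (s ∷ z)) (removeLast-comp r A S i)) (sym (pickE-map (compV (true ∷ r)) op (diff A S)))
removeLast-comp (false ∷ r) (a ∷ A) (s ∷ S) (h , i) rewrite h refl with diff A S in eq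
... | zero  = trans (removeLast-comp r A S i) (cong (compV r) (removeLast-idle A S eq))
... | suc _ = removeLast-comp r A S i

iter-comp : ∀ {n} a (r A S : Row n) → S ⊑ r →
            iter a (removeLast (compV r A)) (compV r S) ≡ compV r (iter a (removeLast A) S)
iter-comp zero    r A S i = refl
iter-comp (suc a) r A S i =
  trans (cong (iter a (removeLast (compV r A))) (removeLast-comp r A S i))
        (iter-comp a r A (removeLast A S) (⊑-trans _ S r (removeLast-⊑ A S) i))

comp-zeros : ∀ {A : Set} {n} (r : Row n) (x : A) → Vec.replicate (cnt r) x ≡ compV r (Vec.replicate n x)
comp-zeros []          x = refl
comp-zeros (true ∷ r)  x = cong (x ∷_) (comp-zeros r x)
comp-zeros (false ∷ r) x = comp-zeros r x

keep-comp : ∀ {n} as (r : Row n) fs → All (_⊑ r) fs → keep as (map (compV r) fs) ≡ compV r (keep as fs)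
keep-comp as       r []       _        = comp-zeros r false
keep-comp []       r (f ∷ fs) _        = refl
keep-comp (a ∷ as) r (f ∷ fs) (h ∷ hs) =
  trans (cong (λ A → iter a (removeLast A) (compV r f)) (keep-comp as r fs hs)) (iter-comp a r (keep as fs) f h)

zipWith-comp : ∀ {A B C : Set} {n} (h : A → B → C) (r : Row n) (u : Vec A n) (v : Vec B n) →
               Vec.zipWith h (compV r u) (compV r v) ≡ compV r (Vec.zipWith h u v)
zipWith-comp h []          []      []      = refl
zipWith-comp h (true ∷ r)  (x ∷ u) (y ∷ v) = cong (h x y ∷_) (zipWith-comp h r u v)
zipWith-comp h (false ∷ r) (x ∷ u) (y ∷ v) = zipWith-comp h r u v

cs-comp : ∀ {n} (r : Row n) fs → cs (map (compV r) fs) ≡ compV r (cs fs)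
cs-comp r []       = comp-zeros r 0
cs-comp r (f ∷ fs) = trans (cong (Vec.zipWith _ (compV r f)) (cs-comp r fs)) (zipWith-comp _ r f (cs fs))

⊑-comp : ∀ {n} (r A S : Row n) → A ⊑ S → compV r A ⊑ compV r S
⊑-comp []          []      []      _       = tt
⊑-comp (true ∷ r)  (a ∷ A) (s ∷ S) (h , i) = h , ⊑-comp r A S i
⊑-comp (false ∷ r) (a ∷ A) (s ∷ S) (h , i) = ⊑-comp r A S i

Nested-comp : ∀ {n} (r : Row n) fs → Nested fs → Nested (map (compV r) fs)
Nested-comp r []       []       = []
Nested-comp r (f ∷ fs) (n ∷ ns) = All.map⁺ (All.map (λ {g} h → ⊑-comp r g f h) n) ∷ Nested-comp r fs ns

thr : ∀ {m} → ℕ → Vec ℕ m → List (Row m)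
thr zero    v = []
thr (suc k) v = Vec.map (0 <ᵇ_) v ∷ thr k (Vec.map pred v)

level₀ : ∀ {m} (f : Row m) v → ZeroOff f v → Vec.map (0 <ᵇ_) (Vec.zipWith (λ p k → bit p + k) f v) ≡ f
level₀ []          []      _       = refl
level₀ (true ∷ f)  (k ∷ v) (_ , z) = cong (true ∷_) (level₀ f v z)
level₀ (false ∷ f) (k ∷ v) (h , z) rewrite h refl = cong (false ∷_) (level₀ f v z)

level-pred : ∀ {m} (f : Row m) v → ZeroOff f v → Vec.map pred (Vec.zipWith (λ p k → bit p + k) f v) ≡ v
level-pred []          []      _       = refl
level-pred (true ∷ f)  (k ∷ v) (_ , z) = cong (k ∷_) (level-pred f v z)
level-pred (false ∷ f) (k ∷ v) (h , z) rewrite h refl = cong (0 ∷_) (level-pred f v z)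

nested⇒thr : ∀ {m} (fs : List (Row m)) → Nested fs → fs ≡ thr (length fs) (cs fs)
nested⇒thr []       []       = refl
nested⇒thr (f ∷ fs) (n ∷ ns) =
  cong₂ _∷_ (sym (level₀ f (cs fs) z)) (trans (nested⇒thr fs ns) (cong (thr (length fs)) (sym (level-pred f (cs fs) z))))
  where z = ZeroOff-cs f fs n

strip-comp : ∀ {n} (r : Row n) v → ZeroOff r v → strip (toList v) ≡ strip (toList (compV r v))
strip-comp []          []          _       = refl
strip-comp (true ∷ r)  (zero ∷ v)  (_ , z) = strip-comp r v z
strip-comp (true ∷ r)  (suc k ∷ v) (_ , z) = cong (suc k ∷_) (strip-comp r v z)
strip-comp (false ∷ r) (k ∷ v)     (h , z) rewrite h refl = strip-comp r v z

strip-comp-pos : ∀ {n} (r : Row n) w →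
  strip (toList (compV r (Vec.zipWith (λ p k → bit p + k) r w))) ≡ toList (compV r (Vec.zipWith (λ p k → bit p + k) r w))
strip-comp-pos []          []      = refl
strip-comp-pos (true ∷ r)  (k ∷ w) = cong (suc k ∷_) (strip-comp-pos r w)
strip-comp-pos (false ∷ r) (k ∷ w) = strip-comp-pos r w

strM : ∀ {n} → Config n → List ℕ
strM M = strip (toList (cs (layM M)))

diff-removeLast : ∀ {n} (A S : Row n) {k} → diff A S ≡ suc k → diff A (removeLast A S) ≡ k
diff-removeLast []      []      ()
diff-removeLast (a ∷ A) (s ∷ S) {k} e with diff A S in eq
... | suc m = suc-injective (trans (sym (+-suc (bit (s ∧ not a)) _))
                (trans (cong (λ z → bit (s ∧ not a) + suc z) (diff-removeLast A S eq)) e))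
... | zero  = trans (cong (bit ((s ∧ a) ∧ not a) +_) eq) (lem s a e)
  where
  lem : ∀ s a → bit (s ∧ not a) + 0 ≡ suc k → bit ((s ∧ a) ∧ not a) + 0 ≡ k
  lem true false refl = refl

iter-removeLast-all : ∀ {n} (A S : Row n) k → A ⊑ S → diff A S ≡ k → iter k (removeLast A) S ≡ A
iter-removeLast-all A S zero    i e = sym (diff≡0⇒≡ A S i e)
iter-removeLast-all A S (suc k) i e =
  iter-removeLast-all A (removeLast A S) k (⊑-removeLast A S i) (diff-removeLast A S e)

-- With no unmatched "(" the difference of the sizes equals `ux b t`, so the reflection removes
-- every idle service.
Tc≡serve : ∀ {n} (b t : Row n) → t ≼ b → Tc b t ≡ serve 0 b t
Tc≡serve b t h = trans (iter-F2 (cnt b ∸ cnt t) b t)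
  (iter-removeLast-all (serve 0 b t) b (cnt b ∸ cnt t) (serve-⊑ 0 b t) (trans (diff-serve 0 b t) (sym ux≡)))
  where
  ux≡ : cnt b ∸ cnt t ≡ ux b t
  ux≡ = trans (cong (_∸ cnt t) (trans (cong (_+ cnt b) (sym (≼⇒uy≡0 b t h))) (balance b t))) (m+n∸n≡m (ux b t) (cnt t))

layM≡layN : ∀ {n} (N : Config n) → HW N → layM N ≡ layN N
layM≡layN []      _  = refl
layM≡layN (r ∷ N) hw = cong (r ∷_) (trans (cong (map (Tc r)) (layM≡layN N (HW-tail hw)))
  (map-cong-local (All.map (λ {f} h → Tc≡serve r f h) (layN-≼ r N hw))))

majM≡0⇒HW : ∀ {n} (N : Config n) → majM N ≡ 0 → HW N
majM≡0⇒HW []          _ = vy-[]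
majM≡0⇒HW (r ∷ [])    _ = HW-one r
majM≡0⇒HW (r ∷ t ∷ N) e zero    = m+n≡0⇒m≡0 (uy r t) (m+n≡0⇒n≡0 (majM (t ∷ N)) e)
majM≡0⇒HW (r ∷ t ∷ N) e (suc j) = majM≡0⇒HW (t ∷ N) (m+n≡0⇒m≡0 (majM (t ∷ N)) e) j

HW⇒majM≡0 : ∀ {n} (N : Config n) → HW N → majM N ≡ 0
HW⇒majM≡0 []      _  = refl
HW⇒majM≡0 (r ∷ N) hw = cong₂ _+_ (HW⇒majM≡0 N (HW-tail hw))
  (trans (cong (sum ∘ map (uy r)) (layM≡layN N (HW-tail hw))) (zeros (layN N) (layN-≼ r N hw)))
  where
  zeros : ∀ fs → All (_≼ r) fs → sum (map (uy r) fs) ≡ 0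
  zeros []       _        = refl
  zeros (f ∷ fs) (h ∷ hs) = cong₂ _+_ (≼⇒uy≡0 r f h) (zeros fs hs)

-- The strong type expressed through the restricted label vector t of the
-- collapsed configuration.
strFrom : (ℕ → List ℕ) → ℕ → ∀ {m} → Vec ℕ m → List ℕ
strFrom e l t = strip (toList (cs (applyUpTo (λ k → keep (e k) (thr l t)) l)))

toList-Σ-injective : ∀ {A : Set} {m m′} (t : Vec A m) (t′ : Vec A m′) → toList t ≡ toList t′ →
                     _≡_ {A = Σ ℕ (Vec A)} (m , t) (m′ , t′)
toList-Σ-injective []      []        _ = refl
toList-Σ-injective (x ∷ t) (x′ ∷ t′) e with ∷-injective e
... | refl , e′ with toList-Σ-injective t t′ e′
...   | refl = refl

length-layN : ∀ {n} (Z : Config n) → length (layN Z) ≡ length Z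
length-layN []      = refl
length-layN (z ∷ Z) = cong suc (trans (length-map (serve 0 z) (layN Z)) (length-layN Z))

module _ {n : ℕ} where

  -- `t` lists the labels on the bottom row of the collapse. Its length is the size of that row and
  -- varies with `M`, so two such vectors are compared through `toList`.
  record StrVia (M : Config n) : Set where
    field
      {m} : ℕ
      t   : Vec ℕ m
      t≡  : toList t ≡ strM (rhoM M)
      M≡  : strM M ≡ strFrom (λ k → exps k M) (length M) t

  strVia : ∀ M → 0 < length M → StrVia M
  strVia M l with nonempty (rhoM M) (subst (0 <_) (sym (Ver.len (Ver-runS (rhoOps 1 (length M ∸ 1))) M)) l)
  ... | r , N , eq = record { t = cs (map (compV r) (layN (rhoM M))) ; t≡ = t≡ ; M≡ = M≡ }
    where
    open ≡-Reasoning
    fs = layN (rhoM M)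
    below : All (_⊑ r) fs
    below = subst (λ Y → All (_⊑ r) (layN Y)) (sym eq) (⊑-refl r ∷ layN-⊑ (layN N) r)
    t≡ : toList (cs (map (compV r) fs)) ≡ strM (rhoM M)
    t≡ = begin
      toList (cs (map (compV r) fs))             ≡⟨ cong toList (cs-comp r fs) ⟩
      toList (compV r (cs fs))                   ≡⟨ cong (λ Y → toList (compV r (cs (layN Y)))) eq ⟩
      toList (compV r (cs (layN (r ∷ N))))       ≡⟨ strip-comp-pos r (cs (map (serve 0 r) (layN N))) ⟨
      strip (toList (compV r (cs (layN (r ∷ N))))) ≡⟨ cong (λ Y → strip (toList (compV r (cs (layN Y))))) eq ⟨
      strip (toList (compV r (cs fs)))           ≡⟨ strip-comp r (cs fs) (ZeroOff-cs r fs below) ⟨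
      strip (toList (cs fs))                     ≡⟨ cong (strip ∘ toList ∘ cs) (layM≡layN (rhoM M) (rhoM-hw M)) ⟨
      strM (rhoM M)                              ∎
    ks = applyUpTo (λ k → keep (exps k M) fs) (length M)
    ksBelow : ∀ m (e : ℕ → List ℕ) → All (_⊑ r) (applyUpTo (λ k → keep (e k) fs) m)
    ksBelow zero    e = []
    ksBelow (suc m) e = keep-⊑ (e 0) r fs below ∷ ksBelow m (e ∘ suc)
    M≡ : strM M ≡ strFrom (λ k → exps k M) (length M) (cs (map (compV r) fs))
    M≡ = begin
      strip (toList (cs (layM M)))
        ≡⟨ cong (strip ∘ toList ∘ cs) (trans (layM-layC M) (applyUpTo-cong (λ k → layer-from-hw k M l) (length M))) ⟩
      strip (toList (cs ks))
        ≡⟨ strip-comp r (cs ks) (ZeroOff-cs r ks (ksBelow (length M) (λ k → exps k M))) ⟩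
      strip (toList (compV r (cs ks)))
        ≡⟨ cong (strip ∘ toList) (cs-comp r ks) ⟨
      strip (toList (cs (map (compV r) ks)))
        ≡⟨ cong (strip ∘ toList ∘ cs) (trans (map-applyUpTo (λ k → keep (exps k M) fs) (compV r) (length M))
             (applyUpTo-cong (λ k → trans (sym (keep-comp (exps k M) r fs below)) (cong (keep (exps k M)) thr≡)) (length M))) ⟩
      strFrom (λ k → exps k M) (length M) (cs (map (compV r) fs)) ∎
      where
      thr≡ : map (compV r) fs ≡ thr (length M) (cs (map (compV r) fs))
      thr≡ = trans (nested⇒thr (map (compV r) fs) (Nested-comp r fs (layN-nested (rhoM M))))
        (cong (λ m → thr m (cs (map (compV r) fs)))
          (trans (length-map (compV r) fs) (trans (length-layN (rhoM M)) (Ver.len (Ver-runS (rhoOps 1 (length M ∸ 1))) M))))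

  -- By `strVia` the strong type is built from the exponents, which `g` preserves, and from the
  -- strong type of the collapse, which agrees by hypothesis.
  strM-hor : ∀ {g} → Hor g → ∀ M → strM (rhoM (g M)) ≡ strM (rhoM M) → strM (g M) ≡ strM M
  strM-hor {g} G [] e with g [] | Hor-len G []
  ... | [] | _ = refl
  strM-hor {g} G (r ∷ M) e = begin
    strM (g (r ∷ M))
      ≡⟨ B.M≡ ⟩
    strFrom (λ k → exps k (g (r ∷ M))) (length (g (r ∷ M))) B.t
      ≡⟨ cong₂ (λ l ft → strip (toList (cs (applyUpTo (λ k → keep (exps k (g (r ∷ M))) (thr l (proj₂ ft))) l)))) (Hor-len G (r ∷ M))
           (toList-Σ-injective B.t A.t (trans B.t≡ (trans e (sym A.t≡)))) ⟩
    strFrom (λ k → exps k (g (r ∷ M))) (length (r ∷ M)) A.t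
      ≡⟨ cong (strip ∘ toList ∘ cs) (applyUpTo-cong (λ k → cong (λ as → keep as (thr (length (r ∷ M)) A.t)) (exps-hor G k (r ∷ M))) (length (r ∷ M))) ⟩
    strFrom (λ k → exps k (r ∷ M)) (length (r ∷ M)) A.t
      ≡⟨ A.M≡ ⟨
    strM (r ∷ M) ∎
    where
    open ≡-Reasoning
    module A = StrVia (strVia (r ∷ M) z<s)
    module B = StrVia (strVia (g (r ∷ M)) (subst (0 <_) (sym (Hor-len G (r ∷ M))) z<s))

-- The collapsing map as a composition of crystal operators

colsG : ∀ {n} → (ℕ → ℕ) → Row n → List ℕ
colsG f []          = []
colsG f (true ∷ B)  = f 0 ∷ colsG (f ∘ suc) B
colsG f (false ∷ B) = colsG (f ∘ suc) B

cols≡colsG : ∀ {n} (f : ℕ → ℕ) (B : Row n) →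
             map proj₁ (filterᵇ proj₂ (zip (applyUpTo f n) (toList B))) ≡ colsG f B
cols≡colsG f []          = refl
cols≡colsG f (true ∷ B)  = cong (f 0 ∷_) (cols≡colsG (f ∘ suc) B)
cols≡colsG f (false ∷ B) = cols≡colsG (f ∘ suc) B

colsG-map : ∀ {n} (g f : ℕ → ℕ) (B : Row n) → colsG (g ∘ f) B ≡ map g (colsG f B)
colsG-map g f []          = refl
colsG-map g f (true ∷ B)  = cong (g (f 0) ∷_) (colsG-map g (f ∘ suc) B)
colsG-map g f (false ∷ B) = colsG-map g (f ∘ suc) B

cols-true : ∀ {n} (B : Row n) → cols (true ∷ B) ≡ 0 ∷ map suc (cols B)
cols-true B = trans (cols≡colsG id (true ∷ B)) (cong (0 ∷_) (trans (colsG-map suc id B) (cong (map suc) (sym (cols≡colsG id B)))))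

cols-false : ∀ {n} (B : Row n) → cols (false ∷ B) ≡ map suc (cols B)
cols-false B = trans (cols≡colsG id (false ∷ B)) (trans (colsG-map suc id B) (cong (map suc) (sym (cols≡colsG id B))))

at : ∀ {n} → ℕ → Row n → Bool
at c       []      = false
at zero    (p ∷ B) = p
at (suc c) (p ∷ B) = at c B

elemᵇ-suc : ∀ c l → elemᵇ (suc c) (map suc l) ≡ elemᵇ c l
elemᵇ-suc c []      = refl
elemᵇ-suc c (x ∷ l) = cong ((c ≡ᵇ x) ∨_) (elemᵇ-suc c l)

elemᵇ-zero : ∀ l → elemᵇ 0 (map suc l) ≡ false
elemᵇ-zero []      = refl
elemᵇ-zero (x ∷ l) = elemᵇ-zero l

elemᵇ-cols : ∀ {n} c (B : Row n) → elemᵇ c (cols B) ≡ at c B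
elemᵇ-cols c       []          = refl
elemᵇ-cols zero    (true ∷ B)  = cong (elemᵇ 0) (cols-true B)
elemᵇ-cols zero    (false ∷ B) = trans (cong (elemᵇ 0) (cols-false B)) (elemᵇ-zero (cols B))
elemᵇ-cols (suc c) (true ∷ B)  = trans (cong (elemᵇ (suc c)) (cols-true B)) (trans (elemᵇ-suc c (cols B)) (elemᵇ-cols c B))
elemᵇ-cols (suc c) (false ∷ B) = trans (cong (elemᵇ (suc c)) (cols-false B)) (trans (elemᵇ-suc c (cols B)) (elemᵇ-cols c B))

length-cols : ∀ {n} (B : Row n) → length (cols B) ≡ cnt B
length-cols []          = refl
length-cols (true ∷ B)  = trans (cong length (cols-true B)) (cong suc (trans (length-map suc (cols B)) (length-cols B)))
length-cols (false ∷ B) = trans (cong length (cols-false B)) (trans (length-map suc (cols B)) (length-cols B))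

∣∣≡cnt : ∀ {n} (B : Row n) → ∣ B ∣ ≡ cnt B
∣∣≡cnt []          = refl
∣∣≡cnt (true ∷ B)  = cong suc (∣∣≡cnt B)
∣∣≡cnt (false ∷ B) = ∣∣≡cnt B

rowR : ∀ {n} → Config n → ℕ → Row n
rowR []      j       = Vec.replicate _ false
rowR (r ∷ N) zero    = r
rowR (r ∷ N) (suc j) = rowR N j

at-zeros : ∀ n c → at c (Vec.replicate n false) ≡ false
at-zeros zero    c       = refl
at-zeros (suc n) zero    = refl
at-zeros (suc n) (suc c) = at-zeros n c

elemᵇ-rowAt : ∀ {n} c (N : Config n) j → elemᵇ c (rowAt N (suc j)) ≡ at c (rowR N j)
elemᵇ-rowAt {n} c []      j       = sym (at-zeros n c)
elemᵇ-rowAt     c (r ∷ N) zero    = elemᵇ-cols c r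
elemᵇ-rowAt     c (r ∷ N) (suc j) = elemᵇ-rowAt c N j

cnt-zeros : ∀ n → cnt (Vec.replicate n false) ≡ 0
cnt-zeros zero    = refl
cnt-zeros (suc n) = cnt-zeros n

push : Bool → ℕ → List ℕ → List ℕ
push true  c st = c ∷ st
push false c st = st

pop : Bool → List ℕ → List ℕ
pop true  []       = []
pop true  (_ ∷ st) = st
pop false st       = st

-- The bracketing read from the left, as in `unmatched`; `ux` and `uy` read the same word from the
-- right.
stack : ∀ {n} → (ℕ → ℕ) → Row n → Row n → List ℕ → List ℕ
stack f []      []      st = st
stack f (p ∷ b) (q ∷ t) st = stack (f ∘ suc) b t (pop p (push q (f 0) st))

stack-map : ∀ {n} (g f : ℕ → ℕ) (b t : Row n) st → stack (g ∘ f) b t (map g st) ≡ map g (stack f b t st)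
stack-map g f []      []      st = refl
stack-map g f (p ∷ b) (q ∷ t) st = trans (cong (stack (g ∘ f ∘ suc) b t) (lem p q st)) (stack-map g (f ∘ suc) b t (pop p (push q (f 0) st)))
  where
  lem : ∀ p q st → pop p (push q (g (f 0)) (map g st)) ≡ map g (pop p (push q (f 0) st))
  lem true  true  st       = refl
  lem true  false []       = refl
  lem true  false (x ∷ st) = refl
  lem false true  st       = refl
  lem false false st       = refl

-- The lowest entry is popped exactly when the unmatched ")" of the word outnumber the entries above
-- it. This connects the left and the right reading.
stack-bottom : ∀ {n} (f : ℕ → ℕ) (b t : Row n) st x →
               stack f b t (st ++ x ∷ []) ≡ stack f b t st ++ pickE op (ux b t ∸ length st) (x ∷ []) []
stack-bottom f []          []          st       x = cong (λ m → st ++ pickE op m (x ∷ []) []) (sym (0∸n≡0 (length st)))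
stack-bottom f (true ∷ b)  (true ∷ t)  st       x = stack-bottom (f ∘ suc) b t st x
stack-bottom f (false ∷ b) (false ∷ t) st       x = stack-bottom (f ∘ suc) b t st x
stack-bottom f (false ∷ b) (true ∷ t)  st       x =
  trans (stack-bottom (f ∘ suc) b t (f 0 ∷ st) x) (cong (λ m → stack (f ∘ suc) b t (f 0 ∷ st) ++ pickE op m (x ∷ []) []) (lem (ux b t) (length st)))
  where
  lem : ∀ m k → m ∸ suc k ≡ pred m ∸ k
  lem zero    k = sym (0∸n≡0 k)
  lem (suc m) k = refl
stack-bottom f (true ∷ b)  (false ∷ t) []       x = sym (++-identityʳ _)
stack-bottom f (true ∷ b)  (false ∷ t) (y ∷ st) x = stack-bottom (f ∘ suc) b t st x

last-++ : ∀ {A : Set} (l : List A) x → last (l ++ x ∷ []) ≡ just x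
last-++ []          x = refl
last-++ (y ∷ [])    x = refl
last-++ (y ∷ z ∷ l) x = last-++ (z ∷ l) x

moved : ∀ {n} → Maybe ℕ → Row n → Row n → Row n × Row n
moved nothing  b t = b , t
moved (just c) b t = setCol c true b , setCol c false t

moved-suc : ∀ {n} m p q (b t : Row n) → moved (Data.Maybe.map suc m) (p ∷ b) (q ∷ t) ≡ cons2 p q (moved m b t)
moved-suc nothing  p q b t = refl
moved-suc (just c) p q b t = refl

E2≡moved : ∀ {n} (b t : Row n) → E2 b t ≡ moved (last (stack id b t [])) b t
E2≡moved []      []      = refl
E2≡moved (p ∷ b) (q ∷ t) = head′ p q
  where
  shift : ∀ p q → cons2 p q (E2 b t) ≡ moved (last (stack suc b t [])) (p ∷ b) (q ∷ t)
  shift p q = trans (cong (cons2 p q) (E2≡moved b t)) (trans (sym (moved-suc (last (stack id b t [])) p q b t))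
    (cong (λ m → moved m (p ∷ b) (q ∷ t)) (trans (sym (last-map suc (stack id b t []))) (cong last (sym (stack-map suc id b t []))))))
  head′ : ∀ p q → E2 (p ∷ b) (q ∷ t) ≡ moved (last (stack suc b t (pop p (push q 0 [])))) (p ∷ b) (q ∷ t)
  head′ true  true  = shift true true
  head′ true  false = shift true false
  head′ false false = shift false false
  -- The "(" at the head lies at the bottom of the stack. If it survives, it is the leftmost
  -- unmatched one and hence the ball to be moved.
  head′ false true  with ux b t | stack-bottom suc b t [] 0
  ... | zero  | e = cong (λ l → moved l (false ∷ b) (true ∷ t)) (sym (trans (cong last e) (last-++ (stack suc b t []) 0)))
  ... | suc _ | e = trans (shift false true) (cong (λ l → moved (last l) (false ∷ b) (true ∷ t)) (sym (trans e (++-identityʳ _))))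

moveAt : ∀ {n} → ℕ → Config n → Maybe ℕ → Config n
moveAt j N nothing  = N
moveAt j N (just c) = modifyAt j (setCol c true) (modifyAt (suc j) (setCol c false) N)

stack-noTop : ∀ {n} (b : Row n) f → stack f b (Vec.replicate n false) [] ≡ []
stack-noTop []          f = refl
stack-noTop (true ∷ b)  f = stack-noTop b (f ∘ suc)
stack-noTop (false ∷ b) f = stack-noTop b (f ∘ suc)

Ev≡moveAt : ∀ {n} j (N : Config n) m → last (stack id (rowR N j) (rowR N (suc j)) []) ≡ m → Ev j N ≡ moveAt j N m
Ev≡moveAt {n} zero    []   m e = cong (moveAt 0 []) (trans (cong last (sym (stack-noTop (Vec.replicate n false) id))) e)
Ev≡moveAt zero    (b ∷ []) m e = cong (moveAt 0 (b ∷ [])) (trans (cong last (sym (stack-noTop b id))) e)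
Ev≡moveAt zero    (b ∷ t ∷ N) nothing  e = cong (λ w → consC w N) (trans (E2≡moved b t) (cong (λ m → moved m b t) e))
Ev≡moveAt zero    (b ∷ t ∷ N) (just c) e = cong (λ w → consC w N) (trans (E2≡moved b t) (cong (λ m → moved m b t) e))
Ev≡moveAt {n} (suc j) []   m e = cong (moveAt (suc j) []) (trans (cong last (sym (stack-noTop (Vec.replicate n false) id))) e)
Ev≡moveAt (suc j) (b ∷ N)  nothing  e = cong (b ∷_) (Ev≡moveAt j N nothing e)
Ev≡moveAt (suc j) (b ∷ N)  (just c) e = cong (b ∷_) (Ev≡moveAt j N (just c) e)

descending : ℕ → List ℕ
descending zero    = []
descending (suc l) = suc l ∷ descending l

reverse-descending : ∀ l → reverse (applyUpTo suc l) ≡ descending l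
reverse-descending zero    = refl
reverse-descending (suc l) = begin
  reverse (applyUpTo suc (suc l))        ≡⟨ cong reverse (applyUpTo-∷ʳ suc l) ⟨
  reverse (applyUpTo suc l ++ suc l ∷ []) ≡⟨ reverse-++ (applyUpTo suc l) (suc l ∷ []) ⟩
  suc l ∷ reverse (applyUpTo suc l)      ≡⟨ cong (suc l ∷_) (reverse-descending l) ⟩
  suc l ∷ descending l                   ∎
  where open ≡-Reasoning

≡ᵇ-refl : ∀ m → (m ≡ᵇ m) ≡ true
≡ᵇ-refl zero    = refl
≡ᵇ-refl (suc m) = ≡ᵇ-refl m

≢⇒≡ᵇ : ∀ m n → m ≢ n → (m ≡ᵇ n) ≡ false
≢⇒≡ᵇ zero    zero    h = ⊥-elim (h refl)
≢⇒≡ᵇ zero    (suc n) h = refl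
≢⇒≡ᵇ (suc m) zero    h = refl
≢⇒≡ᵇ (suc m) (suc n) h = ≢⇒≡ᵇ m n (h ∘ cong suc)

module Column (j c : ℕ) (E : ℕ → Bool) where

  block : ℕ → List (ℕ × ℕ)
  block l = concatMap (λ r → if E r then (c , r) ∷ [] else []) (descending l)

  letter-step : ∀ r ws st → unmatched j ((c , r) ∷ ws) st ≡
    unmatched j ws (pop (r ≡ᵇ j) (push (r ≡ᵇ suc j) c st))
  letter-step r ws st with r ≡ᵇ suc j in e | r ≡ᵇ j in e′
  ... | false | false = refl
  ... | true  | false = refl
  ... | true  | true  = contradiction (trans (sym (≡ᵇ⇒≡ r j (subst T (sym e′) tt))) (≡ᵇ⇒≡ r (suc j) (subst T (sym e) tt))) (λ e → 1+n≢n (sym e))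
  letter-step r ws []       | false | true = refl
  letter-step r ws (x ∷ st) | false | true = refl

  effect : ℕ → List ℕ → List ℕ
  effect zero    st = st
  effect (suc l) st = effect l (pop (E (suc l) ∧ (suc l ≡ᵇ j)) (push (E (suc l) ∧ (suc l ≡ᵇ suc j)) c st))

  block-effect : ∀ l ws st → unmatched j (block l ++ ws) st ≡ unmatched j ws (effect l st)
  block-effect zero    ws st = refl
  block-effect (suc l) ws st with E (suc l)
  ... | true  = trans (letter-step (suc l) (block l ++ ws) st) (block-effect l ws _)
  ... | false = block-effect l ws st

  effect-low : ∀ l st → l < j → effect l st ≡ st
  effect-low zero    st h = refl
  effect-low (suc l) st h
    rewrite ≢⇒≡ᵇ (suc l) j (<⇒≢ h) | ≢⇒≡ᵇ l j (<⇒≢ (<-trans (n<1+n l) h)) | ∧-zeroʳ (E (suc l)) =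
    effect-low l st (<-trans (n<1+n l) h)

  effect-j : ∀ l st → j ≡ suc l → effect (suc l) st ≡ pop (E j) st
  effect-j l st refl rewrite ≡ᵇ-refl l | ≢⇒≡ᵇ l (suc l) (λ e → 1+n≢n (sym e)) | ∧-zeroʳ (E (suc l)) | ∧-identityʳ (E (suc l)) =
    effect-low l _ (n<1+n l)

  effect-high : ∀ i k st → j ≡ suc i → effect (k + suc j) st ≡ pop (E j) (push (E (suc j)) c st)
  effect-high i zero    st refl =
    trans (cong (effect (suc i)) (cong₂ (λ x y → pop x (push y c st))
            (trans (cong (E (suc (suc i)) ∧_) (≢⇒≡ᵇ (suc i) i 1+n≢n)) (∧-zeroʳ (E (suc (suc i)))))
            (trans (cong (E (suc (suc i)) ∧_) (≡ᵇ-refl i)) (∧-identityʳ (E (suc (suc i)))))))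
          (effect-j i (push (E (suc (suc i))) c st) refl)
  effect-high i (suc k) st e
    rewrite ≢⇒≡ᵇ (suc (k + suc j)) j (λ e′ → <-irrefl (sym e′) (s≤s (≤-trans (n≤1+n j) (m≤n+m (suc j) k))))
          | ≢⇒≡ᵇ (k + suc j) j (λ e′ → <-irrefl (sym e′) (m≤n+m (suc j) k)) | ∧-zeroʳ (E (suc (k + suc j))) =
    effect-high i k st e

  effect≡ : ∀ i l st → j ≡ suc i → (∀ r → l < r → E r ≡ false) → effect l st ≡ pop (E j) (push (E (suc j)) c st)
  effect≡ i l st e off with <-cmp l j
  ... | tri< a _ _ rewrite off j a | off (suc j) (<-trans a (n<1+n j)) = effect-low l st a
  ... | tri≈ _ l≡j _ rewrite off (suc j) (subst (_< suc j) (sym l≡j) (n<1+n j)) =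
    trans (cong (λ m → effect m st) (trans l≡j e)) (effect-j i st e)
  ... | tri> _ _ g = trans (cong (λ m → effect m st) (sym (m∸n+n≡m g))) (effect-high i (l ∸ suc j) st e)

unmatched-cw : ∀ {n} i (N : Config n) → unmatched (suc i) (cw N) [] ≡ stack id (rowR N i) (rowR N (suc i)) []
unmatched-cw {n} i N = trans (cong (λ l → unmatched (suc i) (concatMap (col l) (upTo n)) []) (reverse-descending (length N)))
  (go n id (rowR N i) (rowR N (suc i)) (λ c _ → elemᵇ-rowAt c N i) (λ c _ → elemᵇ-rowAt c N (suc i)) [])
  where
  col : List ℕ → ℕ → List (ℕ × ℕ)
  col l c = concatMap (λ r → if elemᵇ c (rowAt N r) then (c , r) ∷ [] else []) l
  rowAt-≥ : ∀ (N : Config n) r → length N < r → rowAt N r ≡ []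
  rowAt-≥ []      (suc r)       _       = refl
  rowAt-≥ (x ∷ N) (suc (suc r)) (s≤s h) = rowAt-≥ N (suc r) h
  off : ∀ c r → length N < r → elemᵇ c (rowAt N r) ≡ false
  off c r h rewrite rowAt-≥ N r h = refl
  go : ∀ m (f : ℕ → ℕ) (b t : Row m) →
       (∀ c → c < m → elemᵇ (f c) (rowAt N (suc i)) ≡ at c b) → (∀ c → c < m → elemᵇ (f c) (rowAt N (suc (suc i))) ≡ at c t) →
       ∀ st → unmatched (suc i) (concatMap (col (descending (length N))) (applyUpTo f m)) st ≡ stack f b t st
  go zero    f []      []      hb ht st = refl
  go (suc m) f (p ∷ b) (q ∷ t) hb ht st =
    trans (C.block-effect (length N) _ st)
    (trans (cong (unmatched (suc i) (concatMap (col (descending (length N))) (applyUpTo (f ∘ suc) m)))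
             (trans (C.effect≡ i (length N) st refl (off (f 0))) (cong₂ (λ x y → pop x (push y (f 0) st)) (hb 0 z<s) (ht 0 z<s))))
           (go m (f ∘ suc) b t (λ c h → hb (suc c) (s<s h)) (λ c h → ht (suc c) (s<s h)) (pop p (push q (f 0) st))))
    where module C = Column (suc i) (f 0) (λ r → elemᵇ (f 0) (rowAt N r))

eDown≡Ev : ∀ {n} j (N : Config n) → eDown (suc j) N ≡ Ev j N
eDown≡Ev j N with last (unmatched (suc j) (cw N) []) | cong last (unmatched-cw j N)
... | nothing | e = sym (Ev≡moveAt j N nothing (sym e))
... | just c  | e = sym (Ev≡moveAt j N (just c) (sym e))

uy≤cnt : ∀ {n} (b t : Row n) → uy b t ≤ cnt t
uy≤cnt b t = subst (uy b t ≤_) (cnt-upper b t) (m≤m+n (uy b t) _)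

vy≤ballCount : ∀ {n} j (N : Config n) → vy j N ≤ ballCount N
vy≤ballCount zero    []          = z≤n
vy≤ballCount zero    (b ∷ [])    = z≤n
vy≤ballCount zero    (b ∷ t ∷ N) = ≤-trans (uy≤cnt b t) (≤-trans (≤-reflexive (sym (∣∣≡cnt t))) (≤-trans (m≤m+n ∣ t ∣ _) (m≤n+m _ ∣ b ∣)))
vy≤ballCount (suc j) []          = z≤n
vy≤ballCount (suc j) (b ∷ N)     = ≤-trans (vy≤ballCount j N) (m≤n+m _ ∣ b ∣)

iter-cong : ∀ {A : Set} {f g : A → A} → (∀ x → f x ≡ g x) → ∀ k x → iter k f x ≡ iter k g x
iter-cong         e zero    x = refl
iter-cong {f = f} e (suc k) x = trans (cong (iter k f) (e x)) (iter-cong e k _)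

eDownStar≡Sv : ∀ {n} j (N : Config n) → eDownStar (suc j) N ≡ Sv j N
eDownStar≡Sv j N = trans (iter-cong (eDown≡Ev j) (ballCount N) N) (iter-Ev≡Sv j (ballCount N) N (vy≤ballCount j N))

applyDown≡runS : ∀ {n} k (N : Config n) → applyDown k N ≡ runS (down k) N
applyDown≡runS zero    N = refl
applyDown≡runS (suc k) N = trans (cong (applyDown k) (eDownStar≡Sv k N)) (applyDown≡runS k (Sv k N))

rhoLoop≡runS : ∀ {n} i k (N : Config n) Q → proj₁ (rhoLoop i k N Q) ≡ runS (rhoOps i k) N
rhoLoop≡runS i zero    N Q = refl
rhoLoop≡runS i (suc k) N Q =
  trans (rhoLoop≡runS (suc i) k (applyDown i N) _)
        (trans (cong (runS (rhoOps (suc i) k)) (applyDown≡runS i N)) (sym (runS-++ (down i) (rhoOps (suc i) k) N)))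

rho₁≡rhoM : ∀ {n} (M : Config n) → proj₁ (rho M) ≡ rhoM M
rho₁≡rhoM M = rhoLoop≡runS 1 (length M ∸ 1) M _

-- First-fit pairing

consIf : Bool → List ℕ → List ℕ
consIf true  l = 0 ∷ l
consIf false l = l

cd : ∀ {n} → Row n → Row n → List ℕ
cd []      []      = []
cd (a ∷ A) (s ∷ S) = consIf (s ∧ not a) (map suc (cd A S))

idleCols : ∀ {n} → ℕ → Row n → Row n → List ℕ
idleCols q b S = cd (serve q b S) b

-- The balls that reach the right edge without a partner; for an empty start these are the wrapping
-- ones (`finalQueue₀`).
finalQueue : ∀ {n} → ℕ → Row n → Row n → ℕ
finalQueue q []      []      = q
finalQueue q (p ∷ b) (s ∷ S) = finalQueue (left p (bit s + q)) b S

finalQueue≡ : ∀ {n} q (b S : Row n) → finalQueue q b S ≡ (q ∸ ux b S) + uy b S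
finalQueue≡ q       []          []          = sym (+-identityʳ q)
finalQueue≡ q       (true ∷ b)  (true ∷ S)  = finalQueue≡ q b S
finalQueue≡ q       (false ∷ b) (false ∷ S) = finalQueue≡ q b S
finalQueue≡ zero    (true ∷ b)  (false ∷ S) = trans (finalQueue≡ 0 b S) (cong (_+ uy b S) (0∸n≡0 (ux b S)))
finalQueue≡ (suc q) (true ∷ b)  (false ∷ S) = finalQueue≡ q b S
finalQueue≡ q       (false ∷ b) (true ∷ S)  with ux b S | finalQueue≡ (suc q) b S
... | zero  | e = trans e (sym (+-suc q (uy b S)))
... | suc m | e = e

finalQueue₀ : ∀ {n} (b S : Row n) → finalQueue 0 b S ≡ uy b S
finalQueue₀ b S = trans (finalQueue≡ 0 b S) (cong (_+ uy b S) (0∸n≡0 (ux b S)))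

-- Describes one additional arrival at column `j`: it occupies an idle service weakly to the right,
-- and `bumpGE` adds one to the overflow if there is none.
delGE : ℕ → List ℕ → List ℕ
delGE j []      = []
delGE j (y ∷ l) = if j ≤ᵇ y then l else y ∷ delGE j l

bumpGE : ℕ → List ℕ → ℕ → ℕ
bumpGE j []      x = suc x
bumpGE j (y ∷ l) x = if j ≤ᵇ y then x else bumpGE j l x

delGE-zero : ∀ l → delGE 0 l ≡ drop 1 l
delGE-zero []      = refl
delGE-zero (y ∷ l) = refl

delGE-suc : ∀ j l → delGE (suc j) (map suc l) ≡ map suc (delGE j l)
delGE-suc j       []      = refl
delGE-suc zero    (y ∷ l) = refl
delGE-suc (suc j) (y ∷ l) with suc j ≤ᵇ y
... | true  = refl
... | false = cong (suc y ∷_) (delGE-suc (suc j) l)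

bumpGE-suc : ∀ j l x → bumpGE (suc j) (map suc l) x ≡ bumpGE j l x
bumpGE-suc j       []      x = refl
bumpGE-suc zero    (y ∷ l) x = refl
bumpGE-suc (suc j) (y ∷ l) x with suc j ≤ᵇ y
... | true  = refl
... | false = bumpGE-suc (suc j) l x

bumpGE-zero-map : ∀ l x → bumpGE 0 (map suc l) x ≡ bumpGE 0 l x
bumpGE-zero-map []      x = refl
bumpGE-zero-map (y ∷ l) x = refl

idleCols-suc : ∀ {n} q (b S : Row n) → idleCols (suc q) b S ≡ drop 1 (idleCols q b S)
idleCols-suc q []          []      = refl
idleCols-suc q (false ∷ b) (s ∷ S) rewrite +-suc (bit s) q =
  trans (cong (map suc) (idleCols-suc (bit s + q) b S)) (sym (drop-map {f = suc} 1 (idleCols (bit s + q) b S)))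
idleCols-suc q (true ∷ b)  (s ∷ S) rewrite +-suc (bit s) q with bit s + q
... | zero  = refl
... | suc m = trans (cong (map suc) (idleCols-suc m b S)) (sym (drop-map {f = suc} 1 (idleCols m b S)))

finalQueue-suc : ∀ {n} q (b S : Row n) → finalQueue (suc q) b S ≡ bumpGE 0 (idleCols q b S) (finalQueue q b S)
finalQueue-suc q []          []      = refl
finalQueue-suc q (false ∷ b) (s ∷ S) rewrite +-suc (bit s) q =
  trans (finalQueue-suc (bit s + q) b S) (sym (bumpGE-zero-map (idleCols (bit s + q) b S) _))
finalQueue-suc q (true ∷ b)  (s ∷ S) rewrite +-suc (bit s) q with bit s + q
... | zero  = refl
... | suc m = trans (finalQueue-suc m b S) (sym (bumpGE-zero-map (idleCols m b S) _))

-- The new arrival may displace others from their services, but the set of busy services grows in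
-- the end by the first idle one weakly to its right.
idleCols-insert : ∀ {n} q (b S : Row n) j → j < n → at j S ≡ false →
                  idleCols q b (setCol j true S) ≡ delGE j (idleCols q b S)
idleCols-insert q       (false ∷ b) (false ∷ S) zero    l e =
  trans (cong (map suc) (idleCols-suc q b S)) (trans (sym (drop-map {f = suc} 1 (idleCols q b S))) (sym (delGE-zero (map suc (idleCols q b S)))))
idleCols-insert zero    (true ∷ b)  (false ∷ S) zero    l e = refl
idleCols-insert (suc q) (true ∷ b)  (false ∷ S) zero    l e =
  trans (cong (map suc) (idleCols-suc q b S)) (trans (sym (drop-map {f = suc} 1 (idleCols q b S))) (sym (delGE-zero (map suc (idleCols q b S)))))
idleCols-insert q       (p ∷ b)     (s ∷ S)     (suc j) (s≤s l) e =
  trans (cong (consIf (p ∧ not (hit p (bit s + q)))) (trans (cong (map suc) (idleCols-insert q′ b S j l e)) (sym (delGE-suc j (idleCols q′ b S)))))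
        (lem (p ∧ not (hit p (bit s + q))) (map suc (idleCols q′ b S)))
  where
  q′ = left p (bit s + q)
  lem : ∀ x l → consIf x (delGE (suc j) l) ≡ delGE (suc j) (consIf x l)
  lem true  l = refl
  lem false l = refl

finalQueue-insert : ∀ {n} q (b S : Row n) j → j < n → at j S ≡ false →
                    finalQueue q b (setCol j true S) ≡ bumpGE j (idleCols q b S) (finalQueue q b S)
finalQueue-insert q       (false ∷ b) (false ∷ S) zero    l e =
  trans (finalQueue-suc q b S) (sym (bumpGE-zero-map (idleCols q b S) _))
finalQueue-insert zero    (true ∷ b)  (false ∷ S) zero    l e = refl
finalQueue-insert (suc q) (true ∷ b)  (false ∷ S) zero    l e =
  trans (finalQueue-suc q b S) (sym (bumpGE-zero-map (idleCols q b S) _))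
finalQueue-insert q       (p ∷ b)     (s ∷ S)     (suc j) (s≤s l) e =
  trans (finalQueue-insert q′ b S j l e) (trans (sym (bumpGE-suc j (idleCols q′ b S) _)) (lem (p ∧ not (hit p (bit s + q))) (map suc (idleCols q′ b S)) _))
  where
  q′ = left p (bit s + q)
  lem : ∀ x l y → bumpGE (suc j) l y ≡ bumpGE (suc j) (consIf x l) y
  lem true  l y = refl
  lem false l y = refl

Inc : List ℕ → Set
Inc = AllPairs _<_

Inc-map-suc : ∀ {l} → Inc l → Inc (map suc l)
Inc-map-suc []       = []
Inc-map-suc (h ∷ hs) = All.map⁺ (All.map s<s h) ∷ Inc-map-suc hs

Inc-cd : ∀ {n} (A S : Row n) → Inc (cd A S)
Inc-cd []      []      = []
Inc-cd (a ∷ A) (s ∷ S) with s ∧ not a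
... | true  = All.map⁺ (All.universal (λ _ → z<s) (cd A S)) ∷ Inc-map-suc (Inc-cd A S)
... | false = Inc-map-suc (Inc-cd A S)

≤ᵇ-true : ∀ {m n} → m ≤ n → (m ≤ᵇ n) ≡ true
≤ᵇ-true h = Equivalence.to T-≡ (≤⇒≤ᵇ h)

≤ᵇ-false : ∀ {m n} → n < m → (m ≤ᵇ n) ≡ false
≤ᵇ-false {m} {n} h with m ≤ᵇ n in e
... | false = refl
... | true  = contradiction (≤ᵇ⇒≤ m n (subst T (sym e) tt)) (<⇒≱ h)

≤ᵇ-true⁻ : ∀ {m n} → (m ≤ᵇ n) ≡ true → m ≤ n
≤ᵇ-true⁻ {m} {n} e = ≤ᵇ⇒≤ m n (subst T (sym e) tt)

≤ᵇ-false⁻ : ∀ {m n} → (m ≤ᵇ n) ≡ false → n < m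
≤ᵇ-false⁻ {m} {n} e = ≰⇒> λ h → case trans (sym (≤ᵇ-true h)) e of λ ()

removeN-idle : ∀ k l → All (k <_) l → removeN k l ≡ l
removeN-idle k []      []       = refl
removeN-idle k (y ∷ l) (h ∷ hs) rewrite ≢⇒≡ᵇ y k (<⇒≢ h ∘ sym) = cong (y ∷_) (removeN-idle k l hs)

removeN-head : ∀ k l → Inc (k ∷ l) → removeN k (k ∷ l) ≡ l
removeN-head k l (h ∷ _) rewrite ≡ᵇ-refl k = removeN-idle k l h

firstGE-≥ : ∀ j l {k} → firstGE j l ≡ just k → j ≤ k × k ∈ l
firstGE-≥ j (y ∷ l) e with j ≤ᵇ y in le
firstGE-≥ j (y ∷ l) refl | true = ≤ᵇ-true⁻ le , here refl
... | false = let h , m = firstGE-≥ j l e in h , there m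

removeN-firstGE : ∀ j l {k} → Inc l → firstGE j l ≡ just k → removeN k l ≡ delGE j l
removeN-firstGE j (y ∷ l) i e with j ≤ᵇ y in le
removeN-firstGE j (y ∷ l) i refl | true = removeN-head y l i
removeN-firstGE j (y ∷ l) {k} (_ ∷ i) e | false
  rewrite ≢⇒≡ᵇ y k (<⇒≢ (<-≤-trans (≤ᵇ-false⁻ le) (proj₁ (firstGE-≥ j l e)))) = cong (y ∷_) (removeN-firstGE j l i e)

delGE-all : ∀ j l → All (j ≤_) l → delGE j l ≡ drop 1 l
delGE-all j []      _       = refl
delGE-all j (y ∷ l) (h ∷ _) rewrite ≤ᵇ-true h = refl

drop-1-drop : ∀ {A : Set} w (l : List A) → drop 1 (drop w l) ≡ drop (suc w) l
drop-1-drop w l = trans (drop-drop w 1 l) (cong (λ k → drop k l) (+-comm w 1))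

delGE-drop : ∀ j w l {k} → Inc l → firstGE j (drop w l) ≡ just k → delGE j (drop w l) ≡ drop w (delGE j l)
delGE-drop j zero    l       i       e = refl
delGE-drop j (suc w) (y ∷ l) (h ∷ i) e with j ≤ᵇ y in le
... | true  = trans (delGE-all j (drop w l) (All.drop⁺ w (All.map (λ y<z → ≤-trans (≤ᵇ-true⁻ le) (<⇒≤ y<z)) h))) (drop-1-drop w l)
... | false = delGE-drop j w l i e

firstGE-drop⇒bump : ∀ j w l x {k} → firstGE j (drop w l) ≡ just k → bumpGE j l x ≡ x
firstGE-drop⇒bump j zero    (y ∷ l) x e with j ≤ᵇ y
... | true  = refl
... | false = firstGE-drop⇒bump j 0 l x e
firstGE-drop⇒bump j (suc w) (y ∷ l) x e with j ≤ᵇ y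
... | true  = refl
... | false = firstGE-drop⇒bump j w l x e

firstGE-nothing : ∀ j l → firstGE j l ≡ nothing → All (_< j) l
firstGE-nothing j []      _ = []
firstGE-nothing j (y ∷ l) e with j ≤ᵇ y in le
... | false = ≤ᵇ-false⁻ le ∷ firstGE-nothing j l e

none-below : ∀ j w l {k l′} → Inc l → drop w l ≡ k ∷ l′ → All (_< j) (drop w l) → All (_< j) l
none-below j zero    l       i       e h = h
none-below j (suc w) (y ∷ l) {k} (a ∷ i) e h =
  <-trans (All.lookup a (∈-drop w l (subst (k ∈_) (sym e) (here refl)))) (All.lookup h (subst (k ∈_) (sym e) (here refl))) ∷ none-below j w l i e h
  where
  ∈-drop : ∀ w (l : List ℕ) {k} → k ∈ drop w l → k ∈ l
  ∈-drop zero    l       m = m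
  ∈-drop (suc w) (x ∷ l) m = there (∈-drop w l m)

delGE-none : ∀ j l → All (_< j) l → delGE j l ≡ l
delGE-none j []      []       = refl
delGE-none j (y ∷ l) (h ∷ hs) rewrite ≤ᵇ-false h = cong (y ∷_) (delGE-none j l hs)

bumpGE-none : ∀ j l x → All (_< j) l → bumpGE j l x ≡ suc x
bumpGE-none j []      x []       = refl
bumpGE-none j (y ∷ l) x (h ∷ hs) rewrite ≤ᵇ-false h = bumpGE-none j l x hs

-- The columns of b still available after the balls of S have been paired:
-- wrapping pairings use up the first idle columns.
avl : ∀ {n} → Row n → Row n → List ℕ
avl b S = drop (uy b S) (idleCols 0 b S)

Inc-drop : ∀ w {l} → Inc l → Inc (drop w l)
Inc-drop zero    i       = i
Inc-drop (suc w) []      = []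
Inc-drop (suc w) (h ∷ i) = Inc-drop w i

Inc-avl : ∀ {n} (b S : Row n) → Inc (avl b S)
Inc-avl b S = Inc-drop (uy b S) (Inc-cd (serve 0 b S) b)

module _ {n : ℕ} (b S : Row n) (j : ℕ) (j<n : j < n) (new : at j S ≡ false) where

  private
    S′ = setCol j true S
    U  = idleCols 0 b S

    uy′ : uy b S′ ≡ bumpGE j U (uy b S)
    uy′ = trans (sym (finalQueue₀ b S′)) (trans (finalQueue-insert 0 b S j j<n new) (cong (bumpGE j U) (finalQueue₀ b S)))

  -- One FM pairing changes the available columns just as adding the ball to `S` does, whatever the
  -- order in which the earlier balls were paired. The result of a round of pairings therefore
  -- depends only on the set of paired balls.
  avl-direct : ∀ {k} → firstGE j (avl b S) ≡ just k → avl b S′ ≡ removeN k (avl b S) × uy b S′ ≡ uy b S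
  avl-direct {k} e = (begin
    drop (uy b S′) (idleCols 0 b S′) ≡⟨ cong₂ drop same (idleCols-insert 0 b S j j<n new) ⟩
    drop (uy b S) (delGE j U)        ≡⟨ delGE-drop j (uy b S) U (Inc-cd (serve 0 b S) b) e ⟨
    delGE j (avl b S)                ≡⟨ removeN-firstGE j (avl b S) (Inc-avl b S) e ⟨
    removeN k (avl b S)              ∎) , same
    where
    open ≡-Reasoning
    same : uy b S′ ≡ uy b S
    same = trans uy′ (firstGE-drop⇒bump j (uy b S) U (uy b S) e)

  -- Earlier wraps have used up the first idle columns. If no later idle column is weakly to the
  -- right of `j`, neither are those, so the new ball also overflows and takes the next column from
  -- the left.
  avl-wrap : ∀ {k l} → firstGE j (avl b S) ≡ nothing → avl b S ≡ k ∷ l →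
             avl b S′ ≡ removeN k (avl b S) × uy b S′ ≡ suc (uy b S)
  avl-wrap {k} {l} e a = (begin
    drop (uy b S′) (idleCols 0 b S′) ≡⟨ cong₂ drop more (trans (idleCols-insert 0 b S j j<n new) (delGE-none j U none)) ⟩
    drop (suc (uy b S)) U            ≡⟨ drop-1-drop (uy b S) U ⟨
    drop 1 (avl b S)                 ≡⟨ cong (drop 1) a ⟩
    l                                ≡⟨ removeN-head k l (subst Inc a (Inc-avl b S)) ⟨
    removeN k (k ∷ l)                ≡⟨ cong (removeN k) a ⟨
    removeN k (avl b S)              ∎) , more
    where
    open ≡-Reasoning
    none : All (_< j) U
    none = none-below j (uy b S) U (Inc-cd (serve 0 b S) b) a (firstGE-nothing j (avl b S) e)
    more : uy b S′ ≡ suc (uy b S)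
    more = trans uy′ (bumpGE-none j U (uy b S) none)

serve-empty : ∀ {n} (b : Row n) → idleCols 0 b (Vec.replicate n false) ≡ cols b
serve-empty []          = refl
serve-empty (true ∷ b)  = trans (cong (λ l → 0 ∷ map suc l) (serve-empty b)) (sym (cols-true b))
serve-empty (false ∷ b) = trans (cong (map suc) (serve-empty b)) (sym (cols-false b))

ux-empty : ∀ {n} (b : Row n) → uy b (Vec.replicate n false) ≡ 0
ux-empty []          = refl
ux-empty (true ∷ b)  = ux-empty b
ux-empty (false ∷ b) = ux-empty b

avl-empty : ∀ {n} (b : Row n) → avl b (Vec.replicate n false) ≡ cols b
avl-empty b = trans (cong (λ w → drop w (idleCols 0 b _)) (ux-empty b)) (serve-empty b)

iter-fix : ∀ {A : Set} (f : A → A) {x} d → f x ≡ x → iter d f x ≡ x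
iter-fix f zero    e = refl
iter-fix f (suc d) e = trans (cong (iter d f) e) (iter-fix f d e)

iter-cons : ∀ {n} d a s (A S : Row n) →
  iter d (removeLast (a ∷ A)) (s ∷ S) ≡ (if d ≤ᵇ diff A S then s else s ∧ a) ∷ iter d (removeLast A) S
iter-cons zero    a s A S = refl
iter-cons (suc d) a s A S with diff A S in eq
... | zero  = trans (iter-idle d) (cong ((s ∧ a) ∷_) (sym (trans (cong (iter d (removeLast A)) (removeLast-idle A S eq)) (iter-fix (removeLast A) d (removeLast-idle A S eq)))))
  where
  again : removeLast (a ∷ A) ((s ∧ a) ∷ S) ≡ (s ∧ a) ∷ S
  again = removeLast-idle (a ∷ A) ((s ∧ a) ∷ S) (cong₂ _+_ (lem s a) eq)
    where
    lem : ∀ s a → bit ((s ∧ a) ∧ not a) ≡ 0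
    lem true  true  = refl
    lem true  false = refl
    lem false a     = refl
  iter-idle : ∀ d → iter d (removeLast (a ∷ A)) ((s ∧ a) ∷ S) ≡ (s ∧ a) ∷ S
  iter-idle d = iter-fix (removeLast (a ∷ A)) d again
... | suc m = trans (iter-cons d a s A (removeLast A S))
                (cong (λ k → (if k then s else s ∧ a) ∷ iter d (removeLast A) (removeLast A S))
                  (trans (cong (d ≤ᵇ_) (diff-removeLast A S eq)) (lem d m)))
  where
  lem : ∀ d m → (d ≤ᵇ m) ≡ (suc d ≤ᵇ suc m)
  lem zero    m = refl
  lem (suc d) m = refl

at-iter-removeLast : ∀ {n} d (A S : Row n) c →
  at c (iter d (removeLast A) S) ≡ at c S ∧ not (elemᵇ c (drop (diff A S ∸ d) (cd A S)))
at-iter-removeLast d [] [] c with iter d (removeLast []) []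
... | [] = refl
at-iter-removeLast d (a ∷ A) (s ∷ S) c rewrite iter-cons d a s A S = go c
  where
  k = diff A S
  tail-elem : ∀ c w l → elemᵇ (suc c) (drop w (map suc l)) ≡ elemᵇ c (drop w l)
  tail-elem c w l = trans (cong (elemᵇ (suc c)) (drop-map {f = suc} w l)) (elemᵇ-suc c (drop w l))
  go : ∀ c → at c ((if d ≤ᵇ k then s else s ∧ a) ∷ iter d (removeLast A) S)
           ≡ at c (s ∷ S) ∧ not (elemᵇ c (drop (bit (s ∧ not a) + k ∸ d) (consIf (s ∧ not a) (map suc (cd A S)))))
  go (suc c) with s ∧ not a
  ... | false = trans (at-iter-removeLast d A S c) (cong (λ x → at c S ∧ not x) (sym (tail-elem c (k ∸ d) (cd A S))))
  ... | true with ≤-<-connex d k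
  ...   | inj₁ l rewrite +-∸-assoc 1 l = trans (at-iter-removeLast d A S c) (cong (λ x → at c S ∧ not x) (sym (tail-elem c (k ∸ d) (cd A S))))
  ...   | inj₂ l rewrite m≤n⇒m∸n≡0 l = trans (at-iter-removeLast d A S c)
            (cong (λ x → at c S ∧ not x) (trans (cong (λ w → elemᵇ c (drop w (cd A S))) (m≤n⇒m∸n≡0 (<⇒≤ l))) (sym (tail-elem c 0 (cd A S)))))
  go zero with s ∧ not a in eq
  ... | false = trans (lem s a (d ≤ᵇ k) eq) (sym (trans (cong (λ x → s ∧ not x) (trans (cong (elemᵇ 0) (drop-map {f = suc} (k ∸ d) (cd A S))) (elemᵇ-zero (drop (k ∸ d) (cd A S))))) (∧-identityʳ s)))
    where
    lem : ∀ s a x → s ∧ not a ≡ false → (if x then s else s ∧ a) ≡ s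
    lem s     a    true  e = refl
    lem true  true false e = refl
    lem false a    false e = refl
  ... | true with ≤-<-connex d k
  ...   | inj₁ l rewrite +-∸-assoc 1 l | ≤ᵇ-true l =
            sym (trans (cong (λ x → s ∧ not x) (trans (cong (elemᵇ 0) (drop-map {f = suc} (k ∸ d) (cd A S))) (elemᵇ-zero (drop (k ∸ d) (cd A S))))) (∧-identityʳ s))
  ...   | inj₂ l rewrite m≤n⇒m∸n≡0 l | ≤ᵇ-false l = lem s a eq
    where
    lem : ∀ s a → s ∧ not a ≡ true → s ∧ a ≡ s ∧ false
    lem true false e = refl

-- `Tc` removes the last `cnt b ∸ cnt S` idle columns, while `avl` skips the first `uy b S` of them;
-- by `balance` both leave the same set.
at-Tc : ∀ {n} (b S : Row n) c → cnt S ≤ cnt b → at c (Tc b S) ≡ at c b ∧ not (elemᵇ c (avl b S))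
at-Tc b S c h = trans (cong (at c) (iter-F2 (cnt b ∸ cnt S) b S))
  (trans (at-iter-removeLast (cnt b ∸ cnt S) (serve 0 b S) b c) (cong (λ w → at c b ∧ not (elemᵇ c (drop w (idleCols 0 b S)))) w≡))
  where
  ux≡ : ux b S ≡ uy b S + (cnt b ∸ cnt S)
  ux≡ = +-cancelʳ-≡ (cnt S) _ _ (trans (sym (balance b S)) (trans (cong (uy b S +_) (sym (m∸n+n≡m h))) (sym (+-assoc (uy b S) _ (cnt S)))))
  w≡ : diff (serve 0 b S) b ∸ (cnt b ∸ cnt S) ≡ uy b S
  w≡ = trans (cong (_∸ (cnt b ∸ cnt S)) (trans (diff-serve 0 b S) ux≡)) (m+n∸n≡m (uy b S) (cnt b ∸ cnt S))

any-↭ : ∀ {A : Set} (p : A → Bool) {xs ys} → xs ↭ ys → any p xs ≡ any p ys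
any-↭ p _↭_.refl        = refl
any-↭ p (prep x h)      = cong (p x ∨_) (any-↭ p h)
any-↭ p (swap x y h)    = trans (cong (λ b → p x ∨ (p y ∨ b)) (any-↭ p h)) (lem (p x) (p y) _)
  where
  lem : ∀ a b c → a ∨ (b ∨ c) ≡ b ∨ (a ∨ c)
  lem true  true  c = refl
  lem true  false c = refl
  lem false true  c = refl
  lem false false c = refl
any-↭ p (_↭_.trans h k) = trans (any-↭ p h) (any-↭ p k)

-- The FM labelling computes the layers

Ball : Set
Ball = ℕ × ℕ

Sorted : List Ball → Set
Sorted = AllPairs (λ x y → proj₂ y ≤ proj₂ x)

insertBall-↭ : ∀ b bs → insertBall b bs ↭ b ∷ bs
insertBall-↭ b       []               = ↭-refl
insertBall-↭ (c , l) ((c′ , l′) ∷ bs) with (l′ <ᵇ l) ∨ ((l ≡ᵇ l′) ∧ (c ≤ᵇ c′))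
... | true  = ↭-refl
... | false = ↭-trans (prep _ (insertBall-↭ (c , l) bs)) (swap _ _ ↭-refl)

insertBall-sorted : ∀ b bs → Sorted bs → Sorted (insertBall b bs)
insertBall-sorted b       []               _        = [] ∷ []
insertBall-sorted (c , l) ((c′ , l′) ∷ bs) (h ∷ hs) with l′ <ᵇ l in e | (l ≡ᵇ l′) ∧ (c ≤ᵇ c′) in e′
... | true  | _     = (l′≤l ∷ All.map (λ k → ≤-trans k l′≤l) h) ∷ (h ∷ hs)
  where l′≤l = <⇒≤ (<ᵇ⇒< l′ l (subst T (sym e) tt))
... | false | true  = (l′≤l ∷ All.map (λ k → ≤-trans k l′≤l) h) ∷ (h ∷ hs)
  where l′≤l = ≤-reflexive (sym (≡ᵇ⇒≡ l l′ (proj₁ (Equivalence.to T-∧ (subst T (sym e′) tt)))))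
... | false | false = Perm.All-resp-↭ (↭-sym (insertBall-↭ (c , l) bs)) (l≤l′ ∷ h) ∷ insertBall-sorted (c , l) bs hs
  where
  l≤l′ : l ≤ l′
  l≤l′ = ≮⇒≥ λ k → subst T e (<⇒<ᵇ k)

sortBalls-↭ : ∀ bs → sortBalls bs ↭ bs
sortBalls-↭ []       = ↭-refl
sortBalls-↭ (b ∷ bs) = ↭-trans (insertBall-↭ b (sortBalls bs)) (prep b (sortBalls-↭ bs))

sortBalls-sorted : ∀ bs → Sorted (sortBalls bs)
sortBalls-sorted []       = []
sortBalls-sorted (b ∷ bs) = insertBall-sorted b (sortBalls bs) (sortBalls-sorted bs)

at-setCol : ∀ {n} j (P : Row n) c → c < n → at c (setCol j true P) ≡ at c P ∨ (c ≡ᵇ j)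
at-setCol zero    (p ∷ P) zero    l       = sym (lem p)
  where
  lem : ∀ p → p ∨ true ≡ true
  lem true  = refl
  lem false = refl
at-setCol zero    (p ∷ P) (suc c) l       = sym (lem (at c P))
  where
  lem : ∀ p → p ∨ false ≡ p
  lem true  = refl
  lem false = refl
at-setCol (suc j) (p ∷ P) zero    l       = sym (lem p)
  where
  lem : ∀ p → p ∨ false ≡ p
  lem true  = refl
  lem false = refl
at-setCol (suc j) (p ∷ P) (suc c) (s≤s l) = at-setCol j P c l

-- Labels decrease along the sorted list, so the balls above a threshold form a prefix of it. A
-- single pass through the list thus serves all thresholds at once.
insK : ∀ {n} → ℕ → Row n → List Ball → Row n
insK k P []             = P
insK k P ((j , l) ∷ bs) = insK k (if k ≤ᵇ l then setCol j true P else P) bs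

insK-none : ∀ {n} k (P : Row n) bs → All (λ x → proj₂ x < k) bs → insK k P bs ≡ P
insK-none k P []             []       = refl
insK-none k P ((j , l) ∷ bs) (h ∷ hs) rewrite ≤ᵇ-false h = insK-none k P bs hs

hasLabel : ℕ → ℕ → List Ball → Bool
hasLabel k c = any (λ x → (c ≡ᵇ proj₁ x) ∧ (k ≤ᵇ proj₂ x))

at-insK : ∀ {n} k (P : Row n) bs c → c < n → at c (insK k P bs) ≡ at c P ∨ hasLabel k c bs
at-insK k P []             c l = sym (lem (at c P))
  where
  lem : ∀ p → p ∨ false ≡ p
  lem true  = refl
  lem false = refl
at-insK k P ((j , m) ∷ bs) c l with k ≤ᵇ m
... | true  = trans (at-insK k (setCol j true P) bs c l) (trans (cong (_∨ hasLabel k c bs) (at-setCol j P c l)) (lem (at c P) (c ≡ᵇ j) _))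
  where
  lem : ∀ a b d → (a ∨ b) ∨ d ≡ a ∨ ((b ∧ true) ∨ d)
  lem true  b     d = refl
  lem false true  d = refl
  lem false false d = refl
... | false = trans (at-insK k P bs c l) (lem (at c P) (c ≡ᵇ j) _)
  where
  lem : ∀ a b d → a ∨ d ≡ a ∨ ((b ∧ false) ∨ d)
  lem a true  d = refl
  lem a false d = refl

Distinct : List Ball → Set
Distinct = AllPairs (λ x y → proj₁ x ≢ proj₁ y)

hasLabel-absent : ∀ k c bs → All (λ x → c ≢ proj₁ x) bs → hasLabel k c bs ≡ false
hasLabel-absent k c []             []       = refl
hasLabel-absent k c ((j , l) ∷ bs) (h ∷ hs) rewrite ≢⇒≡ᵇ c j h = hasLabel-absent k c bs hs

labelAt≡hasLabel : ∀ k c bs → Distinct bs → (suc k ≤ᵇ labelAt c bs) ≡ hasLabel (suc k) c bs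
labelAt≡hasLabel k c []             []       = refl
labelAt≡hasLabel k c ((j , l) ∷ bs) (h ∷ hs) with c ≡ᵇ j in e
... | false = labelAt≡hasLabel k c bs hs
... | true  = sym (trans (cong ((suc k ≤ᵇ l) ∨_) (hasLabel-absent (suc k) c bs (subst (λ z → All (λ x → z ≢ proj₁ x) bs) (sym (≡ᵇ⇒≡ c j (subst T (sym e) tt))) h)))
                         (lem (suc k ≤ᵇ l)))
  where
  lem : ∀ p → p ∨ false ≡ p
  lem true  = refl
  lem false = refl

removeN-↭ : ∀ k l → Unique l → k ∈ l → k ∷ removeN k l ↭ l
removeN-↭ k (y ∷ l) (h ∷ u) (here refl) rewrite ≡ᵇ-refl k = prep k (↭-reflexive (idle l h))
  where
  idle : ∀ l → All (k ≢_) l → removeN k l ≡ l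
  idle []      []       = refl
  idle (z ∷ l) (h ∷ hs) rewrite ≢⇒≡ᵇ z k (h ∘ sym) = cong (z ∷_) (idle l hs)
removeN-↭ k (y ∷ l) (h ∷ u) (there m) rewrite ≢⇒≡ᵇ y k (All.lookup h m) =
  ↭-trans (swap k y ↭-refl) (prep y (removeN-↭ k l u m))

elemᵇ-removeN : ∀ c k l → elemᵇ c (removeN k l) ≡ elemᵇ c l ∧ not (c ≡ᵇ k)
elemᵇ-removeN c k []      = refl
elemᵇ-removeN c k (y ∷ l) with y ≡ᵇ k in e
... | true  rewrite ≡ᵇ⇒≡ y k (subst T (sym e) tt) = trans (elemᵇ-removeN c k l) (lem (c ≡ᵇ k) (elemᵇ c l))
  where
  lem : ∀ a b → b ∧ not a ≡ (a ∨ b) ∧ not a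
  lem true  true  = refl
  lem true  false = refl
  lem false b     = refl
... | false with c ≡ᵇ y in e′
...   | false = elemᵇ-removeN c k l
...   | true rewrite ≡ᵇ⇒≡ c y (subst T (sym e′) tt) | e = refl

Inc⇒Unique : ∀ {l} → Inc l → Unique l
Inc⇒Unique = AllPairs.map <⇒≢

∈⇒elemᵇ : ∀ c l → c ∈ l → elemᵇ c l ≡ true
∈⇒elemᵇ c (y ∷ l) (here refl) rewrite ≡ᵇ-refl c = refl
∈⇒elemᵇ c (y ∷ l) (there m) with c ≡ᵇ y
... | true  = refl
... | false = ∈⇒elemᵇ c l m

-- The `maj` weight of a wrapping pairing, written as the number of thresholds that see it.
count≤ : ∀ N r l → r ≤ l → l < r + N → sum (applyUpTo (λ i → bit (r + i ≤ᵇ l)) N) ≡ suc (l ∸ r)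
count≤ zero    r l h k = contradiction (≤-trans (s≤s h) (≤-trans k (≤-reflexive (+-identityʳ r)))) (<-irrefl refl)
count≤ (suc N) r l h k rewrite +-identityʳ r | ≤ᵇ-true h with m≤n⇒m<n∨m≡n h
... | inj₁ lt = cong suc (trans (cong sum (applyUpTo-cong (λ i → cong (λ m → bit (m ≤ᵇ l)) (+-suc r i)) N))
                  (trans (count≤ N (suc r) l lt (subst (l <_) (+-suc r N) k)) (trans (sym (+-∸-assoc 1 lt)) refl)))
... | inj₂ refl = cong suc (trans (zeros N 0) (sym (n∸n≡0 l)))
  where
  zeros : ∀ N d → sum (applyUpTo (λ i → bit (l + suc (d + i) ≤ᵇ l)) N) ≡ 0
  zeros zero    d = refl
  zeros (suc N) d rewrite ≤ᵇ-false {l + suc (d + 0)} {l} (m<m+n l z<s) =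
    trans (cong sum (applyUpTo-cong (λ i → cong (λ m → bit (l + suc m ≤ᵇ l)) (+-suc d i)) N)) (zeros N (suc d))

sum-applyUpTo-+ : ∀ (f g : ℕ → ℕ) N → sum (applyUpTo (λ i → f i + g i) N) ≡ sum (applyUpTo f N) + sum (applyUpTo g N)
sum-applyUpTo-+ f g zero    = refl
sum-applyUpTo-+ f g (suc N) = trans (cong (f 0 + g 0 +_) (sum-applyUpTo-+ (f ∘ suc) (g ∘ suc) N)) (interchange (f 0) (g 0) _ _)

sum-applyUpTo-0 : ∀ N → sum (applyUpTo (λ _ → 0) N) ≡ 0
sum-applyUpTo-0 zero    = refl
sum-applyUpTo-0 (suc N) = sum-applyUpTo-0 N

module Pairing {n : ℕ} (b : Row n) (r N : ℕ) where

  record Input (bs : List Ball) (P : Row n) : Set where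
    field
      fresh    : All (λ x → proj₁ x < n × at (proj₁ x) P ≡ false) bs
      distinct : Distinct bs
      sorted   : Sorted bs
      room     : length bs ≤ length (avl b P)
      range    : All (λ x → r ≤ proj₂ x × proj₂ x < r + N) bs

  -- An invariant for all thresholds simultaneously. `wraps k` counts the wrapping pairings among
  -- balls with label at least `k`; summed over the thresholds it gives the weights in `maj`. By
  -- `label`, a column exceeds a threshold exactly when the balls above this threshold have used it
  -- up.
  record Spec (bs : List Ball) (P : Row n) (avail : List ℕ) (asg : List Ball) (m : ℕ)
              (out : List Ball × List ℕ × ℕ) : Set where
    private
      asg′ = proj₁ out
    field
      label  : ∀ k c → (suc k ≤ᵇ labelAt c asg′) ≡
               (if elemᵇ c avail then not (elemᵇ c (avl b (insK (suc k) P bs))) else (suc k ≤ᵇ labelAt c asg))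
      sub    : ∀ k c → elemᵇ c (avl b (insK k P bs)) ≡ true → elemᵇ c avail ≡ true
      perm   : map proj₁ asg′ ++ proj₁ (proj₂ out) ↭ map proj₁ asg ++ avail
      range′ : All (λ x → r ≤ proj₂ x × proj₂ x < r + N) asg → All (λ x → r ≤ proj₂ x × proj₂ x < r + N) asg′
      wraps  : ℕ → ℕ
      uy≡    : ∀ k → uy b (insK k P bs) ≡ uy b P + wraps k
      maj≡   : proj₂ (proj₂ out) ≡ m + sum (applyUpTo (λ i → wraps (r + i)) N)

  input-tail : ∀ {j l bs P} → Input ((j , l) ∷ bs) P → length bs ≤ length (avl b (setCol j true P)) →
               Input bs (setCol j true P)
  input-tail {j} {l} {bs} {P} I h = record
    { fresh    = All.zipWith (λ { ((c<n , e) , d) → c<n , trans (at-setCol j P _ c<n) (cong₂ _∨_ e (≢⇒≡ᵇ _ j (d ∘ sym))) })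
                   (All.tail fresh , AllPairs.head distinct)
    ; distinct = AllPairs.tail distinct
    ; sorted   = AllPairs.tail sorted
    ; room     = h
    ; range    = All.tail range }
    where open Input I

  room′ : ∀ {j l bs P avail κ} → κ ∈ avail → avail ≡ avl b P → Input ((j , l) ∷ bs) P →
          avl b (setCol j true P) ≡ removeN κ avail → length bs ≤ length (avl b (setCol j true P))
  room′ {P = P} {avail} {κ} κ∈ av≡ I e = s≤s⁻¹ (≤-trans (Input.room I) (≤-reflexive
    (trans (cong length (sym av≡)) (trans (sym (Perm.↭-length (removeN-↭ κ avail (subst Unique (sym av≡) (Inc⇒Unique (Inc-avl b P))) κ∈)))
           (cong (suc ∘ length) (sym e))))))

  dis-step : ∀ avail asg {l} κ → (∀ c → elemᵇ c avail ≡ true → labelAt c asg ≡ 0) →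
             ∀ c → elemᵇ c (removeN κ avail) ≡ true → labelAt c ((κ , l) ∷ asg) ≡ 0
  dis-step avail asg κ dis c e with trans (sym (elemᵇ-removeN c κ avail)) e
  ... | g with elemᵇ c avail in a | c ≡ᵇ κ
  ...   | true | false = dis c a

  step : ∀ {j l bs P avail asg m} κ δ out → Input ((j , l) ∷ bs) P → avail ≡ avl b P →
         κ ∈ avail → avl b (setCol j true P) ≡ removeN κ avail → uy b (setCol j true P) ≡ uy b P + bit δ →
         Spec bs (setCol j true P) (removeN κ avail) ((κ , l) ∷ asg) (if δ then m + suc (l ∸ r) else m) out →
         Spec ((j , l) ∷ bs) P avail asg m out
  step {j} {l} {bs} {P} {avail} {asg} {m} κ δ out I av≡ κ∈ avl≡ uyδ S = record
    { label  = label′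
    ; sub    = sub′
    ; perm   = ↭-trans S.perm (↭-trans (↭-sym (Perm.shift κ (map proj₁ asg) (removeN κ avail))) (Perm.++⁺ˡ (map proj₁ asg) (removeN-↭ κ avail uniq κ∈)))
    ; range′ = λ h → S.range′ (All.head range ∷ h)
    ; wraps  = λ k → (if k ≤ᵇ l then bit δ else 0) + S.wraps k
    ; uy≡    = uy≡′
    ; maj≡   = maj≡′ }
    where
    open Input I
    module S = Spec S
    uniq : Unique avail
    uniq = subst Unique (sym av≡) (Inc⇒Unique (Inc-avl b P))
    -- Sortedness: once a label falls below the threshold, all later ones do, and the corresponding
    -- row stops growing.
    low : ∀ {k} → l < k → All (λ x → proj₂ x < k) bs
    low h = All.map (λ g → ≤-<-trans g h) (AllPairs.head sorted)
    label′ : ∀ k₀ c → (suc k₀ ≤ᵇ labelAt c (proj₁ out)) ≡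
             (if elemᵇ c avail then not (elemᵇ c (avl b (insK (suc k₀) P ((j , l) ∷ bs)))) else (suc k₀ ≤ᵇ labelAt c asg))
    label′ k₀ c = trans (S.label k₀ c) (trans (cong (λ x → if x then not (elemᵇ c (avl b (insK (suc k₀) (setCol j true P) bs)))
                                                                else (suc k₀ ≤ᵇ labelAt c ((κ , l) ∷ asg))) (elemᵇ-removeN c κ avail)) go)
      where
      k = suc k₀
      go : (if elemᵇ c avail ∧ not (c ≡ᵇ κ) then not (elemᵇ c (avl b (insK k (setCol j true P) bs))) else (k ≤ᵇ (if c ≡ᵇ κ then l else labelAt c asg)))
         ≡ (if elemᵇ c avail then not (elemᵇ c (avl b (insK k P ((j , l) ∷ bs)))) else (k ≤ᵇ labelAt c asg))
      go with c ≡ᵇ κ in e | elemᵇ c avail in a | k ≤ᵇ l in kl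
      ... | false | false | _     = refl
      ... | false | true  | true  = refl
      ... | false | true  | false
        rewrite insK-none k (setCol j true P) bs (low (≤ᵇ-false⁻ kl)) | insK-none k P bs (low (≤ᵇ-false⁻ kl)) | avl≡ | sym av≡
              | elemᵇ-removeN c κ avail | a | e = refl
      ... | true  | false | _     = contradiction (trans (sym a) (subst (λ z → elemᵇ z avail ≡ true) (sym (≡ᵇ⇒≡ c κ (subst T (sym e) tt))) (∈⇒elemᵇ κ avail κ∈))) λ ()
      ... | true  | true  | true  with elemᵇ c (avl b (insK k (setCol j true P) bs)) in g
      ...   | false = kl
      ...   | true  = contradiction (trans (sym (S.sub k c g)) (trans (elemᵇ-removeN c κ avail) (trans (cong (λ x → elemᵇ c avail ∧ not x) e) (∧-zeroʳ _)))) λ ()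
      go | true | true | false rewrite insK-none k P bs (low (≤ᵇ-false⁻ kl)) | sym av≡ | a = kl
    sub′ : ∀ k c → elemᵇ c (avl b (insK k P ((j , l) ∷ bs))) ≡ true → elemᵇ c avail ≡ true
    sub′ k c g with k ≤ᵇ l in kl
    ... | true  = lem (elemᵇ c avail) (trans (sym (elemᵇ-removeN c κ avail)) (S.sub k c g))
      where
      lem : ∀ x {y} → x ∧ y ≡ true → x ≡ true
      lem true e = refl
    ... | false = trans (cong (elemᵇ c) av≡) (trans (cong (λ Q → elemᵇ c (avl b Q)) (sym (insK-none k P bs (low (≤ᵇ-false⁻ kl))))) g)
    uy≡′ : ∀ k → uy b (insK k P ((j , l) ∷ bs)) ≡ uy b P + ((if k ≤ᵇ l then bit δ else 0) + S.wraps k)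
    uy≡′ k with k ≤ᵇ l in kl
    ... | true  = trans (S.uy≡ k) (trans (cong (_+ S.wraps k) uyδ) (+-assoc (uy b P) (bit δ) (S.wraps k)))
    ... | false = trans (cong (uy b) (insK-none k P bs (low (≤ᵇ-false⁻ kl)))) (trans (sym (+-identityʳ (uy b P))) (cong (uy b P +_) (sym w≡0)))
      where
      w≡0 : S.wraps k ≡ 0
      w≡0 = +-cancelˡ-≡ (uy b (setCol j true P)) _ _ (trans (sym (S.uy≡ k)) (trans (cong (uy b) (insK-none k (setCol j true P) bs (low (≤ᵇ-false⁻ kl)))) (sym (+-identityʳ _))))
    maj≡′ : proj₂ (proj₂ out) ≡ m + sum (applyUpTo (λ i → (if r + i ≤ᵇ l then bit δ else 0) + S.wraps (r + i)) N)
    maj≡′ = trans S.maj≡ (trans (lem δ) (trans (+-assoc m _ _) (cong (m +_) (sym (sum-applyUpTo-+ _ _ N)))))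
      where
      lem : ∀ δ → (if δ then m + suc (l ∸ r) else m) + sum (applyUpTo (λ i → S.wraps (r + i)) N)
          ≡ (m + sum (applyUpTo (λ i → if r + i ≤ᵇ l then bit δ else 0) N)) + sum (applyUpTo (λ i → S.wraps (r + i)) N)
      lem true  = cong (λ z → (m + z) + sum (applyUpTo (λ i → S.wraps (r + i)) N))
                    (trans (sym (count≤ N r l (proj₁ (All.head range)) (proj₂ (All.head range)))) (cong sum (applyUpTo-cong (λ i → bit-if (r + i ≤ᵇ l)) N)))
        where
        bit-if : ∀ x → bit x ≡ (if x then 1 else 0)
        bit-if true  = refl
        bit-if false = refl
      lem false = cong (_+ sum (applyUpTo (λ i → S.wraps (r + i)) N)) (trans (sym (+-identityʳ m)) (cong (m +_) (sym
                    (trans (cong sum (applyUpTo-cong (λ i → if-same (r + i ≤ᵇ l)) N)) (sum-applyUpTo-0 N)))))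
        where
        if-same : ∀ x → (if x then 0 else 0) ≡ 0
        if-same true  = refl
        if-same false = refl

  pairRow-spec : ∀ bs P avail asg m → avail ≡ avl b P → (∀ c → elemᵇ c avail ≡ true → labelAt c asg ≡ 0) →
                 Input bs P → Spec bs P avail asg m (pairRow r bs avail asg m)
  pairRow-spec [] P avail asg m av≡ dis I = record
    { label  = lab
    ; sub    = λ k c e → trans (cong (elemᵇ c) av≡) e
    ; perm   = ↭-refl
    ; range′ = id
    ; wraps  = λ _ → 0
    ; uy≡    = λ k → sym (+-identityʳ (uy b P))
    ; maj≡   = sym (trans (cong (m +_) (sum-applyUpTo-0 N)) (+-identityʳ m)) }
    where
    lab : ∀ k c → (suc k ≤ᵇ labelAt c asg) ≡ (if elemᵇ c avail then not (elemᵇ c (avl b P)) else (suc k ≤ᵇ labelAt c asg))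
    lab k c with elemᵇ c avail in e
    ... | false = refl
    ... | true  rewrite dis c e | sym av≡ | e = refl
  pairRow-spec ((j , l) ∷ bs) P avail asg m av≡ dis I with firstGE j avail in e
  ... | just κ = step κ false _ I av≡ κ∈ avl′ (trans (proj₂ d) (sym (+-identityʳ _)))
                   (pairRow-spec bs (setCol j true P) (removeN κ avail) ((κ , l) ∷ asg) m (sym avl′) (dis-step avail asg κ dis) (input-tail I (room′ κ∈ av≡ I avl′)))
    where
    κ∈ = proj₂ (firstGE-≥ j avail e)
    d = let f = All.head (Input.fresh I) in avl-direct b P j (proj₁ f) (proj₂ f) (trans (cong (firstGE j) (sym av≡)) e)
    avl′ = trans (proj₁ d) (cong (removeN κ) (sym av≡))
  pairRow-spec ((j , l) ∷ bs) P [] asg m av≡ dis I | nothing =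
    contradiction (≤-trans (Input.room I) (≤-reflexive (cong length (sym av≡)))) λ ()
  pairRow-spec ((j , l) ∷ bs) P (κ ∷ av) asg m av≡ dis I | nothing =
    step κ true _ I av≡ (here refl) avl′ (trans (proj₂ d) (+-comm 1 _))
      (pairRow-spec bs (setCol j true P) (removeN κ (κ ∷ av)) ((κ , l) ∷ asg) (m + suc (l ∸ r)) (sym avl′) (dis-step (κ ∷ av) asg κ dis) (input-tail I (room′ (here refl) av≡ I avl′)))
    where
    d = let f = All.head (Input.fresh I) in avl-wrap b P j (proj₁ f) (proj₂ f) (trans (cong (firstGE j) (sym av≡)) e) (sym av≡)
    avl′ = trans (proj₁ d) (cong (removeN κ) (sym av≡))

lvec : ∀ n → (ℕ → ℕ) → Vec ℕ n
lvec zero    g = []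
lvec (suc n) g = g 0 ∷ lvec n (g ∘ suc)

toList-lvec : ∀ n g → toList (lvec n g) ≡ applyUpTo g n
toList-lvec zero    g = refl
toList-lvec (suc n) g = cong (g 0 ∷_) (toList-lvec n (g ∘ suc))

at-map-lvec : ∀ n (f : ℕ → Bool) g c → c < n → at c (Vec.map f (lvec n g)) ≡ f (g c)
at-map-lvec (suc n) f g zero    l       = refl
at-map-lvec (suc n) f g (suc c) (s≤s l) = at-map-lvec n f (g ∘ suc) c l

row-ext : ∀ {n} (A B : Row n) → (∀ c → c < n → at c A ≡ at c B) → A ≡ B
row-ext []      []      h = refl
row-ext (a ∷ A) (b ∷ B) h = cong₂ _∷_ (h 0 z<s) (row-ext A B (λ c l → h (suc c) (s<s l)))

labelAt-≥ : ∀ k c bs → All (λ x → suc k ≤ proj₂ x) bs → (suc k ≤ᵇ labelAt c bs) ≡ elemᵇ c (map proj₁ bs)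
labelAt-≥ k c []             []       = refl
labelAt-≥ k c ((j , l) ∷ bs) (h ∷ hs) with c ≡ᵇ j
... | true  = ≤ᵇ-true h
... | false = labelAt-≥ k c bs hs

labelAt-++-low : ∀ k c r l xs → r ≤ k → (suc k ≤ᵇ labelAt c (xs ++ map (λ d → d , r) l)) ≡ (suc k ≤ᵇ labelAt c xs)
labelAt-++-low k c r []      [] h = refl
labelAt-++-low k c r (d ∷ l) [] h with c ≡ᵇ d
... | true  = ≤ᵇ-false (s≤s h)
... | false = labelAt-++-low k c r l [] h
labelAt-++-low k c r l ((j , m) ∷ xs) h with c ≡ᵇ j
... | true  = refl
... | false = labelAt-++-low k c r l xs h

cols-< : ∀ {n} (B : Row n) → All (_< n) (cols B)
cols-< []          = []
cols-< (true ∷ B)  = subst (All (_< _)) (sym (cols-true B)) (z<s ∷ All.map⁺ (All.map s<s (cols-< B)))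
cols-< (false ∷ B) = subst (All (_< _)) (sym (cols-false B)) (All.map⁺ (All.map s<s (cols-< B)))

Inc-cols : ∀ {n} (B : Row n) → Inc (cols B)
Inc-cols B = subst Inc (serve-empty B) (Inc-cd (serve 0 B (Vec.replicate _ false)) B)

Unique-↭ : ∀ {A : Set} {xs ys : List A} → xs ↭ ys → Unique xs → Unique ys
Unique-↭ _↭_.refl        u                    = u
Unique-↭ (prep x h)      (a ∷ u)              = Perm.All-resp-↭ h a ∷ Unique-↭ h u
Unique-↭ (swap x y h)    ((n ∷ a) ∷ (b ∷ u))  = ((n ∘ sym) ∷ Perm.All-resp-↭ h b) ∷ (Perm.All-resp-↭ h a ∷ Unique-↭ h u)
Unique-↭ (_↭_.trans h k) u                    = Unique-↭ k (Unique-↭ h u)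

Tc-⊑ : ∀ {n} (b t : Row n) → Tc b t ⊑ b
Tc-⊑ b t = subst (_⊑ b) (sym (iter-F2 (cnt b ∸ cnt t) b t)) (iter-removeLast-⊑ (cnt b ∸ cnt t) (serve 0 b t) b)

layM-⊑ : ∀ {n} (r : Row n) M → All (_⊑ r) (layM (r ∷ M))
layM-⊑ r M = ⊑-refl r ∷ All.map⁺ (All.universal (Tc-⊑ r) (layM M))

-- `suc r₀` is the index of the row `u` just labelled, hence its smallest possible label. The
-- thresholds from there upwards cut the layers out of the labels.
record FMInv {n : ℕ} (r₀ : ℕ) (u : Row n) (U : Config n) (lab : List Ball) (m : ℕ) : Set where
  field
    perm   : map proj₁ lab ↭ cols u
    range  : All (λ x → suc r₀ ≤ proj₂ x × proj₂ x < suc r₀ + suc (length U)) lab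
    layers : layM (u ∷ U) ≡ applyUpTo (λ i → Vec.map (suc r₀ + i ≤ᵇ_) (lvec n (λ c → labelAt c lab))) (suc (length U))
    maj≡   : m ≡ majM (u ∷ U)

applyUpTo-cong< : ∀ {A : Set} {f g : ℕ → A} k → (∀ j → j < k → f j ≡ g j) → applyUpTo f k ≡ applyUpTo g k
applyUpTo-cong< zero    e = refl
applyUpTo-cong< (suc k) e = cong₂ _∷_ (e 0 z<s) (applyUpTo-cong< k (λ j l → e (suc j) (s<s l)))

module FMStep {n : ℕ} (r₀ : ℕ) (u : Row n) (U : Config n) (lab : List Ball) (m : ℕ)
              (I : FMInv (suc r₀) u U lab m) (B : Row n) (u≤B : cnt u ≤ cnt B) where

  open FMInv I
  r = suc (suc r₀)
  N = suc (length U)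
  bs = sortBalls lab
  O = Vec.replicate n false
  open Pairing B r N

  lab↭ : lab ↭ bs
  lab↭ = ↭-sym (sortBalls-↭ lab)

  bs-cols : map proj₁ bs ↭ cols u
  bs-cols = ↭-trans (Perm.map⁺ proj₁ (sortBalls-↭ lab)) perm

  distinct-bs : Distinct bs
  distinct-bs = APP.map⁻ (Unique-↭ (↭-sym bs-cols) (Inc⇒Unique (Inc-cols u)))

  distinct-lab : Distinct lab
  distinct-lab = APP.map⁻ (Unique-↭ (↭-sym perm) (Inc⇒Unique (Inc-cols u)))

  input : Input bs O
  input = record
    { fresh    = All.map (λ l → l , at-zeros n _) (All.map⁻ (Perm.All-resp-↭ (↭-sym bs-cols) (cols-< u)))
    ; distinct = distinct-bs
    ; sorted   = sortBalls-sorted lab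
    ; room     = ≤-trans (≤-reflexive (trans (sym (length-map proj₁ bs)) (trans (Perm.↭-length bs-cols) (length-cols u))))
                   (≤-trans u≤B (≤-reflexive (trans (sym (length-cols B)) (cong length (sym (avl-empty B))))))
    ; range    = Perm.All-resp-↭ lab↭ range }

  out = pairRow r bs (cols B) [] m
  spec : Spec bs O (cols B) [] m out
  spec = pairRow-spec bs O (cols B) [] m (sym (avl-empty B)) (λ _ _ → refl) input
  module S = Spec spec

  lab′ : List Ball
  lab′ = proj₁ out ++ map (λ c → c , suc r₀) (proj₁ (proj₂ out))

  layer : ℕ → Row n
  layer k = Vec.map (k ≤ᵇ_) (lvec n (λ c → labelAt c lab))

  insK≡layer : ∀ k → insK (suc k) O bs ≡ layer (suc k)
  insK≡layer k = row-ext _ _ λ c l → begin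
    at c (insK (suc k) O bs)             ≡⟨ at-insK (suc k) O bs c l ⟩
    at c O ∨ hasLabel (suc k) c bs       ≡⟨ cong (_∨ hasLabel (suc k) c bs) (at-zeros n c) ⟩
    hasLabel (suc k) c bs                ≡⟨ any-↭ _ (sortBalls-↭ lab) ⟩
    hasLabel (suc k) c lab               ≡⟨ labelAt≡hasLabel k c lab distinct-lab ⟨
    (suc k ≤ᵇ labelAt c lab)             ≡⟨ at-map-lvec n (suc k ≤ᵇ_) (λ d → labelAt d lab) c l ⟨
    at c (layer (suc k))                 ∎
    where open ≡-Reasoning

  layer≤ : ∀ i → i < N → cnt (layer (r + i)) ≤ cnt B
  layer≤ i l = ≤-trans (≼-cnt _ u (⊑⇒≼ _ u (All.lookup (layM-⊑ u U) (subst (layer (r + i) ∈_) (sym layers) (∈-applyUpTo⁺ (λ j → layer (r + j)) l))))) u≤B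

  perm′ : map proj₁ lab′ ↭ cols B
  perm′ = ↭-trans (↭-reflexive (trans (map-++ proj₁ (proj₁ out) _) (cong (map proj₁ (proj₁ out) ++_) (trans (sym (map-∘ (proj₁ (proj₂ out)))) (map-id _))))) S.perm

  range″ : All (λ x → suc r₀ ≤ proj₂ x × proj₂ x < suc r₀ + suc (suc (length U))) lab′
  range″ = All.++⁺ (All.map (λ { (a , b) → ≤-trans (n≤1+n _) a , ≤-trans b (≤-reflexive (sym (+-suc (suc r₀) N))) }) (S.range′ []))
                   (All.map⁺ (All.universal (λ _ → ≤-refl , m<m+n (suc r₀) z<s) (proj₁ (proj₂ out))))

  bottom : Vec.map (suc r₀ + 0 ≤ᵇ_) (lvec n (λ c → labelAt c lab′)) ≡ B
  bottom = row-ext _ B λ c l → begin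
    at c (Vec.map (suc r₀ + 0 ≤ᵇ_) (lvec n (λ c → labelAt c lab′))) ≡⟨ at-map-lvec n _ (λ d → labelAt d lab′) c l ⟩
    (suc r₀ + 0 ≤ᵇ labelAt c lab′)                                  ≡⟨ cong (_≤ᵇ labelAt c lab′) (+-identityʳ (suc r₀)) ⟩
    (suc r₀ ≤ᵇ labelAt c lab′)                                      ≡⟨ labelAt-≥ r₀ c lab′ (All.map proj₁ range″) ⟩
    elemᵇ c (map proj₁ lab′)                                        ≡⟨ any-↭ (c ≡ᵇ_) perm′ ⟩
    elemᵇ c (cols B)                                                ≡⟨ elemᵇ-cols c B ⟩
    at c B                                                          ∎
    where open ≡-Reasoning

  paired : ∀ i → i < N → Tc B (layer (r + i)) ≡ Vec.map (suc r₀ + suc i ≤ᵇ_) (lvec n (λ c → labelAt c lab′))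
  paired i i<N = row-ext _ _ λ c l → begin
    at c (Tc B (layer (r + i)))                                   ≡⟨ at-Tc B (layer (r + i)) c (layer≤ i i<N) ⟩
    at c B ∧ not (elemᵇ c (avl B (layer (r + i))))                ≡⟨ cong (λ S → at c B ∧ not (elemᵇ c (avl B S))) (insK≡layer (suc r₀ + i)) ⟨
    at c B ∧ not (elemᵇ c (avl B (insK (r + i) O bs)))            ≡⟨ cong (λ x → x ∧ not (elemᵇ c (avl B (insK (r + i) O bs)))) (elemᵇ-cols c B) ⟨
    elemᵇ c (cols B) ∧ not (elemᵇ c (avl B (insK (r + i) O bs)))  ≡⟨ if-∧ (elemᵇ c (cols B)) ⟨
    (if elemᵇ c (cols B) then not (elemᵇ c (avl B (insK (r + i) O bs))) else false)
                                                                  ≡⟨ S.label (suc r₀ + i) c ⟨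
    (r + i ≤ᵇ labelAt c (proj₁ out))                              ≡⟨ labelAt-++-low (suc r₀ + i) c (suc r₀) (proj₁ (proj₂ out)) (proj₁ out) (m≤m+n (suc r₀) i) ⟨
    (r + i ≤ᵇ labelAt c lab′)                                     ≡⟨ cong (_≤ᵇ labelAt c lab′) (+-suc (suc r₀) i) ⟨
    (suc r₀ + suc i ≤ᵇ labelAt c lab′)                            ≡⟨ at-map-lvec n _ (λ d → labelAt d lab′) c l ⟨
    at c (Vec.map (suc r₀ + suc i ≤ᵇ_) (lvec n (λ c → labelAt c lab′))) ∎
    where
    open ≡-Reasoning
    if-∧ : ∀ x {y} → (if x then y else false) ≡ x ∧ y
    if-∧ true  = refl
    if-∧ false = refl

  next : FMInv r₀ B (u ∷ U) lab′ (proj₂ (proj₂ out))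
  next = record
    { perm   = perm′
    ; range  = range″
    ; layers = cong₂ _∷_ (sym bottom) (trans (cong (map (Tc B)) layers) (trans (map-applyUpTo (λ i → layer (r + i)) (Tc B) N) (applyUpTo-cong< N paired)))
    ; maj≡   = trans S.maj≡ (cong₂ _+_ maj≡ (trans (cong sum (applyUpTo-cong wr N))
                 (trans (cong sum (sym (map-applyUpTo (λ i → layer (r + i)) (uy B) N))) (cong (sum ∘ map (uy B)) (sym layers))))) }
    where
    wr : ∀ i → S.wraps (r + i) ≡ uy B (layer (r + i))
    wr i = sym (trans (cong (uy B) (sym (insK≡layer (suc r₀ + i)))) (trans (S.uy≡ (r + i)) (cong (_+ S.wraps (r + i)) (ux-empty B))))

Decr : ∀ {n} → Config n → Set
Decr = AllPairs (λ a b → cnt b ≤ cnt a)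

fmGo-inv : ∀ {n} (rest : List (Row n)) (u : Row n) U lab m → FMInv (length rest) u U lab m →
           All (λ B → cnt u ≤ cnt B) rest → AllPairs (λ a b → cnt a ≤ cnt b) rest →
           ∃ λ u′ → ∃ λ U′ → reverse rest ++ (u ∷ U) ≡ u′ ∷ U′ ×
             FMInv 0 u′ U′ (proj₁ (fmGo (suc (length rest)) lab rest m)) (proj₂ (fmGo (suc (length rest)) lab rest m))
fmGo-inv []         u U lab m I _        _        = u , U , refl , I
fmGo-inv (B ∷ rest) u U lab m I (h ∷ hs) (k ∷ ks)
  with fmGo-inv rest B (u ∷ U) _ _ (FMStep.next (length rest) u U lab m I B h) k ks
... | u′ , U′ , e , J = u′ , U′ , trans (cong (_++ (u ∷ U)) (unfold-reverse B rest)) (trans (++-assoc (reverse rest) (B ∷ []) (u ∷ U)) e) , J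

AllPairs-reverse : ∀ {A : Set} {R : A → A → Set} (xs : List A) → AllPairs R xs → AllPairs (λ a b → R b a) (reverse xs)
AllPairs-reverse []       []       = []
AllPairs-reverse (x ∷ xs) (h ∷ hs) =
  subst (AllPairs _) (sym (unfold-reverse x xs))
    (APP.++⁺ (AllPairs-reverse xs hs) ([] ∷ []) (All.map (λ r → r ∷ []) (Perm.All-resp-↭ (↭-sym (Perm.↭-reverse xs)) h)))

cs-levels : ∀ n L (g : ℕ → ℕ) → (∀ c → g c ≤ L) → cs (applyUpTo (λ i → Vec.map (suc i ≤ᵇ_) (lvec n g)) L) ≡ lvec n g
cs-levels n zero    g h = zero-vec n g (λ c → n≤0⇒n≡0 (h c))
  where
  zero-vec : ∀ n (g : ℕ → ℕ) → (∀ c → g c ≡ 0) → Vec.replicate n 0 ≡ lvec n g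
  zero-vec zero    g e = refl
  zero-vec (suc n) g e = cong₂ _∷_ (sym (e 0)) (zero-vec n (g ∘ suc) (e ∘ suc))
cs-levels n (suc L) g h = trans (cong (λ l → Vec.zipWith (λ p k → bit p + k) (Vec.map (1 ≤ᵇ_) (lvec n g)) (cs l)) (applyUpTo-cong (λ i → shift n i g) L))
  (trans (cong (Vec.zipWith (λ p k → bit p + k) (Vec.map (1 ≤ᵇ_) (lvec n g))) (cs-levels n L (pred ∘ g) (λ c → pred-mono-≤ (h c)))) (add n g))
  where
  shift : ∀ n i (g : ℕ → ℕ) → Vec.map (suc (suc i) ≤ᵇ_) (lvec n g) ≡ Vec.map (suc i ≤ᵇ_) (lvec n (pred ∘ g))
  shift zero    i g = refl
  shift (suc n) i g = cong₂ _∷_ (lem (g 0)) (shift n i (g ∘ suc))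
    where
    lem : ∀ x → (suc (suc i) ≤ᵇ x) ≡ (suc i ≤ᵇ pred x)
    lem zero    = refl
    lem (suc x) = refl
  add : ∀ n (g : ℕ → ℕ) → Vec.zipWith (λ p k → bit p + k) (Vec.map (1 ≤ᵇ_) (lvec n g)) (lvec n (pred ∘ g)) ≡ lvec n g
  add zero    g = refl
  add (suc n) g = cong₂ _∷_ (lem (g 0)) (add n (g ∘ suc))
    where
    lem : ∀ x → bit (1 ≤ᵇ x) + pred x ≡ x
    lem zero    = refl
    lem (suc x) = refl

labelAt-≤ : ∀ {L} c bs → All (λ x → proj₂ x ≤ L) bs → labelAt c bs ≤ L
labelAt-≤ c []             []       = z≤n
labelAt-≤ c ((j , l) ∷ bs) (h ∷ hs) with c ≡ᵇ j
... | true  = h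
... | false = labelAt-≤ c bs hs

fm-start : ∀ {n} l (top : Row n) → FMInv l top [] (map (λ c → c , suc l) (cols top)) 0
fm-start {n} l top = record
  { perm   = ↭-reflexive cols≡
  ; range  = rng
  ; layers = cong (_∷ []) (row-ext top _ λ c c<n → sym (begin
      at c (Vec.map (suc l + 0 ≤ᵇ_) (lvec n (λ c → labelAt c lab₀))) ≡⟨ at-map-lvec n _ (λ d → labelAt d lab₀) c c<n ⟩
      (suc l + 0 ≤ᵇ labelAt c lab₀)  ≡⟨ cong (_≤ᵇ labelAt c lab₀) (+-identityʳ (suc l)) ⟩
      (suc l ≤ᵇ labelAt c lab₀)      ≡⟨ labelAt-≥ l c lab₀ (All.map proj₁ rng) ⟩
      elemᵇ c (map proj₁ lab₀)       ≡⟨ cong (elemᵇ c) cols≡ ⟩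
      elemᵇ c (cols top)             ≡⟨ elemᵇ-cols c top ⟩
      at c top                       ∎))
  ; maj≡   = refl }
  where
  open ≡-Reasoning
  lab₀ = map (λ c → c , suc l) (cols top)
  cols≡ : map proj₁ lab₀ ≡ cols top
  cols≡ = trans (sym (map-∘ (cols top))) (map-id (cols top))
  rng : All (λ x → suc l ≤ proj₂ x × proj₂ x < suc l + 1) lab₀
  rng = All.map⁺ (All.universal (λ _ → ≤-refl , m<m+n (suc l) z<s) (cols top))

fm-spec′ : ∀ {n} (M : MLQ n) top rest L → reverse M ≡ top ∷ rest → L ≡ suc (length rest) → Decr M →
           let out = fmGo L (map (λ c → c , L) (cols top)) rest 0 in
           map (λ c → labelAt c (proj₁ out)) (upTo n) ≡ toList (cs (layM M)) × proj₂ out ≡ majM M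
fm-spec′ {n} M top rest .(suc (length rest)) e refl d with subst (AllPairs _) e (AllPairs-reverse M d)
... | h ∷ hs with fmGo-inv rest top [] (map (λ c → c , suc (length rest)) (cols top)) 0 (fm-start (length rest) top) h hs
...   | u , U , eq , J = (begin
  map (λ c → labelAt c out) (upTo n)         ≡⟨ map-upTo (λ c → labelAt c out) n ⟩
  applyUpTo (λ c → labelAt c out) n          ≡⟨ toList-lvec n (λ c → labelAt c out) ⟨
  toList (lvec n (λ c → labelAt c out))      ≡⟨ cong toList (cs-levels n (suc (length U)) (λ c → labelAt c out)
                                                  (λ c → labelAt-≤ c out (All.map (λ x → s≤s⁻¹ (proj₂ x)) (FMInv.range J)))) ⟨
  toList (cs (applyUpTo (λ i → Vec.map (suc i ≤ᵇ_) (lvec n (λ c → labelAt c out))) (suc (length U)))) ≡⟨ cong (toList ∘ cs) (FMInv.layers J) ⟨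
  toList (cs (layM (u ∷ U)))                 ≡⟨ cong (toList ∘ cs ∘ layM) M≡ ⟨
  toList (cs (layM M))                       ∎) , trans (FMInv.maj≡ J) (cong majM (sym M≡))
  where
  open ≡-Reasoning
  out = proj₁ (fmGo (suc (length rest)) (map (λ c → c , suc (length rest)) (cols top)) rest 0)
  M≡ : M ≡ u ∷ U
  M≡ = trans (sym (reverse-involutive M)) (trans (cong reverse e) (trans (unfold-reverse top rest) eq))

fm-spec : ∀ {n} (M : MLQ n) → Decr M → typeM M ≡ toList (cs (layM M)) × maj M ≡ majM M
fm-spec {n} M d with reverse M in e
... | top ∷ rest = fm-spec′ M top rest (length M) e (trans (sym (length-reverse M)) (cong length e)) d
... | [] with trans (sym (reverse-involutive M)) (cong reverse e)
...   | refl = trans (map-upTo (λ _ → 0) n) (zeros n) , refl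
  where
  zeros : ∀ n → applyUpTo (λ _ → 0) n ≡ toList (Vec.replicate n 0)
  zeros zero    = refl
  zeros (suc n) = cong (0 ∷_) (zeros n)

strtype≡strM : ∀ {n} (M : MLQ n) → Decr M → strtype M ≡ strM M
strtype≡strM M d = cong strip (proj₁ (fm-spec M d))

maj≡majM : ∀ {n} (M : MLQ n) → Decr M → maj M ≡ majM M
maj≡majM M d = proj₂ (fm-spec M d)

-- The recording tableau

-- `updQ` expressed through lists of row sizes, which makes it evident that horizontal operators
-- leave the recording tableau unchanged.
updS : ℕ → Tableau → List ℕ → List ℕ → Tableau
updS v []      _        (m ∷ ms) = replicate m v ∷ []
updS v (q ∷ Q) (o ∷ os) (m ∷ ms) = (q ++ replicate (m ∸ o) v) ∷ updS v Q os ms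
updS v _       _        _        = []

rowSize≡nth : ∀ {n} (N : Config n) j → rowSize N (suc j) ≡ nth 0 (sizes N) j
rowSize≡nth []      j       = refl
rowSize≡nth (r ∷ N) zero    = length-cols r
rowSize≡nth (r ∷ N) (suc j) = rowSize≡nth N j

updS≡ : ∀ v Q os ms → length Q ≤ length os → length Q < length ms →
  applyUpTo (λ j → nth [] Q j ++ replicate (nth 0 ms j ∸ nth 0 os j) v) (length Q) ++ (replicate (nth 0 ms (length Q)) v ∷ []) ≡ updS v Q os ms
updS≡ v []      os       (m ∷ ms) _       _       = refl
updS≡ v (q ∷ Q) (o ∷ os) (m ∷ ms) (s≤s h) (s≤s k) = cong ((q ++ replicate (m ∸ o) v) ∷_) (updS≡ v Q os ms h k)

updQ≡updS : ∀ {n} i (N N′ : Config n) Q → length Q ≡ i → i ≤ length N → i < length N′ →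
            updQ i N N′ Q ≡ updS (suc i) Q (sizes N) (sizes N′)
updQ≡updS .(length Q) N N′ Q refl h k =
  trans (cong₂ (λ a z → a ++ (replicate z (suc (length Q)) ∷ []))
          (trans (map-applyUpTo suc _ (length Q)) (applyUpTo-cong (λ j → cong (λ d → nth [] Q j ++ replicate d (suc (length Q)))
            (cong₂ _∸_ (rowSize≡nth N′ j) (rowSize≡nth N j))) (length Q)))
          (rowSize≡nth N′ (length Q)))
        (updS≡ (suc (length Q)) Q (sizes N) (sizes N′) (subst (length Q ≤_) (sym (length-map cnt N)) h) (subst (length Q <_) (sym (length-map cnt N′)) k))

length-updS : ∀ v Q os ms → length Q ≤ length os → length Q < length ms → length (updS v Q os ms) ≡ suc (length Q)
length-updS v []      os       (m ∷ ms) _       _       = refl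
length-updS v (q ∷ Q) (o ∷ os) (m ∷ ms) (s≤s h) (s≤s k) = cong suc (length-updS v Q os ms h k)

qLoop : ∀ {n} → ℕ → ℕ → Config n → Tableau → Tableau
qLoop i zero    N Q = Q
qLoop i (suc k) N Q = let N′ = runS (down i) N in qLoop (suc i) k N′ (updS (suc i) Q (sizes N) (sizes N′))

rhoLoop₂≡qLoop : ∀ {n} i k (N : Config n) Q → length Q ≡ i → i + k ≤ length N → proj₂ (rhoLoop i k N Q) ≡ qLoop i k N Q
rhoLoop₂≡qLoop i zero    N Q e h = refl
rhoLoop₂≡qLoop i (suc k) N Q e h =
  trans (cong₂ (λ N′ Q′ → proj₂ (rhoLoop (suc i) k N′ Q′)) (applyDown≡runS i N)
          (trans (cong (λ N′ → updQ i N N′ Q) (applyDown≡runS i N)) upd))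
        (rhoLoop₂≡qLoop (suc i) k N′ _
          (trans (length-updS (suc i) Q (sizes N) (sizes N′) (subst (length Q ≤_) (sym (length-map cnt N)) (subst (_≤ length N) (sym e) (<⇒≤ i<)))
                    (subst (length Q <_) (sym (length-map cnt N′)) (subst (_< length N′) (sym e) (subst (i <_) (sym lenN′) i<)))) (cong suc e))
          (subst (suc (i + k) ≤_) (sym lenN′) (subst (_≤ length N) (+-suc i k) h)))
  where
  N′ = runS (down i) N
  lenN′ : length N′ ≡ length N
  lenN′ = Ver.len (Ver-runS (down i)) N
  i< : i < length N
  i< = ≤-trans (s≤s (m≤m+n i k)) (subst (_≤ length N) (+-suc i k) h)
  upd = updQ≡updS i N N′ Q e (<⇒≤ i<) (subst (i <_) (sym lenN′) i<)

rhoQ : ∀ {n} → Config n → Tableau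
rhoQ M = qLoop 1 (length M ∸ 1) M (replicate (nth 0 (sizes M) 0) 1 ∷ [])

rho₂≡rhoQ : ∀ {n} (M : Config n) → proj₂ (rho M) ≡ rhoQ M
rho₂≡rhoQ []      = refl
rho₂≡rhoQ (r ∷ M) =
  trans (rhoLoop₂≡qLoop 1 (length M) (r ∷ M) (replicate (rowSize (r ∷ M) 1) 1 ∷ []) refl ≤-refl)
        (cong (λ z → qLoop 1 (length M) (r ∷ M) (replicate z 1 ∷ [])) (rowSize≡nth (r ∷ M) 0))

qLoop-hor : ∀ {n} {g : Config n → Config n} → Hor g → ∀ i k N Q → qLoop i k (g N) Q ≡ qLoop i k N Q
qLoop-hor         G i zero    N Q = refl
qLoop-hor {g = g} G i (suc k) N Q =
  trans (cong₂ (λ N′ s → qLoop (suc i) k N′ (updS (suc i) Q s (sizes N′))) (runS-hor G (down i) N) (Hor.sz G N))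
        (trans (cong (λ s → qLoop (suc i) k (g N′) (updS (suc i) Q (sizes N) s)) (Hor.sz G N′)) (qLoop-hor G (suc i) k N′ _))
  where N′ = runS (down i) N

rhoQ-hor : ∀ {n} {g : Config n → Config n} → Hor g → ∀ M → rhoQ (g M) ≡ rhoQ M
rhoQ-hor {g = g} G M =
  trans (cong₂ (λ l s → qLoop 1 (l ∸ 1) (g M) (replicate (nth 0 s 0) 1 ∷ [])) (Hor-len G M) (Hor.sz G M)) (qLoop-hor G 1 (length M ∸ 1) M _)

StripS : ℕ → List ℕ → List ℕ → Set
StripS zero    (o ∷ os) (m ∷ ms) = os ≡ ms
StripS (suc k) (o ∷ os) (m ∷ ms) = o ≤ m × nth 0 ms 0 ≤ o × StripS k os ms
StripS k       _        _        = ⊤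

Strip⇒StripS : ∀ {n} k (M M′ : Config n) → Strip k M M′ → StripS k (sizes M) (sizes M′)
Strip⇒StripS zero    []      []       h           = tt
Strip⇒StripS zero    (o ∷ M) (m ∷ M′) h           = cong sizes h
Strip⇒StripS (suc k) []      []       h           = tt
Strip⇒StripS (suc k) (o ∷ M) (m ∷ M′) (h , i , j) = h , lem M′ i , Strip⇒StripS k M M′ j
  where
  lem : ∀ M′ → headLe M′ o → nth 0 (sizes M′) 0 ≤ cnt o
  lem []      _ = z≤n
  lem (t ∷ _) l = ≼-cnt t o l

down-strip : ∀ {n} i (M : Config n) → HW< (pred i) M → StripS i (sizes M) (sizes (runS (down i) M))
down-strip zero    []      h = tt
down-strip (suc i) []      h = tt
down-strip i       (r ∷ M) h = let open Inserted (insert-hw i r M h) in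
  subst (λ Y → StripS i (sizes (r ∷ M)) (sizes Y)) (sym (trans (runS-down i (r ∷ M)) eq)) (Strip⇒StripS i (r ∷ M) (r′ ∷ M′) strp)

sum-Sv : ∀ {n} j (M : Config n) → sum (sizes (Sv j M)) ≡ sum (sizes M)
sum-Sv zero    []          = refl
sum-Sv zero    (b ∷ [])    = refl
sum-Sv zero    (b ∷ t ∷ M) = begin
  cnt (lower b t) + (cnt (upper b t) + s)  ≡⟨ cong (_+ (cnt (upper b t) + s)) (cnt-lower b t) ⟩
  (uy b t + cnt b) + (cnt (upper b t) + s) ≡⟨ solve 4 (λ y b u s → (y :+ b) :+ (u :+ s) := b :+ ((y :+ u) :+ s)) refl (uy b t) (cnt b) (cnt (upper b t)) s ⟩
  cnt b + ((uy b t + cnt (upper b t)) + s) ≡⟨ cong (λ z → cnt b + (z + s)) (cnt-upper b t) ⟩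
  cnt b + (cnt t + s)                      ∎
  where
  open ≡-Reasoning
  open +-*-Solver
  s = sum (sizes M)
sum-Sv (suc j) []          = refl
sum-Sv (suc j) (b ∷ M)     = cong (cnt b +_) (sum-Sv j M)

sum-runS : ∀ {n} js (M : Config n) → sum (sizes (runS js M)) ≡ sum (sizes M)
sum-runS []       M = refl
sum-runS (j ∷ js) M = trans (sum-runS js (Sv j M)) (sum-Sv j M)

count-++ : ∀ {A : Set} (p : A → Bool) xs ys → count p (xs ++ ys) ≡ count p xs + count p ys
count-++ p []       ys = refl
count-++ p (x ∷ xs) ys with p x
... | true  = cong suc (count-++ p xs ys)
... | false = count-++ p xs ys

count-replicate-no : ∀ {A : Set} (p : A → Bool) k {x} → p x ≡ false → count p (replicate k x) ≡ 0
count-replicate-no p zero    e = refl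
count-replicate-no p (suc k) e rewrite e = count-replicate-no p k e

count-replicate-yes : ∀ {A : Set} (p : A → Bool) k {x} → p x ≡ true → count p (replicate k x) ≡ k
count-replicate-yes p zero    e = refl
count-replicate-yes p (suc k) e rewrite e = cong suc (count-replicate-yes p k e)

count-none : ∀ {A : Set} (p : A → Bool) xs → All (λ x → p x ≡ false) xs → count p xs ≡ 0
count-none p []       []       = refl
count-none p (x ∷ xs) (h ∷ hs) rewrite h = count-none p xs hs

RowsLen : Tableau → List ℕ → Set
RowsLen []      s       = ⊤
RowsLen (q ∷ Q) (o ∷ s) = length q ≡ o × RowsLen Q s
RowsLen (q ∷ Q) []      = ⊥

Entries : ℕ → Tableau → Set
Entries i = All (All (λ x → 1 ≤ x × x ≤ i))

-- `σ` holds the original row sizes and `s` the current ones. By `rest`, the rows not yet inserted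
-- still have their original size; this provides the content of the next letter.
record Tab (σ : List ℕ) (i : ℕ) (Q : Tableau) (s : List ℕ) : Set where
  field
    len     : length Q ≡ i
    rows    : RowsLen Q s
    entries : Entries i Q
    weak    : All (λ q → weakIncr q ≡ true) Q
    strict  : columnsStrict Q ≡ true
    content : ∀ t → t < i → count (λ x → x ≡ᵇ suc t) (concat Q) ≡ nth 0 σ t
    rest    : drop i s ≡ drop i σ

weakIncr-replicate : ∀ v k → weakIncr (replicate k v) ≡ true
weakIncr-replicate v zero          = refl
weakIncr-replicate v (suc zero)    = refl
weakIncr-replicate v (suc (suc k)) = cong₂ _∧_ (≤ᵇ-true (≤-refl {v})) (weakIncr-replicate v (suc k))

weakIncr-snoc : ∀ v k q → All (_≤ v) q → weakIncr q ≡ true → weakIncr (q ++ replicate k v) ≡ true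
weakIncr-snoc v k             []          _        _ = weakIncr-replicate v k
weakIncr-snoc v zero          (x ∷ [])    _        _ = refl
weakIncr-snoc v (suc k)       (x ∷ [])    (h ∷ _)  _ = cong₂ _∧_ (≤ᵇ-true h) (weakIncr-replicate v (suc k))
weakIncr-snoc v k             (x ∷ y ∷ q) (_ ∷ hs) e with x ≤ᵇ y
... | true = weakIncr-snoc v k (y ∷ q) hs e

-- The new letter exceeds all old entries, and the bound on the lengths makes every new letter of
-- the upper row stand over an old entry of the lower one. This is the horizontal strip condition.
strictAbove-snoc : ∀ i a k q q′ → strictAbove q q′ ≡ true → All (_≤ i) q → length q′ + k ≤ length q →
                   strictAbove (q ++ replicate a (suc i)) (q′ ++ replicate k (suc i)) ≡ true
strictAbove-snoc i a zero    []      []       e _        l = lem (replicate a (suc i))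
  where
  lem : ∀ q → strictAbove q [] ≡ true
  lem []      = refl
  lem (x ∷ q) = refl
strictAbove-snoc i a zero    (x ∷ q) []       e _        l = refl
strictAbove-snoc i a (suc k) (x ∷ q) []       e (h ∷ hs) (s≤s l) =
  trans (cong (_∧ strictAbove (q ++ replicate a (suc i)) (replicate k (suc i))) (≤ᵇ-true (s≤s h))) (strictAbove-snoc i a k q [] (lem q) hs l)
  where
  lem : ∀ q → strictAbove q [] ≡ true
  lem []      = refl
  lem (x ∷ q) = refl
strictAbove-snoc i a k       (x ∷ q) (y ∷ q′) e (h ∷ hs) (s≤s l) with x <ᵇ y
... | true = strictAbove-snoc i a k q q′ e hs l

columnsStrict-cons : ∀ q Q → columnsStrict (q ∷ Q) ≡ true → columnsStrict Q ≡ true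
columnsStrict-cons q []       _ = refl
columnsStrict-cons q (q′ ∷ Q) e with strictAbove q q′
... | true = e

columnsStrict-head : ∀ q q′ Q → columnsStrict (q ∷ q′ ∷ Q) ≡ true → strictAbove q q′ ≡ true
columnsStrict-head q q′ Q e with strictAbove q q′
... | true = refl

module TabStep (σ : List ℕ) (i : ℕ) (v : ℕ) (v≡ : v ≡ suc i) where

  rows′ : ∀ Q s s′ → RowsLen Q s → StripS (length Q) s s′ → length Q < length s′ → RowsLen (updS v Q s s′) s′
  rows′ []      s       (m ∷ ms) _       st            l       = length-replicate m , tt
  rows′ (q ∷ Q) (o ∷ s) (m ∷ ms) (h , r) (om , _ , st) (s≤s l) =
    trans (length-++ q) (trans (cong₂ _+_ h (length-replicate (m ∸ o))) (m+[n∸m]≡n om)) , rows′ Q s ms r st l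

  entries′ : ∀ Q s s′ → Entries i Q → Entries v (updS v Q s s′)
  entries′ []      s       []       _        = []
  entries′ []      s       (m ∷ ms) _        = All.replicate⁺ m (subst (1 ≤_) (sym v≡) (s≤s z≤n) , ≤-refl) ∷ []
  entries′ (q ∷ Q) []      s′       _        = []
  entries′ (q ∷ Q) (o ∷ s) []       _        = []
  entries′ (q ∷ Q) (o ∷ s) (m ∷ ms) (h ∷ hs) =
    All.++⁺ (All.map (λ { (a , b) → a , ≤-trans b (subst (i ≤_) (sym v≡) (n≤1+n i)) }) h) (All.replicate⁺ (m ∸ o) (subst (1 ≤_) (sym v≡) (s≤s z≤n) , ≤-refl))
    ∷ entries′ Q s ms hs

  weak′ : ∀ Q s s′ → Entries i Q → All (λ q → weakIncr q ≡ true) Q → All (λ q → weakIncr q ≡ true) (updS v Q s s′)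
  weak′ []      s       []       _        _        = []
  weak′ []      s       (m ∷ ms) _        _        = weakIncr-snoc v m [] [] refl ∷ []
  weak′ (q ∷ Q) []      s′       _        _        = []
  weak′ (q ∷ Q) (o ∷ s) []       _        _        = []
  weak′ (q ∷ Q) (o ∷ s) (m ∷ ms) (e ∷ es) (h ∷ hs) =
    weakIncr-snoc v (m ∸ o) q (All.map (λ x → ≤-trans (proj₂ x) (subst (i ≤_) (sym v≡) (n≤1+n i))) e) h ∷ weak′ Q s ms es hs

  strict′ : ∀ Q s s′ → RowsLen Q s → StripS (length Q) s s′ → length Q < length s′ → Entries i Q →
            columnsStrict Q ≡ true → columnsStrict (updS v Q s s′) ≡ true
  strict′ []           s            (m ∷ ms)      _            _              _       _        _ = refl
  strict′ (q ∷ [])     (o ∷ s)      (m ∷ m′ ∷ ms) (refl , _)   (om , mo , st) l       (e ∷ _)  c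
    rewrite v≡ = trans (∧-comm _ true) (strictAbove-snoc i (m ∸ length q) m′ q [] (lem q) (All.map proj₂ e) mo)
    where
    lem : ∀ q → strictAbove q [] ≡ true
    lem []      = refl
    lem (x ∷ q) = refl
  strict′ (q ∷ [])     (o ∷ s)      (m ∷ [])      _            _              (s≤s ()) _       _
  strict′ (q ∷ q′ ∷ Q) (o ∷ o′ ∷ s) (m ∷ m′ ∷ ms) (refl , h′ , r) (om , mo , om′ , st) (s≤s l) (e ∷ es) c =
    cong₂ _∧_ (trans (cong (λ w → strictAbove (q ++ replicate (m ∸ length q) w) (q′ ++ replicate (m′ ∸ o′) w)) v≡)
                 (strictAbove-snoc i (m ∸ length q) (m′ ∸ o′) q q′ (columnsStrict-head q q′ Q c) (All.map proj₂ e)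
                   (≤-trans (≤-reflexive (trans (cong (_+ (m′ ∸ o′)) h′) (m+[n∸m]≡n (proj₁ (om′ , st))))) mo)))
              (strict′ (q′ ∷ Q) (o′ ∷ s) (m′ ∷ ms) (h′ , r) (om′ , st) l es (columnsStrict-cons q (q′ ∷ Q) c))

  count-old : ∀ p Q s s′ → p v ≡ false → length Q ≤ length s → length Q < length s′ → count p (concat (updS v Q s s′)) ≡ count p (concat Q)
  count-old p []      s       (m ∷ ms) e _       _       = trans (count-++ p (replicate m v) []) (trans (+-identityʳ _) (count-replicate-no p m e))
  count-old p (q ∷ Q) (o ∷ s) (m ∷ ms) e (s≤s h) (s≤s k) =
    trans (count-++ p (q ++ replicate (m ∸ o) v) _)
      (trans (cong₂ _+_ (trans (count-++ p q _) (trans (cong (count p q +_) (count-replicate-no p (m ∸ o) e)) (+-identityʳ _))) (count-old p Q s ms e h k))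
             (sym (count-++ p q (concat Q))))

  -- Once the total number of balls is known to be preserved, this says that the new letter occurs
  -- as often as the inserted row has balls.
  count-new : ∀ Q s s′ → Entries i Q → StripS (length Q) s s′ → length Q < length s → length Q < length s′ →
              count (λ x → x ≡ᵇ v) (concat (updS v Q s s′)) + (sum s ∸ 0) ≡ sum s′ + nth 0 s (length Q)
  count-new []      (o ∷ s) (m ∷ ms) _        refl          _       _       =
    trans (cong (_+ (o + sum s)) (trans (count-++ (λ x → x ≡ᵇ v) (replicate m v) []) (trans (+-identityʳ _) (count-replicate-yes (λ x → x ≡ᵇ v) m (≡ᵇ-refl v)))))
          (trans (cong (m +_) (+-comm o (sum s))) (sym (+-assoc m (sum s) o)))
  count-new (q ∷ Q) (o ∷ s) (m ∷ ms) (e ∷ es) (om , _ , st) (s≤s h) (s≤s k) = begin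
    count p ((q ++ replicate (m ∸ o) v) ++ C) + (o + sum s)     ≡⟨ cong (_+ (o + sum s)) (trans (count-++ p (q ++ replicate (m ∸ o) v) C) (cong (_+ count p C) (trans (count-++ p q _)
                                                                     (cong₂ _+_ (count-none p q (All.map (λ {z} x → ≢⇒≡ᵇ z v (<⇒≢ (subst (z <_) (sym v≡) (s≤s (proj₂ x))))) e)) (count-replicate-yes p (m ∸ o) (≡ᵇ-refl v)))))) ⟩
    ((m ∸ o) + count p C) + (o + sum s)                         ≡⟨ solve 4 (λ d c o s → (d :+ c) :+ (o :+ s) := (d :+ o) :+ (c :+ s)) refl (m ∸ o) (count p C) o (sum s) ⟩
    ((m ∸ o) + o) + (count p C + sum s)                         ≡⟨ cong₂ _+_ (m∸n+n≡m om) (count-new Q s ms es st h k) ⟩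
    m + (sum ms + nth 0 s (length Q))                           ≡⟨ +-assoc m (sum ms) _ ⟨
    m + sum ms + nth 0 s (length Q)                             ∎
    where
    open ≡-Reasoning
    open +-*-Solver
    p = λ x → x ≡ᵇ v
    C = concat (updS v Q s ms)

  drop-strip : ∀ k s s′ → StripS k s s′ → k < length s → k < length s′ → drop (suc k) s′ ≡ drop (suc k) s
  drop-strip zero    (o ∷ s) (m ∷ ms) st            _       _       = sym st
  drop-strip (suc k) (o ∷ s) (m ∷ ms) (_ , _ , st)  (s≤s h) (s≤s l) = drop-strip k s ms st h l

nth-drop : ∀ i (s σ : List ℕ) → drop i s ≡ drop i σ → nth 0 s i ≡ nth 0 σ i
nth-drop i s σ e = trans (sym (lem i s)) (trans (cong (λ l → nth 0 l 0) e) (lem i σ))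
  where
  lem : ∀ i s → nth 0 (drop i s) 0 ≡ nth 0 s i
  lem zero    s       = refl
  lem (suc i) []      = refl
  lem (suc i) (x ∷ s) = lem i s

Tab-step : ∀ σ i Q s s′ → Tab σ i Q s → StripS i s s′ → sum s′ ≡ sum s → i < length s → i < length s′ →
           Tab σ (suc i) (updS (suc i) Q s s′) s′
Tab-step σ .(length Q) Q s s′ T@record { len = refl } st sm l l′ = record
  { len     = length-updS (suc (length Q)) Q s s′ (<⇒≤ l) l′
  ; rows    = rows′ Q s s′ (Tab.rows T) st l′
  ; entries = entries′ Q s s′ (Tab.entries T)
  ; weak    = weak′ Q s s′ (Tab.entries T) (Tab.weak T)
  ; strict  = strict′ Q s s′ (Tab.rows T) st l′ (Tab.entries T) (Tab.strict T)
  ; content = cont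
  ; rest    = trans (drop-strip (length Q) s s′ st l l′) (trans (sym (lem (length Q) s)) (trans (cong (drop 1) (Tab.rest T)) (lem (length Q) σ))) }
  where
  open TabStep σ (length Q) (suc (length Q)) refl
  lem : ∀ i (s : List ℕ) → drop 1 (drop i s) ≡ drop (suc i) s
  lem = drop-1-drop
  cont : ∀ t → t < suc (length Q) → count (λ x → x ≡ᵇ suc t) (concat (updS (suc (length Q)) Q s s′)) ≡ nth 0 σ t
  cont t h with m≤n⇒m<n∨m≡n (s≤s⁻¹ h)
  ... | inj₁ lt   = trans (count-old (λ x → x ≡ᵇ suc t) Q s s′ (≢⇒≡ᵇ (length Q) t (<⇒≢ lt ∘ sym)) (<⇒≤ l) l′) (Tab.content T t lt)
  ... | inj₂ refl = trans (+-cancelˡ-≡ (sum s) _ _ (trans (+-comm (sum s) _) (trans (count-new Q s s′ (Tab.entries T) st l l′) (cong (_+ nth 0 s (length Q)) sm))))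
                          (nth-drop (length Q) s σ (Tab.rest T))

length-sizes : ∀ {n} js (N : Config n) → length (sizes (runS js N)) ≡ length (sizes N)
length-sizes js N = trans (length-map cnt (runS js N)) (trans (Ver.len (Ver-runS js) N) (sym (length-map cnt N)))

qLoop-Tab : ∀ {n} σ k i (N : Config n) Q → HW< (pred i) N → i + k ≤ length (sizes N) → Tab σ i Q (sizes N) →
            Tab σ (i + k) (qLoop i k N Q) (sizes (runS (rhoOps i k) N))
qLoop-Tab σ zero    i N Q hw l T rewrite +-identityʳ i = T
qLoop-Tab σ (suc k) i N Q hw l T rewrite runS-++ (down i) (rhoOps (suc i) k) N | +-suc i k =
  qLoop-Tab σ k (suc i) N′ (updS (suc i) Q (sizes N) (sizes N′)) (down-hw i N hw)
    (subst (suc (i + k) ≤_) (sym (length-sizes (down i) N)) l)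
    (Tab-step σ i Q (sizes N) (sizes N′) T (down-strip i N hw) (sum-runS (down i) N) i<
      (subst (i <_) (sym (length-sizes (down i) N)) i<))
  where
  N′ = runS (down i) N
  i< : i < length (sizes N)
  i< = ≤-trans (s≤s (m≤m+n i k)) l

rhoQ-Tab : ∀ {n} (M : Config n) → 0 < length M → Tab (sizes M) (length M) (rhoQ M) (sizes (rhoM M))
rhoQ-Tab (r ∷ M) _ = qLoop-Tab (sizes (r ∷ M)) (length M) 1 (r ∷ M) _ (λ _ ()) (≤-reflexive (cong suc (sym (length-map cnt M)))) record
  { len     = refl
  ; rows    = length-replicate (cnt r) , tt
  ; entries = All.replicate⁺ (cnt r) (≤-refl , ≤-refl) ∷ []
  ; weak    = weakIncr-snoc 1 (cnt r) [] [] refl ∷ []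
  ; strict  = refl
  ; content = λ { zero _ → trans (count-++ (λ x → x ≡ᵇ 1) (replicate (cnt r) 1) []) (trans (+-identityʳ _) (count-replicate-yes (λ x → x ≡ᵇ 1) (cnt r) refl)) ; (suc t) (s≤s ()) }
  ; rest    = refl }

-- Injectivity of the collapse

updS-filter : ∀ i Q s s′ → Entries i Q → length Q ≤ length s → length Q < length s′ →
              map (filterᵇ (_≤ᵇ i)) (take (length Q) (updS (suc i) Q s s′)) ≡ Q
updS-filter i []      s       s′       _        _       _       = refl
updS-filter i (q ∷ Q) (o ∷ s) (m ∷ s′) (e ∷ es) (s≤s h) (s≤s k) =
  cong₂ _∷_ (trans (filter-++ _ q (replicate (m ∸ o) (suc i)))
               (trans (cong₂ _++_ (filterᵇ-all (_≤ᵇ i) q (All.map (λ x → ≤ᵇ-true (proj₂ x)) e)) (filterᵇ-none (_≤ᵇ i) (replicate (m ∸ o) (suc i)) (All.replicate⁺ (m ∸ o) (≤ᵇ-false (n<1+n i))))) (++-identityʳ q)))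
            (updS-filter i Q s s′ es h k)

szAt-Sv : ∀ {n} k (N : Config n) → nth 0 (sizes (Sv k N)) k ≡ vy k N + nth 0 (sizes N) k
szAt-Sv zero    []          = refl
szAt-Sv zero    (b ∷ [])    = refl
szAt-Sv zero    (b ∷ t ∷ N) = cnt-lower b t
szAt-Sv (suc k) []          = refl
szAt-Sv (suc k) (b ∷ N)     = szAt-Sv k N

szAt-Sv-low : ∀ {n} k j (N : Config n) → j < k → nth 0 (sizes (Sv k N)) j ≡ nth 0 (sizes N) j
szAt-Sv-low (suc k) j       []      _       = refl
szAt-Sv-low (suc k) zero    (b ∷ N) _       = refl
szAt-Sv-low (suc k) (suc j) (b ∷ N) (s≤s h) = szAt-Sv-low k j N h

-- A collapse is undone by applying `Fv` as often as `Ev` was applied. The growth of the lower row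
-- gives this number, so knowing the row sizes beforehand is enough.
down-injective : ∀ {n} k (N N₂ : Config n) → (∀ j → j < k → nth 0 (sizes N) j ≡ nth 0 (sizes N₂) j) →
                 runS (down k) N ≡ runS (down k) N₂ → N ≡ N₂
down-injective zero    N N₂ h e = e
down-injective (suc k) N N₂ h e = begin
  N                              ≡⟨ iter-Fv-Sv k (vy k N) N refl ⟨
  iter (vy k N) (Fv k) (Sv k N)  ≡⟨ cong₂ (λ m → iter m (Fv k)) same P≡ ⟩
  iter (vy k N₂) (Fv k) (Sv k N₂) ≡⟨ iter-Fv-Sv k (vy k N₂) N₂ refl ⟩
  N₂                             ∎
  where
  open ≡-Reasoning
  P≡ : Sv k N ≡ Sv k N₂
  P≡ = down-injective k (Sv k N) (Sv k N₂) (λ j l → trans (szAt-Sv-low k j N l) (trans (h j (<-trans l (n<1+n k))) (sym (szAt-Sv-low k j N₂ l)))) e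
  same : vy k N ≡ vy k N₂
  same = +-cancelʳ-≡ (nth 0 (sizes N) k) _ _ (trans (sym (szAt-Sv k N)) (trans (cong (λ Y → nth 0 (sizes Y) k) P≡)
           (trans (szAt-Sv k N₂) (cong (vy k N₂ +_) (sym (h k (n<1+n k)))))))

RowsLen-nth : ∀ Q s j → RowsLen Q s → j < length Q → nth 0 s j ≡ length (nth [] Q j)
RowsLen-nth (q ∷ Q) (o ∷ s) zero    (h , _) _       = sym h
RowsLen-nth (q ∷ Q) (o ∷ s) (suc j) (_ , r) (s≤s l) = RowsLen-nth Q s j r l

take-updS : ∀ i Q s s′ R → length Q ≡ i → Entries i Q → length Q ≤ length s → length Q < length s′ →
            map (filterᵇ (_≤ᵇ suc i)) (take (suc i) R) ≡ updS (suc i) Q s s′ → map (filterᵇ (_≤ᵇ i)) (take i R) ≡ Q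
take-updS .(length Q) Q s s′ R refl es h k e = trans (lem (length Q) R) (trans (cong (λ Y → map (filterᵇ (_≤ᵇ length Q)) (take (length Q) Y)) e) (updS-filter (length Q) Q s s′ es h k))
  where
  filter-filter : ∀ i xs → filterᵇ (_≤ᵇ i) (filterᵇ (_≤ᵇ suc i) xs) ≡ filterᵇ (_≤ᵇ i) xs
  filter-filter i []       = refl
  filter-filter i (x ∷ xs) with x ≤ᵇ suc i in e
  ... | true with x ≤ᵇ i
  ...   | true  = cong (x ∷_) (filter-filter i xs)
  ...   | false = filter-filter i xs
  filter-filter i (x ∷ xs) | false rewrite ≤ᵇ-false (<-trans (n<1+n i) (≤ᵇ-false⁻ {x} {suc i} e)) = filter-filter i xs
  lem₂ : ∀ i k R → map (filterᵇ (_≤ᵇ i)) (take k R) ≡ map (filterᵇ (_≤ᵇ i)) (take k (map (filterᵇ (_≤ᵇ suc i)) (take (suc k) R)))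
  lem₂ i zero    R       = refl
  lem₂ i (suc k) []      = refl
  lem₂ i (suc k) (x ∷ R) = cong₂ _∷_ (sym (filter-filter i x)) (lem₂ i k R)
  lem : ∀ i R → map (filterᵇ (_≤ᵇ i)) (take i R) ≡ map (filterᵇ (_≤ᵇ i)) (take i (map (filterᵇ (_≤ᵇ suc i)) (take (suc i) R)))
  lem i R = lem₂ i i R

-- Every intermediate tableau is the restriction of the final one to small letters. The final
-- tableau therefore reveals the relevant row sizes at each stage, as `down-injective` requires.
qLoop-filter : ∀ {n} σ k i (N : Config n) Q → HW< (pred i) N → i + k ≤ length (sizes N) → Tab σ i Q (sizes N) →
               map (filterᵇ (_≤ᵇ i)) (take i (qLoop i k N Q)) ≡ Q
qLoop-filter σ zero    i N Q hw l T = go i Q (Tab.len T) (Tab.entries T)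
  where
  rowsAll : ∀ i Q → Entries i Q → map (filterᵇ (_≤ᵇ i)) Q ≡ Q
  rowsAll i []      []       = refl
  rowsAll i (q ∷ Q) (e ∷ es) = cong₂ _∷_ (filterᵇ-all (_≤ᵇ i) q (All.map (λ x → ≤ᵇ-true (proj₂ x)) e)) (rowsAll i Q es)
  go : ∀ i Q → length Q ≡ i → Entries i Q → map (filterᵇ (_≤ᵇ i)) (take i Q) ≡ Q
  go i Q e es = trans (cong (map (filterᵇ (_≤ᵇ i))) (take-all i Q (≤-reflexive e))) (rowsAll i Q es)
qLoop-filter σ (suc k) i N Q hw l T =
  take-updS i Q (sizes N) (sizes N′) (qLoop (suc i) k N′ Q′) (Tab.len T) (Tab.entries T)
    (subst (_≤ length (sizes N)) (sym (Tab.len T)) (<⇒≤ i<)) (subst (_< length (sizes N′)) (sym (Tab.len T)) i<′)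
    (qLoop-filter σ k (suc i) N′ Q′ (down-hw i N hw) (subst (suc (i + k) ≤_) (sym (length-sizes (down i) N)) l′)
      (Tab-step σ i Q (sizes N) (sizes N′) T (down-strip i N hw) (sum-runS (down i) N) i< i<′))
  where
  N′ = runS (down i) N
  Q′ = updS (suc i) Q (sizes N) (sizes N′)
  l′ : suc (i + k) ≤ length (sizes N)
  l′ = subst (_≤ length (sizes N)) (+-suc i k) l
  i< : i < length (sizes N)
  i< = ≤-trans (s≤s (m≤m+n i k)) l′
  i<′ : i < length (sizes N′)
  i<′ = subst (i <_) (sym (length-sizes (down i) N)) i<

qLoop-injective : ∀ {n} σ k i (N N₂ : Config n) Q Q₂ → HW< (pred i) N → HW< (pred i) N₂ →
  i + k ≤ length (sizes N) → i + k ≤ length (sizes N₂) → Tab σ i Q (sizes N) → Tab σ i Q₂ (sizes N₂) →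
  qLoop i k N Q ≡ qLoop i k N₂ Q₂ → runS (rhoOps i k) N ≡ runS (rhoOps i k) N₂ → N ≡ N₂
qLoop-injective σ zero    i N N₂ Q Q₂ hw hw₂ l l₂ T T₂ eq en = en
qLoop-injective σ (suc k) i N N₂ Q Q₂ hw hw₂ l l₂ T T₂ eq en =
  down-injective i N N₂ (λ j h → trans (RowsLen-nth Q (sizes N) j (Tab.rows T) (subst (j <_) (sym (Tab.len T)) h))
      (trans (cong (λ Y → length (nth [] Y j)) Q≡) (sym (RowsLen-nth Q₂ (sizes N₂) j (Tab.rows T₂) (subst (j <_) (sym (Tab.len T₂)) h)))))
    (qLoop-injective σ k (suc i) N′ N₂′ (updS (suc i) Q (sizes N) (sizes N′)) (updS (suc i) Q₂ (sizes N₂) (sizes N₂′)) (down-hw i N hw) (down-hw i N₂ hw₂)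
      (subst (suc (i + k) ≤_) (sym (length-sizes (down i) N)) l′) (subst (suc (i + k) ≤_) (sym (length-sizes (down i) N₂)) l₂′)
      (Tab-step σ i Q (sizes N) (sizes N′) T (down-strip i N hw) (sum-runS (down i) N) i< (subst (i <_) (sym (length-sizes (down i) N)) i<))
      (Tab-step σ i Q₂ (sizes N₂) (sizes N₂′) T₂ (down-strip i N₂ hw₂) (sum-runS (down i) N₂) i<₂ (subst (i <_) (sym (length-sizes (down i) N₂)) i<₂))
      eq (trans (sym (runS-++ (down i) (rhoOps (suc i) k) N)) (trans en (runS-++ (down i) (rhoOps (suc i) k) N₂))))
  where
  N′ = runS (down i) N
  N₂′ = runS (down i) N₂
  l′ : suc (i + k) ≤ length (sizes N)
  l′ = subst (_≤ length (sizes N)) (+-suc i k) l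
  l₂′ : suc (i + k) ≤ length (sizes N₂)
  l₂′ = subst (_≤ length (sizes N₂)) (+-suc i k) l₂
  i< : i < length (sizes N)
  i< = ≤-trans (s≤s (m≤m+n i k)) l′
  i<₂ : i < length (sizes N₂)
  i<₂ = ≤-trans (s≤s (m≤m+n i k)) l₂′
  Q≡ : Q ≡ Q₂
  Q≡ = trans (sym (qLoop-filter σ (suc k) i N Q hw l T)) (trans (cong (λ Y → map (filterᵇ (_≤ᵇ i)) (take i Y)) eq) (qLoop-filter σ (suc k) i N₂ Q₂ hw₂ l₂ T₂))

-- Empty columns, and configurations with the same recording tableau

-- Covers the insertion of empty columns at either end: they contribute neutral letters to the
-- bracket words and are never touched.
record Emb {n n′ : ℕ} (ι : Row n → Row n′) : Set where
  field
    eux  : ∀ b t → ux (ι b) (ι t) ≡ ux b t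
    euy  : ∀ b t → uy (ι b) (ι t) ≡ uy b t
    ecnt : ∀ b → cnt (ι b) ≡ cnt b
    eF   : ∀ b t → F2 (ι b) (ι t) ≡ (ι (proj₁ (F2 b t)) , ι (proj₂ (F2 b t)))
    eS   : ∀ b t → S2 (ι b) (ι t) ≡ (ι (lower b t) , ι (upper b t))

module EmbFacts {n n′ : ℕ} {ι : Row n → Row n′} (e : Emb ι) where
  open Emb e

  sizes-emb : ∀ M → sizes (map ι M) ≡ sizes M
  sizes-emb M = trans (sym (map-∘ M)) (map-cong ecnt M)

  Tc-emb : ∀ b t → Tc (ι b) (ι t) ≡ ι (Tc b t)
  Tc-emb b t = trans (cong₂ (λ x y → proj₁ (iter (x ∸ y) F2² (ι b , ι t))) (ecnt b) (ecnt t)) (cong proj₁ (go (cnt b ∸ cnt t) b t))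
    where
    go : ∀ k b t → iter k F2² (ι b , ι t) ≡ (ι (proj₁ (iter k F2² (b , t))) , ι (proj₂ (iter k F2² (b , t))))
    go zero    b t = refl
    go (suc k) b t = trans (cong (iter k F2²) (eF b t)) (go k (proj₁ (F2 b t)) (proj₂ (F2 b t)))

  layM-emb : ∀ M → layM (map ι M) ≡ map ι (layM M)
  layM-emb []      = refl
  layM-emb (r ∷ M) = cong (ι r ∷_) (trans (cong (map (Tc (ι r))) (layM-emb M))
    (trans (sym (map-∘ (layM M))) (trans (map-cong (Tc-emb r) (layM M)) (map-∘ (layM M)))))

  majM-emb : ∀ M → majM (map ι M) ≡ majM M
  majM-emb []      = refl
  majM-emb (r ∷ M) = cong₂ _+_ (majM-emb M) (cong sum (trans (cong (map (uy (ι r))) (layM-emb M))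
    (trans (sym (map-∘ (layM M))) (map-cong (euy r) (layM M)))))

  Sv-emb : ∀ j M → Sv j (map ι M) ≡ map ι (Sv j M)
  Sv-emb zero    []          = refl
  Sv-emb zero    (b ∷ [])    = refl
  Sv-emb zero    (b ∷ t ∷ M) = cong (λ w → consC w (map ι M)) (eS b t)
  Sv-emb (suc j) []          = refl
  Sv-emb (suc j) (b ∷ M)     = cong (ι b ∷_) (Sv-emb j M)

  runS-emb : ∀ js M → runS js (map ι M) ≡ map ι (runS js M)
  runS-emb []       M = refl
  runS-emb (j ∷ js) M = trans (cong (runS js) (Sv-emb j M)) (runS-emb js (Sv j M))

  qLoop-emb : ∀ i k M Q → qLoop i k (map ι M) Q ≡ qLoop i k M Q
  qLoop-emb i zero    M Q = refl
  qLoop-emb i (suc k) M Q =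
    trans (cong₂ (λ N s → qLoop (suc i) k N (updS (suc i) Q s (sizes N))) (runS-emb (down i) M) (sizes-emb M))
          (trans (cong (λ s → qLoop (suc i) k (map ι M′) (updS (suc i) Q (sizes M) s)) (sizes-emb M′)) (qLoop-emb (suc i) k M′ _))
    where M′ = runS (down i) M

  rhoQ-emb : ∀ M → rhoQ (map ι M) ≡ rhoQ M
  rhoQ-emb M = trans (cong₂ (λ l s → qLoop 1 (l ∸ 1) (map ι M) (replicate (nth 0 s 0) 1 ∷ [])) (length-map ι M) (sizes-emb M)) (qLoop-emb 1 (length M ∸ 1) M _)

padL : ∀ m {n} → Row n → Row (m + n)
padL m r = Vec.replicate m false Vec.++ r

padR : ∀ m {n} → Row n → Row (n + m)
padR m r = r Vec.++ Vec.replicate m false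

padL-Emb : ∀ m {n} → Emb {n} (padL m)
padL-Emb zero    = record { eux = λ _ _ → refl ; euy = λ _ _ → refl ; ecnt = λ _ → refl ; eF = λ _ _ → refl ; eS = λ _ _ → refl }
padL-Emb (suc m) = record
  { eux = eux ; euy = euy ; ecnt = ecnt
  ; eF = λ b t → cong (cons2 false false) (eF b t)
  ; eS = λ b t → cong (cons2 false false) (eS b t) }
  where open Emb (padL-Emb m)

padR-ux : ∀ m {n} (b t : Row n) → ux (padR m b) (padR m t) ≡ ux b t
padR-ux zero    []      []      = refl
padR-ux (suc m) []      []      = padR-ux m [] []
padR-ux m       (p ∷ b) (q ∷ t) = cong (stepX (bracket q p)) (padR-ux m b t)

padR-uy : ∀ m {n} (b t : Row n) → uy (padR m b) (padR m t) ≡ uy b t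
padR-uy zero    []      []      = refl
padR-uy (suc m) []      []      = padR-uy m [] []
padR-uy m       (p ∷ b) (q ∷ t) = cong₂ (stepY (bracket q p)) (padR-ux m b t) (padR-uy m b t)

padR-cnt : ∀ m {n} (b : Row n) → cnt (padR m b) ≡ cnt b
padR-cnt m []      = cnt-zeros m
padR-cnt m (p ∷ b) = cong (bit p +_) (padR-cnt m b)

padR² : ∀ m {n} → Row n × Row n → Row (n + m) × Row (n + m)
padR² m w = padR m (proj₁ w) , padR m (proj₂ w)

padR-F : ∀ m {n} (b t : Row n) → F2 (padR m b) (padR m t) ≡ padR² m (F2 b t)
padR-F zero    []      []      = refl
padR-F (suc m) []      []      = cong (cons2 false false) (padR-F m [] [])
padR-F m       (p ∷ b) (q ∷ t) =
  trans (cong₂ (λ x r → pickF (bracket q p) x (cons2 q p (padR² m (b , t))) (cons2 p q (padR² m (b , t))) (cons2 p q r)) (padR-ux m b t) (padR-F m b t))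
        (sym (pickF-map (padR² m) (bracket q p) (ux b t)))

padR-S : ∀ m {n} (b t : Row n) → S2 (padR m b) (padR m t) ≡ padR² m (S2 b t)
padR-S zero    []      []      = refl
padR-S (suc m) []      []      = cong (cons2 false false) (padR-S m [] [])
padR-S m       (p ∷ b) (q ∷ t) =
  cong₂ (λ x r → cons2 (pickE (bracket q p) x q p) (pickE (bracket q p) x p q) r) (padR-ux m b t) (padR-S m b t)

padR-Emb : ∀ m {n} → Emb {n} (padR m)
padR-Emb m = record { eux = padR-ux m ; euy = padR-uy m ; ecnt = padR-cnt m ; eF = padR-F m ; eS = padR-S m }

rho-injective : ∀ {n} (M M₂ : Config n) → sizes M ≡ sizes M₂ → rhoQ M ≡ rhoQ M₂ → rhoM M ≡ rhoM M₂ → M ≡ M₂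
rho-injective []      []       _ _ _ = refl
rho-injective (r ∷ M) (r₂ ∷ M₂) es eQ eN =
  qLoop-injective σ (length M) 1 (r ∷ M) (r₂ ∷ M₂) _ _ (λ _ ()) (λ _ ()) (≤-reflexive (cong suc (sym (length-map cnt M))))
    (subst (λ l → suc l ≤ suc (length (sizes M₂))) (sym len) (≤-reflexive (cong suc (sym (length-map cnt M₂))))) (start r M refl) (start r₂ M₂ es)
    (trans eQ (cong (λ l → qLoop 1 l (r₂ ∷ M₂) (replicate (cnt r₂) 1 ∷ [])) (sym len)))
    (trans eN (cong (λ l → runS (rhoOps 1 l) (r₂ ∷ M₂)) (sym len)))
  where
  σ = sizes (r ∷ M)
  len : length M ≡ length M₂
  len = trans (sym (length-map cnt M)) (trans (suc-injective (cong length es)) (length-map cnt M₂))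
  start : ∀ r′ M′ → σ ≡ sizes (r′ ∷ M′) → Tab σ 1 (replicate (cnt r′) 1 ∷ []) (sizes (r′ ∷ M′))
  start r′ M′ e = record
    { len     = refl
    ; rows    = length-replicate (cnt r′) , tt
    ; entries = All.replicate⁺ (cnt r′) (≤-refl , ≤-refl) ∷ []
    ; weak    = weakIncr-snoc 1 (cnt r′) [] [] refl ∷ []
    ; strict  = refl
    ; content = λ { zero _ → trans (count-++ (λ x → x ≡ᵇ 1) (replicate (cnt r′) 1) []) (trans (+-identityʳ _)
                               (trans (count-replicate-yes (λ x → x ≡ᵇ 1) (cnt r′) refl) (cong (λ s → nth 0 s 0) (sym e)))) ; (suc t) (s≤s ()) }
    ; rest    = cong (drop 1) (sym e) }

RowsLen-sizes : ∀ Q s s₂ → RowsLen Q s → RowsLen Q s₂ → length s ≡ length Q → length s₂ ≡ length Q → s ≡ s₂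
RowsLen-sizes []      []      []        _       _         _ _ = refl
RowsLen-sizes (q ∷ Q) (o ∷ s) (o₂ ∷ s₂) (h , r) (h₂ , r₂) e e₂ =
  cong₂ _∷_ (trans (sym h) h₂) (RowsLen-sizes Q s s₂ r r₂ (suc-injective e) (suc-injective e₂))

sizes-rhoM : ∀ {n n₂} (M : Config n) (M₂ : Config n₂) → length M ≡ length M₂ → rhoQ M ≡ rhoQ M₂ → sizes (rhoM M) ≡ sizes (rhoM M₂)
sizes-rhoM []      []        _ _ = refl
sizes-rhoM (r ∷ M) (r₂ ∷ M₂) l e =
  RowsLen-sizes (rhoQ (r ∷ M)) _ _ A.rows (subst (λ Q → RowsLen Q _) (sym e) B.rows)
    (trans (trans (length-sizes (rhoOps 1 (length M)) (r ∷ M)) (length-map cnt (r ∷ M))) (sym A.len))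
    (trans (trans (length-sizes (rhoOps 1 (length M₂)) (r₂ ∷ M₂)) (length-map cnt (r₂ ∷ M₂))) (trans (sym l) (sym A.len)))
  where
  module A = Tab (rhoQ-Tab (r ∷ M) z<s)
  module B = Tab (rhoQ-Tab (r₂ ∷ M₂) z<s)

-- Both collapses have the row lengths of the common tableau, so a horizontal composite carries one
-- to the other. It keeps the recording tableau, and injectivity identifies the image of `M` with
-- `M₂`.
sameQ-connected : ∀ {n} (M M₂ : Config n) → sizes M ≡ sizes M₂ → rhoQ M ≡ rhoQ M₂ → ∃ λ g → Hor g × g M ≡ M₂
sameQ-connected M M₂ es eQ with hw-connected (rhoM M) (rhoM M₂) (rhoM-hw M) (rhoM-hw M₂)
                                 (sizes-rhoM M M₂ (trans (sym (length-map cnt M)) (trans (cong length es) (length-map cnt M₂))) eQ)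
... | g , G , e = g , G , rho-injective (g M) M₂ (trans (Hor.sz G M) es) (trans (rhoQ-hor G M) eQ) (trans (rhoM-hor G M) e)

-- The two configurations may differ in width. Padding one on the right and the other on the left
-- gives both the width `n + n₂`, without changing tableau or wraps.
majM-sameQ : ∀ {n n₂} (M : Config n) (M₂ : Config n₂) → sizes M ≡ sizes M₂ → rhoQ M ≡ rhoQ M₂ → majM M ≡ majM M₂
majM-sameQ {n} {n₂} M M₂ es eQ with sameQ-connected (map (padR n₂) M) (map (padL n) M₂)
    (trans (R.sizes-emb M) (trans es (sym (L.sizes-emb M₂)))) (trans (R.rhoQ-emb M) (trans eQ (sym (L.rhoQ-emb M₂))))
  where
  module R = EmbFacts (padR-Emb n₂ {n})
  module L = EmbFacts (padL-Emb n {n₂})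
... | g , G , e = trans (sym (R.majM-emb M)) (trans (sym (majM-hor G (map (padR n₂) M))) (trans (cong majM e) (L.majM-emb M₂)))
  where
  module R = EmbFacts (padR-Emb n₂ {n})
  module L = EmbFacts (padL-Emb n {n₂})

-- The configuration with one ball per letter of the row reading word of a
-- tableau; a cell is a pair (row index, entry).

Cell : Set
Cell = ℕ × ℕ

cellsFrom : ℕ → Tableau → List Cell
cellsFrom s []      = []
cellsFrom s (q ∷ Q) = cellsFrom (suc s) Q ++ map (s ,_) q

cells-word : ∀ s Q → map proj₂ (cellsFrom s Q) ≡ concat (reverse Q)
cells-word s []      = refl
cells-word s (q ∷ Q) = begin
  map proj₂ (cellsFrom (suc s) Q ++ map (s ,_) q)            ≡⟨ map-++ proj₂ (cellsFrom (suc s) Q) _ ⟩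
  map proj₂ (cellsFrom (suc s) Q) ++ map proj₂ (map (s ,_) q) ≡⟨ cong₂ _++_ (cells-word (suc s) Q) (trans (sym (map-∘ q)) (map-id q)) ⟩
  concat (reverse Q) ++ q                                    ≡⟨ cong (concat (reverse Q) ++_) (++-identityʳ q) ⟨
  concat (reverse Q) ++ concat (q ∷ [])                      ≡⟨ concat-++ (reverse Q) (q ∷ []) ⟩
  concat (reverse Q ++ q ∷ [])                               ≡⟨ cong concat (unfold-reverse q Q) ⟨
  concat (reverse (q ∷ Q))                                   ∎
  where open ≡-Reasoning

_∨ᵥ_ : ∀ {n} → Row n → Row n → Row n
_∨ᵥ_ = Vec.zipWith _∨_

-- From left to right come first the elements of `A`, then those of `B`, then those of `U`. Each
-- predicate says what may still occur in the remaining columns.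
PhU PhB PhA : ∀ {n} → Row n → Row n → Row n → Set
PhU []      []      []      = ⊤
PhU (a ∷ A) (b ∷ B) (u ∷ U) = a ≡ false × b ≡ false × PhU A B U
PhB []      []      []      = ⊤
PhB (a ∷ A) (b ∷ B) (u ∷ U) = a ≡ false × (b ≡ true → u ≡ false) × (u ≡ true → PhU A B U) × PhB A B U
PhA []      []      []      = ⊤
PhA (a ∷ A) (b ∷ B) (u ∷ U) =
  (a ≡ true → b ≡ false × u ≡ false) × (b ≡ true → u ≡ false × PhB A B U) × (u ≡ true → PhU A B U) × PhA A B U

S2-U : ∀ {n} (A B U : Row n) → PhU A B U → ux B (A ∨ᵥ U) ≡ 0 × S2 B (A ∨ᵥ U) ≡ (B ∨ᵥ U , A) × cnt A ≡ 0 × cnt B ≡ 0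
S2-U []          []          []          _                 = refl , refl , refl , refl
S2-U (false ∷ A) (false ∷ B) (u ∷ U)     (refl , refl , h) with S2-U A B U h
... | x , s , ca , cb = lem u
  where
  lem : ∀ u → ux (false ∷ B) (u ∷ (A ∨ᵥ U)) ≡ 0 × S2 (false ∷ B) (u ∷ (A ∨ᵥ U)) ≡ (u ∷ (B ∨ᵥ U) , false ∷ A) × cnt A ≡ 0 × cnt B ≡ 0
  lem true  rewrite x = refl , cong (cons2 true false) s , ca , cb
  lem false = x , cong (cons2 false false) s , ca , cb

S2-B : ∀ {n} (A B U : Row n) → PhB A B U → ux B (A ∨ᵥ U) ≡ cnt B × S2 B (A ∨ᵥ U) ≡ (B ∨ᵥ U , A) × cnt A ≡ 0
S2-B []      []          []      _                     = refl , refl , refl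
S2-B (a ∷ A) (b ∷ B)     (u ∷ U) (refl , bu , uU , h) with S2-B A B U h
... | x , s , ca = lem b u bu uU
  where
  lem : ∀ b u → (b ≡ true → u ≡ false) → (u ≡ true → PhU A B U) →
        ux (b ∷ B) (u ∷ (A ∨ᵥ U)) ≡ bit b + cnt B × S2 (b ∷ B) (u ∷ (A ∨ᵥ U)) ≡ ((b ∨ u) ∷ (B ∨ᵥ U) , false ∷ A) × cnt A ≡ 0
  lem true  true  bu uU = contradiction (bu refl) λ ()
  lem true  false bu uU = cong suc x , cong (cons2 true false) s , ca
  lem false false bu uU = x , cong (cons2 false false) s , ca
  lem false true  bu uU with S2-U A B U (uU refl)
  ... | x₀ , _ , _ , cb rewrite x₀ = sym cb , cong (cons2 true false) s , ca

-- Every ball of `A` finds a partner in `B` to its right, since `B` is at least as large. `U` lies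
-- to the right of both and has no partner, so precisely `U` falls.
S2-A : ∀ {n} (A B U : Row n) → PhA A B U → cnt A ≤ cnt B → ux B (A ∨ᵥ U) + cnt A ≡ cnt B × S2 B (A ∨ᵥ U) ≡ (B ∨ᵥ U , A)
S2-A []      []      []      _                  _ = refl , refl
S2-A (a ∷ A) (b ∷ B) (u ∷ U) (ha , hb , hu , h) l = lem a b u ha hb hu l
  where
  lem : ∀ a b u → (a ≡ true → b ≡ false × u ≡ false) → (b ≡ true → u ≡ false × PhB A B U) → (u ≡ true → PhU A B U) →
        bit a + cnt A ≤ bit b + cnt B →
        ux (b ∷ B) ((a ∨ u) ∷ (A ∨ᵥ U)) + (bit a + cnt A) ≡ bit b + cnt B × S2 (b ∷ B) ((a ∨ u) ∷ (A ∨ᵥ U)) ≡ ((b ∨ u) ∷ (B ∨ᵥ U) , a ∷ A)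
  lem true  true  u     ha hb hu l = contradiction (proj₁ (ha refl)) λ ()
  lem true  false true  ha hb hu l = contradiction (proj₂ (ha refl)) λ ()
  lem true  false false ha hb hu l with S2-A A B U h (≤-trans (n≤1+n _) l)
  ... | x , s with ux B (A ∨ᵥ U)
  ...   | zero  = contradiction (≤-trans l (≤-reflexive (sym x))) (<-irrefl refl)
  ...   | suc k = trans (+-suc k (cnt A)) x , cong (cons2 false true) s
  lem false true  true  ha hb hu l = contradiction (proj₁ (hb refl)) λ ()
  lem false true  false ha hb hu l with S2-B A B U (proj₂ (hb refl))
  ... | x , s , ca = trans (cong₂ (λ p q → suc p + q) x ca) (+-identityʳ _) , cong (cons2 true false) s
  lem false false true  ha hb hu l with S2-U A B U (hu refl)
  ... | x , s , ca , cb rewrite x = trans ca (sym cb) , cong (cons2 true false) s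
  lem false false false ha hb hu l with S2-A A B U h l
  ... | x , s = x , cong (cons2 false false) s

CellOrd : Cell → Cell → Set
CellOrd (ρ , x) (ρ′ , x′) = ρ′ < ρ ⊎ (ρ′ ≡ ρ × x ≤ x′)

vecOf : (p : Cell → Bool) (l : List Cell) → Row (length l)
vecOf p []      = []
vecOf p (c ∷ l) = p c ∷ vecOf p l

cnt-vecOf : ∀ p l → cnt (vecOf p l) ≡ count p l
cnt-vecOf p []      = refl
cnt-vecOf p (c ∷ l) with p c
... | true  = cong suc (cnt-vecOf p l)
... | false = cnt-vecOf p l

vecOf-∨ : ∀ p q l → vecOf p l ∨ᵥ vecOf q l ≡ vecOf (λ c → p c ∨ q c) l
vecOf-∨ p q []      = refl
vecOf-∨ p q (c ∷ l) = cong ((p c ∨ q c) ∷_) (vecOf-∨ p q l)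

vecOf-cong : ∀ {p q} l → All (λ c → p c ≡ q c) l → vecOf p l ≡ vecOf q l
vecOf-cong []      []       = refl
vecOf-cong (c ∷ l) (h ∷ hs) = cong₂ _∷_ h (vecOf-cong l hs)

≡ᵇ-true⁻ : ∀ {m n} → (m ≡ᵇ n) ≡ true → m ≡ n
≡ᵇ-true⁻ {m} {n} e = ≡ᵇ⇒≡ m n (subst T (sym e) tt)

∧-true⁻ : ∀ x {y} → x ∧ y ≡ true → x ≡ true × y ≡ true
∧-true⁻ true e = refl , e

∧-falseˡ : ∀ {x y} → x ≡ false → x ∧ y ≡ false
∧-falseˡ refl = refl

-- The situation at the collapse of the rows `j + 1` and `j` while the letters `i + 1` are inserted:
-- `isA` is what remains in row `j + 1`, `isB` what row `j` already holds, and `isU` the letters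
-- that move down.
module Separation (i j : ℕ) where

  isA isB isU : Cell → Bool
  isA (ρ , x) = (ρ ≡ᵇ suc j) ∧ (x ≤ᵇ suc i)
  isB (ρ , x) = (ρ ≡ᵇ j) ∧ (x ≤ᵇ i)
  isU (ρ , x) = (x ≡ᵇ suc i) ∧ (ρ ≤ᵇ j)

  A-low : ∀ ρ x → ρ ≤ j → isA (ρ , x) ≡ false
  A-low ρ x h = ∧-falseˡ (≢⇒≡ᵇ ρ (suc j) (<⇒≢ (s≤s h)))

  after-U : ∀ c c′ → isU c ≡ true → CellOrd c c′ → isA c′ ≡ false × isB c′ ≡ false
  after-U (ρ , x) (ρ′ , x′) e o with ∧-true⁻ (x ≡ᵇ suc i) e
  ... | ex , eρ with ≡ᵇ-true⁻ {x} ex | ≤ᵇ-true⁻ {ρ} eρ | o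
  ...   | refl | ρ≤j | inj₁ lt         = A-low ρ′ x′ (≤-trans (<⇒≤ lt) ρ≤j) , ∧-falseˡ (≢⇒≡ᵇ ρ′ j (<⇒≢ (<-≤-trans lt ρ≤j)))
  ...   | refl | ρ≤j | inj₂ (refl , l) = A-low ρ′ x′ ρ≤j , trans (cong ((ρ′ ≡ᵇ j) ∧_) (≤ᵇ-false l)) (∧-zeroʳ (ρ′ ≡ᵇ j))

  after-B : ∀ c c′ → isB c ≡ true → CellOrd c c′ → isA c′ ≡ false
  after-B (ρ , x) (ρ′ , x′) e o with ≡ᵇ-true⁻ {ρ} (proj₁ (∧-true⁻ (ρ ≡ᵇ j) e)) | o
  ... | refl | inj₁ lt         = A-low ρ′ x′ (<⇒≤ lt)
  ... | refl | inj₂ (refl , l) = A-low ρ′ x′ ≤-refl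

  B-not-U : ∀ c → isB c ≡ true → isU c ≡ false
  B-not-U (ρ , x) e = ∧-falseˡ (≢⇒≡ᵇ x (suc i) (<⇒≢ (s≤s (≤ᵇ-true⁻ (proj₂ (∧-true⁻ (ρ ≡ᵇ j) e))))))

  A-not-BU : ∀ c → isA c ≡ true → isB c ≡ false × isU c ≡ false
  A-not-BU (ρ , x) e with ≡ᵇ-true⁻ {ρ} (proj₁ (∧-true⁻ (ρ ≡ᵇ suc j) e))
  ... | refl = ∧-falseˡ (≢⇒≡ᵇ (suc j) j 1+n≢n) , trans (cong ((x ≡ᵇ suc i) ∧_) (≤ᵇ-false (n<1+n j))) (∧-zeroʳ (x ≡ᵇ suc i))

  phU : ∀ l → All (λ c → isA c ≡ false × isB c ≡ false) l → PhU (vecOf isA l) (vecOf isB l) (vecOf isU l)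
  phU []      []       = tt
  phU (c ∷ l) (h ∷ hs) = proj₁ h , proj₂ h , phU l hs

  phB : ∀ l → All (λ c → isA c ≡ false) l → AllPairs CellOrd l → PhB (vecOf isA l) (vecOf isB l) (vecOf isU l)
  phB []      []       []       = tt
  phB (c ∷ l) (h ∷ hs) (o ∷ os) = h , B-not-U c , (λ e → phU l (All.map (λ {c′} → after-U c c′ e) o)) , phB l hs os

  phA : ∀ l → AllPairs CellOrd l → PhA (vecOf isA l) (vecOf isB l) (vecOf isU l)
  phA []      []       = tt
  phA (c ∷ l) (o ∷ os) = A-not-BU c , (λ e → B-not-U c e , phB l (All.map (λ {c′} → after-B c c′ e) o) os) ,
    (λ e → phU l (All.map (λ {c′} → after-U c c′ e) o)) , phA l os

-- Rows of the configuration after the letters up to i have been inserted.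
pD : ℕ → ℕ → Cell → Bool
pD i j (ρ , x) = if suc j ≤ᵇ i then (ρ ≡ᵇ j) ∧ (x ≤ᵇ i) else (x ≡ᵇ suc j)

-- Row `j` in the middle of an insertion, carrying also those letters `i + 1` whose final place is
-- in row `j` or below.
pH : ℕ → ℕ → Cell → Bool
pH i j (ρ , x) = ((ρ ≡ᵇ j) ∧ (x ≤ᵇ i)) ∨ ((x ≡ᵇ suc i) ∧ (ρ ≤ᵇ j))

≤ᵇ-suc : ∀ m n → (m ≤ᵇ suc n) ≡ (m ≤ᵇ n) ∨ (m ≡ᵇ suc n)
≤ᵇ-suc m n with <-cmp m (suc n)
... | tri< a ne _ rewrite ≤ᵇ-true (<⇒≤ a) | ≤ᵇ-true (s≤s⁻¹ a) = refl
... | tri≈ _ refl _ rewrite ≤ᵇ-true (≤-refl {suc n}) | ≤ᵇ-false (n<1+n n) | ≡ᵇ-refl n = refl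
... | tri> _ ne g rewrite ≤ᵇ-false g | ≤ᵇ-false (<-trans (n<1+n n) g) | ≢⇒≡ᵇ m (suc n) ne = refl

module _ (l : List Cell) (ord : AllPairs CellOrd l) (low : All (λ c → suc (proj₁ c) ≤ proj₂ c) l)
         (fits : ∀ i j → count (Separation.isA i j) l ≤ count (Separation.isB i j) l) where

  sep : ∀ i j → suc j ≤ i → S2 (vecOf (pD i j) l) (vecOf (pH i (suc j)) l) ≡ (vecOf (pH i j) l , vecOf (pD (suc i) (suc j)) l)
  sep i j h = begin
    S2 (vecOf (pD i j) l) (vecOf (pH i (suc j)) l)
      ≡⟨ cong₂ S2 (vecOf-cong l (All.universal (λ c → d≡ c) l))
                  (trans (vecOf-cong l (All.universal (λ c → h≡ c) l)) (sym (vecOf-∨ isA isU l))) ⟩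
    S2 (vecOf isB l) (vecOf isA l ∨ᵥ vecOf isU l)
      ≡⟨ proj₂ (S2-A (vecOf isA l) (vecOf isB l) (vecOf isU l) (phA l ord)
           (≤-trans (≤-reflexive (cnt-vecOf isA l)) (≤-trans (fits i j) (≤-reflexive (sym (cnt-vecOf isB l)))))) ⟩
    (vecOf isB l ∨ᵥ vecOf isU l , vecOf isA l)
      ≡⟨ cong₂ _,_ (vecOf-∨ isB isU l) (vecOf-cong l (All.universal (λ c → a≡ c) l)) ⟩
    (vecOf (pH i j) l , vecOf (pD (suc i) (suc j)) l) ∎
    where
    open ≡-Reasoning
    open Separation i j
    d≡ : ∀ c → pD i j c ≡ isB c
    d≡ (ρ , x) rewrite ≤ᵇ-true h = refl
    a≡ : ∀ c → isA c ≡ pD (suc i) (suc j) c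
    a≡ (ρ , x) rewrite ≤ᵇ-true (s≤s h) = refl
    h≡ : ∀ c → pH i (suc j) c ≡ isA c ∨ isU c
    h≡ (ρ , x) rewrite ≤ᵇ-suc ρ j | ≤ᵇ-suc x i = lem (ρ ≡ᵇ suc j) (x ≤ᵇ i) (x ≡ᵇ suc i) (ρ ≤ᵇ j)
      where
      lem : ∀ b c d e → (b ∧ c) ∨ (d ∧ (e ∨ b)) ≡ (b ∧ (c ∨ d)) ∨ (d ∧ e)
      lem true  true  d     e     = refl
      lem true  false true  true  = refl
      lem true  false true  false = refl
      lem true  false false e     = refl
      lem false c     true  true  = refl
      lem false c     true  false = refl
      lem false c     false e     = refl

  stage : ∀ k i j r → j + k ≡ i → k ≤ r →
    appD k (applyUpTo (λ t → vecOf (pD i (j + t)) l) (suc r)) ≡ vecOf (pH i j) l ∷ applyUpTo (λ t → vecOf (pD (suc i) (suc j + t)) l) r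
  stage zero i j r e _ rewrite +-identityʳ j | e = cong₂ _∷_ (vecOf-cong l (All.map top low))
      (applyUpTo-cong (λ t → vecOf-cong l (All.universal (λ c → above t c) l)) r)
    where
    top : ∀ {c} → suc (proj₁ c) ≤ proj₂ c → pD i i c ≡ pH i i c
    top {ρ , x} h rewrite ≤ᵇ-false (n<1+n i) with <-cmp ρ i
    ... | tri< a ne _ rewrite ≢⇒≡ᵇ ρ i ne | ≤ᵇ-true (<⇒≤ a) = sym (∧-identityʳ _)
    ... | tri≈ _ refl _ rewrite ≡ᵇ-refl ρ | ≤ᵇ-true (≤-refl {ρ}) | ≤ᵇ-false h = sym (∧-identityʳ _)
    ... | tri> _ ne g rewrite ≢⇒≡ᵇ ρ i ne | ≤ᵇ-false g | ≢⇒≡ᵇ x (suc i) (<⇒≢ (<-≤-trans (s≤s g) h) ∘ sym) = refl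
    above : ∀ t c → pD i (i + suc t) c ≡ pD (suc i) (suc i + t) c
    above t (ρ , x) rewrite +-suc i t | ≤ᵇ-false {suc (suc (i + t))} {i} (s≤s (≤-trans (m≤m+n i t) (n≤1+n _)))
                          | ≤ᵇ-false {suc (suc (i + t))} {suc i} (s≤s (s≤s (m≤m+n i t))) = refl
  stage (suc k) i j (suc r) e (s≤s h) = begin
    Sv 0 (vecOf (pD i (j + 0)) l ∷ appD k (applyUpTo (λ t → vecOf (pD i (j + suc t)) l) (suc r)))
      ≡⟨ cong₂ (λ a N → Sv 0 (vecOf (pD i a) l ∷ N)) (+-identityʳ j)
           (trans (cong (appD k) (applyUpTo-cong (λ t → cong (λ a → vecOf (pD i a) l) (+-suc j t)) (suc r)))
                  (stage k i (suc j) r (trans (sym (+-suc j k)) e) h)) ⟩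
    consC (S2 (vecOf (pD i j) l) (vecOf (pH i (suc j)) l)) (applyUpTo (λ t → vecOf (pD (suc i) (suc (suc j) + t)) l) r)
      ≡⟨ cong (λ w → consC w (applyUpTo (λ t → vecOf (pD (suc i) (suc (suc j) + t)) l) r)) (sep i j (subst (suc j ≤_) e (subst (suc j ≤_) (sym (+-suc j k)) (s≤s (m≤m+n j k))))) ⟩
    vecOf (pH i j) l ∷ vecOf (pD (suc i) (suc j)) l ∷ applyUpTo (λ t → vecOf (pD (suc i) (suc (suc j) + t)) l) r
      ≡⟨ cong₂ (λ a N → vecOf (pH i j) l ∷ vecOf (pD (suc i) a) l ∷ N) (sym (+-identityʳ (suc j)))
           (applyUpTo-cong (λ t → cong (λ a → vecOf (pD (suc i) a) l) (sym (+-suc (suc j) t))) r) ⟩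
    vecOf (pH i j) l ∷ applyUpTo (λ t → vecOf (pD (suc i) (suc j + t)) l) (suc r) ∎
    where open ≡-Reasoning

  Dcfg : ℕ → ℕ → Config (length l)
  Dcfg r i = applyUpTo (λ j → vecOf (pD i j) l) (suc r)

  insert-letter : ∀ r i → i ≤ r → runS (down i) (Dcfg r i) ≡ Dcfg r (suc i)
  insert-letter r i h = trans (runS-down i (Dcfg r i)) (trans (stage i i 0 r refl h)
    (cong (_∷ applyUpTo (λ t → vecOf (pD (suc i) (suc t)) l) r) (vecOf-cong l (All.universal (λ c → bottom c) l))))
    where
    bottom : ∀ c → pH i 0 c ≡ pD (suc i) 0 c
    bottom (zero  , x) rewrite ≤ᵇ-suc x i = cong ((x ≤ᵇ i) ∨_) (∧-identityʳ (x ≡ᵇ suc i))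
    bottom (suc ρ , x) = ∧-zeroʳ (x ≡ᵇ suc i)

  sizes-Dcfg : ∀ r i → sizes (Dcfg r i) ≡ applyUpTo (λ j → count (pD i j) l) (suc r)
  sizes-Dcfg r i = trans (map-applyUpTo (λ j → vecOf (pD i j) l) cnt (suc r)) (applyUpTo-cong (λ j → cnt-vecOf (pD i j) l) (suc r))

weakIncr-tail : ∀ x q → weakIncr (x ∷ q) ≡ true → weakIncr q ≡ true
weakIncr-tail x []      _ = refl
weakIncr-tail x (y ∷ q) e = proj₂ (∧-true⁻ (x ≤ᵇ y) e)

weakIncr-All : ∀ x q → weakIncr (x ∷ q) ≡ true → All (x ≤_) q
weakIncr-All x []      _ = []
weakIncr-All x (y ∷ q) e = x≤y ∷ All.map (≤-trans x≤y) (weakIncr-All y q (proj₂ (∧-true⁻ (x ≤ᵇ y) e)))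
  where x≤y = ≤ᵇ-true⁻ (proj₁ (∧-true⁻ (x ≤ᵇ y) e))

filter-min : ∀ v q → All (v ≤_) q → filterᵇ (_≤ᵇ v) q ≡ replicate (count (_≤ᵇ v) q) v
filter-min v []      []       = refl
filter-min v (x ∷ q) (h ∷ hs) with x ≤ᵇ v in e
... | true  = cong₂ _∷_ (≤-antisym (≤ᵇ-true⁻ e) h) (filter-min v q hs)
... | false = filter-min v q hs

inc-filter : ∀ i q → weakIncr q ≡ true →
  filterᵇ (_≤ᵇ suc i) q ≡ filterᵇ (_≤ᵇ i) q ++ replicate (count (_≤ᵇ suc i) q ∸ count (_≤ᵇ i) q) (suc i)
inc-filter i []      _ = refl
inc-filter i (x ∷ q) e with ≤-<-connex x i
... | inj₁ h rewrite ≤ᵇ-true h | ≤ᵇ-true (m≤n⇒m≤1+n h) = cong (x ∷_) (inc-filter i q (weakIncr-tail x q e))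
... | inj₂ h = trans (filter-min (suc i) (x ∷ q) big)
    (sym (cong₂ (λ a b → a ++ replicate (count (_≤ᵇ suc i) (x ∷ q) ∸ b) (suc i)) none (cong length none)))
  where
  big : All (suc i ≤_) (x ∷ q)
  big = h ∷ All.map (≤-trans h) (weakIncr-All x q e)
  none : filterᵇ (_≤ᵇ i) (x ∷ q) ≡ []
  none = filterᵇ-none (_≤ᵇ i) (x ∷ q) (All.map ≤ᵇ-false big)

cells-above : ∀ s Q → All (λ c → s ≤ proj₁ c) (cellsFrom s Q)
cells-above s []      = []
cells-above s (q ∷ Q) = All.++⁺ (All.map (≤-trans (n≤1+n s)) (cells-above (suc s) Q)) (All.map⁺ (All.universal (λ _ → ≤-refl) q))

count-map-cell : ∀ (p : ℕ → Bool) (s : ℕ) q → count (λ c → (proj₁ c ≡ᵇ s) ∧ p (proj₂ c)) (map (s ,_) q) ≡ count p q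
count-map-cell p s []      = refl
count-map-cell p s (x ∷ q) rewrite ≡ᵇ-refl s with p x
... | true  = cong suc (count-map-cell p s q)
... | false = count-map-cell p s q

count-cells : ∀ (p : ℕ → Bool) s t Q → count (λ c → (proj₁ c ≡ᵇ s + t) ∧ p (proj₂ c)) (cellsFrom s Q) ≡ count p (nth [] Q t)
count-cells p s t       []      = refl
count-cells p s zero    (q ∷ Q) rewrite +-identityʳ s = trans (count-++ _ (cellsFrom (suc s) Q) (map (s ,_) q))
    (cong₂ _+_ (count-none _ (cellsFrom (suc s) Q) (All.map (λ {c} h → ∧-falseˡ (≢⇒≡ᵇ (proj₁ c) s (<⇒≢ h ∘ sym))) (cells-above (suc s) Q)))
               (count-map-cell p s q))
count-cells p s (suc t) (q ∷ Q) = trans (count-++ _ (cellsFrom (suc s) Q) (map (s ,_) q))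
    (trans (cong₂ _+_ (trans (cong (λ z → count (λ c → (proj₁ c ≡ᵇ z) ∧ p (proj₂ c)) (cellsFrom (suc s) Q)) (+-suc s t)) (count-cells p (suc s) t Q))
                      (count-none _ (map (s ,_) q) (All.map⁺ (All.universal (λ _ → ∧-falseˡ (≢⇒≡ᵇ s (s + suc t) (<⇒≢ (m<m+n s z<s)))) q))))
           (+-identityʳ _))

restr : ℕ → ℕ → Tableau → Tableau
restr i k Q = map (filterᵇ (_≤ᵇ i)) (take k Q)

updS-restr : ∀ i k Q (f g : ℕ → ℕ) r → k < length Q → length Q ≡ suc r →
  All (λ q → weakIncr q ≡ true) Q → count (_≤ᵇ i) (nth [] Q k) ≡ 0 →
  (∀ t → t < k → f t ≡ count (_≤ᵇ i) (nth [] Q t)) → (∀ t → t ≤ k → g t ≡ count (_≤ᵇ suc i) (nth [] Q t)) →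
  updS (suc i) (restr i k Q) (applyUpTo f (suc r)) (applyUpTo g (suc r)) ≡ restr (suc i) (suc k) Q
updS-restr i zero    (q ∷ Q) f g r       l       e (w ∷ ws) z hf hg =
  cong (_∷ []) (trans (cong (λ m → replicate m (suc i)) (hg 0 z≤n)) (sym (trans (inc-filter i q w)
    (cong₂ (λ a b → a ++ replicate (count (_≤ᵇ suc i) q ∸ b) (suc i)) (length≡0⇒[] (filterᵇ (_≤ᵇ i) q) z) z))))
updS-restr i (suc k) (q ∷ Q) f g zero    (s≤s l) e (w ∷ ws) z hf hg = contradiction (≤-trans l (≤-reflexive (suc-injective e))) λ ()
updS-restr i (suc k) (q ∷ Q) f g (suc r) (s≤s l) e (w ∷ ws) z hf hg =
  cong₂ _∷_ (trans (cong₂ (λ a b → filterᵇ (_≤ᵇ i) q ++ replicate (a ∸ b) (suc i)) (hg 0 z≤n) (hf 0 z<s)) (sym (inc-filter i q w)))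
            (updS-restr i k Q (f ∘ suc) (g ∘ suc) r l (suc-injective e) ws z (λ t h → hf (suc t) (s<s h)) (λ t h → hg (suc t) (s≤s h)))

-- `columnsStrict` compares two rows only as far as both reach, so the condition on their lengths
-- has to be stated separately.
Shape : Tableau → Set
Shape []           = ⊤
Shape (q ∷ [])     = ⊤
Shape (q ∷ q′ ∷ Q) = length q′ ≤ length q × Shape (q′ ∷ Q)

count-∷-≤ : ∀ (p : ℕ → Bool) x q → count p q ≤ count p (x ∷ q)
count-∷-≤ p x q with p x
... | true  = n≤1+n _
... | false = ≤-refl

strict-count : ∀ i q q′ → strictAbove q q′ ≡ true → length q′ ≤ length q → count (_≤ᵇ suc i) q′ ≤ count (_≤ᵇ i) q
strict-count i q       []       _ _       = z≤n
strict-count i (x ∷ q) (y ∷ q′) e (s≤s l) with ∧-true⁻ (x <ᵇ y) e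
... | lt , e′ with y ≤ᵇ suc i in ey
...   | false = ≤-trans (strict-count i q q′ e′ l) (count-∷-≤ (_≤ᵇ i) x q)
...   | true rewrite ≤ᵇ-true (s≤s⁻¹ (≤-trans (<ᵇ⇒< x y (subst T (sym lt) tt)) (≤ᵇ-true⁻ {y} ey))) = s≤s (strict-count i q q′ e′ l)

strict-low : ∀ k q q′ → strictAbove q q′ ≡ true → length q′ ≤ length q → All (k ≤_) q → All (suc k ≤_) q′
strict-low k q       []       _ _       _        = []
strict-low k (x ∷ q) (y ∷ q′) e (s≤s l) (h ∷ hs) with ∧-true⁻ (x <ᵇ y) e
... | lt , e′ = ≤-trans (s≤s h) (<ᵇ⇒< x y (subst T (sym lt) tt)) ∷ strict-low k q q′ e′ l hs

module WordConfig (q₀ : List ℕ) (Q₀ : Tableau)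
                  (weak : All (λ q → weakIncr q ≡ true) (q₀ ∷ Q₀)) (strict : columnsStrict (q₀ ∷ Q₀) ≡ true)
                  (shape : Shape (q₀ ∷ Q₀)) (entries : Entries (suc (length Q₀)) (q₀ ∷ Q₀)) where

  Q = q₀ ∷ Q₀
  l = cellsFrom 0 Q

  ord : AllPairs CellOrd l
  ord = go 0 Q weak
    where
    rowOrd : ∀ s q → weakIncr q ≡ true → AllPairs CellOrd (map (s ,_) q)
    rowOrd s []      _ = []
    rowOrd s (x ∷ q) e = All.map⁺ (All.map (λ h → inj₂ (refl , h)) (weakIncr-All x q e)) ∷ rowOrd s q (weakIncr-tail x q e)
    go : ∀ s Q → All (λ q → weakIncr q ≡ true) Q → AllPairs CellOrd (cellsFrom s Q)
    go s []      []       = []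
    go s (q ∷ Q) (w ∷ ws) = APP.++⁺ (go (suc s) Q ws) (rowOrd s q w) (All.map (λ h → All.map⁺ (All.universal (λ _ → inj₁ h) q)) (cells-above (suc s) Q))

  lowRows : ∀ s q Q → columnsStrict (q ∷ Q) ≡ true → Shape (q ∷ Q) → All (suc s ≤_) q → All (λ c → suc (proj₁ c) ≤ proj₂ c) (cellsFrom s (q ∷ Q))
  lowRows s q []       _ _       h = All.map⁺ h
  lowRows s q (q′ ∷ Q) e (l , S) h =
    All.++⁺ (lowRows (suc s) q′ Q (columnsStrict-cons q (q′ ∷ Q) e) S (strict-low (suc s) q q′ (columnsStrict-head q q′ Q e) l h)) (All.map⁺ h)

  low : All (λ c → suc (proj₁ c) ≤ proj₂ c) l
  low = lowRows 0 q₀ Q₀ strict shape (All.map proj₁ (All.head entries))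

  row-counts : ∀ i j → count (_≤ᵇ suc i) (nth [] Q (suc j)) ≤ count (_≤ᵇ i) (nth [] Q j)
  row-counts i j = go j q₀ Q₀ strict shape
    where
    go : ∀ j q Q → columnsStrict (q ∷ Q) ≡ true → Shape (q ∷ Q) → count (_≤ᵇ suc i) (nth [] (q ∷ Q) (suc j)) ≤ count (_≤ᵇ i) (nth [] (q ∷ Q) j)
    go j       q []       _ _       = z≤n
    go zero    q (q′ ∷ Q) e (l , _) = strict-count i q q′ (columnsStrict-head q q′ Q e) l
    go (suc j) q (q′ ∷ Q) e (_ , S) = go j q′ Q (columnsStrict-cons q (q′ ∷ Q) e) S

  fits : ∀ i j → count (Separation.isA i j) l ≤ count (Separation.isB i j) l
  fits i j = ≤-trans (≤-reflexive (count-cells (_≤ᵇ suc i) 0 (suc j) Q)) (≤-trans (row-counts i j) (≤-reflexive (sym (count-cells (_≤ᵇ i) 0 j Q))))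

  r = length Q₀
  D = Dcfg l ord low fits r

  Mw : Config (length l)
  Mw = applyUpTo (λ j → vecOf (λ c → proj₂ c ≡ᵇ suc j) l) (suc r)

  Mw≡D : Mw ≡ D 1
  Mw≡D = cong₂ _∷_ (vecOf-cong l (All.map (λ {c} → first {c}) low)) refl
    where
    first : ∀ {c} → suc (proj₁ c) ≤ proj₂ c → (proj₂ c ≡ᵇ 1) ≡ pD 1 0 c
    first {zero  , suc zero}    _ = refl
    first {zero  , suc (suc x)} _ = refl
    first {suc ρ , suc zero}    (s≤s ())
    first {suc ρ , suc (suc x)} _ = refl

  nth-low : ∀ t → count (_≤ᵇ t) (nth [] Q t) ≡ 0
  nth-low t = go t 0 q₀ Q₀ strict shape (All.map proj₁ (All.head entries))
    where
    go : ∀ t s q Q → columnsStrict (q ∷ Q) ≡ true → Shape (q ∷ Q) → All (suc s ≤_) q → count (_≤ᵇ (s + t)) (nth [] (q ∷ Q) t) ≡ 0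
    go zero    s q Q        _ _       h rewrite +-identityʳ s = count-none (_≤ᵇ s) q (All.map ≤ᵇ-false h)
    go (suc t) s q []       _ _       h = refl
    go (suc t) s q (q′ ∷ Q) e (l , S) h rewrite +-suc s t = go t (suc s) q′ Q (columnsStrict-cons q (q′ ∷ Q) e) S (strict-low (suc s) q q′ (columnsStrict-head q q′ Q e) l h)

  pD-count : ∀ i j → suc j ≤ i → count (pD i j) l ≡ count (_≤ᵇ i) (nth [] Q j)
  pD-count i j h = trans (cong (λ b → count (λ c → if b then (proj₁ c ≡ᵇ j) ∧ (proj₂ c ≤ᵇ i) else (proj₂ c ≡ᵇ suc j)) l) (≤ᵇ-true h)) (count-cells (_≤ᵇ i) 0 j Q)

  loop : ∀ k i → i + k ≡ suc r → qLoop i k (D i) (restr i i Q) ≡ restr (suc r) (suc r) Q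
  loop zero    i e = cong (λ m → restr m m Q) (trans (sym (+-identityʳ i)) e)
  loop (suc k) i e =
    trans (cong (λ N → qLoop (suc i) k N (updS (suc i) (restr i i Q) (sizes (D i)) (sizes N))) (insert-letter l ord low fits r i i≤r))
      (trans (cong (qLoop (suc i) k (D (suc i)))
               (trans (cong₂ (updS (suc i) (restr i i Q)) (sizes-Dcfg l ord low fits r i) (sizes-Dcfg l ord low fits r (suc i)))
                 (updS-restr i i Q _ _ r (s≤s i≤r) refl weak (nth-low i) (λ t h → pD-count i t h) (λ t h → pD-count (suc i) t (s≤s h)))))
             (loop k (suc i) (trans (sym (+-suc i k)) e)))
    where
    i≤r : i ≤ r
    i≤r = s≤s⁻¹ (subst (suc i ≤_) e (subst (suc i ≤_) (sym (+-suc i k)) (s≤s (m≤m+n i k))))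

  -- Inserting the letters of the reading word value by value moves each of them to its own row of
  -- the tableau. The rows that grow when `i` is inserted are thus those containing `i`, and the
  -- tableau records itself.
  rhoQ-Mw : rhoQ Mw ≡ Q
  rhoQ-Mw = begin
    rhoQ Mw
      ≡⟨ cong (λ m → qLoop 1 (m ∸ 1) Mw (replicate (nth 0 (sizes Mw) 0) 1 ∷ [])) (length-applyUpTo (λ j → vecOf (λ c → proj₂ c ≡ᵇ suc j) l) (suc r)) ⟩
    qLoop 1 r Mw (replicate (nth 0 (sizes Mw) 0) 1 ∷ [])
      ≡⟨ cong (λ N → qLoop 1 r N (replicate (nth 0 (sizes N) 0) 1 ∷ [])) Mw≡D ⟩
    qLoop 1 r (D 1) (replicate (nth 0 (sizes (D 1)) 0) 1 ∷ [])
      ≡⟨ cong (λ z → qLoop 1 r (D 1) (z ∷ [])) (trans (cong (λ s → replicate (nth 0 s 0) 1) (sizes-Dcfg l ord low fits r 1))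
           (trans (cong (λ z → replicate z 1) (pD-count 1 0 ≤-refl)) (sym (filter-min 1 q₀ (All.map proj₁ (All.head entries)))))) ⟩
    qLoop 1 r (D 1) (restr 1 1 Q)
      ≡⟨ loop r 1 refl ⟩
    restr (suc r) (suc r) Q
      ≡⟨ cong (map (filterᵇ (_≤ᵇ suc r))) (take-all (suc r) Q ≤-refl) ⟩
    map (filterᵇ (_≤ᵇ suc r)) Q
      ≡⟨ rowsAll Q entries ⟩
    Q ∎
    where
    open ≡-Reasoning
    rowsAll : ∀ Q → Entries (suc r) Q → map (filterᵇ (_≤ᵇ suc r)) Q ≡ Q
    rowsAll []      []       = refl
    rowsAll (q ∷ Q) (e ∷ es) = cong₂ _∷_ (filterᵇ-all (_≤ᵇ suc r) q (All.map (λ x → ≤ᵇ-true (proj₂ x)) e)) (rowsAll Q es)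

-- Wraps along chains of rows, and their minimum

-- Total number of wrapping pairings along a chain of rows.
wD : ∀ {n} → Row n → List (Row n) → ℕ
wD S []       = 0
wD S (R ∷ Rs) = uy R S + wD (Tc R S) Rs

-- Every prefix of F contains at least as many balls as that of A, up to v.
PD : ∀ {n} → ℕ → Row n → Row n → Set
PD v []      []      = ⊤
PD v (f ∷ F) (a ∷ A) = ∃ λ v₁ → v₁ + bit a ≡ v + bit f × PD v₁ F A

PD-refl : ∀ {n} (X : Row n) → PD 0 X X
PD-refl []      = tt
PD-refl (x ∷ X) = 0 , refl , PD-refl X

at-cd : ∀ {n} (A S : Row n) c → A ⊑ S → at c A ≡ at c S ∧ not (elemᵇ c (cd A S))
at-cd []      []      c       _       = refl
at-cd (a ∷ A) (s ∷ S) zero    (h , i) = lem s a h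
  where
  lem : ∀ s a → (s ≡ false → a ≡ false) → a ≡ s ∧ not (elemᵇ 0 (consIf (s ∧ not a) (map suc (cd A S))))
  lem true  true  h = sym (cong not (elemᵇ-zero (cd A S)))
  lem true  false h = refl
  lem false a     h = h refl
at-cd (a ∷ A) (s ∷ S) (suc c) (h , i) = trans (at-cd A S c i) (cong (λ x → at c S ∧ not x) (sym (lem (s ∧ not a))))
  where
  lem : ∀ x → elemᵇ (suc c) (consIf x (map suc (cd A S))) ≡ elemᵇ c (cd A S)
  lem true  = elemᵇ-suc c (cd A S)
  lem false = elemᵇ-suc c (cd A S)

idleCols-drop : ∀ {n} q (b S : Row n) → idleCols q b S ≡ drop q (idleCols 0 b S)
idleCols-drop zero    b S = refl
idleCols-drop (suc q) b S = trans (idleCols-suc q b S) (trans (cong (drop 1) (idleCols-drop q b S)) (drop-1-drop q (idleCols 0 b S)))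

-- Cyclic pairing is a queue in equilibrium: `uy R S` balls leave at the right edge and reenter at
-- the left, and with that many waiting at the start the same number waits at the end
-- (`finalQueue-uy`).
Tc≡serve-uy : ∀ {n} (R S : Row n) → cnt S ≤ cnt R → Tc R S ≡ serve (uy R S) R S
Tc≡serve-uy R S h = row-ext _ _ λ c _ → trans (at-Tc R S c h)
  (trans (cong (λ l → at c R ∧ not (elemᵇ c l)) (sym (idleCols-drop (uy R S) R S))) (sym (at-cd (serve (uy R S) R S) R c (serve-⊑ (uy R S) R S))))

cnt-serve+queue : ∀ {n} q (b t : Row n) → cnt (serve q b t) + finalQueue q b t ≡ q + cnt t
cnt-serve+queue q []      []      = sym (+-identityʳ q)
cnt-serve+queue q (p ∷ b) (s ∷ t) = begin
  (bit h + C) + finalQueue m b t ≡⟨ +-assoc (bit h) C _ ⟩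
  bit h + (C + finalQueue m b t) ≡⟨ cong (bit h +_) (cnt-serve+queue m b t) ⟩
  bit h + (m + cnt t)            ≡⟨ +-assoc (bit h) m (cnt t) ⟨
  bit h + m + cnt t              ≡⟨ cong (_+ cnt t) (hit+left p (bit s + q)) ⟩
  bit s + q + cnt t              ≡⟨ solve 3 (λ s q t → s :+ q :+ t := q :+ (s :+ t)) refl (bit s) q (cnt t) ⟩
  q + (bit s + cnt t)            ∎
  where
  open ≡-Reasoning
  open +-*-Solver
  h = hit p (bit s + q)
  m = left p (bit s + q)
  C = cnt (serve m b t)

uy≤ux : ∀ {n} (R S : Row n) → cnt S ≤ cnt R → uy R S ≤ ux R S
uy≤ux R S h = +-cancelʳ-≤ (cnt S) _ _ (≤-trans (+-monoʳ-≤ (uy R S) h) (≤-reflexive (balance R S)))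

finalQueue-uy : ∀ {n} (R S : Row n) → cnt S ≤ cnt R → finalQueue (uy R S) R S ≡ uy R S
finalQueue-uy R S h = trans (finalQueue≡ (uy R S) R S) (cong (_+ uy R S) (m≤n⇒m∸n≡0 (uy≤ux R S h)))

cnt-Tc : ∀ {n} (R S : Row n) → cnt S ≤ cnt R → cnt (Tc R S) ≡ cnt S
cnt-Tc R S h = +-cancelʳ-≡ (uy R S) _ _ (begin
  cnt (Tc R S) + uy R S                                   ≡⟨ cong₂ (λ x y → cnt x + y) (Tc≡serve-uy R S h) (sym (finalQueue-uy R S h)) ⟩
  cnt (serve (uy R S) R S) + finalQueue (uy R S) R S      ≡⟨ cnt-serve+queue (uy R S) R S ⟩
  uy R S + cnt S                                          ≡⟨ +-comm (uy R S) (cnt S) ⟩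
  cnt S + uy R S                                          ∎)
  where open ≡-Reasoning

ux≡uy : ∀ {n} (b t : Row n) → cnt b ≡ cnt t → ux b t ≡ uy b t
ux≡uy b t e = +-cancelʳ-≡ (cnt t) _ _ (trans (sym (balance b t)) (cong (uy b t +_) e))

finalQueue-serve : ∀ {n} q (R S : Row n) → finalQueue q (serve q R S) S ≡ finalQueue q R S
finalQueue-serve q []      []      = refl
finalQueue-serve q (p ∷ R) (s ∷ S) = trans (cong (λ m → finalQueue m (serve (left p (bit s + q)) R S) S) (lem p (bit s + q)))
                                           (finalQueue-serve (left p (bit s + q)) R S)
  where
  lem : ∀ p m → left (hit p m) m ≡ left p m
  lem true  zero    = refl
  lem true  (suc m) = refl
  lem false m       = refl

finalQueue-mono : ∀ {n} q q′ (R D S : Row n) → q ≤ q′ → D ⊑ R → finalQueue q R S ≤ finalQueue q′ D S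
finalQueue-mono q q′ []      []      []      l _       = l
finalQueue-mono q q′ (p ∷ R) (d ∷ D) (s ∷ S) l (h , i) = finalQueue-mono _ _ R D S (lem p d h (+-monoʳ-≤ (bit s) l)) i
  where
  lem : ∀ p d → (p ≡ false → d ≡ false) → ∀ {m m′} → m ≤ m′ → left p m ≤ left d m′
  lem true  true  _ l = pred-mono-≤ l
  lem true  false _ l = ≤-trans pred[n]≤n l
  lem false d     h l rewrite h refl = l

uy-Tc : ∀ {n} (R S : Row n) → cnt S ≤ cnt R → uy (Tc R S) S ≡ uy R S
uy-Tc R S h rewrite Tc≡serve-uy R S h = ≤-antisym
  (subst (uy D S ≤_) fin (m≤n+m (uy D S) (uy R S ∸ uy D S)))
  (≤-trans (≤-reflexive (sym (finalQueue₀ R S))) (≤-trans (finalQueue-mono 0 0 R D S z≤n (serve-⊑ (uy R S) R S)) (≤-reflexive (finalQueue₀ D S))))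
  where
  D = serve (uy R S) R S
  cntD : cnt D ≡ cnt S
  cntD = trans (cong cnt (sym (Tc≡serve-uy R S h))) (cnt-Tc R S h)
  fin : (uy R S ∸ uy D S) + uy D S ≡ uy R S
  fin = trans (cong (λ x → (uy R S ∸ x) + uy D S) (sym (ux≡uy D S cntD)))
          (trans (sym (finalQueue≡ (uy R S) D S)) (trans (finalQueue-serve (uy R S) R S) (finalQueue-uy R S h)))

-- Two queues run side by side, the greedy one on all services `R` and a competitor that uses each
-- service of `A`. `v` and `u` are the leads of the greedy one in arrivals and in departures. A ball
-- that has arrived is waiting or has departed, hence the equation between leads and queue lengths.
run : ∀ {n} (R F A A′ : Row n) qF qA v u → A ⊑ R → PD v F A′ → serve qA A A′ ≡ A → u + qF ≡ v + qA →
      finalQueue qF R F + cnt A′ ≤ (v + cnt F) + finalQueue qA A A′ × PD u (serve qF R F) A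
run []      []      []      []        qF qA v u _       _               _   e = ≤-reflexive′ , tt
  where
  ≤-reflexive′ : qF + 0 ≤ (v + 0) + qA
  ≤-reflexive′ = ≤-trans (≤-reflexive (+-identityʳ qF)) (≤-trans (m≤n+m qF u) (≤-reflexive (trans e (cong (_+ qA) (sym (+-identityʳ v))))))
run (r ∷ R) (f ∷ F) (a ∷ A) (a′ ∷ A′) qF qA v u (h , i) (v₁ , ev , pd) va e =
  (begin
     finalQueue qF₁ R F + (bit a′ + cnt A′)          ≡⟨ solve 3 (λ x y z → x :+ (y :+ z) := (x :+ z) :+ y) refl _ (bit a′) (cnt A′) ⟩
     (finalQueue qF₁ R F + cnt A′) + bit a′          ≤⟨ +-monoˡ-≤ (bit a′) (proj₁ rec) ⟩
     ((v₁ + cnt F) + finalQueue qA₁ A A′) + bit a′   ≡⟨ solve 4 (λ x y z w → ((x :+ y) :+ z) :+ w := ((x :+ w) :+ y) :+ z) refl v₁ (cnt F) _ (bit a′) ⟩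
     ((v₁ + bit a′) + cnt F) + finalQueue qA₁ A A′   ≡⟨ cong (λ x → (x + cnt F) + finalQueue qA₁ A A′) ev ⟩
     ((v + bit f) + cnt F) + finalQueue qA₁ A A′     ≡⟨ cong (_+ finalQueue qA₁ A A′) (+-assoc v (bit f) (cnt F)) ⟩
     (v + (bit f + cnt F)) + finalQueue qA₁ A A′     ∎) ,
  (u₁ , u₁≡ , proj₂ rec)
  where
  open ≤-Reasoning
  open +-*-Solver
  hF = hit r (bit f + qF)
  qF₁ = left r (bit f + qF)
  qA₁ = left a (bit a′ + qA)
  aHit : hit a (bit a′ + qA) ≡ a
  aHit = Vec.∷-injectiveˡ va
  bal : (u + bit hF) + qF₁ ≡ (v₁ + qA₁) + bit a
  bal = let open ≡-Reasoning in trans (+-assoc u (bit hF) qF₁) (trans (cong (u +_) (hit+left r (bit f + qF)))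
    (trans (solve 3 (λ u f q → u :+ (f :+ q) := (u :+ q) :+ f) refl u (bit f) qF)
    (trans (cong (_+ bit f) e)
    (trans (solve 3 (λ v q f → (v :+ q) :+ f := (v :+ f) :+ q) refl v qA (bit f))
    (trans (cong (_+ qA) (sym ev))
    (trans (+-assoc v₁ (bit a′) qA)
    (trans (cong (v₁ +_) (trans (sym (hit+left a (bit a′ + qA))) (cong (λ x → bit x + qA₁) aHit)))
           (solve 3 (λ v b q → v :+ (b :+ q) := (v :+ q) :+ b) refl v₁ (bit a) qA₁))))))))
  -- The lead in departures can only shrink when `A` serves and the greedy queue is empty. With
  -- nothing waiting there, the balance expresses the new lead as `v₁ + qA₁`, a natural number.
  choose : ∀ a r m → (r ≡ false → a ≡ false) → (u + bit (hit r m)) + left r m ≡ (v₁ + qA₁) + bit a →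
           ∃ λ u₁ → u₁ + bit a ≡ u + bit (hit r m) × u₁ + left r m ≡ v₁ + qA₁
  choose false r    m       h b = u + bit (hit r m) , +-identityʳ _ , trans b (+-identityʳ _)
  choose true  true (suc m) h b = u , refl , suc-injective (trans (sym (+-suc u m)) (trans (trans (+-suc u m) (cong (_+ m) (sym (+-comm u 1)))) (trans b (+-comm _ 1))))
  choose true  true zero    h b = v₁ + qA₁ , trans (sym b) (+-identityʳ (u + 0)) , +-identityʳ (v₁ + qA₁)
  choose true  false m      h b = contradiction (h refl) λ ()
  ch = choose a r (bit f + qF) h bal
  u₁ = proj₁ ch
  u₁≡ = proj₁ (proj₂ ch)
  rec = run R F A A′ qF₁ qA₁ v₁ u₁ i pd (Vec.∷-injectiveʳ va) (proj₂ (proj₂ ch))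

-- The first pass of the queue compares the numbers of wraps, the second one the
-- positions.
earliest : ∀ {n} (R F A A′ : Row n) v → A ⊑ R → PD v F A′ → cnt F ≡ cnt A′ → cnt A ≡ cnt A′ →
           ∃ λ u → u + uy R F ≡ v + uy A A′ × PD u (Tc R F) A
earliest R F A A′ v i pd eF eA = (v + w) ∸ uy R F , m∸n+n≡m le ,
  subst (λ X → PD ((v + w) ∸ uy R F) X A) (sym (Tc≡serve-uy R F F≤R)) (proj₂ (run R F A A′ (uy R F) w v _ i pd valid (m∸n+n≡m le)))
  where
  w = uy A A′
  F≤R : cnt F ≤ cnt R
  F≤R = ≤-trans (≤-reflexive (trans eF (sym eA))) (≼-cnt A R (⊑⇒≼ A R i))
  valid : serve w A A′ ≡ A
  valid = serve-full w A A′ (≤-reflexive (ux≡uy A A′ eA))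
  le : uy R F ≤ v + w
  le = +-cancelʳ-≤ (cnt A′) _ _ (≤-trans (≤-reflexive (cong (_+ cnt A′) (sym (finalQueue₀ R F))))
    (≤-trans (proj₁ (run R F A A′ 0 w v (v + w) i pd valid (+-identityʳ (v + w))))
      (≤-reflexive (trans (cong₂ (λ x y → (v + x) + y) eF (finalQueue-uy A A′ (≤-reflexive (sym eA))))
        (solve 3 (λ v a w → (v :+ a) :+ w := (v :+ w) :+ a) refl v (cnt A′) w)))))
    where open +-*-Solver

aC : ∀ {n} → Row n → List (Row n) → ℕ
aC A₀ []       = 0
aC A₀ (A ∷ As) = uy A A₀ + aC A As

ChainOf : ∀ {n} → ℕ → List (Row n) → List (Row n) → Set
ChainOf s = Pointwise (λ R A → A ⊑ R × cnt A ≡ s)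

-- By `earliest`, the greedy wraps of a step plus the new lead equal the competitor's wraps plus the
-- old lead. Over the whole chain the excess is therefore at most the initial lead.
wD≤aC : ∀ {n} s v (S A₀ : Row n) Rs As → PD v S A₀ → cnt S ≡ s → cnt A₀ ≡ s → ChainOf s Rs As → wD S Rs ≤ v + aC A₀ As
wD≤aC s v S A₀ []       []       pd eS eA []               = z≤n
wD≤aC s v S A₀ (R ∷ Rs) (A ∷ As) pd eS eA ((i , e) ∷ ch) with earliest R S A A₀ v i pd (trans eS (sym eA)) (trans e (sym eA))
... | u , eu , pd′ = begin
  uy R S + wD (Tc R S) Rs  ≤⟨ +-monoʳ-≤ (uy R S) (wD≤aC s u (Tc R S) A Rs As pd′ (trans (cnt-Tc R S S≤R) eS) e ch) ⟩
  uy R S + (u + aC A As)   ≡⟨ +-assoc (uy R S) u _ ⟨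
  uy R S + u + aC A As     ≡⟨ cong (_+ aC A As) (trans (+-comm (uy R S) u) eu) ⟩
  v + uy A A₀ + aC A As    ≡⟨ +-assoc v (uy A A₀) _ ⟩
  v + (uy A A₀ + aC A As)  ∎
  where
  open ≤-Reasoning
  S≤R : cnt S ≤ cnt R
  S≤R = ≤-trans (≤-reflexive (trans eS (sym e))) (≼-cnt A R (⊑⇒≼ A R i))

tcs : ∀ {n} → Row n → List (Row n) → List (Row n)
tcs S []       = []
tcs S (R ∷ Rs) = Tc R S ∷ tcs (Tc R S) Rs

tcs-chain : ∀ {n} s (S : Row n) Rs → cnt S ≡ s → All (λ R → s ≤ cnt R) Rs → ChainOf s Rs (tcs S Rs)
tcs-chain s S []       e []       = []
tcs-chain s S (R ∷ Rs) e (h ∷ hs) = (Tc-⊑ R S , e′) ∷ tcs-chain s (Tc R S) Rs e′ hs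
  where e′ = trans (cnt-Tc R S (≤-trans (≤-reflexive e) h)) e

aC-tcs : ∀ {n} s (S : Row n) Rs → cnt S ≡ s → All (λ R → s ≤ cnt R) Rs → aC S (tcs S Rs) ≡ wD S Rs
aC-tcs s S []       e []       = refl
aC-tcs s S (R ∷ Rs) e (h ∷ hs) = cong₂ _+_ (uy-Tc R S l) (aC-tcs s (Tc R S) Rs (trans (cnt-Tc R S l) e) hs)
  where l = ≤-trans (≤-reflexive e) h

rev : ∀ {n} → Row n → Row n
rev = Vec.reverse

snoc-op : ∀ {n} (b t : Row n) → ux (b Vec.∷ʳ false) (t Vec.∷ʳ true) ≡ ux b t × uy (b Vec.∷ʳ false) (t Vec.∷ʳ true) ≡ suc (uy b t)
snoc-op []      []      = refl , refl
snoc-op (p ∷ b) (q ∷ t) with snoc-op b t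
... | x , y = cong (stepX (bracket q p)) x , trans (cong₂ (stepY (bracket q p)) x y) (lem (bracket q p) (ux b t))
  where
  lem : ∀ l m → stepY l m (suc (uy b t)) ≡ suc (stepY l m (uy b t))
  lem op zero    = refl
  lem op (suc m) = refl
  lem cl m       = refl
  lem nu m       = refl

snoc-nu : ∀ {n} r (b t : Row n) → ux (b Vec.∷ʳ r) (t Vec.∷ʳ r) ≡ ux b t × uy (b Vec.∷ʳ r) (t Vec.∷ʳ r) ≡ uy b t
snoc-nu true  []      []      = refl , refl
snoc-nu false []      []      = refl , refl
snoc-nu r     (p ∷ b) (q ∷ t) with snoc-nu r b t
... | x , y = cong (stepX (bracket q p)) x , cong₂ (stepY (bracket q p)) x y

snoc-cl : ∀ {n} (b t : Row n) → ux (b Vec.∷ʳ true) (t Vec.∷ʳ false) ≡ ux b t + (1 ∸ uy b t) × uy (b Vec.∷ʳ true) (t Vec.∷ʳ false) ≡ pred (uy b t)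
snoc-cl []      []      = refl , refl
snoc-cl (p ∷ b) (q ∷ t) with snoc-cl b t
... | x , y = trans (cong (stepX (bracket q p)) x) (lemX (bracket q p) (ux b t) (uy b t)) ,
              trans (cong₂ (stepY (bracket q p)) x y) (lemY (bracket q p) (ux b t) (uy b t))
  where
  lemX : ∀ l m k → stepX l (m + (1 ∸ k)) ≡ stepX l m + (1 ∸ stepY l m k)
  lemX op zero    zero    = refl
  lemX op zero    (suc k) = cong pred (0∸n≡0 k)
  lemX op (suc m) k       = refl
  lemX cl m       k       = refl
  lemX nu m       k       = refl
  lemY : ∀ l m k → stepY l (m + (1 ∸ k)) (pred k) ≡ pred (stepY l m k)
  lemY op zero    zero    = refl
  lemY op zero    (suc k) rewrite 0∸n≡0 k = refl
  lemY op (suc m) k       = refl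
  lemY cl m       k       = refl
  lemY nu m       k       = refl

-- Reversing the columns and exchanging the two rows gives the mirror image of the bracket word,
-- under which unmatched "(" and ")" trade places.
rev-xy : ∀ {n} (b t : Row n) → ux (rev b) (rev t) ≡ uy t b × uy (rev b) (rev t) ≡ ux t b
rev-xy []      []      = refl , refl
rev-xy (p ∷ b) (q ∷ t) rewrite Vec.reverse-∷ p b | Vec.reverse-∷ q t with rev-xy b t
... | x , y = lem p q
  where
  lem : ∀ p q → ux (rev b Vec.∷ʳ p) (rev t Vec.∷ʳ q) ≡ stepY (bracket p q) (ux t b) (uy t b) ×
                uy (rev b Vec.∷ʳ p) (rev t Vec.∷ʳ q) ≡ stepX (bracket p q) (ux t b)
  lem true  true  = trans (proj₁ (snoc-nu true (rev b) (rev t))) x , trans (proj₂ (snoc-nu true (rev b) (rev t))) y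
  lem false false = trans (proj₁ (snoc-nu false (rev b) (rev t))) x , trans (proj₂ (snoc-nu false (rev b) (rev t))) y
  lem false true  = trans (proj₁ (snoc-op (rev b) (rev t))) x , trans (proj₂ (snoc-op (rev b) (rev t))) (cong suc y)
  lem true  false = trans (proj₁ (snoc-cl (rev b) (rev t))) (trans (cong₂ (λ a c → a + (1 ∸ c)) x y) (lem′ (ux t b) (uy t b))) ,
                    trans (proj₂ (snoc-cl (rev b) (rev t))) (cong pred y)
    where
    lem′ : ∀ m k → k + (1 ∸ m) ≡ stepY op m k
    lem′ zero    k = +-comm k 1
    lem′ (suc m) k = trans (cong (k +_) (0∸n≡0 m)) (+-identityʳ k)

cnt-∷ʳ : ∀ {n} (r : Row n) p → cnt (r Vec.∷ʳ p) ≡ bit p + cnt r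
cnt-∷ʳ []      p = refl
cnt-∷ʳ (x ∷ r) p = trans (cong (bit x +_) (cnt-∷ʳ r p)) (solve 3 (λ x p r → x :+ (p :+ r) := p :+ (x :+ r)) refl (bit x) (bit p) (cnt r))
  where open +-*-Solver

cnt-rev : ∀ {n} (r : Row n) → cnt (rev r) ≡ cnt r
cnt-rev []      = refl
cnt-rev (p ∷ r) = trans (cong cnt (Vec.reverse-∷ p r)) (trans (cnt-∷ʳ (rev r) p) (cong (bit p +_) (cnt-rev r)))

⊑-∷ʳ : ∀ {n} (A R : Row n) a r → A ⊑ R → (r ≡ false → a ≡ false) → (A Vec.∷ʳ a) ⊑ (R Vec.∷ʳ r)
⊑-∷ʳ []      []      a r _       h = h , tt
⊑-∷ʳ (x ∷ A) (y ∷ R) a r (k , i) h = k , ⊑-∷ʳ A R a r i h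

⊑-rev : ∀ {n} (A R : Row n) → A ⊑ R → rev A ⊑ rev R
⊑-rev []      []      _       = tt
⊑-rev (a ∷ A) (r ∷ R) (h , i) rewrite Vec.reverse-∷ a A | Vec.reverse-∷ r R = ⊑-∷ʳ (rev A) (rev R) a r (⊑-rev A R i) h

chain-rev : ∀ {n} s {Rs As : List (Row n)} → ChainOf s Rs As → ChainOf s (map rev (reverse Rs)) (map rev (reverse As))
chain-rev s ch = PW.map⁺ rev rev (PW.reverse⁺ (PW.map (λ {R} {A} (i , e) → ⊑-rev A R i , trans (cnt-rev A) e) ch))

cost : ∀ {n} → List (Row n) → ℕ
cost []       = 0
cost (A ∷ As) = aC A As

lastOr : ∀ {n} → Row n → List (Row n) → Row n
lastOr A []       = A
lastOr A (B ∷ As) = lastOr B As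

aC-∷ʳ : ∀ {n} (A : Row n) As B → aC A (As ++ B ∷ []) ≡ aC A As + uy B (lastOr A As)
aC-∷ʳ A []       B = +-identityʳ (uy B A)
aC-∷ʳ A (C ∷ As) B = trans (cong (uy C A +_) (aC-∷ʳ C As B)) (sym (+-assoc (uy C A) (aC C As) _))

lastOr-∷ʳ : ∀ {n} (D : Row n) Ds E → lastOr D (Ds ++ E ∷ []) ≡ E
lastOr-∷ʳ D []       E = refl
lastOr-∷ʳ D (F ∷ Ds) E = lastOr-∷ʳ F Ds E

cost-∷ʳ : ∀ {n} (L : List (Row n)) E B → cost ((L ++ E ∷ []) ++ B ∷ []) ≡ cost (L ++ E ∷ []) + uy B E
cost-∷ʳ []      E B = +-identityʳ (uy B E)
cost-∷ʳ (C ∷ L) E B = trans (aC-∷ʳ C (L ++ E ∷ []) B) (cong (λ X → aC C (L ++ E ∷ []) + uy B X) (lastOr-∷ʳ C L E))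

-- Rows of equal size have as many unmatched brackets of one kind as of the other, so a chain costs
-- the same when traversed in the opposite direction.
cost-rev : ∀ {n} s (As : List (Row n)) → All (λ A → cnt A ≡ s) As → cost (map rev (reverse As)) ≡ cost As
cost-rev s []           _              = refl
cost-rev s (A ∷ [])     _              = refl
cost-rev s (A ∷ B ∷ As) (a ∷ b ∷ as) = begin
  cost (map rev (reverse (A ∷ B ∷ As)))                    ≡⟨ cong cost (trans (snoc A (B ∷ As)) (cong (_++ rev A ∷ []) (snoc B As))) ⟩
  cost ((map rev (reverse As) ++ rev B ∷ []) ++ rev A ∷ []) ≡⟨ cost-∷ʳ (map rev (reverse As)) (rev B) (rev A) ⟩
  cost (map rev (reverse As) ++ rev B ∷ []) + uy (rev A) (rev B)
    ≡⟨ cong₂ _+_ (trans (cong cost (sym (snoc B As))) (cost-rev s (B ∷ As) (b ∷ as))) (trans (proj₂ (rev-xy A B)) (ux≡uy B A (trans b (sym a)))) ⟩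
  aC B As + uy B A                                         ≡⟨ +-comm (aC B As) (uy B A) ⟩
  uy B A + aC B As                                         ∎
  where
  open ≡-Reasoning
  snoc : ∀ X Xs → map rev (reverse (X ∷ Xs)) ≡ map rev (reverse Xs) ++ rev X ∷ []
  snoc X Xs = trans (cong (map rev) (unfold-reverse X Xs)) (map-++ rev (reverse Xs) (X ∷ []))

-- The first `k` subwords of the charge begin at these columns. No other choice of `k` balls in the
-- row is ahead of this one (`PD-firstN`).
firstN : ∀ {n} → ℕ → Row n → Row n
firstN k       []          = []
firstN zero    (p ∷ R)     = false ∷ firstN 0 R
firstN (suc k) (true ∷ R)  = true ∷ firstN k R
firstN (suc k) (false ∷ R) = false ∷ firstN (suc k) R

firstN-⊑ : ∀ {n} k (R : Row n) → firstN k R ⊑ R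
firstN-⊑ k       []          = tt
firstN-⊑ zero    (p ∷ R)     = (λ _ → refl) , firstN-⊑ 0 R
firstN-⊑ (suc k) (true ∷ R)  = id , firstN-⊑ k R
firstN-⊑ (suc k) (false ∷ R) = id , firstN-⊑ (suc k) R

cnt-firstN : ∀ {n} k (R : Row n) → k ≤ cnt R → cnt (firstN k R) ≡ k
cnt-firstN zero    []          _       = refl
cnt-firstN zero    (p ∷ R)     _       = cnt-firstN 0 R z≤n
cnt-firstN (suc k) (true ∷ R)  (s≤s h) = cong suc (cnt-firstN k R h)
cnt-firstN (suc k) (false ∷ R) h       = cnt-firstN (suc k) R h

PD-firstN : ∀ {n} v k (R A : Row n) → A ⊑ R → v + k ≡ cnt A → PD v (firstN k R) A
PD-firstN v k       []          []          _       _ = tt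
PD-firstN v zero    (p ∷ R)     (true ∷ A)  (h , i) e = cnt A , trans (+-comm (cnt A) 1) (trans (sym e) refl) , PD-firstN (cnt A) 0 R A i (+-identityʳ (cnt A))
PD-firstN v zero    (p ∷ R)     (false ∷ A) (h , i) e = v , refl , PD-firstN v 0 R A i e
PD-firstN v (suc k) (true ∷ R)  (true ∷ A)  (h , i) e = v , refl , PD-firstN v k R A i (suc-injective (trans (sym (+-suc v k)) e))
PD-firstN v (suc k) (true ∷ R)  (false ∷ A) (h , i) e = suc v , trans (+-identityʳ (suc v)) (+-comm 1 v) , PD-firstN (suc v) k R A i (trans (sym (+-suc v k)) e)
PD-firstN v (suc k) (false ∷ R) (a ∷ A)     (h , i) e rewrite h refl = v , refl , PD-firstN v (suc k) R A i e

⊑-cnt⇒≡ : ∀ {n} (A R : Row n) → A ⊑ R → cnt A ≡ cnt R → A ≡ R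
⊑-cnt⇒≡ A R i e = diff≡0⇒≡ A R i (+-cancelʳ-≡ (cnt A) _ 0 (trans (diff+cnt A R i) (sym e)))

-- The two greedy ways of connecting the top row with the bottom row, downwards
-- to the right and upwards to the left, are both optimal.
min-flow : ∀ {n} (R₁ : Row n) Rs T Ds → reverse (R₁ ∷ Rs) ≡ T ∷ Ds → All (λ R → cnt T ≤ cnt R) (R₁ ∷ Rs) →
           wD T Ds ≡ wD (firstN (cnt T) (rev R₁)) (map rev Rs)
min-flow {n} R₁ Rs T Ds eq big = ≤-antisym down≤up up≤down
  where
  s = cnt T
  P₁ = firstN s (rev R₁)
  Us = map rev Rs
  cntP₁ : cnt P₁ ≡ s
  cntP₁ = cnt-firstN s (rev R₁) (≤-trans (All.head big) (≤-reflexive (sym (cnt-rev R₁))))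
  bigU : All (λ R → s ≤ cnt R) Us
  bigU = All.map⁺ (All.map (λ {R} h → ≤-trans h (≤-reflexive (sym (cnt-rev R)))) (All.tail big))
  bigD : All (λ R → s ≤ cnt R) (T ∷ Ds)
  bigD = subst (All _) eq (Perm.All-resp-↭ (↭-sym (Perm.↭-reverse (R₁ ∷ Rs))) big)
  Pl = P₁ ∷ tcs P₁ Us
  Fl = T ∷ tcs T Ds
  chP : ChainOf s (rev R₁ ∷ Us) Pl
  chP = (firstN-⊑ s (rev R₁) , cntP₁) ∷ tcs-chain s P₁ Us cntP₁ bigU
  chF : ChainOf s (T ∷ Ds) Fl
  chF = (⊑-refl T , refl) ∷ tcs-chain s T Ds refl (All.tail bigD)
  counts : ∀ {Rs As : List (Row n)} → ChainOf s Rs As → All (λ A → cnt A ≡ s) As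
  counts []             = []
  counts ((_ , e) ∷ ch) = e ∷ counts ch
  revRows : map rev (reverse (rev R₁ ∷ Us)) ≡ T ∷ Ds
  revRows = trans (cong (map rev) (sym (reverse-map rev (R₁ ∷ Rs)))) (trans (sym (map-∘ (reverse (R₁ ∷ Rs)))) (trans (map-cong Vec.reverse-involutive (reverse (R₁ ∷ Rs))) (trans (map-id (reverse (R₁ ∷ Rs))) eq)))
  revRows′ : map rev (reverse (T ∷ Ds)) ≡ rev R₁ ∷ Us
  revRows′ = cong (map rev) (trans (cong reverse (sym eq)) (reverse-involutive (R₁ ∷ Rs)))
  -- The reversed upward chain competes with the downward one. It has to start at `T`, which
  -- contains exactly `s` balls.
  down≤up : wD T Ds ≤ wD P₁ Us
  down≤up with map rev (reverse Pl) in e | subst (λ X → ChainOf s X (map rev (reverse Pl))) revRows (chain-rev s chP) | cost-rev s Pl (counts chP)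
  ... | A ∷ As | (i , c) ∷ ch | ce with ⊑-cnt⇒≡ A T i c
  ...   | refl = ≤-trans (wD≤aC s 0 T T Ds As (PD-refl T) refl refl ch) (≤-reflexive (trans ce (aC-tcs s P₁ Us cntP₁ bigU)))
  -- The reversed downward chain competes with the upward one. It may start at any `s` balls of the
  -- bottom row, and `P₁` is ahead of all of them.
  up≤down : wD P₁ Us ≤ wD T Ds
  up≤down with map rev (reverse Fl) in e | subst (λ X → ChainOf s X (map rev (reverse Fl))) revRows′ (chain-rev s chF) | cost-rev s Fl (counts chF)
  ... | A ∷ As | (i , c) ∷ ch | ce = ≤-trans (wD≤aC s 0 P₁ A Us As (PD-firstN 0 s (rev R₁) A i (sym c)) cntP₁ c ch)
                                            (≤-reflexive (trans ce (aC-tcs s T Ds refl (All.tail bigD))))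

-- The charge statistic. Positions p of a word of length m are replaced by
-- the columns m - 1 - p, so that searching to the left becomes first fit.

maxPos-bound : ∀ P p st {q} → All (λ a → p < proj₁ a) st → maxPosWith P st ≡ just q → p < q
maxPos-bound P p ((p′ , y) ∷ st) (h ∷ hs) e with P p′ y
... | false = maxPos-bound P p st hs e
... | true with maxPosWith P st
maxPos-bound P p ((p′ , y) ∷ st) (h ∷ hs) refl | true | nothing = h
maxPos-bound P p ((p′ , y) ∷ st) (h ∷ hs) refl | true | just q  = <-≤-trans h (m≤m⊔n p′ q)

orElse : Maybe ℕ → Maybe ℕ → Maybe ℕ
orElse (just q) _ = just q
orElse nothing  b = b

maxPosWith-last : ∀ P p y st → All (λ a → p < proj₁ a) st →
  maxPosWith P ((p , y) ∷ st) ≡ orElse (maxPosWith P st) (if P p y then just p else nothing)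
maxPosWith-last P p y st h with P p y
... | false = lem (maxPosWith P st)
  where
  lem : ∀ a → a ≡ orElse a nothing
  lem nothing  = refl
  lem (just q) = refl
... | true with maxPosWith P st in e
...   | nothing = refl
...   | just q  = cong just (m≤n⇒m⊔n≡n (<⇒≤ (maxPos-bound P p st h e)))

firstGE-++ : ∀ j l y → firstGE j (l ++ y ∷ []) ≡ orElse (firstGE j l) (if j ≤ᵇ y then just y else nothing)
firstGE-++ j []      y = refl
firstGE-++ j (x ∷ l) y with j ≤ᵇ x
... | true  = refl
... | false = firstGE-++ j l y

extract-just : ∀ fuel k p idx w {q} → maxPosWith (λ pos x → (x ≡ᵇ suc k) ∧ (pos <ᵇ p)) w ≡ just q →
  extractRest (suc fuel) k p idx w ≡ (idx + proj₁ (extractRest fuel (suc k) q idx (removePos q w)) , proj₂ (extractRest fuel (suc k) q idx (removePos q w)))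
extract-just fuel k p idx w e rewrite e = refl

extract-wrap : ∀ fuel k p idx w {q} → maxPosWith (λ pos x → (x ≡ᵇ suc k) ∧ (pos <ᵇ p)) w ≡ nothing → maxPosWith (λ pos x → x ≡ᵇ suc k) w ≡ just q →
  extractRest (suc fuel) k p idx w ≡ (suc idx + proj₁ (extractRest fuel (suc k) q (suc idx) (removePos q w)) , proj₂ (extractRest fuel (suc k) q (suc idx) (removePos q w)))
extract-wrap fuel k p idx w e e′ rewrite e | e′ = refl

extract-none : ∀ fuel k p idx w → maxPosWith (λ pos x → (x ≡ᵇ suc k) ∧ (pos <ᵇ p)) w ≡ nothing → maxPosWith (λ pos x → x ≡ᵇ suc k) w ≡ nothing →
  extractRest (suc fuel) k p idx w ≡ (0 , w)
extract-none fuel k p idx w e e′ rewrite e | e′ = refl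

-- Extraction of one standard subword from the lists of available columns.
ext : ℕ → ℕ → List (List ℕ) → ℕ × List (List ℕ)
ext j idx []             = 0 , []
ext j idx ([] ∷ ls)      = 0 , [] ∷ ls
ext j idx ((a ∷ l) ∷ ls) with firstGE j (a ∷ l)
... | just κ  = idx + proj₁ (ext κ idx ls) , removeN κ (a ∷ l) ∷ proj₂ (ext κ idx ls)
... | nothing = suc idx + proj₁ (ext a (suc idx) ls) , removeN a (a ∷ l) ∷ proj₂ (ext a (suc idx) ls)

module Columns (m : ℕ) where

  spots : ℕ → List Cell → List ℕ
  spots x []             = []
  spots x ((p , y) ∷ st) = spots x st ++ (if y ≡ᵇ x then (m ∸ suc p) ∷ [] else [])

  record Good (st : List Cell) : Set where
    field
      incr  : AllPairs (λ a b → proj₁ a < proj₁ b) st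
      bound : All (λ a → proj₁ a < m) st

  Good-tail : ∀ {a st} → Good (a ∷ st) → Good st
  Good-tail g = record { incr = AllPairs.tail (Good.incr g) ; bound = All.tail (Good.bound g) }

  flip-flip : ∀ p → p < m → m ∸ suc (m ∸ suc p) ≡ p
  flip-flip p h = trans (cong (m ∸_) (sym (+-∸-assoc 1 h))) (m∸[m∸n]≡n (<⇒≤ h))

  toPos : Maybe ℕ → Maybe ℕ
  toPos (just κ) = just (m ∸ suc κ)
  toPos nothing  = nothing

  toPos-orElse : ∀ a b → toPos (orElse a b) ≡ orElse (toPos a) (toPos b)
  toPos-orElse (just q) b = refl
  toPos-orElse nothing  b = refl

  search : ∀ P x t st → Good st → (∀ pos y → pos < m → P pos y ≡ (y ≡ᵇ x) ∧ (t ≤ᵇ m ∸ suc pos)) →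
           maxPosWith P st ≡ toPos (firstGE t (spots x st))
  search P x t []             g h = refl
  search P x t ((p , y) ∷ st) g h = trans (maxPosWith-last P p y st (AllPairs.head (Good.incr g)))
    (trans (cong₂ (λ a b → orElse a (if b then just p else nothing)) (search P x t st (Good-tail g) h) (h p y (All.head (Good.bound g)))) (lem (y ≡ᵇ x)))
    where
    lem : ∀ b → orElse (toPos (firstGE t (spots x st))) (if b ∧ (t ≤ᵇ m ∸ suc p) then just p else nothing)
              ≡ toPos (firstGE t (spots x st ++ (if b then (m ∸ suc p) ∷ [] else [])))
    lem false = trans (lem′ (toPos (firstGE t (spots x st)))) (cong (λ l → toPos (firstGE t l)) (sym (++-identityʳ (spots x st))))
      where
      lem′ : ∀ a → orElse a nothing ≡ a
      lem′ nothing  = refl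
      lem′ (just q) = refl
    lem true  = sym (trans (cong toPos (firstGE-++ t (spots x st) (m ∸ suc p))) (trans (toPos-orElse (firstGE t (spots x st)) _) (cong (orElse (toPos (firstGE t (spots x st)))) (lem″ (t ≤ᵇ m ∸ suc p)))))
      where
      lem″ : ∀ c → toPos (if c then just (m ∸ suc p) else nothing) ≡ (if c then just p else nothing)
      lem″ true  = cong just (flip-flip p (All.head (Good.bound g)))
      lem″ false = refl

  search-left : ∀ x p st → Good st → p < m →
    maxPosWith (λ pos y → (y ≡ᵇ x) ∧ (pos <ᵇ p)) st ≡ toPos (firstGE (suc (m ∸ suc p)) (spots x st))
  search-left x p st g p<m = search _ x (suc (m ∸ suc p)) st g λ pos y pos<m → cong ((y ≡ᵇ x) ∧_) (lem pos pos<m)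
    where
    lem : ∀ pos → pos < m → (pos <ᵇ p) ≡ (suc (m ∸ suc p) ≤ᵇ m ∸ suc pos)
    lem pos pos<m with <-≤-connex pos p
    ... | inj₁ h = trans (≤ᵇ-true h) (sym (≤ᵇ-true (subst (_≤ m ∸ suc pos) (+-∸-assoc 1 p<m) (∸-monoʳ-≤ m h))))
    ... | inj₂ h = trans (≤ᵇ-false (s≤s h)) (sym (≤ᵇ-false (s≤s (∸-monoʳ-≤ m (s≤s h)))))

  search-any : ∀ x st → Good st → maxPosWith (λ pos y → y ≡ᵇ x) st ≡ toPos (firstGE 0 (spots x st))
  search-any x st g = search _ x 0 st g λ pos y _ → sym (∧-identityʳ (y ≡ᵇ x))

  spots-pos : ∀ x st {κ} → κ ∈ spots x st → ∃ λ p → (p , x) ∈ st × κ ≡ m ∸ suc p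
  spots-pos x ((p , y) ∷ st) h with ∈-++⁻ (spots x st) h
  ... | inj₁ h′ = let q , i , e = spots-pos x st h′ in q , there i , e
  ... | inj₂ h′ with y ≡ᵇ x in e
  spots-pos x ((p , y) ∷ st) h | inj₂ (here refl) | true = p , here (cong (p ,_) (sym (≡ᵇ-true⁻ {y} e))) , refl

  unique-letter : ∀ st → Good st → ∀ {p x y} → (p , x) ∈ st → (p , y) ∈ st → x ≡ y
  unique-letter (a ∷ st) g (here refl) (here refl) = refl
  unique-letter (a ∷ st) g (here refl) (there j)   = contradiction refl (<⇒≢ (All.lookup (AllPairs.head (Good.incr g)) j))
  unique-letter (a ∷ st) g (there i)   (here refl) = contradiction refl (<⇒≢ (All.lookup (AllPairs.head (Good.incr g)) i))
  unique-letter (a ∷ st) g (there i)   (there j)   = unique-letter st (Good-tail g) i j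

  spots-disjoint : ∀ x y st → Good st → ∀ {κ} → κ ∈ spots x st → κ ∈ spots y st → x ≡ y
  spots-disjoint x y st g h h′ with spots-pos x st h | spots-pos y st h′
  ... | p , i , e | q , j , e′ with trans (sym (flip-flip p (All.lookup (Good.bound g) i))) (trans (cong (λ κ → m ∸ suc κ) (trans (sym e) e′)) (flip-flip q (All.lookup (Good.bound g) j)))
  ...   | refl = unique-letter st g i j

  removeN-++ : ∀ k (l l′ : List ℕ) → removeN k (l ++ l′) ≡ removeN k l ++ removeN k l′
  removeN-++ k []      l′ = refl
  removeN-++ k (x ∷ l) l′ with x ≡ᵇ k
  ... | true  = removeN-++ k l l′
  ... | false = cong (x ∷_) (removeN-++ k l l′)

  spots-remove : ∀ x q st → Good st → q < m → spots x (removePos q st) ≡ removeN (m ∸ suc q) (spots x st)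
  spots-remove x q []             g q<m = refl
  spots-remove x q ((p , y) ∷ st) g q<m with p ≡ᵇ q in e
  ... | true rewrite ≡ᵇ-true⁻ {p} e = trans (spots-remove x q st (Good-tail g) q<m)
        (sym (trans (removeN-++ (m ∸ suc q) (spots x st) _) (trans (cong (removeN (m ∸ suc q) (spots x st) ++_) (gone (y ≡ᵇ x))) (++-identityʳ _))))
    where
    gone : ∀ b → removeN (m ∸ suc q) (if b then (m ∸ suc q) ∷ [] else []) ≡ []
    gone true rewrite ≡ᵇ-refl (m ∸ suc q) = refl
    gone false = refl
  ... | false = trans (cong (_++ (if y ≡ᵇ x then (m ∸ suc p) ∷ [] else [])) (spots-remove x q st (Good-tail g) q<m))
        (sym (trans (removeN-++ (m ∸ suc q) (spots x st) _) (cong (removeN (m ∸ suc q) (spots x st) ++_) (stays (y ≡ᵇ x)))))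
    where
    ne : m ∸ suc p ≢ m ∸ suc q
    ne h = case trans (sym (≡ᵇ-refl p)) (trans (cong (p ≡ᵇ_) (trans (sym (flip-flip p (All.head (Good.bound g)))) (trans (cong (λ κ → m ∸ suc κ) h) (flip-flip q q<m)))) e) of λ ()
    stays : ∀ b → removeN (m ∸ suc q) (if b then (m ∸ suc p) ∷ [] else []) ≡ (if b then (m ∸ suc p) ∷ [] else [])
    stays true rewrite ≢⇒≡ᵇ (m ∸ suc p) (m ∸ suc q) ne = refl
    stays false = refl

  removeN-absent : ∀ k l → k ∉ l → removeN k l ≡ l
  removeN-absent k []      h = refl
  removeN-absent k (x ∷ l) h rewrite ≢⇒≡ᵇ x k (λ e → h (here (sym e))) = cong (x ∷_) (removeN-absent k l (h ∘ there))

  Good-remove : ∀ q st → Good st → Good (removePos q st)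
  Good-remove q st g = record { incr = APP.filter⁺ _ (Good.incr g) ; bound = All.filter⁺ _ (Good.bound g) }

  absent-remove : ∀ q st → All (λ a → proj₁ a ≢ q) (removePos q st)
  absent-remove q []             = []
  absent-remove q ((p , y) ∷ st) with p ≡ᵇ q in e
  ... | true  = absent-remove q st
  ... | false = (λ h → case trans (sym (≡ᵇ-refl p)) (trans (cong (p ≡ᵇ_) h) e) of λ ()) ∷ absent-remove q st

  length-remove : ∀ q st {x} → (q , x) ∈ st → length (removePos q st) < length st
  length-remove q ((p , y) ∷ st) (here refl) rewrite ≡ᵇ-refl q = s≤s (length-filter _ st)
  length-remove q ((p , y) ∷ st) (there i) with p ≡ᵇ q
  ... | true  = s≤s (length-filter _ st)
  ... | false = s<s (length-remove q st i)

  avs : ℕ → ℕ → List Cell → List (List ℕ)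
  avs k zero    st = []
  avs k (suc K) st = spots (suc k) st ∷ avs (suc k) K st

  avs-cong : ∀ k K st st′ → (∀ y → k < y → spots y st ≡ spots y st′) → avs k K st ≡ avs k K st′
  avs-cong k zero    st st′ h = refl
  avs-cong k (suc K) st st′ h = cong₂ _∷_ (h (suc k) (n<1+n k)) (avs-cong (suc k) K st st′ (λ y l → h y (<-trans (n<1+n k) l)))

  record Extracted (k K : ℕ) (st : List Cell) (out : ℕ × List Cell) (e : ℕ × List (List ℕ)) : Set where
    constructor extracted
    field
      charge≡ : proj₁ out ≡ proj₁ e
      lists   : avs k K (proj₂ out) ≡ proj₂ e
      below   : ∀ y → y ≤ k → spots y (proj₂ out) ≡ spots y st
      above   : ∀ y → suc k + K ≤ y → spots y (proj₂ out) ≡ []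
      good    : Good (proj₂ out)

  -- The charge searches strictly to the left of the last letter taken, the pairing weakly to the
  -- right of a column. The two agree because that letter has already been removed from the word.
  firstGE-suc : ∀ j l → j ∉ l → firstGE (suc j) l ≡ firstGE j l
  firstGE-suc j []      h = refl
  firstGE-suc j (x ∷ l) h with <-cmp j x
  ... | tri< a _ _ rewrite ≤ᵇ-true a | ≤ᵇ-true (<⇒≤ a) = refl
  ... | tri≈ _ refl _ = ⊥-elim (h (here refl))
  ... | tri> _ _ g rewrite ≤ᵇ-false {suc j} {x} (s≤s (<⇒≤ g)) | ≤ᵇ-false g = firstGE-suc j l (h ∘ there)

  spots-absent : ∀ x p st → Good st → p < m → All (λ a → proj₁ a ≢ p) st → m ∸ suc p ∉ spots x st
  spots-absent x p st g p<m ab h with spots-pos x st h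
  ... | q , i , e = All.lookup ab i (trans (sym (flip-flip q (All.lookup (Good.bound g) i))) (trans (cong (λ κ → m ∸ suc κ) (sym e)) (flip-flip p p<m)))

  -- `K` bounds the number of further letters that can occur, all larger ones being absent. Every
  -- step removes a letter from the word, so its length is enough fuel.
  extract : ∀ K fuel k p idx st → Good st → p < m → All (λ a → proj₁ a ≢ p) st → length st ≤ fuel →
            (∀ y → suc k + K ≤ y → spots y st ≡ []) →
            Extracted k K st (extractRest fuel k p idx st) (ext (m ∸ suc p) idx (avs k K st))

  found : ∀ K fuel k idx st κ L → spots (suc k) st ≡ L → Good st → κ ∈ spots (suc k) st → length st ≤ suc fuel → (∀ y → suc k + suc K ≤ y → spots y st ≡ []) →
    Extracted k (suc K) st
      (idx + proj₁ (extractRest fuel (suc k) (m ∸ suc κ) idx (removePos (m ∸ suc κ) st)) , proj₂ (extractRest fuel (suc k) (m ∸ suc κ) idx (removePos (m ∸ suc κ) st)))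
      (idx + proj₁ (ext κ idx (avs (suc k) K st)) , removeN κ L ∷ proj₂ (ext κ idx (avs (suc k) K st)))
  found K fuel k idx st κ L eL g κ∈ len high with spots-pos (suc k) st κ∈
  ... | q , i , refl rewrite flip-flip q (All.lookup (Good.bound g) i) =
    extracted (cong (idx +_) (trans R.charge≡ (cong proj₁ e≡))) (cong₂ _∷_ (trans (R.below (suc k) ≤-refl) (trans rm (cong (removeN (m ∸ suc q)) eL))) (trans R.lists (cong proj₂ e≡)))
              (λ y l → trans (R.below y (m≤n⇒m≤1+n l)) (other y (<⇒≢ (s≤s l) ∘ sym))) (λ y l → R.above y (subst (_≤ y) (cong suc (+-suc k K)) l)) R.good
    where
    q<m = All.lookup (Good.bound g) i
    st₁ = removePos q st
    rm : spots (suc k) st₁ ≡ removeN (m ∸ suc q) (spots (suc k) st)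
    rm = spots-remove (suc k) q st g q<m
    other : ∀ y → suc k ≢ y → spots y st₁ ≡ spots y st
    other y ne = trans (spots-remove y q st g q<m) (removeN-absent (m ∸ suc q) (spots y st) (λ h → ne (spots-disjoint (suc k) y st g κ∈ h)))
    e≡ : ext (m ∸ suc q) idx (avs (suc k) K st₁) ≡ ext (m ∸ suc q) idx (avs (suc k) K st)
    e≡ = cong (ext (m ∸ suc q) idx) (avs-cong (suc k) K st₁ st (λ y l → other y (<⇒≢ l)))
    R = extract K fuel (suc k) q idx st₁ (Good-remove q st g) q<m (absent-remove q st) (s≤s⁻¹ (≤-trans (length-remove q st i) len))
          (λ y l → trans (other y (<⇒≢ (≤-trans (s≤s (s≤s (m≤m+n k K))) l))) (high y (subst (_≤ y) (cong suc (sym (+-suc k K))) l)))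
    module R = Extracted R

  empty-lists : ∀ k K j idx → ext j idx (avs k K []) ≡ (0 , avs k K [])
  empty-lists k zero    j idx = refl
  empty-lists k (suc K) j idx = refl

  extract K       zero       k p idx []       g p<m ab len high rewrite empty-lists k K (m ∸ suc p) idx = extracted refl refl (λ _ _ → refl) (λ _ _ → refl) g
  extract zero    (suc fuel) k p idx st g p<m ab len high with spots (suc k) st in eq | search-left (suc k) p st g p<m | search-any (suc k) st g
  ... | a ∷ l | _  | _  = contradiction (trans (sym eq) (high (suc k) (≤-reflexive (+-identityʳ (suc k))))) λ ()
  ... | []    | e₁ | e₂ rewrite extract-none fuel k p idx st e₁ e₂ = extracted refl refl (λ _ _ → refl) high g
  extract (suc K) (suc fuel) k p idx st g p<m ab len high
    with spots (suc k) st in eq | trans (search-left (suc k) p st g p<m) (cong toPos (firstGE-suc (m ∸ suc p) (spots (suc k) st) (spots-absent (suc k) p st g p<m ab))) | search-any (suc k) st g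
  ... | [] | e₁ | e₂ rewrite extract-none fuel k p idx st e₁ e₂ =
    extracted refl (cong (_∷ avs (suc k) K st) eq) (λ _ _ → refl) high g
  ... | a ∷ l | e₁ | e₂ with firstGE (m ∸ suc p) (a ∷ l) in ef
  ...   | just κ rewrite extract-just fuel k p idx st e₁ =
    found K fuel k idx st κ (a ∷ l) eq g (subst (κ ∈_) (sym eq) (proj₂ (firstGE-≥ (m ∸ suc p) (a ∷ l) ef))) len high
  ...   | nothing rewrite extract-wrap fuel k p idx st e₁ e₂ =
    found K fuel k (suc idx) st a (a ∷ l) eq g (subst (a ∈_) (sym eq) (here refl)) len high

cg : List ℕ → List (List ℕ) → ℕ
cg []       ls = 0
cg (j ∷ js) ls = proj₁ (ext j 0 ls) + cg js (proj₂ (ext j 0 ls))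

chargeGo-just : ∀ fuel w {p} → maxPosWith (λ pos x → x ≡ᵇ 1) w ≡ just p →
  chargeGo (suc fuel) w ≡ proj₁ (extractRest (length w) 1 p 0 (removePos p w)) + chargeGo fuel (proj₂ (extractRest (length w) 1 p 0 (removePos p w)))
chargeGo-just fuel w e rewrite e = refl

chargeGo-none : ∀ fuel w → maxPosWith (λ pos x → x ≡ᵇ 1) w ≡ nothing → chargeGo (suc fuel) w ≡ 0
chargeGo-none fuel w e rewrite e = refl

module ColumnsCharge (m : ℕ) where
  open Columns m

  -- The rightmost remaining 1 of the word is the first remaining column in `ones`, so the
  -- successive subwords start at the successive entries of this list.
  chargeGo≡cg : ∀ fuel K st ones → Good st → spots 1 st ≡ ones → Inc ones → length ones ≤ fuel →
                (∀ y → 2 + K ≤ y → spots y st ≡ []) → chargeGo fuel st ≡ cg ones (avs 1 K st)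
  chargeGo≡cg zero       K st []         g e i       l high = refl
  chargeGo≡cg (suc fuel) K st []         g e i       l high = chargeGo-none fuel st (trans (search-any 1 st g) (cong (toPos ∘ firstGE 0) e))
  chargeGo≡cg (suc fuel) K st (a ∷ ones) g e (u ∷ i) l high with spots-pos 1 st (subst (a ∈_) (sym e) (here refl))
  ... | q , q∈ , refl = begin
    chargeGo (suc fuel) st
      ≡⟨ chargeGo-just fuel st (trans (search-any 1 st g) (trans (cong (toPos ∘ firstGE 0) e) (cong just (flip-flip q q<m)))) ⟩
    proj₁ out + chargeGo fuel (proj₂ out)
      ≡⟨ cong₂ _+_ R.charge≡ (chargeGo≡cg fuel K (proj₂ out) ones R.good ones≡ i (s≤s⁻¹ l) R.above) ⟩
    proj₁ (ext (m ∸ suc q) 0 (avs 1 K st₁)) + cg ones (avs 1 K (proj₂ out))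
      ≡⟨ cong (λ z → proj₁ (ext (m ∸ suc q) 0 (avs 1 K st₁)) + cg ones z) R.lists ⟩
    proj₁ (ext (m ∸ suc q) 0 (avs 1 K st₁)) + cg ones (proj₂ (ext (m ∸ suc q) 0 (avs 1 K st₁)))
      ≡⟨ cong (λ z → proj₁ (ext (m ∸ suc q) 0 z) + cg ones (proj₂ (ext (m ∸ suc q) 0 z))) (avs-cong 1 K st₁ st (λ y h → other y (<⇒≢ h))) ⟩
    cg ((m ∸ suc q) ∷ ones) (avs 1 K st) ∎
    where
    open ≡-Reasoning
    q<m = All.lookup (Good.bound g) q∈
    st₁ = removePos q st
    out = extractRest (length st) 1 q 0 st₁
    κ∈ : m ∸ suc q ∈ spots 1 st
    κ∈ = subst (m ∸ suc q ∈_) (sym e) (here refl)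
    other : ∀ y → 1 ≢ y → spots y st₁ ≡ spots y st
    other y ne = trans (spots-remove y q st g q<m) (removeN-absent (m ∸ suc q) (spots y st) (λ h → ne (spots-disjoint 1 y st g κ∈ h)))
    R = extract K (length st) 1 q 0 st₁ (Good-remove q st g) q<m (absent-remove q st) (<⇒≤ (length-remove q st q∈))
          (λ y h → trans (other y (<⇒≢ (≤-trans (s≤s (s≤s z≤n)) h))) (high y h))
    module R = Extracted R
    ones≡ : spots 1 (proj₂ out) ≡ ones
    ones≡ = trans (R.below 1 ≤-refl) (trans (spots-remove 1 q st g q<m) (trans (cong (removeN (m ∸ suc q)) e) (removeN-head (m ∸ suc q) ones (u ∷ i))))

-- The charge as a sum over chains of rows

-- First fit for all subwords at one value of the letter. Here the second component of a ball is the
-- charge index reached so far, and a wrap raises it by one.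
FF : List Ball → List ℕ → List Ball
FF []             l       = []
FF (b ∷ ps)       []      = []
FF ((j , i) ∷ ps) (a ∷ l) with firstGE j (a ∷ l)
... | just κ  = (κ , i) ∷ FF ps (removeN κ (a ∷ l))
... | nothing = (a , suc i) ∷ FF ps (removeN a (a ∷ l))

sumIdx : List Ball → ℕ
sumIdx ps = sum (map proj₂ ps)

H : List Ball → List (List ℕ) → ℕ
H ps []       = 0
H ps (l ∷ ls) = sumIdx (FF ps l) + H (FF ps l) ls

FF-[] : ∀ ps → FF ps [] ≡ []
FF-[] []       = refl
FF-[] (b ∷ ps) = refl

H-nil : ∀ ls → H [] ls ≡ 0
H-nil []       = refl
H-nil (l ∷ ls) = H-nil ls

-- Exchanges two loops: the charge follows one subword through all letters, `H` advances all
-- subwords letter by letter. The outcomes agree because in both a subword meets exactly what its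
-- predecessors have left over.
H-cons : ∀ j i ps ls → H ((j , i) ∷ ps) ls ≡ proj₁ (ext j i ls) + H ps (proj₂ (ext j i ls))
H-cons j i ps []             = refl
H-cons j i ps ([] ∷ ls)      rewrite FF-[] ps = refl
H-cons j i ps ((a ∷ l) ∷ ls) with firstGE j (a ∷ l)
... | just κ  = trans (cong (i + sumIdx (FF ps (removeN κ (a ∷ l))) +_) (H-cons κ i (FF ps (removeN κ (a ∷ l))) ls))
                      (solve 4 (λ a b c d → (a :+ b) :+ (c :+ d) := (a :+ c) :+ (b :+ d)) refl i (sumIdx (FF ps (removeN κ (a ∷ l)))) _ _)
  where open +-*-Solver
... | nothing = trans (cong (suc i + sumIdx (FF ps (removeN a (a ∷ l))) +_) (H-cons a (suc i) (FF ps (removeN a (a ∷ l))) ls))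
                      (solve 4 (λ a b c d → (a :+ b) :+ (c :+ d) := (a :+ c) :+ (b :+ d)) refl (suc i) (sumIdx (FF ps (removeN a (a ∷ l)))) _ _)
  where open +-*-Solver

cg≡H : ∀ js ls → cg js ls ≡ H (map (_, 0) js) ls
cg≡H []       ls = sym (H-nil ls)
cg≡H (j ∷ js) ls = trans (cong (proj₁ (ext j 0 ls) +_) (cg≡H js _)) (sym (H-cons j 0 (map (_, 0) js) ls))

FF-take : ∀ c ps l → FF (take c ps) l ≡ take c (FF ps l)
FF-take zero    ps             l       = refl
FF-take (suc c) []             l       = refl
FF-take (suc c) (b ∷ ps)       []      = refl
FF-take (suc c) ((j , i) ∷ ps) (a ∷ l) with firstGE j (a ∷ l)
... | just κ  = cong ((κ , i) ∷_) (FF-take c ps (removeN κ (a ∷ l)))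
... | nothing = cong ((a , suc i) ∷_) (FF-take c ps (removeN a (a ∷ l)))

length-removeN : ∀ κ l → Unique l → κ ∈ l → suc (length (removeN κ l)) ≡ length l
length-removeN κ l u h = Perm.↭-length (removeN-↭ κ l u h)

Unique-removeN : ∀ κ l → Unique l → Unique (removeN κ l)
Unique-removeN κ l u = APP.filter⁺ _ u

FF-length : ∀ ps l → Unique l → length (FF ps l) ≤ length l
FF-length []             l       u = z≤n
FF-length (b ∷ ps)       []      u = z≤n
FF-length ((j , i) ∷ ps) (a ∷ l) u with firstGE j (a ∷ l) in e
... | just κ  = ≤-trans (s≤s (FF-length ps (removeN κ (a ∷ l)) (Unique-removeN κ (a ∷ l) u))) (≤-reflexive (length-removeN κ (a ∷ l) u (proj₂ (firstGE-≥ j (a ∷ l) e))))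
... | nothing = ≤-trans (s≤s (FF-length ps (removeN a (a ∷ l)) (Unique-removeN a (a ∷ l) u))) (≤-reflexive (length-removeN a (a ∷ l) u (here refl)))

cnt-setCol : ∀ {n} j (P : Row n) → j < n → at j P ≡ false → cnt (setCol j true P) ≡ suc (cnt P)
cnt-setCol zero    (false ∷ P) l       e = refl
cnt-setCol (suc j) (p ∷ P)     (s≤s l) e = trans (cong (bit p +_) (cnt-setCol j P l e)) (+-suc (bit p) (cnt P))

module FirstFit {n : ℕ} (R : Row n) where

  record FFIn (ps : List Ball) (P : Row n) : Set where
    field
      fresh    : All (λ x → proj₁ x < n × at (proj₁ x) P ≡ false) ps
      distinct : Distinct ps
      room     : length ps ≤ length (avl R P)

  record FFOut (ps : List Ball) (P : Row n) (avail : List ℕ) (out : List Ball) : Set where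
    constructor ffOut
    field
      perm : map proj₁ out ++ avl R (insK 0 P ps) ↭ avail
      idx  : sumIdx out + uy R P ≡ sumIdx ps + uy R (insK 0 P ps)
      len  : length out ≡ length ps

  FF-step : ∀ {j i ps P avail} κ i′ δ out → avail ≡ avl R P → κ ∈ avail → i′ ≡ δ + i → uy R (setCol j true P) ≡ δ + uy R P →
            FFOut ps (setCol j true P) (removeN κ avail) out → FFOut ((j , i) ∷ ps) P avail ((κ , i′) ∷ out)
  FF-step {j} {i} {ps} {P} {avail} κ i′ δ out av κ∈ refl uyδ (ffOut p x l) = ffOut
    (↭-trans (prep κ p) (removeN-↭ κ avail (subst Unique (sym av) (Inc⇒Unique (Inc-avl R P))) κ∈))
    (begin
      δ + i + sumIdx out + uy R P       ≡⟨ solve 4 (λ d i s u → d :+ i :+ s :+ u := i :+ (s :+ (d :+ u))) refl δ i (sumIdx out) (uy R P) ⟩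
      i + (sumIdx out + (δ + uy R P))   ≡⟨ cong (λ z → i + (sumIdx out + z)) uyδ ⟨
      i + (sumIdx out + uy R (setCol j true P)) ≡⟨ cong (i +_) x ⟩
      i + (sumIdx ps + uy R (insK 0 (setCol j true P) ps)) ≡⟨ +-assoc i (sumIdx ps) _ ⟨
      i + sumIdx ps + uy R (insK 0 (setCol j true P) ps) ∎)
    (cong suc l)
    where
    open ≡-Reasoning
    open +-*-Solver

  tailIn : ∀ {j i ps P κ avail} → avail ≡ avl R P → κ ∈ avail → avl R (setCol j true P) ≡ removeN κ avail →
           FFIn ((j , i) ∷ ps) P → FFIn ps (setCol j true P)
  tailIn {j} {i} {ps} {P} {κ} {avail} av κ∈ e I = record
    { fresh    = All.zipWith (λ { ((c<n , e) , d) → c<n , trans (at-setCol j P _ c<n) (cong₂ _∨_ e (≢⇒≡ᵇ _ j (d ∘ sym))) }) (All.tail fresh , AllPairs.head distinct)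
    ; distinct = AllPairs.tail distinct
    ; room     = s≤s⁻¹ (≤-trans room (≤-reflexive (trans (cong length (sym av)) (trans (sym (length-removeN κ avail (subst Unique (sym av) (Inc⇒Unique (Inc-avl R P))) κ∈)) (cong (suc ∘ length) (sym e)))))) }
    where open FFIn I

  FF-spec : ∀ ps P avail → avail ≡ avl R P → FFIn ps P → FFOut ps P avail (FF ps avail)
  FF-spec []             P avail   av I = ffOut (↭-reflexive (sym av)) refl refl
  FF-spec ((j , i) ∷ ps) P []      av I = contradiction (≤-trans (FFIn.room I) (≤-reflexive (cong length (sym av)))) λ ()
  FF-spec ((j , i) ∷ ps) P (a ∷ l) av I with firstGE j (a ∷ l) in e
  ... | just κ = FF-step κ i 0 _ av κ∈ refl (proj₂ d) (FF-spec ps (setCol j true P) (removeN κ (a ∷ l)) (sym e′) (tailIn av κ∈ e′ I))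
    where
    κ∈ = proj₂ (firstGE-≥ j (a ∷ l) e)
    f = All.head (FFIn.fresh I)
    d = avl-direct R P j (proj₁ f) (proj₂ f) (trans (cong (firstGE j) (sym av)) e)
    e′ = trans (proj₁ d) (cong (removeN κ) (sym av))
  ... | nothing = FF-step a (suc i) 1 _ av (here refl) refl (proj₂ d) (FF-spec ps (setCol j true P) (removeN a (a ∷ l)) (sym e′) (tailIn av (here refl) e′ I))
    where
    f = All.head (FFIn.fresh I)
    d = avl-wrap R P j (proj₁ f) (proj₂ f) (trans (cong (firstGE j) (sym av)) e) (sym av)
    e′ = trans (proj₁ d) (cong (removeN a) (sym av))

rowOf : ∀ n → List Ball → Row n
rowOf n = insK 0 (Vec.replicate n false)

at-rowOf : ∀ n ps c → c < n → at c (rowOf n ps) ≡ elemᵇ c (map proj₁ ps)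
at-rowOf n ps c l = trans (at-insK 0 _ ps c l) (trans (cong (_∨ hasLabel 0 c ps) (at-zeros n c)) (go ps))
  where
  go : ∀ ps → hasLabel 0 c ps ≡ elemᵇ c (map proj₁ ps)
  go []             = refl
  go ((j , i) ∷ ps) = cong₂ _∨_ (∧-identityʳ (c ≡ᵇ j)) (go ps)

record Marks (n : ℕ) (ps : List Ball) : Set where
  field
    inside   : All (λ x → proj₁ x < n) ps
    distinct : Distinct ps

cnt-insK : ∀ {n} (P : Row n) ps → All (λ x → proj₁ x < n × at (proj₁ x) P ≡ false) ps → Distinct ps → cnt (insK 0 P ps) ≡ length ps + cnt P
cnt-insK P []             _        _        = refl
cnt-insK P ((j , i) ∷ ps) (f ∷ fs) (d ∷ ds) =
  trans (cnt-insK (setCol j true P) ps (All.zipWith (λ { ((c<n , e) , d) → c<n , trans (at-setCol j P _ c<n) (cong₂ _∨_ e (≢⇒≡ᵇ _ j (d ∘ sym))) }) (fs , d)) ds)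
        (trans (cong (length ps +_) (cnt-setCol j P (proj₁ f) (proj₂ f))) (+-suc (length ps) (cnt P)))

cnt-rowOf : ∀ {n} ps → Marks n ps → cnt (rowOf n ps) ≡ length ps
cnt-rowOf {n} ps M = trans (cnt-insK _ ps (All.map (λ l → l , at-zeros n _) (Marks.inside M)) (Marks.distinct M)) (trans (cong (length ps +_) (cnt-zeros n)) (+-identityʳ _))

elemᵇ-++ : ∀ c xs ys → elemᵇ c (xs ++ ys) ≡ elemᵇ c xs ∨ elemᵇ c ys
elemᵇ-++ c []       ys = refl
elemᵇ-++ c (x ∷ xs) ys with c ≡ᵇ x
... | true  = refl
... | false = elemᵇ-++ c xs ys

elemᵇ⇒∈ : ∀ c xs → elemᵇ c xs ≡ true → c ∈ xs
elemᵇ⇒∈ c (x ∷ xs) e with c ≡ᵇ x in eq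
... | true  = here (≡ᵇ-true⁻ {c} eq)
... | false = there (elemᵇ⇒∈ c xs e)

module _ {n : ℕ} (R : Row n) (ps : List Ball) (M : Marks n ps) (room : length ps ≤ cnt R) where

  private
    O = Vec.replicate n false
    open FirstFit R
    spec : FFOut ps O (cols R) (FF ps (cols R))
    spec = FF-spec ps O (cols R) (sym (avl-empty R)) record
      { fresh    = All.map (λ l → l , at-zeros n _) (Marks.inside M)
      ; distinct = Marks.distinct M
      ; room     = ≤-trans room (≤-reflexive (trans (sym (length-cols R)) (cong length (sym (avl-empty R))))) }
    module S = FFOut spec
    uniq : Unique (map proj₁ (FF ps (cols R)) ++ avl R (rowOf n ps))
    uniq = Unique-↭ (↭-sym S.perm) (Inc⇒Unique (Inc-cols R))

  FF-marks : Marks n (FF ps (cols R))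
  FF-marks = record
    { inside   = All.map⁻ (All.++⁻ˡ (map proj₁ (FF ps (cols R))) (Perm.All-resp-↭ (↭-sym S.perm) (cols-< R)))
    ; distinct = APP.map⁻ (left-unique (map proj₁ (FF ps (cols R))) uniq) }
    where
    left-unique : ∀ (xs : List ℕ) {ys} → Unique (xs ++ ys) → Unique xs
    left-unique []       _       = []
    left-unique (x ∷ xs) (h ∷ u) = All.++⁻ˡ xs h ∷ left-unique xs u

  FF-len : length (FF ps (cols R)) ≡ length ps
  FF-len = S.len

  FF-idx : sumIdx (FF ps (cols R)) ≡ sumIdx ps + uy R (rowOf n ps)
  FF-idx = trans (sym (+-identityʳ _)) (trans (cong (sumIdx (FF ps (cols R)) +_) (sym (ux-empty R))) S.idx)

  FF-row : rowOf n (FF ps (cols R)) ≡ Tc R (rowOf n ps)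
  FF-row = row-ext _ _ λ c l → begin
    at c (rowOf n (FF ps (cols R)))                           ≡⟨ at-rowOf n (FF ps (cols R)) c l ⟩
    elemᵇ c X                                                 ≡⟨ excl c (elemᵇ c X) (elemᵇ c Y) refl refl ⟩
    (elemᵇ c X ∨ elemᵇ c Y) ∧ not (elemᵇ c Y)                 ≡⟨ cong (_∧ not (elemᵇ c Y)) (trans (sym (elemᵇ-++ c X Y)) (any-↭ (c ≡ᵇ_) S.perm)) ⟩
    elemᵇ c (cols R) ∧ not (elemᵇ c Y)                        ≡⟨ cong (_∧ not (elemᵇ c Y)) (elemᵇ-cols c R) ⟩
    at c R ∧ not (elemᵇ c Y)                                  ≡⟨ at-Tc R (rowOf n ps) c (≤-trans (≤-reflexive (cnt-rowOf ps M)) room) ⟨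
    at c (Tc R (rowOf n ps))                                  ∎
    where
    open ≡-Reasoning
    X = map proj₁ (FF ps (cols R))
    Y = avl R (rowOf n ps)
    disj : ∀ (xs : List ℕ) {ys} → Unique (xs ++ ys) → ∀ {c} → c ∈ xs → c ∈ ys → ⊥
    disj (x ∷ xs) (h ∷ u) (here refl) j = All.lookup h (∈-++⁺ʳ xs j) refl
    disj (x ∷ xs) (h ∷ u) (there i)   j = disj xs u i j
    excl : ∀ c a b → elemᵇ c X ≡ a → elemᵇ c Y ≡ b → a ≡ (a ∨ b) ∧ not b
    excl c true  true  e e′ = ⊥-elim (disj X uniq (elemᵇ⇒∈ c X e) (elemᵇ⇒∈ c Y e′))
    excl c true  false e e′ = refl
    excl c false true  e e′ = refl
    excl c false false e e′ = refl

chainIdx : ∀ {n} → List Ball → List (Row n) → ℕ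
chainIdx ps []       = sumIdx ps
chainIdx ps (R ∷ Rs) = chainIdx (FF ps (cols R)) Rs

chainIdx≡ : ∀ {n} ps (Rs : List (Row n)) → Marks n ps → All (λ R → length ps ≤ cnt R) Rs → chainIdx ps Rs ≡ sumIdx ps + wD (rowOf n ps) Rs
chainIdx≡ ps []       M _        = sym (+-identityʳ _)
chainIdx≡ {n} ps (R ∷ Rs) M (h ∷ hs) = begin
  chainIdx (FF ps (cols R)) Rs
    ≡⟨ chainIdx≡ (FF ps (cols R)) Rs (FF-marks R ps M h) (All.map (≤-trans (≤-reflexive (FF-len R ps M h))) hs) ⟩
  sumIdx (FF ps (cols R)) + wD (rowOf n (FF ps (cols R))) Rs
    ≡⟨ cong₂ (λ a b → a + wD b Rs) (FF-idx R ps M h) (FF-row R ps M h) ⟩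
  (sumIdx ps + uy R (rowOf n ps)) + wD (Tc R (rowOf n ps)) Rs
    ≡⟨ +-assoc (sumIdx ps) _ _ ⟩
  sumIdx ps + (uy R (rowOf n ps) + wD (Tc R (rowOf n ps)) Rs) ∎
  where open ≡-Reasoning

-- The nonempty prefixes of the list of rows, each with the size of its last row. When sizes
-- decrease, just that many subwords reach this row, and their indices there come from the chains
-- through the prefix.
preC : ∀ {n} → List (Row n) → List (ℕ × List (Row n))
preC []       = []
preC (R ∷ Rs) = (cnt R , R ∷ []) ∷ map (λ z → proj₁ z , R ∷ proj₂ z) (preC Rs)

H≡chains : ∀ {n} ps (Rs : List (Row n)) → H ps (map cols Rs) ≡ sum (map (λ z → chainIdx (take (proj₁ z) ps) (proj₂ z)) (preC Rs))
H≡chains ps []       = refl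
H≡chains ps (R ∷ Rs) = cong₂ _+_ (cong sumIdx (sym (trans (FF-take (cnt R) ps (cols R)) (take-all (cnt R) (FF ps (cols R)) (≤-trans (FF-length ps (cols R) (Inc⇒Unique (Inc-cols R))) (≤-reflexive (length-cols R)))))))
  (trans (H≡chains (FF ps (cols R)) Rs) (cong sum (trans (map-cong (λ z → cong (λ q → chainIdx q (proj₂ z)) (sym (FF-take (proj₁ z) ps (cols R)))) (preC Rs)) (map-∘ (preC Rs)))))

-- The downward counterpart of `preC`: a row with the rows below it in descending order, which is
-- the path of one FM layer.
lw : ∀ {n} → Config n → List (Row n × List (Row n))
lw []      = []
lw (r ∷ M) = (r , []) ∷ map (λ z → proj₁ z , proj₂ z ++ r ∷ []) (lw M)

endTc : ∀ {n} → Row n → List (Row n) → Row n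
endTc S []       = S
endTc S (R ∷ Rs) = endTc (Tc R S) Rs

wD-∷ʳ : ∀ {n} (S : Row n) Rs r → wD S (Rs ++ r ∷ []) ≡ wD S Rs + uy r (endTc S Rs)
wD-∷ʳ S []       r = +-identityʳ (uy r S)
wD-∷ʳ S (R ∷ Rs) r = trans (cong (uy R S +_) (wD-∷ʳ (Tc R S) Rs r)) (sym (+-assoc (uy R S) _ _))

endTc-∷ʳ : ∀ {n} (S : Row n) Rs r → endTc S (Rs ++ r ∷ []) ≡ Tc r (endTc S Rs)
endTc-∷ʳ S []       r = refl
endTc-∷ʳ S (R ∷ Rs) r = endTc-∷ʳ (Tc R S) Rs r

layM-lw : ∀ {n} (M : Config n) → layM M ≡ map (uncurry endTc) (lw M)
layM-lw []      = refl
layM-lw (r ∷ M) = cong (r ∷_) (trans (cong (map (Tc r)) (layM-lw M)) (trans (sym (map-∘ (lw M)))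
  (trans (map-cong (λ z → sym (endTc-∷ʳ (proj₁ z) (proj₂ z) r)) (lw M)) (map-∘ (lw M)))))

majM-lw : ∀ {n} (M : Config n) → majM M ≡ sum (map (uncurry wD) (lw M))
majM-lw []      = refl
majM-lw (r ∷ M) = trans (cong₂ _+_ (majM-lw M) (cong sum (trans (cong (map (uy r)) (layM-lw M)) (sym (map-∘ (lw M))))))
  (trans (go (lw M)) (cong sum (map-∘ (lw M))))
  where
  go : ∀ zs → sum (map (uncurry wD) zs) + sum (map (λ z → uy r (uncurry endTc z)) zs) ≡ sum (map (λ z → wD (proj₁ z) (proj₂ z ++ r ∷ [])) zs)
  go []       = refl
  go (z ∷ zs) = trans (solve 4 (λ a b c d → (a :+ b) :+ (c :+ d) := (a :+ c) :+ (b :+ d)) refl (uncurry wD z) _ (uy r (uncurry endTc z)) _)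
    (cong₂ _+_ (sym (wD-∷ʳ (proj₁ z) (proj₂ z) r)) (go zs))
    where open +-*-Solver

Aligned : ∀ {n} → Row n × List (Row n) → ℕ × List (Row n) → Set
Aligned (T , Ds) (c , Z) = reverse Z ≡ T ∷ Ds × c ≡ cnt T

aligned : ∀ {n} (Rs : List (Row n)) → Pointwise Aligned (lw Rs) (preC Rs)
aligned []       = []
aligned (R ∷ Rs) = (refl , refl) ∷ PW.map⁺ _ _ (PW.map (λ { {T , Ds} {c , Z} (e , f) → trans (unfold-reverse R Z) (cong (_++ R ∷ []) e) , f }) (aligned Rs))

preC-bound : ∀ {n} (b : Row n) (Rs : List (Row n)) → All (λ R → cnt R ≤ cnt b) Rs → All (λ z → proj₁ z ≤ cnt b) (preC Rs)
preC-bound b []       []       = []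
preC-bound b (R ∷ Rs) (h ∷ hs) = h ∷ All.map⁺ (preC-bound b Rs hs)

preC-decr : ∀ {n} (Rs : List (Row n)) → Decr Rs → All (λ z → All (λ R → proj₁ z ≤ cnt R) (proj₂ z)) (preC Rs)
preC-decr []       []       = []
preC-decr (R ∷ Rs) (h ∷ hs) = (≤-refl ∷ []) ∷ All.map⁺ (All.zipWith (λ { (a , b) → a ∷ b }) (preC-bound R Rs h , preC-decr Rs hs))

preC-rev : ∀ {n} (Rs : List (Row n)) → preC (map rev Rs) ≡ map (λ z → proj₁ z , map rev (proj₂ z)) (preC Rs)
preC-rev []       = refl
preC-rev (R ∷ Rs) = cong₂ _∷_ (cong (_, rev R ∷ []) (cnt-rev R)) (trans (cong (map _) (preC-rev Rs)) (trans (sym (map-∘ (preC Rs))) (map-∘ (preC Rs))))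

majM-upward : ∀ {n} (R₁ : Row n) Rs → Decr (R₁ ∷ Rs) →
  majM (R₁ ∷ Rs) ≡ sum (map (λ z → wD (firstN (proj₁ z) (rev R₁)) (map rev (proj₂ z))) (preC Rs))
majM-upward R₁ Rs (d ∷ ds) = trans (majM-lw (R₁ ∷ Rs)) (trans (cong sum (sym (map-∘ (lw Rs))))
  (go (lw Rs) (preC Rs) (aligned Rs) (preC-bound R₁ Rs d) (preC-decr Rs ds)))
  where
  go : ∀ as bs → Pointwise Aligned as bs → All (λ z → proj₁ z ≤ cnt R₁) bs → All (λ z → All (λ R → proj₁ z ≤ cnt R) (proj₂ z)) bs →
       sum (map (λ z → wD (proj₁ z) (proj₂ z ++ R₁ ∷ [])) as) ≡ sum (map (λ z → wD (firstN (proj₁ z) (rev R₁)) (map rev (proj₂ z))) bs)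
  go []              []             []                 _        _        = refl
  go ((T , Ds) ∷ as) ((c , Z) ∷ bs) ((e , refl) ∷ al) (h ∷ hs) (k ∷ ks) =
    cong₂ _+_ (min-flow R₁ Z T (Ds ++ R₁ ∷ []) (trans (unfold-reverse R₁ Z) (cong (_++ R₁ ∷ []) e)) (h ∷ k)) (go as bs al hs ks)

cols-firstN : ∀ {n} c (R : Row n) → cols (firstN c R) ≡ take c (cols R)
cols-firstN zero    []          = refl
cols-firstN (suc c) []          = refl
cols-firstN zero    (p ∷ R)     = trans (cols-false (firstN 0 R)) (cong (map suc) (cols-firstN 0 R))
cols-firstN (suc c) (true ∷ R)  = trans (cols-true (firstN c R)) (trans (cong (λ l → 0 ∷ map suc l) (cols-firstN c R)) (trans (cong (0 ∷_) (sym (take-map c (cols R)))) (cong (take (suc c)) (sym (cols-true R)))))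
cols-firstN (suc c) (false ∷ R) = trans (cols-false (firstN (suc c) R)) (trans (cong (map suc) (cols-firstN (suc c) R)) (trans (sym (take-map (suc c) (cols R))) (cong (take (suc c)) (sym (cols-false R)))))

rowOf-take : ∀ {n} c (R : Row n) → rowOf n (take c (map (_, 0) (cols R))) ≡ firstN c R
rowOf-take {n} c R = row-ext _ _ λ x l → trans (at-rowOf n (take c (map (_, 0) (cols R))) x l) (trans (cong (elemᵇ x)
  (trans (sym (take-map {f = proj₁} c (map (_, 0) (cols R)))) (trans (cong (take c) (trans (sym (map-∘ (cols R))) (map-id (cols R)))) (sym (cols-firstN c R))))) (elemᵇ-cols x (firstN c R)))

marks-take : ∀ {n} c (R : Row n) → Marks n (take c (map (_, 0) (cols R)))
marks-take c R = record
  { inside   = All.take⁺ c (All.map⁺ (cols-< R))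
  ; distinct = APP.take⁺ c (APP.map⁺ (Inc⇒Unique (Inc-cols R))) }

sumIdx-zero : ∀ c l → sumIdx (take c (map (_, 0) l)) ≡ 0
sumIdx-zero zero    l       = refl
sumIdx-zero (suc c) []      = refl
sumIdx-zero (suc c) (x ∷ l) = sumIdx-zero c l

cg≡majM : ∀ {n} (R₁ : Row n) Rs → Decr (R₁ ∷ Rs) → cg (cols (rev R₁)) (map cols (map rev Rs)) ≡ majM (R₁ ∷ Rs)
cg≡majM R₁ Rs d@(d₁ ∷ ds) = begin
  cg (cols (rev R₁)) (map cols (map rev Rs))                     ≡⟨ cg≡H (cols (rev R₁)) (map cols (map rev Rs)) ⟩
  H ones (map cols (map rev Rs))                                 ≡⟨ H≡chains ones (map rev Rs) ⟩
  sum (map (λ z → chainIdx (take (proj₁ z) ones) (proj₂ z)) (preC (map rev Rs)))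
    ≡⟨ cong (sum ∘ map (λ z → chainIdx (take (proj₁ z) ones) (proj₂ z))) (preC-rev Rs) ⟩
  sum (map (λ z → chainIdx (take (proj₁ z) ones) (proj₂ z)) (map (λ z → proj₁ z , map rev (proj₂ z)) (preC Rs)))
    ≡⟨ cong sum (sym (map-∘ (preC Rs))) ⟩
  sum (map (λ z → chainIdx (take (proj₁ z) ones) (map rev (proj₂ z))) (preC Rs))
    ≡⟨ cong sum (map-cong-local (All.map (λ {z} → each z) (preC-decr Rs ds))) ⟩
  sum (map (λ z → wD (firstN (proj₁ z) (rev R₁)) (map rev (proj₂ z))) (preC Rs))
    ≡⟨ majM-upward R₁ Rs d ⟨
  majM (R₁ ∷ Rs) ∎
  where
  open ≡-Reasoning
  ones = map (_, 0) (cols (rev R₁))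
  each : ∀ z → All (λ R → proj₁ z ≤ cnt R) (proj₂ z) → chainIdx (take (proj₁ z) ones) (map rev (proj₂ z)) ≡ wD (firstN (proj₁ z) (rev R₁)) (map rev (proj₂ z))
  each (c , Z) h = trans (chainIdx≡ (take c ones) (map rev Z) (marks-take c (rev R₁))
      (All.map⁺ (All.map (λ {R} l → ≤-trans (≤-trans (≤-reflexive (length-take c ones)) (m⊓n≤m c _)) (≤-trans l (≤-reflexive (sym (cnt-rev R))))) h)))
    (cong₂ (λ a b → a + wD b (map rev Z)) (sumIdx-zero c (cols (rev R₁))) (rowOf-take c (rev R₁)))

map-suc-if : ∀ n b → map suc (if b then n ∷ [] else []) ≡ (if b then suc n ∷ [] else [])
map-suc-if n true  = refl
map-suc-if n false = refl

cols-∷ʳ : ∀ {n} (r : Row n) b → cols (r Vec.∷ʳ b) ≡ cols r ++ (if b then n ∷ [] else [])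
cols-∷ʳ []          true  = refl
cols-∷ʳ []          false = refl
cols-∷ʳ {suc n} (true ∷ r) b = trans (cols-true (r Vec.∷ʳ b)) (trans (cong (λ l → 0 ∷ map suc l) (cols-∷ʳ r b)) (trans (cong (0 ∷_) (map-++ suc (cols r) _))
  (trans (cong (λ l → 0 ∷ map suc (cols r) ++ l) (map-suc-if n b)) (cong (_++ (if b then suc n ∷ [] else [])) (sym (cols-true r))))))
cols-∷ʳ {suc n} (false ∷ r) b = trans (cols-false (r Vec.∷ʳ b)) (trans (cong (map suc) (cols-∷ʳ r b)) (trans (map-++ suc (cols r) _)
  (trans (cong (map suc (cols r) ++_) (map-suc-if n b)) (cong (_++ (if b then suc n ∷ [] else [])) (sym (cols-false r))))))

module WordCharge (l : List Cell) where
  m = length l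
  open Columns m
  open ColumnsCharge m

  numbered : (f : ℕ → ℕ) → List Cell → List Cell
  numbered f l = zip (applyUpTo f (length l)) (map proj₂ l)

  letterRow : ℕ → Row m
  letterRow x = vecOf (λ c → proj₂ c ≡ᵇ x) l

  -- Positions are turned into columns counted from the right end, so the rows of the word
  -- configuration appear reversed. This is the reversal for which `min-flow` is stated.
  spots-word : ∀ x → spots x (numbered id l) ≡ cols (rev (letterRow x))
  spots-word x = go l id 0 (λ _ → refl) refl
    where
    go : ∀ l′ (f : ℕ → ℕ) s → (∀ i → f i ≡ s + i) → s + length l′ ≡ m → spots x (numbered f l′) ≡ cols (rev (vecOf (λ c → proj₂ c ≡ᵇ x) l′))
    go []       f s h e = refl
    go (c ∷ l′) f s h e = trans (cong₂ (λ a p → a ++ (if proj₂ c ≡ᵇ x then p ∷ [] else []))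
        (go l′ (f ∘ suc) (suc s) (λ i → trans (h (suc i)) (+-suc s i)) (trans (sym (+-suc s (length l′))) e))
        (trans (cong₂ (λ a b → a ∸ suc b) (trans (sym e) (+-suc s (length l′))) (trans (h 0) (+-identityʳ s))) (m+n∸m≡n s (length l′))))
      (sym (trans (cong cols (Vec.reverse-∷ (proj₂ c ≡ᵇ x) (vecOf _ l′))) (cols-∷ʳ (rev (vecOf (λ c → proj₂ c ≡ᵇ x) l′)) (proj₂ c ≡ᵇ x))))

  good-word : Good (numbered id l)
  good-word = record { incr = go l id (λ a b h → h) ; bound = bnd l id (λ i h → h) }
    where
    low : ∀ l′ (f : ℕ → ℕ) s → (∀ i → s < f i) → All (λ a → s < proj₁ a) (numbered f l′)
    low []       f s h = []
    low (c ∷ l′) f s h = h 0 ∷ low l′ (f ∘ suc) s (h ∘ suc)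
    go : ∀ l′ (f : ℕ → ℕ) → (∀ a b → a < b → f a < f b) → AllPairs (λ a b → proj₁ a < proj₁ b) (numbered f l′)
    go []       f h = []
    go (c ∷ l′) f h = low l′ (f ∘ suc) (f 0) (λ i → h 0 (suc i) z<s) ∷ go l′ (f ∘ suc) (λ a b k → h (suc a) (suc b) (s<s k))
    bnd : ∀ l′ (f : ℕ → ℕ) → (∀ i → i < length l′ → f i < m) → All (λ a → proj₁ a < m) (numbered f l′)
    bnd []       f h = []
    bnd (c ∷ l′) f h = h 0 z<s ∷ bnd l′ (f ∘ suc) (λ i k → h (suc i) (s<s k))

  charge≡majM : ∀ r → All (λ c → proj₂ c ≤ suc r) l → Decr (applyUpTo (λ j → letterRow (suc j)) (suc r)) →
                chargeWord (map proj₂ l) ≡ majM (applyUpTo (λ j → letterRow (suc j)) (suc r))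
  charge≡majM r bound d = begin
    chargeGo (length (map proj₂ l)) (zip (upTo (length (map proj₂ l))) (map proj₂ l))
      ≡⟨ cong (λ k → chargeGo k (zip (upTo k) (map proj₂ l))) (length-map proj₂ l) ⟩
    chargeGo m (numbered id l)
      ≡⟨ chargeGo≡cg m r (numbered id l) (cols (rev (letterRow 1))) good-word (spots-word 1) (Inc-cols (rev (letterRow 1)))
           (≤-trans (≤-reflexive (trans (length-cols (rev (letterRow 1))) (trans (cnt-rev (letterRow 1)) (cnt-vecOf _ l)))) (length-filter _ l))
           (λ y h → trans (spots-word y) (trans (cong (cols ∘ rev) (noLetter y h)) cols-none)) ⟩
    cg (cols (rev (letterRow 1))) (avs 1 r (numbered id l))
      ≡⟨ cong (cg (cols (rev (letterRow 1)))) (avs≡ r 1 id (λ i → refl)) ⟩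
    cg (cols (rev (letterRow 1))) (map cols (map rev (applyUpTo (λ j → letterRow (suc (suc j))) r)))
      ≡⟨ cg≡majM (letterRow 1) (applyUpTo (λ j → letterRow (suc (suc j))) r) d ⟩
    majM (applyUpTo (λ j → letterRow (suc j)) (suc r)) ∎
    where
    open ≡-Reasoning
    noLetter : ∀ y → 2 + r ≤ y → letterRow y ≡ Vec.replicate m false
    noLetter y h = go l bound
      where
      go : ∀ l → All (λ c → proj₂ c ≤ suc r) l → vecOf (λ c → proj₂ c ≡ᵇ y) l ≡ Vec.replicate (length l) false
      go []      []       = refl
      go (c ∷ l) (b ∷ bs) = cong₂ _∷_ (≢⇒≡ᵇ (proj₂ c) y (<⇒≢ (≤-trans (s≤s b) h))) (go l bs)
    cols-none : cols (rev (Vec.replicate m false)) ≡ []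
    cols-none = length≡0⇒[] (cols (rev (Vec.replicate m false))) (trans (length-cols (rev (Vec.replicate m false))) (trans (cnt-rev (Vec.replicate m false)) (cnt-zeros m)))
    avs≡ : ∀ K k (f : ℕ → ℕ) → (∀ i → f i ≡ i) → avs k K (numbered id l) ≡ map cols (map rev (applyUpTo (λ j → letterRow (suc (k + j))) K))
    avs≡ zero    k f h = refl
    avs≡ (suc K) k f h = cong₂ _∷_ (trans (spots-word (suc k)) (cong (λ z → cols (rev (letterRow (suc z)))) (sym (+-identityʳ k))))
      (trans (avs≡ K (suc k) f h) (cong (map cols ∘ map rev) (applyUpTo-cong (λ j → cong (λ z → letterRow (suc z)) (sym (+-suc k j))) K)))

-- Boolean tests and lists without repetition

Unique-filterᵇ : ∀ {A : Set} (p : A → Bool) {xs} → Unique xs → Unique (filterᵇ p xs)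
Unique-filterᵇ p u = APP.filter⁺ _ u

∈-filterᵇ⁺ : ∀ {A : Set} (p : A → Bool) {x xs} → x ∈ xs → p x ≡ true → x ∈ filterᵇ p xs
∈-filterᵇ⁺ p (here refl) e rewrite e = here refl
∈-filterᵇ⁺ p {xs = y ∷ xs} (there i) e with p y
... | true  = there (∈-filterᵇ⁺ p i e)
... | false = ∈-filterᵇ⁺ p i e

∈-filterᵇ⁻ : ∀ {A : Set} (p : A → Bool) {x} xs → x ∈ filterᵇ p xs → x ∈ xs × p x ≡ true
∈-filterᵇ⁻ p (y ∷ xs) i with p y in e
∈-filterᵇ⁻ p (y ∷ xs) (here refl) | true = here refl , e
∈-filterᵇ⁻ p (y ∷ xs) (there i)   | true = let j , h = ∈-filterᵇ⁻ p xs i in there j , h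
... | false = let j , h = ∈-filterᵇ⁻ p xs i in there j , h

any-true⁺ : ∀ {A : Set} (p : A → Bool) {x xs} → x ∈ xs → p x ≡ true → any p xs ≡ true
any-true⁺ p (here refl) e rewrite e = refl
any-true⁺ p {xs = y ∷ xs} (there i) e with p y
... | true  = refl
... | false = any-true⁺ p i e

any-true⁻ : ∀ {A : Set} (p : A → Bool) xs → any p xs ≡ true → ∃ λ x → x ∈ xs × p x ≡ true
any-true⁻ p (x ∷ xs) e with p x in eq
... | true  = x , here refl , eq
... | false = let y , i , h = any-true⁻ p xs e in y , there i , h

all-true : ∀ {A : Set} (p : A → Bool) xs → All (λ x → p x ≡ true) xs → all p xs ≡ true
all-true p []       []       = refl
all-true p (x ∷ xs) (h ∷ hs) rewrite h = all-true p xs hs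

eqNat-sound : ∀ xs ys → eqNat xs ys ≡ true → xs ≡ ys
eqNat-sound []       []       _ = refl
eqNat-sound (x ∷ xs) (y ∷ ys) e with ∧-true⁻ (x ≡ᵇ y) e
... | a , b = cong₂ _∷_ (≡ᵇ-true⁻ a) (eqNat-sound xs ys b)

eqNat-refl : ∀ xs → eqNat xs xs ≡ true
eqNat-refl []       = refl
eqNat-refl (x ∷ xs) rewrite ≡ᵇ-refl x = eqNat-refl xs

eqNats-sound : ∀ xs ys → eqNats xs ys ≡ true → xs ≡ ys
eqNats-sound []       []       _ = refl
eqNats-sound (x ∷ xs) (y ∷ ys) e with ∧-true⁻ (eqNat x y) e
... | a , b = cong₂ _∷_ (eqNat-sound x y a) (eqNats-sound xs ys b)

eqNats-refl : ∀ xs → eqNats xs xs ≡ true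
eqNats-refl []       = refl
eqNats-refl (x ∷ xs) rewrite eqNat-refl x = eqNats-refl xs

eqBool-sound : ∀ {n} (xs ys : Row n) → eqBool (toList xs) (toList ys) ≡ true → xs ≡ ys
eqBool-sound []           []           _ = refl
eqBool-sound (true ∷ xs)  (true ∷ ys)  e = cong (true ∷_) (eqBool-sound xs ys e)
eqBool-sound (false ∷ xs) (false ∷ ys) e = cong (false ∷_) (eqBool-sound xs ys e)
eqBool-sound (true ∷ xs)  (false ∷ ys) ()
eqBool-sound (false ∷ xs) (true ∷ ys)  ()

eqBool-refl : ∀ xs → eqBool xs xs ≡ true
eqBool-refl []           = refl
eqBool-refl (true ∷ xs)  = eqBool-refl xs
eqBool-refl (false ∷ xs) = eqBool-refl xs

eqBools-sound : ∀ {n} (M N : Config n) → eqBools (map toList M) (map toList N) ≡ true → M ≡ N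
eqBools-sound []      []      _ = refl
eqBools-sound (x ∷ M) (y ∷ N) e with ∧-true⁻ (eqBool (toList x) (toList y)) e
... | a , b = cong₂ _∷_ (eqBool-sound x y a) (eqBools-sound M N b)

eqBools-refl : ∀ xs → eqBools xs xs ≡ true
eqBools-refl []       = refl
eqBools-refl (x ∷ xs) rewrite eqBool-refl x = eqBools-refl xs

Unique-map-on : ∀ {A B : Set} (f : A → B) xs → (∀ {x y} → x ∈ xs → y ∈ xs → f x ≡ f y → x ≡ y) → Unique xs → Unique (map f xs)
Unique-map-on f []       inj []      = []
Unique-map-on f (x ∷ xs) inj (h ∷ u) =
  All.map⁺ (All.tabulate (λ {y} i e → All.lookup h i (inj (here refl) (there i) e))) ∷ Unique-map-on f xs (λ i j → inj (there i) (there j)) u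

∈-concatMap⁺ : ∀ {A B : Set} (f : A → List B) {x xs z} → x ∈ xs → z ∈ f x → z ∈ concatMap f xs
∈-concatMap⁺ f             (here refl) h = ∈-++⁺ˡ h
∈-concatMap⁺ f {xs = y ∷ xs} (there i) h = ∈-++⁺ʳ (f y) (∈-concatMap⁺ f i h)

∈-concatMap⁻ : ∀ {A B : Set} (f : A → List B) xs {z} → z ∈ concatMap f xs → ∃ λ x → x ∈ xs × z ∈ f x
∈-concatMap⁻ f (x ∷ xs) i with ∈-++⁻ (f x) i
... | inj₁ h = x , here refl , h
... | inj₂ h = let y , j , k = ∈-concatMap⁻ f xs h in y , there j , k

Unique-++ : ∀ {A : Set} (xs : List A) {ys} → Unique xs → Unique ys → (∀ {z} → z ∈ xs → z ∈ ys → ⊥) → Unique (xs ++ ys)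
Unique-++ []       u       v d = v
Unique-++ (x ∷ xs) (h ∷ u) v d = All.++⁺ h (All.tabulate (λ {y} i e → d (here refl) (subst (_∈ _) (sym e) i))) ∷ Unique-++ xs u v (λ i j → d (there i) j)

Unique-concatMap : ∀ {A B : Set} (f : A → List B) (key : B → A) xs → Unique xs →
  (∀ {x} → x ∈ xs → Unique (f x)) → (∀ {x z} → x ∈ xs → z ∈ f x → key z ≡ x) → Unique (concatMap f xs)
Unique-concatMap f key []       []      uf k = []
Unique-concatMap f key (x ∷ xs) (h ∷ u) uf k =
  Unique-++ (f x) (uf (here refl)) (Unique-concatMap f key xs u (uf ∘ there) (k ∘ there))
    (λ i j → let y , y∈ , z∈ = ∈-concatMap⁻ f xs j in All.lookup h y∈ (trans (sym (k (here refl) i)) (k (there y∈) z∈)))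

-- Enumerations

∈-allSubsets : ∀ {n} (B : Row n) → B ∈ allSubsets n
∈-allSubsets []          = here refl
∈-allSubsets (true ∷ B)  = ∈-concatMap⁺ _ (∈-allSubsets B) (here refl)
∈-allSubsets (false ∷ B) = ∈-concatMap⁺ _ (∈-allSubsets B) (there (here refl))

Unique-allSubsets : ∀ n → Unique (allSubsets n)
Unique-allSubsets zero    = [] ∷ []
Unique-allSubsets (suc n) = Unique-concatMap _ Vec.tail (allSubsets n) (Unique-allSubsets n)
  (λ _ → ((λ ()) ∷ []) ∷ [] ∷ []) (λ { _ (here refl) → refl ; _ (there (here refl)) → refl })

configs : ∀ n → List ℕ → List (Config n)
configs n = foldr (λ k acc → concatMap (λ B → map (B ∷_) acc) (filterᵇ (λ B → ∣ B ∣ ≡ᵇ k) (allSubsets n))) ([] ∷ [])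

∈-configs⁺ : ∀ {n} (M : Config n) → M ∈ configs n (sizes M)
∈-configs⁺ []      = here refl
∈-configs⁺ (r ∷ M) = ∈-concatMap⁺ _ (∈-filterᵇ⁺ _ (∈-allSubsets r) (trans (cong (_≡ᵇ cnt r) (∣∣≡cnt r)) (≡ᵇ-refl (cnt r)))) (∈-map⁺ (r ∷_) (∈-configs⁺ M))

∈-configs⁻ : ∀ {n} ks (M : Config n) → M ∈ configs n ks → sizes M ≡ ks
∈-configs⁻ []       M (here refl) = refl
∈-configs⁻ (k ∷ ks) M i with ∈-concatMap⁻ _ (filterᵇ (λ B → ∣ B ∣ ≡ᵇ k) (allSubsets _)) i
... | B , B∈ , j with ∈-map⁻ (B ∷_) j | ∈-filterᵇ⁻ (λ B → ∣ B ∣ ≡ᵇ k) (allSubsets _) B∈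
...   | M′ , M′∈ , refl | _ , e = cong₂ _∷_ (trans (sym (∣∣≡cnt B)) (≡ᵇ-true⁻ e)) (∈-configs⁻ ks M′ M′∈)

Unique-configs : ∀ n ks → Unique (configs n ks)
Unique-configs n []       = [] ∷ []
Unique-configs n (k ∷ ks) = Unique-concatMap _ headR _ (Unique-filterᵇ _ (Unique-allSubsets n))
  (λ {B} _ → Unique-map-on (B ∷_) (configs n ks) (λ _ _ e → ∷-injectiveʳ e) (Unique-configs n ks))
  (λ { {B} _ i → let M , _ , e = ∈-map⁻ (B ∷_) i in cong headR e })

∈-comps : ∀ N c → All (0 <_) c → sum c ≡ N → c ∈ comps N
∈-comps zero          []                _          _ = here refl
∈-comps zero          (suc x ∷ c)       _          ()
∈-comps zero          (zero ∷ c)        (() ∷ _)   _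
∈-comps (suc zero)    (suc zero ∷ [])   _          _ = here refl
∈-comps (suc zero)    (suc zero ∷ suc y ∷ c) _     ()
∈-comps (suc zero)    (suc zero ∷ zero ∷ c) (_ ∷ () ∷ _) _
∈-comps (suc zero)    (suc (suc x) ∷ c) _          ()
∈-comps (suc zero)    (zero ∷ c)        (() ∷ _)   _
∈-comps (suc (suc N)) (suc zero ∷ c)    (_ ∷ h)    e = ∈-concatMap⁺ _ (∈-comps (suc N) c h (suc-injective e)) (here refl)
∈-comps (suc (suc N)) (suc (suc x) ∷ c) (_ ∷ h)    e = ∈-concatMap⁺ _ (∈-comps (suc N) (suc x ∷ c) (z<s ∷ h) (suc-injective e)) (there (here refl))
∈-comps (suc (suc N)) (zero ∷ c)        (() ∷ _)   _
∈-comps (suc (suc N)) []                _          ()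
∈-comps (suc zero)    []                _          ()

decHead : List ℕ → List ℕ
decHead []                = []
decHead (suc (suc x) ∷ c) = suc x ∷ c
decHead (_ ∷ c)           = c

comps-head : ∀ N {c} → c ∈ comps (suc N) → ∃ λ x → ∃ λ c′ → c ≡ suc x ∷ c′
comps-head zero    (here refl) = 0 , [] , refl
comps-head (suc N) i with ∈-concatMap⁻ _ (comps (suc N)) i
... | c , c∈ , h with comps-head N c∈
comps-head (suc N) i | c , c∈ , here refl         | x , c′ , refl = 0 , _ , refl
comps-head (suc N) i | c , c∈ , there (here refl) | x , c′ , refl = suc x , c′ , refl

Unique-comps : ∀ N → Unique (comps N)
Unique-comps zero          = [] ∷ []
Unique-comps (suc zero)    = [] ∷ []
Unique-comps (suc (suc N)) = Unique-concatMap _ decHead (comps (suc N)) (Unique-comps (suc N)) uf key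
  where
  uf : ∀ {c} → c ∈ comps (suc N) → Unique _
  uf i with comps-head N i
  ... | x , c′ , refl = ((λ ()) ∷ []) ∷ [] ∷ []
  key : ∀ {c z} → c ∈ comps (suc N) → z ∈ _ → decHead z ≡ c
  key i h with comps-head N i
  key i (here refl)         | x , c′ , refl = refl
  key i (there (here refl)) | x , c′ , refl = refl

∈-words : ∀ m w → All (λ x → 1 ≤ x × x ≤ m) w → w ∈ words m (length w)
∈-words m []          []             = here refl
∈-words m (suc x ∷ w) ((_ , l) ∷ hs) = ∈-concatMap⁺ _ (∈-words m w hs) (∈-map⁺ (_∷ w) (∈-applyUpTo⁺ suc l))

words-length : ∀ m k {w} → w ∈ words m k → length w ≡ k
words-length m zero    (here refl) = refl
words-length m (suc k) i with ∈-concatMap⁻ _ (words m k) i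
... | w , w∈ , h with ∈-map⁻ (_∷ w) h
...   | x , _ , refl = cong suc (words-length m k w∈)

Unique-applyUpTo : ∀ m (f : ℕ → ℕ) → (∀ a b → a < b → f a < f b) → Unique (applyUpTo f m)
Unique-applyUpTo m f mono = Inc⇒Unique (go m f mono)
  where
  low : ∀ m (f : ℕ → ℕ) s → (∀ i → s < f i) → All (s <_) (applyUpTo f m)
  low zero    f s h = []
  low (suc m) f s h = h 0 ∷ low m (f ∘ suc) s (h ∘ suc)
  go : ∀ m (f : ℕ → ℕ) → (∀ a b → a < b → f a < f b) → Inc (applyUpTo f m)
  go zero    f h = []
  go (suc m) f h = low m (f ∘ suc) (f 0) (λ i → h 0 (suc i) z<s) ∷ go m (f ∘ suc) (λ a b k → h (suc a) (suc b) (s<s k))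

Unique-words : ∀ m k → Unique (words m k)
Unique-words m zero    = [] ∷ []
Unique-words m (suc k) = Unique-concatMap _ (drop 1) (words m k) (Unique-words m k)
  (λ {w} _ → Unique-map-on (_∷ w) (applyUpTo suc m) (λ _ _ e → ∷-injectiveˡ e) (Unique-applyUpTo m suc (λ _ _ → s<s)))
  (λ { {w} _ i → let x , _ , e = ∈-map⁻ (_∷ w) i in cong (drop 1) e })

concat-chop : ∀ mu w → length w ≡ sum mu → concat (chop mu w) ≡ w
concat-chop []       []      _ = refl
concat-chop (k ∷ mu) w       e = trans (cong (take k w ++_) (concat-chop mu (drop k w) (trans (length-drop k w) (trans (cong (_∸ k) e) (m+n∸m≡n k (sum mu)))))) (take++drop≡id k w)

chop-concat : ∀ Q → chop (map length Q) (concat Q) ≡ Q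
chop-concat []      = refl
chop-concat (q ∷ Q) = cong₂ _∷_ (take-++-length q (concat Q)) (trans (cong (chop (map length Q)) (drop-++-length q (concat Q))) (chop-concat Q))
  where
  take-++-length : ∀ (q w : List ℕ) → take (length q) (q ++ w) ≡ q
  take-++-length []      w = refl
  take-++-length (x ∷ q) w = cong (x ∷_) (take-++-length q w)
  drop-++-length : ∀ (q w : List ℕ) → drop (length q) (q ++ w) ≡ w
  drop-++-length []      w = refl
  drop-++-length (x ∷ q) w = drop-++-length q w

Unique-ssyts : ∀ mu ν → Unique (ssyts mu ν)
Unique-ssyts mu ν = Unique-filterᵇ _ (Unique-map-on (chop mu) _
  (λ {x} {y} i j e → trans (sym (concat-chop mu x (words-length (length ν) (sum mu) i))) (trans (cong concat e) (concat-chop mu y (words-length (length ν) (sum mu) j))))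
  (Unique-words (length ν) (sum mu)))

length-concat : ∀ (Q : Tableau) → length (concat Q) ≡ sum (map length Q)
length-concat []      = refl
length-concat (q ∷ Q) = trans (length-++ q) (cong (length q +_) (length-concat Q))

∈-ssyts : ∀ Q ν → All (λ q → weakIncr q ≡ true) Q → columnsStrict Q ≡ true → Entries (length ν) Q →
          (∀ t → t < length ν → count (λ x → x ≡ᵇ suc t) (concat Q) ≡ nth 0 ν t) → Q ∈ ssyts (map length Q) ν
∈-ssyts Q ν weak strict entries content = ∈-filterᵇ⁺ _
  (subst (_∈ map (chop (map length Q)) (words (length ν) (sum (map length Q)))) (chop-concat Q)
    (∈-map⁺ (chop (map length Q)) (subst (λ k → concat Q ∈ words (length ν) k) (length-concat Q) (∈-words (length ν) (concat Q) (All.concat⁺ entries)))))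
  (cong₂ _∧_ (all-true weakIncr Q weak) (cong₂ _∧_ strict (all-true _ (upTo (length ν)) (go (length ν) id (λ t l → l)))))
  where
  go : ∀ m (f : ℕ → ℕ) → (∀ t → t < m → f t < length ν) → All (λ i → (count (λ x → x ≡ᵇ suc i) (concat Q) ≡ᵇ nth 0 ν i) ≡ true) (applyUpTo f m)
  go zero    f h = []
  go (suc m) f h = trans (cong (_≡ᵇ nth 0 ν (f 0)) (content (f 0) (h 0 z<s))) (≡ᵇ-refl (nth 0 ν (f 0))) ∷ go m (f ∘ suc) (λ t l → h (suc t) (s<s l))

-- The charge of the recording tableau is the major index

applyUpTo-nth : ∀ (s : List ℕ) → applyUpTo (nth 0 s) (length s) ≡ s
applyUpTo-nth []      = refl
applyUpTo-nth (x ∷ s) = cong (x ∷_) (applyUpTo-nth s)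

Desc : List ℕ → Set
Desc = AllPairs (λ a b → b ≤ a)

Desc⇒Decr : ∀ {n} (M : Config n) → Desc (sizes M) → Decr M
Desc⇒Decr M = APP.map⁻

Decr⇒Desc : ∀ {n} (M : Config n) → Decr M → Desc (sizes M)
Decr⇒Desc M = APP.map⁺

HW⇒Decr : ∀ {n} (N : Config n) → HW N → Decr N
HW⇒Decr []      _ = []
HW⇒Decr (r ∷ N) h = All.map (λ {t} k → ≼-cnt t r k) (HW-below r N h) ∷ HW⇒Decr N (HW-tail h)

count-↭ : ∀ {A : Set} (p : A → Bool) {xs ys} → xs ↭ ys → count p xs ≡ count p ys
count-↭ p h = Perm.↭-length (Perm.filter-↭ _ h)

lengths-rhoQ : ∀ {n} r (M : Config n) → map length (rhoQ (r ∷ M)) ≡ sizes (rhoM (r ∷ M))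
lengths-rhoQ r M = go (rhoQ (r ∷ M)) _ T.rows
    (trans (trans (length-sizes (rhoOps 1 (length M)) (r ∷ M)) (length-map cnt (r ∷ M))) (sym T.len))
  where
  module T = Tab (rhoQ-Tab (r ∷ M) z<s)
  go : ∀ Q s → RowsLen Q s → length s ≡ length Q → map length Q ≡ s
  go []      []      _       _ = refl
  go (q ∷ Q) (o ∷ s) (h , k) e = cong₂ _∷_ h (go Q s k (suc-injective e))

Desc-rhoQ : ∀ {n} r (M : Config n) → Desc (map length (rhoQ (r ∷ M)))
Desc-rhoQ r M = subst Desc (sym (lengths-rhoQ r M)) (Decr⇒Desc _ (HW⇒Decr (rhoM (r ∷ M)) (rhoM-hw (r ∷ M))))

Desc⇒Shape : ∀ Q → Desc (map length Q) → Shape Q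
Desc⇒Shape []           _             = tt
Desc⇒Shape (q ∷ [])     _             = tt
Desc⇒Shape (q ∷ q′ ∷ Q) ((h ∷ _) ∷ d) = h , Desc⇒Shape (q′ ∷ Q) d

concat-trimQ : ∀ Q → concat (trimQ Q) ≡ concat Q
concat-trimQ []            = refl
concat-trimQ ([] ∷ Q)      = concat-trimQ Q
concat-trimQ ((x ∷ q) ∷ Q) = cong ((x ∷ q) ++_) (concat-trimQ Q)

charge-trimQ : ∀ Q → charge (trimQ Q) ≡ charge Q
charge-trimQ Q = cong chargeWord (trans (cong concat (reverse-trimQ Q)) (concat-trimQ (reverse Q)))
  where
  trimQ-∷ʳ : ∀ (q : List ℕ) Q → trimQ (Q ∷ʳ q) ≡ trimQ Q ++ trimQ (q ∷ [])
  trimQ-∷ʳ q Q = filter-++ _ Q (q ∷ [])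
  reverse-trimQ : ∀ Q → reverse (trimQ Q) ≡ trimQ (reverse Q)
  reverse-trimQ []            = refl
  reverse-trimQ ([] ∷ Q)      = trans (reverse-trimQ Q) (sym (trans (cong trimQ (unfold-reverse [] Q)) (trans (trimQ-∷ʳ [] (reverse Q)) (++-identityʳ _))))
  reverse-trimQ ((x ∷ q) ∷ Q) = trans (unfold-reverse (x ∷ q) (trimQ Q)) (trans (cong (_∷ʳ (x ∷ q)) (reverse-trimQ Q))
    (sym (trans (cong trimQ (unfold-reverse (x ∷ q) Q)) (trimQ-∷ʳ (x ∷ q) (reverse Q)))))

All-concat-reverse : ∀ {P : ℕ → Set} Q → All (All P) Q → All P (concat (reverse Q))
All-concat-reverse Q h = All.concat⁺ (Perm.All-resp-↭ (↭-sym (Perm.↭-reverse Q)) h)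

-- maj depends only on the recording tableau, so it may be computed on the
-- reading word of that tableau.
charge-rhoQ : ∀ {n} (M : Config n) → Decr M → charge (rhoQ M) ≡ majM M
charge-rhoQ []      _ = refl
charge-rhoQ (r ∷ M) d = go (rhoQ (r ∷ M)) refl
  where
  module T = Tab (rhoQ-Tab (r ∷ M) z<s)
  go : ∀ Q → rhoQ (r ∷ M) ≡ Q → charge Q ≡ majM (r ∷ M)
  go []       e = ⊥-elim (1+n≢0 (trans (sym T.len) (cong length e)))
  go (q₀ ∷ Q₀) e = begin
    chargeWord (concat (reverse (q₀ ∷ Q₀))) ≡⟨ cong chargeWord (cells-word 0 (q₀ ∷ Q₀)) ⟨
    chargeWord (map proj₂ W.l)              ≡⟨ WordCharge.charge≡majM W.l (length Q₀) bound (Desc⇒Decr W.Mw (subst Desc sizes≡ (Decr⇒Desc (r ∷ M) d))) ⟩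
    majM W.Mw                               ≡⟨ majM-sameQ (r ∷ M) W.Mw sizes≡ (trans e (sym W.rhoQ-Mw)) ⟨
    majM (r ∷ M)                            ∎
    where
    open ≡-Reasoning
    lenQ : suc (length Q₀) ≡ suc (length M)
    lenQ = trans (cong length (sym e)) T.len
    module W = WordConfig q₀ Q₀ (subst (All _) e T.weak) (trans (cong columnsStrict (sym e)) T.strict)
                 (subst Shape e (Desc⇒Shape _ (Desc-rhoQ r M))) (subst (λ m → Entries m (q₀ ∷ Q₀)) (sym lenQ) (subst (Entries _) e T.entries))
    bound : All (λ c → proj₂ c ≤ suc (length Q₀)) W.l
    bound = All.map⁻ (subst (All (_≤ suc (length Q₀))) (sym (cells-word 0 (q₀ ∷ Q₀)))
      (All-concat-reverse (q₀ ∷ Q₀) (All.map (All.map (λ {x} h → subst (x ≤_) (sym lenQ) (proj₂ h))) (subst (Entries _) e T.entries))))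
    sizes≡ : sizes (r ∷ M) ≡ sizes W.Mw
    sizes≡ = begin
      sizes (r ∷ M)                                                ≡⟨ applyUpTo-nth (sizes (r ∷ M)) ⟨
      applyUpTo (nth 0 (sizes (r ∷ M))) (length (sizes (r ∷ M)))   ≡⟨ cong (applyUpTo (nth 0 (sizes (r ∷ M)))) (length-map cnt (r ∷ M)) ⟩
      applyUpTo (nth 0 (sizes (r ∷ M))) (suc (length M))           ≡⟨ applyUpTo-cong< (suc (length M)) row≡ ⟩
      applyUpTo (λ j → cnt (vecOf (λ c → proj₂ c ≡ᵇ suc j) W.l)) (suc (length M))
        ≡⟨ cong (applyUpTo (λ j → cnt (vecOf (λ c → proj₂ c ≡ᵇ suc j) W.l))) lenQ ⟨
      applyUpTo (λ j → cnt (vecOf (λ c → proj₂ c ≡ᵇ suc j) W.l)) (suc (length Q₀))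
        ≡⟨ map-applyUpTo (λ j → vecOf (λ c → proj₂ c ≡ᵇ suc j) W.l) cnt (suc (length Q₀)) ⟨
      sizes W.Mw                                                   ∎
      where
      row≡ : ∀ j → j < suc (length M) → nth 0 (sizes (r ∷ M)) j ≡ cnt (vecOf (λ c → proj₂ c ≡ᵇ suc j) W.l)
      row≡ j l = begin
        nth 0 (sizes (r ∷ M)) j                                  ≡⟨ T.content j l ⟨
        count (_≡ᵇ suc j) (concat (rhoQ (r ∷ M)))                ≡⟨ cong (count (_≡ᵇ suc j) ∘ concat) e ⟩
        count (_≡ᵇ suc j) (concat (q₀ ∷ Q₀))                     ≡⟨ count-concat-reverse (q₀ ∷ Q₀) ⟨
        count (_≡ᵇ suc j) (concat (reverse (q₀ ∷ Q₀)))           ≡⟨ cong (count (_≡ᵇ suc j)) (cells-word 0 (q₀ ∷ Q₀)) ⟨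
        count (_≡ᵇ suc j) (map proj₂ W.l)                        ≡⟨ count-map W.l ⟩
        count (λ c → proj₂ c ≡ᵇ suc j) W.l                       ≡⟨ cnt-vecOf _ W.l ⟨
        cnt (vecOf (λ c → proj₂ c ≡ᵇ suc j) W.l)                 ∎
        where
        count-map : ∀ (l : List Cell) → count (_≡ᵇ suc j) (map proj₂ l) ≡ count (λ c → proj₂ c ≡ᵇ suc j) l
        count-map []      = refl
        count-map (c ∷ l) with proj₂ c ≡ᵇ suc j
        ... | true  = cong suc (count-map l)
        ... | false = count-map l
        count-concat-reverse : ∀ Q → count (_≡ᵇ suc j) (concat (reverse Q)) ≡ count (_≡ᵇ suc j) (concat Q)
        count-concat-reverse Q = count-↭ (_≡ᵇ suc j) (concat-↭ (Perm.↭-reverse Q))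
          where
          concat-↭ : ∀ {Q Q′ : Tableau} → Q ↭ Q′ → concat Q ↭ concat Q′
          concat-↭ _↭_.refl       = ↭-refl
          concat-↭ (prep q h)     = Perm.++⁺ˡ q (concat-↭ h)
          concat-↭ (swap q q′ h)  = ↭-trans (↭-reflexive (sym (++-assoc q q′ _))) (↭-trans (Perm.++⁺ (Perm.++-comm q q′) (concat-↭ h)) (↭-reflexive (++-assoc q′ q _)))
          concat-↭ (_↭_.trans a b) = ↭-trans (concat-↭ a) (concat-↭ b)

-- Empty rows

unpad : ∀ {A : Set} (p : A → Bool) z xs → (∀ a → p a ≡ false → a ≡ z) → AllPairs (λ a b → p a ≡ false → p b ≡ false) xs →
        xs ≡ filterᵇ p xs ++ replicate (length xs ∸ length (filterᵇ p xs)) z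
unpad p z []       h []       = refl
unpad p z (x ∷ xs) h (k ∷ ks) with p x in e
... | true  = cong (x ∷_) (unpad p z xs h ks)
... | false = trans (all-z (x ∷ xs) (e ∷ All.map (λ f → f refl) k)) (sym rest)
  where
  none : filterᵇ p xs ≡ []
  none = filterᵇ-none p xs (All.map (λ f → f refl) k)
  all-z : ∀ xs → All (λ b → p b ≡ false) xs → xs ≡ replicate (length xs) z
  all-z []       []       = refl
  all-z (y ∷ ys) (f ∷ fs) = cong₂ _∷_ (h y f) (all-z ys fs)
  rest : filterᵇ p xs ++ replicate (suc (length xs) ∸ length (filterᵇ p xs)) z ≡ replicate (suc (length xs)) z
  rest rewrite none = refl

zeroRow : ∀ {n} → Row n
zeroRow = Vec.replicate _ false

nonempty? : ∀ {n} → Row n → Bool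
nonempty? B = not (∣ B ∣ ≡ᵇ 0)

pad : ∀ {n} → ℕ → Config n → Config n
pad k N = N ++ replicate k zeroRow

trimN-∷ʳ-zero : ∀ {n} (N : Config n) r → ∣ r ∣ ≡ 0 → trimN (N ∷ʳ r) ≡ trimN N
trimN-∷ʳ-zero N r e rewrite reverse-++ N (r ∷ []) | e = refl

trimN-∷ʳ-pos : ∀ {n} (N : Config n) r → nonempty? r ≡ true → trimN (N ∷ʳ r) ≡ N ∷ʳ r
trimN-∷ʳ-pos N r e rewrite reverse-++ N (r ∷ []) with ∣ r ∣ ≡ᵇ 0 | e
... | false | refl = trans (unfold-reverse r (reverse N)) (cong (_∷ʳ r) (reverse-involutive N))

∣zeroRow∣ : ∀ n → ∣ zeroRow {n} ∣ ≡ 0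
∣zeroRow∣ n = trans (∣∣≡cnt (zeroRow {n})) (cnt-zeros n)

replicate-∷ʳ : ∀ {A : Set} k (z : A) → replicate (suc k) z ≡ replicate k z ∷ʳ z
replicate-∷ʳ zero    z = refl
replicate-∷ʳ (suc k) z = cong (z ∷_) (replicate-∷ʳ k z)

trimN-full : ∀ {n} (N : Config n) → All (λ r → nonempty? r ≡ true) N → trimN N ≡ N
trimN-full N h with initLast N
trimN-full .[]       h | []      = refl
trimN-full .(N ∷ʳ r) h | N ∷ʳ′ r with All.++⁻ʳ N h
... | e ∷ [] = trimN-∷ʳ-pos N r e

trimN-pad : ∀ {n} k (N : Config n) → All (λ r → nonempty? r ≡ true) N → trimN (pad k N) ≡ N
trimN-pad zero    N h = trans (cong trimN (++-identityʳ N)) (trimN-full N h)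
trimN-pad {n} (suc k) N h = trans (cong trimN (trans (cong (N ++_) (replicate-∷ʳ k zeroRow)) (sym (++-assoc N (replicate k zeroRow) (zeroRow ∷ [])))))
  (trans (trimN-∷ʳ-zero (pad k N) zeroRow (∣zeroRow∣ n)) (trimN-pad k N h))

All-filterᵇ : ∀ {A : Set} (p : A → Bool) xs → All (λ x → p x ≡ true) (filterᵇ p xs)
All-filterᵇ p []       = []
All-filterᵇ p (x ∷ xs) with p x in e
... | true  = e ∷ All-filterᵇ p xs
... | false = All-filterᵇ p xs

cnt≡0⇒zeroRow : ∀ {n} (r : Row n) → cnt r ≡ 0 → r ≡ zeroRow
cnt≡0⇒zeroRow []          _ = refl
cnt≡0⇒zeroRow (false ∷ r) e = cong (false ∷_) (cnt≡0⇒zeroRow r e)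

not-false⁻ : ∀ {b} → not b ≡ false → b ≡ true
not-false⁻ {true} _ = refl

empty⇒cnt : ∀ {n} (r : Row n) → nonempty? r ≡ false → cnt r ≡ 0
empty⇒cnt r e = trans (sym (∣∣≡cnt r)) (≡ᵇ-true⁻ (not-false⁻ e))

cnt⇒empty : ∀ {n} (r : Row n) → cnt r ≡ 0 → nonempty? r ≡ false
cnt⇒empty r e = cong (λ m → not (m ≡ᵇ 0)) (trans (∣∣≡cnt r) e)

cnt⇒nonempty : ∀ {n} (r : Row n) → 0 < cnt r → nonempty? r ≡ true
cnt⇒nonempty r l with ∣ r ∣ | ∣∣≡cnt r
... | zero  | e = ⊥-elim (<⇒≢ l e)
... | suc _ | _ = refl

nonempty⇒cnt : ∀ {n} (r : Row n) → nonempty? r ≡ true → 0 < cnt r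
nonempty⇒cnt r e with cnt r in c
... | suc _ = z<s
... | zero  = contradiction (trans (sym e) (cnt⇒empty r c)) λ ()

-- Row sizes decrease, so the empty rows of a collapse are all at the top, and their number `k` is
-- enough to restore it from the trimmed one.
record Trimmed {n} (N : Config n) : Set where
  field
    k      : ℕ
    N≡     : N ≡ pad k (trimN N)
    filled : All (λ r → 0 < cnt r) (trimN N)
    sizes≡ : sizes (trimN N) ≡ strip (sizes N)
    len    : length (trimN N) + k ≡ length N

trimmed : ∀ {n} (N : Config n) → Decr N → Trimmed N
trimmed N d = record
  { k      = length N ∸ length (filterᵇ nonempty? N)
  ; N≡     = trans un (cong (pad _) (sym trim≡))
  ; filled = subst (All _) (sym trim≡) (All.map (λ {r} → nonempty⇒cnt r) (All-filterᵇ nonempty? N))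
  ; sizes≡ = trans (cong sizes trim≡) (strip≡ N)
  ; len    = trans (cong (λ x → length x + (length N ∸ length (filterᵇ nonempty? N))) trim≡) (m+[n∸m]≡n (length-filter _ N)) }
  where
  un : N ≡ pad (length N ∸ length (filterᵇ nonempty? N)) (filterᵇ nonempty? N)
  un = unpad nonempty? zeroRow N (λ r e → cnt≡0⇒zeroRow r (empty⇒cnt r e))
    (AllPairs.map (λ {a} {b} l e → cnt⇒empty b (n≤0⇒n≡0 (subst (cnt b ≤_) (empty⇒cnt a e) l))) d)
  trim≡ : trimN N ≡ filterᵇ nonempty? N
  trim≡ = trans (cong trimN un) (trimN-pad _ _ (All-filterᵇ nonempty? N))
  strip≡ : ∀ N → sizes (filterᵇ nonempty? N) ≡ strip (sizes N)
  strip≡ []      = refl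
  strip≡ (r ∷ N) rewrite ∣∣≡cnt r with cnt r in e
  ... | zero  = strip≡ N
  ... | suc _ = cong₂ _∷_ e (strip≡ N)

serve-sub : ∀ {n} (z f : Row n) → f ⊑ z → serve 0 z f ≡ f
serve-sub []          []          _       = refl
serve-sub (true ∷ z)  (true ∷ f)  (_ , i) = cong (true ∷_) (serve-sub z f i)
serve-sub (true ∷ z)  (false ∷ f) (_ , i) = cong (false ∷_) (serve-sub z f i)
serve-sub (false ∷ z) (true ∷ f)  (h , i) with () ← h refl
serve-sub (false ∷ z) (false ∷ f) (_ , i) = cong (false ∷_) (serve-sub z f i)

HW-cons : ∀ {n} (r : Row n) N → All (_≼ r) N → HW N → HW (r ∷ N)
HW-cons r []      _       h         = HW-one r
HW-cons r (t ∷ N) (k ∷ _) h zero    = ≼⇒uy≡0 r t k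
HW-cons r (t ∷ N) (k ∷ _) h (suc j) = h j

Nested⇒HW : ∀ {n} (N : Config n) → Nested N → HW N
Nested⇒HW []      []       = vy-[]
Nested⇒HW (r ∷ N) (h ∷ hs) = HW-cons r N (All.map (λ {t} → ⊑⇒≼ t r) h) (Nested⇒HW N hs)

layN-Nested : ∀ {n} (N : Config n) → Nested N → layN N ≡ N
layN-Nested []      []       = refl
layN-Nested (r ∷ N) (h ∷ hs) = cong (r ∷_) (trans (cong (map (serve 0 r)) (layN-Nested N hs))
  (trans (map-cong-local (All.map (λ {f} → serve-sub r f) h)) (map-id N)))

Nested-zeros : ∀ {n} k → Nested (replicate k (zeroRow {n}))
Nested-zeros zero    = []
Nested-zeros (suc k) = All.replicate⁺ k (zeros-⊑ zeroRow) ∷ Nested-zeros k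

HW-pad : ∀ {n} k (N : Config n) → HW N → HW (pad k N)
HW-pad k []      _ = Nested⇒HW (replicate k zeroRow) (Nested-zeros k)
HW-pad k (r ∷ N) h = HW-cons r (pad k N) (All.++⁺ (HW-below r N h) (All.replicate⁺ k (⊑⇒≼ zeroRow r (zeros-⊑ r)))) (HW-pad k N (HW-tail h))

HW-unpad : ∀ {n} k (N : Config n) → HW (pad k N) → HW N
HW-unpad k []      _ = vy-[]
HW-unpad k (r ∷ N) h = HW-cons r N (All.++⁻ˡ N (HW-below r (pad k N) h)) (HW-unpad k N (HW-tail h))

layN-pad : ∀ {n} k (N : Config n) → layN (pad k N) ≡ pad k (layN N)
layN-pad k []      = layN-Nested (replicate k zeroRow) (Nested-zeros k)
layN-pad k (r ∷ N) = cong (r ∷_) (begin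
  map (serve 0 r) (layN (pad k N))                       ≡⟨ cong (map (serve 0 r)) (layN-pad k N) ⟩
  map (serve 0 r) (pad k (layN N))                       ≡⟨ map-++ (serve 0 r) (layN N) (replicate k zeroRow) ⟩
  map (serve 0 r) (layN N) ++ map (serve 0 r) (replicate k zeroRow) ≡⟨ cong (map (serve 0 r) (layN N) ++_) (trans (map-replicate (serve 0 r) k zeroRow) (cong (replicate k) (serve-zeros r))) ⟩
  pad k (map (serve 0 r) (layN N))                       ∎)
  where open ≡-Reasoning

cs-pad : ∀ {n} k (N : Config n) → cs (pad k N) ≡ cs N
cs-pad zero    []      = refl
cs-pad (suc k) []      = trans (cong (Vec.zipWith _ zeroRow) (cs-pad k [])) (add-zeros _)
  where
  add-zeros : ∀ {n} (v : Vec ℕ n) → Vec.zipWith (λ p k → bit p + k) zeroRow v ≡ v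
  add-zeros []      = refl
  add-zeros (x ∷ v) = cong (x ∷_) (add-zeros v)
cs-pad k       (r ∷ N) = cong (Vec.zipWith _ r) (cs-pad k N)

strM≡layN : ∀ {n} (N : Config n) → HW N → strM N ≡ strip (toList (cs (layN N)))
strM≡layN N h = cong (strip ∘ toList ∘ cs) (layM≡layN N h)

strM-pad : ∀ {n} k (N : Config n) → HW N → strM (pad k N) ≡ strM N
strM-pad k N h = trans (strM≡layN (pad k N) (HW-pad k N h))
  (trans (cong (strip ∘ toList) (trans (cong cs (layN-pad k N)) (cs-pad k (layN N)))) (sym (strM≡layN N h)))

sizes-pad : ∀ {n} k (N : Config n) → sizes (pad k N) ≡ sizes N ++ replicate k 0
sizes-pad {n} k N = trans (map-++ cnt N (replicate k zeroRow)) (cong (sizes N ++_) (trans (map-replicate cnt k zeroRow) (cong (replicate k) (cnt-zeros n))))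

count-strip : ∀ k xs → count (suc k ≤ᵇ_) (strip xs) ≡ count (suc k ≤ᵇ_) xs
count-strip k []           = refl
count-strip k (zero ∷ xs)  = count-strip k xs
count-strip k (suc x ∷ xs) with suc k ≤ᵇ suc x
... | true  = cong suc (count-strip k xs)
... | false = count-strip k xs

cnt-map : ∀ {n} (p : ℕ → Bool) (v : Vec ℕ n) → cnt (Vec.map p v) ≡ count p (toList v)
cnt-map p []      = refl
cnt-map p (x ∷ v) with p x
... | true  = cong suc (cnt-map p v)
... | false = cnt-map p v

count-cs : ∀ {n} (fs : List (Row n)) → Nested fs → ∀ k → count (suc k ≤ᵇ_) (toList (cs fs)) ≡ nth 0 (sizes fs) k
count-cs {n} [] [] k = count-none _ _ (zeros n)
  where
  zeros : ∀ n → All (λ x → (suc k ≤ᵇ x) ≡ false) (toList (Vec.replicate n 0))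
  zeros zero    = []
  zeros (suc n) = refl ∷ zeros n
count-cs (f ∷ fs) (h ∷ hs) zero    = trans (sym (cnt-map (1 ≤ᵇ_) (cs (f ∷ fs)))) (cong cnt (level₀ f (cs fs) (ZeroOff-cs f fs h)))
count-cs (f ∷ fs) (h ∷ hs) (suc k) = trans (count-pred (cs (f ∷ fs))) (trans (cong (count (suc k ≤ᵇ_) ∘ toList) (level-pred f (cs fs) (ZeroOff-cs f fs h))) (count-cs fs hs k))
  where
  count-pred : ∀ {n} (v : Vec ℕ n) → count (suc (suc k) ≤ᵇ_) (toList v) ≡ count (suc k ≤ᵇ_) (toList (Vec.map pred v))
  count-pred []          = refl
  count-pred (zero ∷ v)  = count-pred v
  count-pred (suc x ∷ v) with suc k ≤ᵇ x
  ... | true  = cong suc (count-pred v)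
  ... | false = count-pred v

sizes-layN : ∀ {n} (N : Config n) → HW N → sizes (layN N) ≡ sizes N
sizes-layN []      _ = refl
sizes-layN (r ∷ N) h = cong (cnt r ∷_) (trans (go (layN N) (layN-≼ r N h)) (sizes-layN N (HW-tail h)))
  where
  go : ∀ fs → All (_≼ r) fs → sizes (map (serve 0 r) fs) ≡ sizes fs
  go []       []       = refl
  go (f ∷ fs) (k ∷ ks) = cong₂ _∷_ (cnt-serve 0 r f (≼⇒uy≡0 r f k , z≤n)) (go fs ks)

-- In a nonwrapping configuration every ball of row `k` is paired all the way down, so as many
-- bottom labels exceed `k` as that row has balls. The row sizes are therefore conjugate to the
-- strong type.
count-strM : ∀ {n} (N : Config n) → HW N → ∀ k → count (suc k ≤ᵇ_) (strM N) ≡ nth 0 (sizes N) k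
count-strM N h k = begin
  count (suc k ≤ᵇ_) (strM N)                         ≡⟨ cong (count (suc k ≤ᵇ_)) (strM≡layN N h) ⟩
  count (suc k ≤ᵇ_) (strip (toList (cs (layN N))))   ≡⟨ count-strip k (toList (cs (layN N))) ⟩
  count (suc k ≤ᵇ_) (toList (cs (layN N)))           ≡⟨ count-cs (layN N) (layN-nested N) k ⟩
  nth 0 (sizes (layN N)) k                           ≡⟨ cong (λ s → nth 0 s k) (sizes-layN N h) ⟩
  nth 0 (sizes N) k                                  ∎
  where open ≡-Reasoning

strip-pos : ∀ xs → All (0 <_) (strip xs)
strip-pos xs = All.map (λ { {suc _} _ → z<s ; {zero} () }) (All-filterᵇ _ xs)

strip-id : ∀ xs → All (0 <_) xs → strip xs ≡ xs
strip-id xs h = filterᵇ-all _ xs (All.map (λ { {suc _} _ → refl }) h)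

strM-length : ∀ {n} (N : Config n) → length (strM N) ≤ n
strM-length N = ≤-trans (length-filter _ (toList (cs (layM N)))) (≤-reflexive (Vec.length-toList (cs (layM N))))

-- Partitions and conjugates

insertDesc-↭ : ∀ x ys → insertDesc x ys ↭ x ∷ ys
insertDesc-↭ x []       = ↭-refl
insertDesc-↭ x (y ∷ ys) with y <ᵇ x
... | true  = ↭-refl
... | false = ↭-trans (prep y (insertDesc-↭ x ys)) (swap y x ↭-refl)

sort-↭ : ∀ xs → foldr insertDesc [] xs ↭ xs
sort-↭ []       = ↭-refl
sort-↭ (x ∷ xs) = ↭-trans (insertDesc-↭ x (foldr insertDesc [] xs)) (prep x (sort-↭ xs))

sortP-↭ : ∀ xs → All (0 <_) xs → sortP xs ↭ xs
sortP-↭ xs h = ↭-trans (sort-↭ (strip xs)) (↭-reflexive (strip-id xs h))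

insertDesc-Desc : ∀ x ys → Desc ys → Desc (insertDesc x ys)
insertDesc-Desc x []       _        = [] ∷ []
insertDesc-Desc x (y ∷ ys) (h ∷ hs) with y <ᵇ x in e
... | true  = (<⇒≤ y<x ∷ All.map (λ l → ≤-trans l (<⇒≤ y<x)) h) ∷ h ∷ hs
  where
  y<x : y < x
  y<x = <ᵇ⇒< y x (subst T (sym e) tt)
... | false = Perm.All-resp-↭ (↭-sym (insertDesc-↭ x ys)) (x≤y ∷ h) ∷ insertDesc-Desc x ys hs
  where
  x≤y : x ≤ y
  x≤y = ≮⇒≥ (λ l → subst T e (<⇒<ᵇ l))

sortP-Desc : ∀ xs → Desc (sortP xs)
sortP-Desc xs = go (strip xs)
  where
  go : ∀ xs → Desc (foldr insertDesc [] xs)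
  go []       = []
  go (x ∷ xs) = insertDesc-Desc x _ (go xs)

≤maxL : ∀ xs → All (_≤ maxL xs) xs
≤maxL []       = []
≤maxL (x ∷ xs) = m≤m⊔n x (maxL xs) ∷ All.map (λ l → ≤-trans l (m≤n⊔m x (maxL xs))) (≤maxL xs)

maxL-least : ∀ xs {m} → All (_≤ m) xs → maxL xs ≤ m
maxL-least []       []       = z≤n
maxL-least (x ∷ xs) (h ∷ hs) = ⊔-lub h (maxL-least xs hs)

count≡0⇒All : ∀ k xs → count (suc k ≤ᵇ_) xs ≡ 0 → All (_≤ k) xs
count≡0⇒All k []       _ = []
count≡0⇒All k (x ∷ xs) e with suc k ≤ᵇ x in l
... | false = ≮⇒≥ (λ k<x → contradiction (trans (sym l) (≤ᵇ-true k<x)) λ ()) ∷ count≡0⇒All k xs e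

All⇒count≡0 : ∀ k xs → All (_≤ k) xs → count (suc k ≤ᵇ_) xs ≡ 0
All⇒count≡0 k xs h = count-none _ xs (All.map (λ l → ≤ᵇ-false (s≤s l)) h)

nth-applyUpTo : ∀ (f : ℕ → ℕ) m k → (∀ j → m ≤ j → f j ≡ 0) → nth 0 (applyUpTo f m) k ≡ f k
nth-applyUpTo f zero    k       h = sym (h k z≤n)
nth-applyUpTo f (suc m) zero    h = refl
nth-applyUpTo f (suc m) (suc k) h = nth-applyUpTo (f ∘ suc) m k (λ j l → h (suc j) (s≤s l))

nth-conj : ∀ la k → nth 0 (conj la) k ≡ count (suc k ≤ᵇ_) la
nth-conj la k = nth-applyUpTo _ (maxL la) k (λ j l → All⇒count≡0 j la (All.map (λ h → ≤-trans h l) (≤maxL la)))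

nth-ext : ∀ s s′ → All (0 <_) s → All (0 <_) s′ → (∀ k → nth 0 s k ≡ nth 0 s′ k) → s ≡ s′
nth-ext []      []        _       _        _ = refl
nth-ext []      (x ∷ s′)  _       (h ∷ _)  e = contradiction (e 0) (<⇒≢ h)
nth-ext (x ∷ s) []        (h ∷ _) _        e = contradiction (sym (e 0)) (<⇒≢ h)
nth-ext (x ∷ s) (x′ ∷ s′) (_ ∷ h) (_ ∷ h′) e = cong₂ _∷_ (e 0) (nth-ext s s′ h h′ (e ∘ suc))

conj-pos : ∀ la → All (0 <_) (conj la)
conj-pos la = All.applyUpTo⁺₁ _ (maxL la) (λ {r} l → n≢0⇒n>0 (λ e → <⇒≱ l (maxL-least la (count≡0⇒All r la e))))

count-mono : ∀ {i j} la → i ≤ j → count (suc j ≤ᵇ_) la ≤ count (suc i ≤ᵇ_) la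
count-mono         []       _ = z≤n
count-mono {i} {j} (x ∷ la) l with suc j ≤ᵇ x in e
... | true with suc i ≤ᵇ x in e′
...   | true  = s≤s (count-mono la l)
...   | false = contradiction (trans (sym e′) (≤ᵇ-true (≤-trans (s≤s l) (≤ᵇ-true⁻ {suc j} {x} e)))) λ ()
count-mono {i} {j} (x ∷ la) l | false with suc i ≤ᵇ x
...   | true  = m≤n⇒m≤1+n (count-mono la l)
...   | false = count-mono la l

conj-Desc : ∀ la → Desc (conj la)
conj-Desc la = APP.applyUpTo⁺₁ _ (maxL la) (λ i<j _ → count-mono la (<⇒≤ i<j))

conj-↭ : ∀ {la mu} → la ↭ mu → conj la ≡ conj mu
conj-↭ {la} {mu} h = nth-ext _ _ (conj-pos la) (conj-pos mu) (λ k → trans (nth-conj la k) (trans (count-↭ _ h) (sym (nth-conj mu k))))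

sum-counts : ∀ K xs → All (_≤ K) xs → sum (applyUpTo (λ r → count (suc r ≤ᵇ_) xs) K) ≡ sum xs
sum-counts K []       []       = sum-applyUpTo-0 K
sum-counts K (x ∷ xs) (h ∷ hs) = begin
  sum (applyUpTo (λ r → count (suc r ≤ᵇ_) (x ∷ xs)) K)                          ≡⟨ cong sum (applyUpTo-cong (λ r → split r) K) ⟩
  sum (applyUpTo (λ r → bit (suc r ≤ᵇ x) + count (suc r ≤ᵇ_) xs) K)             ≡⟨ sum-applyUpTo-+ (λ r → bit (suc r ≤ᵇ x)) (λ r → count (suc r ≤ᵇ_) xs) K ⟩
  sum (applyUpTo (λ r → bit (suc r ≤ᵇ x)) K) + sum (applyUpTo (λ r → count (suc r ≤ᵇ_) xs) K) ≡⟨ cong₂ _+_ (ones K x h) (sum-counts K xs hs) ⟩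
  x + sum xs                                                                    ∎
  where
  open ≡-Reasoning
  split : ∀ r → count (suc r ≤ᵇ_) (x ∷ xs) ≡ bit (suc r ≤ᵇ x) + count (suc r ≤ᵇ_) xs
  split r with suc r ≤ᵇ x
  ... | true  = refl
  ... | false = refl
  ones : ∀ K x → x ≤ K → sum (applyUpTo (λ r → bit (suc r ≤ᵇ x)) K) ≡ x
  ones zero    zero    _       = refl
  ones (suc K) zero    _       = ones K zero z≤n
  ones (suc K) (suc x) (s≤s l) = cong suc (ones K x l)

sum-conj : ∀ la → sum (conj la) ≡ sum la
sum-conj la = sum-counts (maxL la) la (≤maxL la)

count-take : ∀ r k la → Desc la → count (suc r ≤ᵇ_) (take k la) ≡ k ⊓ count (suc r ≤ᵇ_) la
count-take r zero    la       _        = refl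
count-take r (suc k) []       _        = refl
count-take r (suc k) (x ∷ la) (h ∷ hs) with suc r ≤ᵇ x in e
... | true  = cong suc (count-take r k la hs)
... | false = trans (All⇒count≡0 r (take k la) (All.take⁺ k low)) (sym (trans (cong (suc k ⊓_) (All⇒count≡0 r la low)) (⊓-zeroʳ (suc k))))
  where
  low : All (_≤ r) la
  low = All.map (λ l → ≤-trans l (≮⇒≥ (λ r<x → contradiction (trans (sym e) (≤ᵇ-true r<x)) λ ()))) h

sum-take : ∀ k K la → Desc la → All (_≤ K) la → sum (take k la) ≡ sum (applyUpTo (λ r → k ⊓ count (suc r ≤ᵇ_) la) K)
sum-take k K la d h = trans (sym (sum-counts K (take k la) (All.take⁺ k h))) (cong sum (applyUpTo-cong (λ r → count-take r k la d) K))

tabulate-lvec : ∀ {A : Set} n (f : ℕ → A) g → Vec.tabulate {n = n} (λ i → f (g (toℕ i))) ≡ Vec.map f (lvec n g)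
tabulate-lvec zero    f g = refl
tabulate-lvec (suc n) f g = cong (f (g 0) ∷_) (tabulate-lvec n f (g ∘ suc))

strip-applyUpTo-nth : ∀ n τ → length τ ≤ n → strip (applyUpTo (nth 0 τ) n) ≡ strip τ
strip-applyUpTo-nth n       []            _       = filterᵇ-none _ _ (All.applyUpTo⁺₂ _ n (λ _ → refl))
strip-applyUpTo-nth (suc n) (zero ∷ τ)    (s≤s l) = strip-applyUpTo-nth n τ l
strip-applyUpTo-nth (suc n) (suc x ∷ τ)   (s≤s l) = cong (suc x ∷_) (strip-applyUpTo-nth n τ l)

level-⊑ : ∀ {n i j} → i ≤ j → (v : Vec ℕ n) → Vec.map (suc j ≤ᵇ_) v ⊑ Vec.map (suc i ≤ᵇ_) v
level-⊑         l []      = tt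
level-⊑ {i = i} {j} l (x ∷ v) = (λ e → ≤ᵇ-false (≤-trans (≤ᵇ-false⁻ {suc i} {x} e) (s≤s l))) , level-⊑ l v

module _ (n : ℕ) (τ : List ℕ) (len : length τ ≤ n) where

  Mtau≡ : Mtau n τ ≡ applyUpTo (λ r → Vec.map (suc r ≤ᵇ_) (lvec n (nth 0 τ))) (maxL τ)
  Mtau≡ = applyUpTo-cong (λ r → tabulate-lvec n (suc r ≤ᵇ_) (nth 0 τ)) (maxL τ)

  Mtau-Nested : Nested (Mtau n τ)
  Mtau-Nested = subst Nested (sym Mtau≡) (APP.applyUpTo⁺₁ _ (maxL τ) (λ i<j _ → level-⊑ (<⇒≤ i<j) (lvec n (nth 0 τ))))

  sizes-Mtau : sizes (Mtau n τ) ≡ conj τ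
  sizes-Mtau = trans (cong sizes Mtau≡) (trans (map-applyUpTo _ cnt (maxL τ)) (applyUpTo-cong row (maxL τ)))
    where
    open ≡-Reasoning
    row : ∀ r → cnt (Vec.map (suc r ≤ᵇ_) (lvec n (nth 0 τ))) ≡ count (suc r ≤ᵇ_) τ
    row r = begin
      cnt (Vec.map (suc r ≤ᵇ_) (lvec n (nth 0 τ)))       ≡⟨ cnt-map (suc r ≤ᵇ_) (lvec n (nth 0 τ)) ⟩
      count (suc r ≤ᵇ_) (toList (lvec n (nth 0 τ)))      ≡⟨ cong (count (suc r ≤ᵇ_)) (toList-lvec n (nth 0 τ)) ⟩
      count (suc r ≤ᵇ_) (applyUpTo (nth 0 τ) n)          ≡⟨ count-strip r (applyUpTo (nth 0 τ) n) ⟨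
      count (suc r ≤ᵇ_) (strip (applyUpTo (nth 0 τ) n))  ≡⟨ cong (count (suc r ≤ᵇ_)) (strip-applyUpTo-nth n τ len) ⟩
      count (suc r ≤ᵇ_) (strip τ)                        ≡⟨ count-strip r τ ⟩
      count (suc r ≤ᵇ_) τ                                ∎

  strM-Mtau : strM (Mtau n τ) ≡ strip τ
  strM-Mtau = begin
    strM (Mtau n τ)                            ≡⟨ strM≡layN (Mtau n τ) (Nested⇒HW (Mtau n τ) Mtau-Nested) ⟩
    strip (toList (cs (layN (Mtau n τ))))      ≡⟨ cong (strip ∘ toList ∘ cs) (trans (layN-Nested (Mtau n τ) Mtau-Nested) Mtau≡) ⟩
    strip (toList (cs (applyUpTo (λ r → Vec.map (suc r ≤ᵇ_) (lvec n (nth 0 τ))) (maxL τ))))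
      ≡⟨ cong (strip ∘ toList) (cs-levels n (maxL τ) (nth 0 τ) (nth≤ τ (≤maxL τ))) ⟩
    strip (toList (lvec n (nth 0 τ)))          ≡⟨ cong strip (toList-lvec n (nth 0 τ)) ⟩
    strip (applyUpTo (nth 0 τ) n)              ≡⟨ strip-applyUpTo-nth n τ len ⟩
    strip τ                                    ∎
    where
    open ≡-Reasoning
    nth≤ : ∀ {m} xs → All (_≤ m) xs → ∀ c → nth 0 xs c ≤ m
    nth≤ []       []       c       = z≤n
    nth≤ (x ∷ xs) (h ∷ hs) zero    = h
    nth≤ (x ∷ xs) (h ∷ hs) (suc c) = nth≤ xs hs c

xexp≡cs : ∀ {n} (M : MLQ n) → xexp M ≡ cs M
xexp≡cs {n} []      = zeros n
  where
  zeros : ∀ n → Vec.tabulate {n = n} (λ _ → 0) ≡ Vec.replicate n 0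
  zeros zero    = refl
  zeros (suc n) = cong (0 ∷_) (zeros n)
xexp≡cs (r ∷ M) = trans (Vec.tabulate-cong split) (trans (add r _) (cong (Vec.zipWith _ r) (xexp≡cs M)))
  where
  split : ∀ i → count (λ B → elemᵇ (toℕ i) (cols B)) (r ∷ M) ≡ bit (at (toℕ i) r) + count (λ B → elemᵇ (toℕ i) (cols B)) M
  split i rewrite sym (elemᵇ-cols (toℕ i) r) with elemᵇ (toℕ i) (cols r)
  ... | true  = refl
  ... | false = refl
  add : ∀ {n} (r : Row n) (g : Fin n → ℕ) → Vec.tabulate (λ i → bit (at (toℕ i) r) + g i) ≡ Vec.zipWith (λ p k → bit p + k) r (Vec.tabulate g)
  add []      g = refl
  add (x ∷ r) g = cong (_ ∷_) (add r (g ∘ Fin.suc))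

cs-rhoM : ∀ {n} (M : Config n) → cs (rhoM M) ≡ cs M
cs-rhoM M = Ver.col (Ver-runS (rhoOps 1 (length M ∸ 1))) M

length-rhoM : ∀ {n} (M : Config n) → length (rhoM M) ≡ length M
length-rhoM M = Ver.len (Ver-runS (rhoOps 1 (length M ∸ 1))) M

-- Dominance

pre : ∀ {n} → ℕ → Vec ℕ n → ℕ
pre zero    v       = 0
pre (suc k) []      = 0
pre (suc k) (x ∷ v) = x + pre k v

preR : ∀ {n} → ℕ → Row n → ℕ
preR k r = pre k (Vec.map bit r)

pre-cs : ∀ {n} k (M : Config n) → pre k (cs M) ≡ sum (map (preR k) M)
pre-cs {n} k []  = zeros n k
  where
  zeros : ∀ n k → pre k (Vec.replicate n 0) ≡ 0
  zeros n       zero    = refl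
  zeros zero    (suc k) = refl
  zeros (suc n) (suc k) = zeros n k
pre-cs k (r ∷ M) = trans (add k r (cs M)) (cong (preR k r +_) (pre-cs k M))
  where
  add : ∀ {n} k (r : Row n) v → pre k (Vec.zipWith (λ p k → bit p + k) r v) ≡ preR k r + pre k v
  add zero    r       v       = refl
  add (suc k) []      []      = refl
  add (suc k) (p ∷ r) (x ∷ v) = trans (cong (bit p + x +_) (add k r v)) (interchange (bit p) x (preR k r) (pre k v))

preR≤ : ∀ {n} k (r : Row n) → preR k r ≤ k ⊓ cnt r
preR≤ zero    r           = z≤n
preR≤ (suc k) []          = z≤n
preR≤ (suc k) (true ∷ r)  = s≤s (preR≤ k r)
preR≤ (suc k) (false ∷ r) = ≤-trans (preR≤ k r) (⊓-monoˡ-≤ (cnt r) (n≤1+n k))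

preR-lj : ∀ n k s → s ≤ n → k ⊓ s ≤ preR k (lj n s)
preR-lj n       zero    s       _       = z≤n
preR-lj n       (suc k) zero    _       = z≤n
preR-lj (suc n) (suc k) (suc s) (s≤s l) = s≤s (preR-lj n k s l)

cnt≤n : ∀ {n} (r : Row n) → cnt r ≤ n
cnt≤n []          = z≤n
cnt≤n (true ∷ r)  = s≤s (cnt≤n r)
cnt≤n (false ∷ r) = m≤n⇒m≤1+n (cnt≤n r)

-- Move the collapse horizontally until it is left-justified: its first k
-- columns then carry the sum on the left, and M, moved along with it, has the
-- same column sums and the row sizes of M.
sizes-dominated : ∀ {n} (M : Config n) k → sum (map (k ⊓_) (sizes (rhoM M))) ≤ sum (map (k ⊓_) (sizes M))
sizes-dominated {n} M k = begin
  sum (map (k ⊓_) (sizes (rhoM M)))                        ≤⟨ just-≤ (rhoM M) ⟩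
  sum (map (preR k) (map (lj n) (sizes (rhoM M))))         ≡⟨ cong (sum ∘ map (preR k)) (L.fwd≡) ⟨
  sum (map (preR k) (L.fwd (rhoM M)))                      ≡⟨ pre-cs k (L.fwd (rhoM M)) ⟨
  pre k (cs (L.fwd (rhoM M)))                              ≡⟨ cong (pre k ∘ cs) (rhoM-hor L.fwdHor M) ⟨
  pre k (cs (rhoM (L.fwd M)))                              ≡⟨ cong (pre k) (cs-rhoM (L.fwd M)) ⟩
  pre k (cs (L.fwd M))                                     ≡⟨ pre-cs k (L.fwd M) ⟩
  sum (map (preR k) (L.fwd M))                             ≤⟨ below (L.fwd M) ⟩
  sum (map (k ⊓_) (sizes (L.fwd M)))                       ≡⟨ cong (sum ∘ map (k ⊓_)) (Hor.sz L.fwdHor M) ⟩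
  sum (map (k ⊓_) (sizes M))                               ∎
  where
  open ≤-Reasoning
  module L = ToLJ (toLJ (rhoM M) (rhoM-hw M))
  just-≤ : ∀ N → sum (map (k ⊓_) (sizes N)) ≤ sum (map (preR k) (map (lj n) (sizes N)))
  just-≤ []      = z≤n
  just-≤ (r ∷ N) = +-mono-≤ (preR-lj n k (cnt r) (cnt≤n r)) (just-≤ N)
  below : ∀ N → sum (map (preR k) N) ≤ sum (map (k ⊓_) (sizes N))
  below []      = z≤n
  below (r ∷ N) = +-mono-≤ (preR≤ k r) (below N)

-- Partial sums in dominance order, computed from the conjugate partition by cutting its parts off
-- at `k`. In this form they can be compared with ball counts in the first `k` columns.
sum-take-sizes : ∀ k la s → Desc la → (∀ r → count (suc r ≤ᵇ_) la ≡ nth 0 s r) → sum (take k la) ≡ sum (map (k ⊓_) s)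
sum-take-sizes k la s d h = begin
  sum (take k la)                                                  ≡⟨ sum-take k (length s) la d (count≡0⇒All (length s) la (trans (h (length s)) (nth-length s))) ⟩
  sum (applyUpTo (λ r → k ⊓ count (suc r ≤ᵇ_) la) (length s))      ≡⟨ cong sum (applyUpTo-cong (λ r → cong (k ⊓_) (h r)) (length s)) ⟩
  sum (applyUpTo (λ r → k ⊓ nth 0 s r) (length s))                 ≡⟨ cong sum (map-applyUpTo (nth 0 s) (k ⊓_) (length s)) ⟨
  sum (map (k ⊓_) (applyUpTo (nth 0 s) (length s)))                ≡⟨ cong (sum ∘ map (k ⊓_)) (applyUpTo-nth s) ⟩
  sum (map (k ⊓_) s)                                               ∎
  where
  open ≡-Reasoning
  nth-length : ∀ s → nth 0 s (length s) ≡ 0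
  nth-length []      = refl
  nth-length (x ∷ s) = nth-length s

-- Shape and strong type of the collapse

module Collapse {n : ℕ} (γ : List ℕ) (M : Config n) (sz : sizes M ≡ conj (sortP γ)) where

  N = rhoM M
  τ = strM N

  N-hw : HW N
  N-hw = rhoM-hw M

  M-decr : Decr M
  M-decr = Desc⇒Decr M (subst Desc (sym sz) (conj-Desc (sortP γ)))

  open Trimmed (trimmed N (HW⇒Decr N N-hw)) public

  trim-hw : HW (trimN N)
  trim-hw = HW-unpad k (trimN N) (subst HW N≡ N-hw)

  strM-trim : strM (trimN N) ≡ τ
  strM-trim = trans (sym (strM-pad k (trimN N) trim-hw)) (cong strM (sym N≡))

  τ-pos : All (0 <_) τ
  τ-pos = strip-pos (toList (cs (layM N)))

  sizes-trim : sizes (trimN N) ≡ conj (sortP τ)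
  sizes-trim = nth-ext _ _ (All.map⁺ filled) (conj-pos (sortP τ)) (λ k → begin
    nth 0 (sizes (trimN N)) k             ≡⟨ count-strM (trimN N) trim-hw k ⟨
    count (suc k ≤ᵇ_) (strM (trimN N))    ≡⟨ cong (count (suc k ≤ᵇ_)) strM-trim ⟩
    count (suc k ≤ᵇ_) τ                   ≡⟨ count-↭ _ (sortP-↭ τ τ-pos) ⟨
    count (suc k ≤ᵇ_) (sortP τ)           ≡⟨ nth-conj (sortP τ) k ⟨
    nth 0 (conj (sortP τ)) k              ∎)
    where open ≡-Reasoning

  sum-sortP : sum (sortP τ) ≡ sum (sortP γ)
  sum-sortP = begin
    sum (sortP τ)             ≡⟨ sum-conj (sortP τ) ⟨
    sum (conj (sortP τ))      ≡⟨ cong sum sizes-trim ⟨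
    sum (sizes (trimN N))     ≡⟨ cong sum sizes≡ ⟩
    sum (strip (sizes N))     ≡⟨ sum-strip (sizes N) ⟩
    sum (sizes N)             ≡⟨ sum-runS (rhoOps 1 (length M ∸ 1)) M ⟩
    sum (sizes M)             ≡⟨ cong sum sz ⟩
    sum (conj (sortP γ))      ≡⟨ sum-conj (sortP γ) ⟩
    sum (sortP γ)             ∎
    where
    open ≡-Reasoning
    sum-strip : ∀ xs → sum (strip xs) ≡ sum xs
    sum-strip []           = refl
    sum-strip (zero ∷ xs)  = sum-strip xs
    sum-strip (suc x ∷ xs) = cong (suc x +_) (sum-strip xs)

  dominated : dominatesᵇ (sortP τ) (sortP γ) ≡ true
  dominated = cong₂ _∧_ (trans (cong (_≡ᵇ sum (sortP γ)) sum-sortP) (≡ᵇ-refl (sum (sortP γ))))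
    (all-true _ (upTo (suc (length (sortP τ) + length (sortP γ)))) (All.applyUpTo⁺₂ id _ (λ k → ≤ᵇ-true (begin
      sum (take k (sortP τ))        ≡⟨ sum-take-sizes k (sortP τ) (sizes N) (sortP-Desc τ) (λ r → trans (count-↭ _ (sortP-↭ τ τ-pos)) (count-strM N N-hw r)) ⟩
      sum (map (k ⊓_) (sizes N))    ≤⟨ sizes-dominated M k ⟩
      sum (map (k ⊓_) (sizes M))    ≡⟨ sum-take-sizes k (sortP γ) (sizes M) (sortP-Desc γ) (λ r → trans (sym (nth-conj (sortP γ) r)) (cong (λ s → nth 0 s r) (sym sz))) ⟨
      sum (take k (sortP γ))        ∎))))
    where open ≤-Reasoning

  τ∈taus : All (0 <_) γ → τ ∈ taus γ
  τ∈taus pos = ∈-filterᵇ⁺ _ (∈-comps (sum γ) τ τ-pos (trans (sym (sum-↭ (sortP-↭ τ τ-pos))) (trans sum-sortP (sum-↭ (sortP-↭ γ pos))))) dominated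

trimQ-unpad : ∀ Q → Desc (map length Q) → Q ≡ trimQ Q ++ replicate (length Q ∸ length (trimQ Q)) []
trimQ-unpad Q d = unpad _ [] Q (λ { [] _ → refl })
  (AllPairs.map (λ { {[]} {[]} _ _ → refl ; {[]} {_ ∷ _} () _ }) (APP.map⁻ d))

trimQ∈ssyts : ∀ {n} (M : Config n) → trimQ (rhoQ M) ∈ ssyts (sizes (trimN (rhoM M))) (sizes M)
trimQ∈ssyts []      = here refl
trimQ∈ssyts (r ∷ M) = subst (λ μ → trimQ Q ∈ ssyts μ (sizes (r ∷ M))) shape
  (∈-ssyts (trimQ Q) (sizes (r ∷ M)) (All.filter⁺ _ T.weak)
    (prefix (trimQ Q) _ (trans (cong columnsStrict (sym (trimQ-unpad Q (Desc-rhoQ r M)))) T.strict))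
    (subst (λ m → Entries m (trimQ Q)) (sym len) (All.filter⁺ _ T.entries))
    (λ t l → trans (cong (count (λ x → x ≡ᵇ suc t)) (concat-trimQ Q)) (T.content t (subst (t <_) len l))))
  where
  Q = rhoQ (r ∷ M)
  module T = Tab (rhoQ-Tab (r ∷ M) z<s)
  len : length (sizes (r ∷ M)) ≡ suc (length M)
  len = length-map cnt (r ∷ M)
  lengths-trimQ : ∀ Q → map length (trimQ Q) ≡ strip (map length Q)
  lengths-trimQ []            = refl
  lengths-trimQ ([] ∷ Q)      = lengths-trimQ Q
  lengths-trimQ ((x ∷ q) ∷ Q) = cong (_ ∷_) (lengths-trimQ Q)
  shape : map length (trimQ Q) ≡ sizes (trimN (rhoM (r ∷ M)))
  shape = trans (lengths-trimQ Q) (trans (cong strip (lengths-rhoQ r M))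
    (sym (Trimmed.sizes≡ (trimmed (rhoM (r ∷ M)) (HW⇒Decr _ (rhoM-hw (r ∷ M)))))))
  prefix : ∀ A B → columnsStrict (A ++ B) ≡ true → columnsStrict A ≡ true
  prefix []           B _ = refl
  prefix (q ∷ [])     B _ = refl
  prefix (q ∷ q′ ∷ A) B e = cong₂ _∧_ (columnsStrict-head q q′ (A ++ B) e) (prefix (q′ ∷ A) B (columnsStrict-cons q (q′ ∷ A ++ B) e))

-- The untrimmed tableau has as many rows as the configuration, so the number of empty rows that
-- were dropped is known.
trimQ-injective : ∀ {n} (M M₂ : Config n) → length M ≡ length M₂ → trimQ (rhoQ M) ≡ trimQ (rhoQ M₂) → rhoQ M ≡ rhoQ M₂
trimQ-injective []      []        _ _ = refl
trimQ-injective (r ∷ M) (r₂ ∷ M₂) l e = begin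
  rhoQ (r ∷ M)                                                                   ≡⟨ trimQ-unpad _ (Desc-rhoQ r M) ⟩
  trimQ (rhoQ (r ∷ M)) ++ replicate (length (rhoQ (r ∷ M)) ∸ length (trimQ (rhoQ (r ∷ M)))) []
    ≡⟨ cong₂ (λ m T → T ++ replicate (m ∸ length T) []) (trans A.len (trans l (sym B.len))) e ⟩
  trimQ (rhoQ (r₂ ∷ M₂)) ++ replicate (length (rhoQ (r₂ ∷ M₂)) ∸ length (trimQ (rhoQ (r₂ ∷ M₂)))) []
    ≡⟨ trimQ-unpad _ (Desc-rhoQ r₂ M₂) ⟨
  rhoQ (r₂ ∷ M₂)                                                                 ∎
  where
  open ≡-Reasoning
  module A = Tab (rhoQ-Tab (r ∷ M) z<s)
  module B = Tab (rhoQ-Tab (r₂ ∷ M₂) z<s)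

length-sizes≡ : ∀ {n n₂} (M : Config n) (M₂ : Config n₂) → sizes M ≡ sizes M₂ → length M ≡ length M₂
length-sizes≡ M M₂ e = trans (sym (length-map cnt M)) (trans (cong length e) (length-map cnt M₂))

-- The bijection and the expansion

module _ {n : ℕ} where

  ∈-SMLQ⁻ : ∀ γ (M : MLQ n) → M ∈ SMLQ n γ → sizes M ≡ conj (sortP γ) × strM M ≡ γ
  ∈-SMLQ⁻ γ M i with ∈-filterᵇ⁻ _ (mlqs n (sortP γ)) i
  ... | j , e = sz , trans (sym (strtype≡strM M (Collapse.M-decr γ M sz))) (eqNat-sound _ γ e)
    where sz = ∈-configs⁻ (conj (sortP γ)) M j

  ∈-mlqs : ∀ γ (M : MLQ n) → sizes M ≡ conj (sortP γ) → M ∈ mlqs n (sortP γ)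
  ∈-mlqs γ M sz = subst (λ ks → M ∈ configs n ks) sz (∈-configs⁺ M)

  eq-strtype : ∀ γ (M : MLQ n) → sizes M ≡ conj (sortP γ) → strM M ≡ γ → eqNat (strtype M) γ ≡ true
  eq-strtype γ M sz e = trans (cong (λ x → eqNat x γ) (trans (strtype≡strM M (Collapse.M-decr γ M sz)) e)) (eqNat-refl γ)

  ∈-SMLQ⁺ : ∀ γ (M : MLQ n) → sizes M ≡ conj (sortP γ) → strM M ≡ γ → M ∈ SMLQ n γ
  ∈-SMLQ⁺ γ M sz e = ∈-filterᵇ⁺ _ (∈-mlqs γ M sz) (eq-strtype γ M sz e)

  Unique-SMLQ : ∀ γ → Unique (SMLQ n γ)
  Unique-SMLQ γ = Unique-filterᵇ _ (Unique-configs n (conj (sortP γ)))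

  ∈-SNMLQ⁺ : ∀ τ (N : MLQ n) → sizes N ≡ conj (sortP τ) → strM N ≡ τ → HW N → N ∈ SNMLQ n τ
  ∈-SNMLQ⁺ τ N sz e hw = ∈-filterᵇ⁺ _ (∈-SMLQ⁺ τ N sz e) (cong (_≡ᵇ 0) (trans (maj≡majM N (Collapse.M-decr τ N sz)) (HW⇒majM≡0 N hw)))

  ∈-SNMLQ⁻ : ∀ τ (N : MLQ n) → N ∈ SNMLQ n τ → sizes N ≡ conj (sortP τ) × strM N ≡ τ × HW N
  ∈-SNMLQ⁻ τ N i with ∈-filterᵇ⁻ _ (SMLQ n τ) i
  ... | j , e with ∈-SMLQ⁻ τ N j
  ...   | sz , st = sz , st , majM≡0⇒HW N (trans (sym (maj≡majM N (Collapse.M-decr τ N sz))) (≡ᵇ-true⁻ e))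

  rhoIs⁺ : ∀ (M : MLQ n) τ Q → trimN (rhoM M) ≡ Mtau n τ → trimQ (rhoQ M) ≡ Q → rhoIsᵇ M τ Q ≡ true
  rhoIs⁺ M τ Q e₁ e₂ = cong₂ _∧_
    (trans (cong (λ x → eqBools (map toList x) (map toList (Mtau n τ))) (trans (cong trimN (rho₁≡rhoM M)) e₁)) (eqBools-refl (map toList (Mtau n τ))))
    (trans (cong (λ x → eqNats x Q) (trans (cong trimQ (rho₂≡rhoQ M)) e₂)) (eqNats-refl Q))

  rhoIs⁻ : ∀ (M : MLQ n) τ Q → rhoIsᵇ M τ Q ≡ true → trimN (rhoM M) ≡ Mtau n τ × trimQ (rhoQ M) ≡ Q
  rhoIs⁻ M τ Q e with ∧-true⁻ (eqBools (map toList (trimN (proj₁ (rho M)))) (map toList (Mtau n τ))) e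
  ... | a , b = trans (cong trimN (sym (rho₁≡rhoM M))) (eqBools-sound _ (Mtau n τ) a)
              , trans (cong trimQ (sym (rho₂≡rhoQ M))) (eqNats-sound _ Q b)

  Triple : Set
  Triple = List ℕ × Tableau × MLQ n

  collapse : MLQ n → Triple
  collapse M = strM (rhoM M) , trimQ (rhoQ M) , trimN (rhoM M)

  triples : List ℕ → List Triple
  triples γ = concatMap (λ τ → concatMap (λ Q → map (λ N → τ , Q , N) (SNMLQ n τ)) (Kset n γ τ)) (taus γ)

  ∈-triples⁺ : ∀ γ {τ Q N} → τ ∈ taus γ → Q ∈ Kset n γ τ → N ∈ SNMLQ n τ → (τ , Q , N) ∈ triples γ
  ∈-triples⁺ γ {τ} {Q} a b c = ∈-concatMap⁺ _ a (∈-concatMap⁺ _ b (∈-map⁺ (λ N → τ , Q , N) c))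

  ∈-triples⁻ : ∀ γ {t} → t ∈ triples γ → ∃ λ τ → ∃ λ Q → ∃ λ N → t ≡ (τ , Q , N) × τ ∈ taus γ × Q ∈ Kset n γ τ × N ∈ SNMLQ n τ
  ∈-triples⁻ γ i with ∈-concatMap⁻ _ (taus γ) i
  ... | τ , a , j with ∈-concatMap⁻ (λ Q → map (λ N → τ , Q , N) (SNMLQ n τ)) (Kset n γ τ) j
  ...   | Q , b , l with ∈-map⁻ (λ N → τ , Q , N) l
  ...     | N , c , e = τ , Q , N , e , a , b , c

  Unique-triples : ∀ γ → Unique (triples γ)
  Unique-triples γ = Unique-concatMap _ proj₁ (taus γ) (Unique-filterᵇ _ (Unique-comps (sum γ)))
    (λ {τ} _ → Unique-concatMap _ (proj₁ ∘ proj₂) (Kset n γ τ) (Unique-filterᵇ _ (Unique-ssyts (conj (sortP τ)) (conj (sortP γ))))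
      (λ {Q} _ → Unique-map-on _ (SNMLQ n τ) (λ { _ _ refl → refl }) (Unique-filterᵇ _ (Unique-SMLQ τ)))
      (λ { {Q} _ i → let _ , _ , e = ∈-map⁻ (λ N → τ , Q , N) i in cong (proj₁ ∘ proj₂) e }))
    (λ { {τ} _ i → let Q , _ , j = ∈-concatMap⁻ (λ Q → map (λ N → τ , Q , N) (SNMLQ n τ)) (Kset n γ τ) i
                       _ , _ , e = ∈-map⁻ (λ N → τ , Q , N) j in cong proj₁ e })

  collapse-injective : ∀ γ {M M₂} → M ∈ SMLQ n γ → M₂ ∈ SMLQ n γ → collapse M ≡ collapse M₂ → M ≡ M₂
  collapse-injective γ {M} {M₂} i i₂ e = rho-injective M M₂ sz (trimQ-injective M M₂ len (cong (proj₁ ∘ proj₂) e)) (begin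
    rhoM M                    ≡⟨ A.N≡ ⟩
    pad A.k (trimN (rhoM M))  ≡⟨ cong₂ pad k≡ (cong (proj₂ ∘ proj₂) e) ⟩
    pad B.k (trimN (rhoM M₂)) ≡⟨ B.N≡ ⟨
    rhoM M₂                   ∎)
    where
    open ≡-Reasoning
    szM = proj₁ (∈-SMLQ⁻ γ M i)
    szM₂ = proj₁ (∈-SMLQ⁻ γ M₂ i₂)
    sz = trans szM (sym szM₂)
    len = length-sizes≡ M M₂ sz
    module A = Collapse γ M szM
    module B = Collapse γ M₂ szM₂
    k≡ : A.k ≡ B.k
    k≡ = +-cancelˡ-≡ (length (trimN (rhoM M))) A.k B.k (trans A.len (trans (trans (length-rhoM M) (trans len (sym (length-rhoM M₂))))
      (trans (sym B.len) (cong (λ N → length N + B.k) (cong (proj₂ ∘ proj₂) (sym e))))))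

  -- Horizontal operators carry the collapse to any highest weight
  -- configuration of the same shape and leave the recording tableau alone.
  replace : ∀ (M : MLQ n) k (A B : MLQ n) → rhoM M ≡ pad k A → HW A → HW B → sizes A ≡ sizes B → strM A ≡ strM B → All (λ r → 0 < cnt r) B →
            ∃ λ M′ → sizes M′ ≡ sizes M × rhoQ M′ ≡ rhoQ M × trimN (rhoM M′) ≡ B × strM (rhoM M′) ≡ strM B × strM M′ ≡ strM M
  replace M k A B e hA hB es et pos with hw-connected (pad k A) (pad k B) (HW-pad k A hA) (HW-pad k B hB)
                                          (trans (sizes-pad k A) (trans (cong (_++ replicate k 0) es) (sym (sizes-pad k B))))
  ... | g , G , gA = g M , Hor.sz G M , rhoQ-hor G M
      , trans (cong trimN rhoB) (trimN-pad k B (All.map (λ {r} → cnt⇒nonempty r) pos))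
      , strB
      , strM-hor G M (trans strB (trans (sym et) (trans (sym (strM-pad k A hA)) (cong strM (sym e)))))
    where
    rhoB : rhoM (g M) ≡ pad k B
    rhoB = trans (rhoM-hor G M) (trans (cong g e) gA)
    strB : strM (rhoM (g M)) ≡ strM B
    strB = trans (cong strM rhoB) (strM-pad k B hB)

  module MtauFacts (τ : List ℕ) (pos : All (0 <_) τ) (len : length τ ≤ n) where

    hw : HW (Mtau n τ)
    hw = Nested⇒HW (Mtau n τ) (Mtau-Nested n τ len)

    sz : sizes (Mtau n τ) ≡ conj (sortP τ)
    sz = trans (sizes-Mtau n τ len) (sym (conj-↭ (sortP-↭ τ pos)))

    st : strM (Mtau n τ) ≡ τ
    st = trans (strM-Mtau n τ len) (strip-id τ pos)

  conj-filled : ∀ τ (N : MLQ n) → sizes N ≡ conj (sortP τ) → All (λ r → 0 < cnt r) N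
  conj-filled τ N e = All.map⁻ (subst (All (0 <_)) (sym e) (conj-pos (sortP τ)))

  module _ (γ : List ℕ) (pos : All (0 <_) γ) where

    -- Membership in `Kset` asks for a queue whose collapse is `Mtau n τ`. `replace` produces one
    -- from `M`, with the same tableau and the same strong type.
    collapse∈triples : ∀ M → M ∈ SMLQ n γ → collapse M ∈ triples γ
    collapse∈triples M i with ∈-SMLQ⁻ γ M i
    ... | sz , st with replace M C.k (trimN C.N) (Mtau n C.τ) C.N≡ C.trim-hw T.hw (trans C.sizes-trim (sym T.sz)) (trans C.strM-trim (sym T.st)) (conj-filled C.τ _ T.sz)
      where
      module C = Collapse γ M sz
      module T = MtauFacts C.τ C.τ-pos (strM-length C.N)
    ... | M₀ , sz₀ , Q₀ , N₀ , _ , st₀ = ∈-triples⁺ γ (C.τ∈taus pos)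
        (∈-filterᵇ⁺ _ (subst (λ μ → trimQ (rhoQ M) ∈ ssyts (conj (sortP C.τ)) μ) sz (subst (λ μ → trimQ (rhoQ M) ∈ ssyts μ (sizes M)) C.sizes-trim (trimQ∈ssyts M)))
          (any-true⁺ _ (∈-mlqs γ M₀ (trans sz₀ sz)) (cong₂ _∧_ (rhoIs⁺ M₀ C.τ _ N₀ (cong trimQ Q₀)) (eq-strtype γ M₀ (trans sz₀ sz) (trans st₀ st)))))
        (∈-SNMLQ⁺ C.τ (trimN C.N) C.sizes-trim C.strM-trim C.trim-hw)
      where module C = Collapse γ M sz

    -- The queue that witnesses membership in `Kset` collapses to `Mtau n τ`; `replace` now moves
    -- its collapse to the prescribed `N`, again keeping tableau and strong type.
    triples⊆collapse : ∀ t → t ∈ triples γ → t ∈ map collapse (SMLQ n γ)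
    triples⊆collapse t i with ∈-triples⁻ γ i
    ... | τ , Q , N , refl , _ , Q∈ , N∈ with ∈-SNMLQ⁻ τ N N∈ | ∈-filterᵇ⁻ _ (ssyts (conj (sortP τ)) (conj (sortP γ))) Q∈
    ...   | szN , stN , hwN | _ , any≡ with any-true⁻ _ (mlqs n (sortP γ)) any≡
    ...     | M₀ , M₀∈ , both with ∧-true⁻ (rhoIsᵇ M₀ τ Q) both
    ...       | isρ , isγ with rhoIs⁻ M₀ τ Q isρ | ∈-SMLQ⁻ γ M₀ (∈-filterᵇ⁺ (λ M → eqNat (strtype M) γ) M₀∈ isγ)
    ...         | eN , eQ | sz₀ , st₀
              with replace M₀ C.k (trimN C.N) N C.N≡ C.trim-hw hwN (trans C.sizes-trim (trans (cong (conj ∘ sortP) τ≡) (sym szN))) (trans C.strM-trim (trans τ≡ (sym stN))) (conj-filled τ N szN)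
      where
      module C = Collapse γ M₀ sz₀
      τ≡ : C.τ ≡ τ
      τ≡ = trans (sym C.strM-trim) (trans (cong strM eN) (MtauFacts.st τ
        (subst (All (0 <_)) stN (strip-pos (toList (cs (layM N))))) (subst (λ l → length l ≤ n) stN (strM-length N))))
    ...           | M , sz , Q≡ , N≡ , τ≡ , st =
      subst (_∈ map collapse (SMLQ n γ)) (cong₂ _,_ (trans τ≡ stN) (cong₂ _,_ (trans (cong trimQ Q≡) eQ) N≡))
        (∈-map⁺ collapse (∈-SMLQ⁺ γ M (trans sz sz₀) (trans st st₀)))

    collapse-↭ : map collapse (SMLQ n γ) ↭ triples γ
    collapse-↭ = ∼bag⇒↭ (unique∧set⇒bag (Unique-map-on collapse (SMLQ n γ) (collapse-injective γ) (Unique-SMLQ γ)) (Unique-triples γ)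
      (mk⇔ (λ i → let M , j , e = ∈-map⁻ collapse i in subst (_∈ triples γ) (sym e) (collapse∈triples M j)) (triples⊆collapse _)))

    monomial : Triple → Monomial n
    monomial (τ , Q , N) = charge Q , xexp N

    monomial-collapse : ∀ M → M ∈ SMLQ n γ → (maj M , xexp M) ≡ monomial (collapse M)
    monomial-collapse M i = cong₂ _,_
      (trans (maj≡majM M C.M-decr) (sym (trans (charge-trimQ (rhoQ M)) (charge-rhoQ M C.M-decr))))
      (begin
        xexp M                      ≡⟨ xexp≡cs M ⟩
        cs M                        ≡⟨ cs-rhoM M ⟨
        cs C.N                      ≡⟨ cong cs C.N≡ ⟩
        cs (pad C.k (trimN C.N))    ≡⟨ cs-pad C.k (trimN C.N) ⟩
        cs (trimN C.N)              ≡⟨ xexp≡cs (trimN C.N) ⟨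
        xexp (trimN C.N)            ∎)
      where
      open ≡-Reasoning
      module C = Collapse γ M (proj₁ (∈-SMLQ⁻ γ M i))

    monomials-triples : map monomial (triples γ) ≡ RHSpoly n γ
    monomials-triples = trans (map-concatMap monomial _ (taus γ)) (concatMap-cong (λ τ →
      trans (map-concatMap monomial _ (Kset n γ τ)) (trans (concatMap-cong (λ Q →
        trans (sym (map-∘ (SNMLQ n τ))) (map-∘ (SNMLQ n τ))) (Kset n γ τ)) (sym (concatMap-map _ charge (Kset n γ τ))))) (taus γ))

    expansion : Gpoly n γ ↭ RHSpoly n γ
    expansion = ↭-trans (↭-reflexive (trans (map-cong-local (All.tabulate (λ {M} → monomial-collapse M))) (map-∘ (SMLQ n γ))))
      (↭-trans (Perm.map⁺ monomial collapse-↭) (↭-reflexive monomials-triples))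

theorem4p5 : (n : ℕ) → 0 < n → (γ : List ℕ) → All (0 <_) γ →
             length γ ≤ n → length (sortP γ) < n →
             Gpoly n γ ↭ RHSpoly n γ
theorem4p5 n _ γ pos _ _ = expansion γ pos
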